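{- Let $(W,S)$ be a finite Coxeter system with identity $e$, length function $\ell$ and Bruhat order $\le$, and let $w\in W$. Define the Bruhat–Poincar\'e polynomial $\overrightarrow{P}_w(q)=\sum_{v\le w}R_{ev}(q+1)$ and its average $\mathrm{av}(\overrightarrow{P}_w)=\overrightarrow{P}_w{}'(1)/\overrightarrow{P}_w(1)$. If $\mathrm{av}(\overrightarrow{P}_w)\ne \ell(w)/2$, then the lower interval $[e,w]$ is irregular.
   Context: The $R$-polynomials $R_{uw}(q)\in\mathbb{Z}[q]$ are the unique family with $R_{uw}=0$ if $u\not\le w$, $R_{uu}=1$, and, for $s\in S$ with $\ell(ws)<\ell(w)$: $R_{uw}=R_{us,ws}$ if $\ell(us)<\ell(u)$, $R_{uw}=(q-1)R_{u,ws}+qR_{us,ws}$ if $\ell(us)>\ell(u)$. The Bruhat graph of $W$ has an edge between $x$ and $y$ whenever $y=xt$ for a reflection $t$; $[e,w]$ is called regular if the (undirected) Bruhat graph induced on the vertex set $[e,w]=\{v: e\le v\le w\}$ is a regular graph (every vertex has degree $\ell(w)$), and irregular otherwise. -}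

module Defs where

open import Level using (0ℓ)
open import Data.Nat as ℕ using (ℕ; zero; suc)
open import Data.Integer as ℤ using (ℤ; +_; 0ℤ; 1ℤ)
open import Data.Fin using (Fin)
open import Data.List using (List; []; _∷_; foldr; map; length)
open import Data.List.Membership.Propositional using (_∈_)
open import Data.List.Relation.Unary.Unique.Propositional using (Unique)
open import Data.Product using (Σ; ∃; _×_; _,_)
open import Relation.Binary.PropositionalEquality using (_≡_; _≢_)
open import Relation.Nullary using (¬_)
open import Algebra.Bundles using (Group)

-- Polynomials over ℤ as coefficient lists (constant term first).

Poly : Set
Poly = List ℤ

coeff : Poly → ℕ → ℤ
coeff []      _       = 0ℤ
coeff (a ∷ p) zero    = a
coeff (a ∷ p) (suc i) = coeff p i

_≈ₚ_ : Poly → Poly → Set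
p ≈ₚ q = ∀ i → coeff p i ≡ coeff q i

infixl 6 _+ₚ_ _-ₚ_
infixl 7 _*ₚ_

_+ₚ_ : Poly → Poly → Poly
[]      +ₚ q       = q
(a ∷ p) +ₚ []      = a ∷ p
(a ∷ p) +ₚ (b ∷ q) = (a ℤ.+ b) ∷ (p +ₚ q)

scaleₚ : ℤ → Poly → Poly
scaleₚ a p = map (a ℤ.*_) p

-ₚ_ : Poly → Poly
-ₚ p = scaleₚ (ℤ.- 1ℤ) p

_-ₚ_ : Poly → Poly → Poly
p -ₚ q = p +ₚ (-ₚ q)

_*ₚ_ : Poly → Poly → Poly
[]      *ₚ q = []
(a ∷ p) *ₚ q = scaleₚ a q +ₚ (0ℤ ∷ (p *ₚ q))

0ₚ 1ₚ Xₚ : Poly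
0ₚ = []
1ₚ = 1ℤ ∷ []
Xₚ = 0ℤ ∷ 1ℤ ∷ []

evalₚ : Poly → ℤ → ℤ
evalₚ p x = foldr (λ a acc → a ℤ.+ x ℤ.* acc) 0ℤ p

derivFrom : ℕ → Poly → Poly
derivFrom k []      = []
derivFrom k (b ∷ p) = (+ k ℤ.* b) ∷ derivFrom (suc k) p

derivₚ : Poly → Poly
derivₚ []      = []
derivₚ (a ∷ p) = derivFrom 1 p

shift1ₚ : Poly → Poly
shift1ₚ = foldr (λ a acc → (a ∷ []) +ₚ (Xₚ +ₚ 1ₚ) *ₚ acc) []

sumₚ : List Poly → Poly
sumₚ = foldr _+ₚ_ []

powG : (H : Group 0ℓ 0ℓ) → Group.Carrier H → ℕ → Group.Carrier H
powG H x zero    = Group.ε H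
powG H x (suc k) = Group._∙_ H x (powG H x k)

-- Finite Coxeter systems.
-- W is a finite group (propositional equality), S = {gen i | i : Fin n}
-- a set of involutions generating W, and W is *presented* by S subject
-- to the relations (s t)^k = e that hold in W (equivalently the Coxeter
-- relations s² = e, (st)^{m(s,t)} = e): universal property of the
-- presentation.

powOp : {A : Set} → (A → A → A) → A → A → ℕ → A
powOp _·_ e x zero    = e
powOp _·_ e x (suc k) = x · powOp _·_ e x k

evalWordOp : {A : Set} {n : ℕ} → (A → A → A) → A → (Fin n → A) → List (Fin n) → A
evalWordOp _·_ e gen = foldr (λ i w → gen i · w) e

record FiniteCoxeterSystem : Set₁ where
  infixl 7 _·_
  field
    W     : Set
    _·_   : W → W → W
    e     : W
    inv   : W → W
    assoc : ∀ x y z → (x · y) · z ≡ x · (y · z)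
    identityˡ : ∀ x → e · x ≡ x
    identityʳ : ∀ x → x · e ≡ x
    inverseˡ  : ∀ x → inv x · x ≡ e
    inverseʳ  : ∀ x → x · inv x ≡ e
    elems          : List W
    elems-complete : ∀ w → w ∈ elems
    n       : ℕ
    gen     : Fin n → W
    gen-inj : ∀ i j → gen i ≡ gen j → i ≡ j
    gen-ne  : ∀ i → gen i ≢ e
    gen-sq  : ∀ i → gen i · gen i ≡ e

  field
    generates : ∀ w → Σ (List (Fin n)) λ ws → evalWordOp _·_ e gen ws ≡ w
    presentation :
      (H : Group 0ℓ 0ℓ) (f : Fin n → Group.Carrier H) →
      (∀ i j k → powOp _·_ e (gen i · gen j) k ≡ e →
                 Group._≈_ H (powG H (Group._∙_ H (f i) (f j)) k) (Group.ε H)) →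
      Σ (W → Group.Carrier H) λ φ →
        (∀ x y → Group._≈_ H (φ (x · y)) (Group._∙_ H (φ x) (φ y))) ×
        (∀ i → Group._≈_ H (φ (gen i)) (f i))

module _ (C : FiniteCoxeterSystem) where
  open FiniteCoxeterSystem C

  evalWord : List (Fin n) → W
  evalWord = evalWordOp _·_ e gen

  IsLength : W → ℕ → Set
  IsLength w k = (Σ (List (Fin n)) λ ws → evalWord ws ≡ w × length ws ≡ k)
               × (∀ ws → evalWord ws ≡ w → k ℕ.≤ length ws)

  Reflection : W → Set
  Reflection t = Σ W λ u → Σ (Fin n) λ i → t ≡ u · gen i · inv u

  BruhatEdge : W → W → Set
  BruhatEdge x y = Σ W λ t → Reflection t × y ≡ x · t

  module _ (ℓ : W → ℕ) where
    data _≤B_ : W → W → Set where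
      ≤B-refl : ∀ {u} → u ≤B u
      ≤B-step : ∀ {u v t} → u ≤B v → Reflection t → ℓ v ℕ.< ℓ (v · t) → u ≤B (v · t)

    record IsRFamily (R : W → W → Poly) : Set where
      field
        R-not≤ : ∀ u w → ¬ (u ≤B w) → R u w ≈ₚ 0ₚ
        R-diag : ∀ u → R u u ≈ₚ 1ₚ
        R-desc : ∀ u w i → ℓ (w · gen i) ℕ.< ℓ w → ℓ (u · gen i) ℕ.< ℓ u →
                 R u w ≈ₚ R (u · gen i) (w · gen i)
        R-asc  : ∀ u w i → ℓ (w · gen i) ℕ.< ℓ w → ℓ u ℕ.< ℓ (u · gen i) →
                 R u w ≈ₚ ((Xₚ -ₚ 1ₚ) *ₚ R u (w · gen i) +ₚ Xₚ *ₚ R (u · gen i) (w · gen i))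

    InInterval : W → W → Set
    InInterval w v = (e ≤B v) × (v ≤B w)

    Enumerates : W → List W → Set
    Enumerates w L = Unique L × (∀ v → (v ∈ L → InInterval w v) × (InInterval w v → v ∈ L))

    BruhatPoincare : (W → W → Poly) → List W → Poly
    BruhatPoincare R L = sumₚ (map (λ v → shift1ₚ (R e v)) L)

    HasDegree : W → W → ℕ → Set
    HasDegree w v d = Σ (List W) λ N → Unique N ×
                        (∀ x → (x ∈ N → InInterval w x × BruhatEdge v x) ×
                               (InInterval w x × BruhatEdge v x → x ∈ N)) ×
                        length N ≡ d

    Regular : W → Set
    Regular w = ∀ v → InInterval w v → HasDegree w v (ℓ w)

    Irregular : W → Set
    Irregular w = ¬ Regular w

{-# OPTIONS --safe #-}
module Submission where

-- Suppose I = [e,w] is regular. The nil Hecke ring provides functions p on W with values in the polynomial functions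
-- on the reflection representation, supported on I, homogeneous of degree |T| − ℓ(w), and such that the root of t divides
-- p(v) + p(tv). Regularity says that exactly |T| − ℓ(w) of the neighbours tv of v lie outside I, so each p(v) is
-- a scalar times the product of their roots. Specialising to rank two shows that I meets the cosets of dihedral
-- parabolic subgroups in a balanced way, and from this that y has equally many inversions t′ with t′v ∈ I and with t′tv ∈ I
-- whenever sy > y, t = y⁻¹sy and v, tv ∈ I. Hence all coefficients of T_y Σ_{v ∈ I} T_v stay pure powers of q while y
-- grows; at the longest element this reads Σ_{v ≤ w} R_{e,v}(q) = q^ℓ(w). At q = 2 + ε, ε² = 0, the average of the
-- Bruhat–Poincaré polynomial comes out as ℓ(w) / 2.
--
-- The reflection representation needs the numbers 2 cos (π / m) and their signs. They are found in the quotient of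
-- ℤ[x] by a Chebyshev polynomial, whose Chebyshev values span a cone that plays the role of the positive
-- numbers, divided by a prime ideal avoiding that cone.

open import Defs
open import Data.Nat using (ℕ)
open import Data.Integer using (ℤ; +_)
open import Data.List using (List)
open import Relation.Binary.PropositionalEquality using (_≢_)
open import Algebra.Bundles using (CommutativeRing; Group; RawRing)
import Algebra.Properties.AbelianGroup
import Algebra.Properties.Group
import Algebra.Properties.Ring
import Algebra.Properties.Semiring.Mult
import Algebra.Solver.Ring
open import Algebra.Solver.Ring.AlmostCommutativeRing using (fromCommutativeRing; _-Raw-AlmostCommutative⟶_)
open import Data.Bool using (Bool; true; false; not; _xor_; if_then_else_; _∧_)
import Data.Bool.Properties as Bool
open import Data.Empty using (⊥; ⊥-elim)
open import Data.Fin as Fin using (Fin; toℕ)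
import Data.Fin.Properties as Fin
open import Data.Integer as ℤ using (-[1+_])
import Data.Integer.Properties as ℤ
open import Data.List as List using ([]; _∷_; _++_; length; map; filter; foldr; reverse; lookup; [_]; deduplicate; cartesianProductWith; allFin; applyUpTo)
import Data.List.Membership.DecPropositional as DecMembership
open import Data.List.Membership.Propositional using (_∈_)
open import Data.List.Membership.Propositional.Properties using (∈-map⁺; ∈-map⁻; ∈-filter⁺; ∈-filter⁻; ∈-deduplicate⁺; ∈-deduplicate⁻; ∈-cartesianProductWith⁺; ∈-cartesianProductWith⁻; ∈-allFin; ∈-applyUpTo⁺; ∈-applyUpTo⁻)
import Data.List.Properties as List
open import Data.List.Relation.Unary.All as All using (All; []; _∷_)
import Data.List.Relation.Unary.All.Properties as All
open import Data.List.Relation.Unary.AllPairs using ([]; _∷_)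
open import Data.List.Relation.Unary.Any using (here; there; index)
open import Data.List.Relation.Unary.Any.Properties using (lookup-index)
open import Data.List.Relation.Unary.Unique.Propositional using (Unique)
import Data.List.Relation.Unary.Unique.DecPropositional.Properties as DecUnique
import Data.List.Relation.Unary.Unique.Propositional.Properties as Unique
open import Data.Maybe using (Maybe; just; nothing)
open import Data.Nat as ℕ using (zero; suc; z≤n; s≤s; _≤′_; ≤′-refl; ≤′-step; _!)
open import Data.Nat.DivMod using (_/_; _%_; m≡m%n+[m/n]*n; m%n<n)
open import Data.Nat.Divisibility as ℕ using (divides; ∣-trans; m∣m*n; n∣m*n; m≤n⇒m!∣n!)
import Data.Nat.Properties as ℕ
open import Data.Product using (Σ; ∃; _×_; _,_; proj₁; proj₂)
open import Data.Sum using (_⊎_; inj₁; inj₂)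
open import Function using (_∘_; mk⇔)
open import Level using (0ℓ)
open import Relation.Binary.Definitions using (tri<; tri≈; tri>)
open import Relation.Binary.PropositionalEquality as ≡ using (_≡_)
open import Relation.Nullary using (¬_; Dec; yes; no; does; ¬?)
open import Relation.Nullary.Decidable using (dec-true; dec-false; does-⇔)

-- Regularity counts the missing neighbours of v in all of W, while the Hecke computation needs such
-- counts inside single dihedral cosets. The functions p make the count local: sending one simple
-- root to 0, a second to a variable X and the others to 1 keeps every root outside their plane
-- nonzero at X = 0. The order of p(v) in X then counts only the missing neighbours in the coset,
-- and the congruence modulo the root that goes to 0 equates the orders at both ends of an edge.
-- Passing from y to sy produces q^N(y,v) + (q - 1) q^N(y,tv) with N the inversion count, a single
-- power once the two counts agree; this is why equality of inversion counts is the target. At the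
-- longest element w₀ the coefficient of T_(w₀v) in T_(w₀) T_x is q^ℓ(v) R_(v,x), so v = e yields
-- the sum of R-polynomials, and the exponent is the degree of e in the Bruhat graph of I. The
-- coefficient field is a quotient by an ideal obtained without decisions, so its equality is only
-- stable under double negation; this shapes all arguments about divisibility and vanishing.

¬¬-em : {P : Set} → ¬ ¬ (P ⊎ ¬ P)
¬¬-em k = k (inj₂ (λ p → k (inj₁ p)))

-- Commutative rings, domains and quotients without decidable equality.

CRing : Set₁
CRing = CommutativeRing 0ℓ 0ℓ

module IntSolver (R : CRing) where
  open CommutativeRing R hiding (zero)
  open Algebra.Properties.Ring ring using (-‿distribˡ-*; -‿distribʳ-*; -0#≈0#; -‿involutive)
  open Algebra.Properties.AbelianGroup +-abelianGroup using (⁻¹-∙-comm)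
  open Algebra.Properties.Semiring.Mult semiring using (×-homo-+; ×1-homo-*) renaming (_×_ to _×ₙ_)
  open import Relation.Binary.Reasoning.Setoid setoid

  ⟦_⟧ℤ : ℤ → Carrier
  ⟦ + n ⟧ℤ      = n ×ₙ 1#
  ⟦ -[1+ n ] ⟧ℤ = - (suc n ×ₙ 1#)

  private
    neg-homo : ∀ i → ⟦ ℤ.- i ⟧ℤ ≈ - ⟦ i ⟧ℤ
    neg-homo (+ zero)  = sym -0#≈0#
    neg-homo (+ suc n) = refl
    neg-homo -[1+ n ]  = sym (-‿involutive _)

    ⊖-homo : ∀ m n → ⟦ m ℤ.⊖ n ⟧ℤ ≈ m ×ₙ 1# - n ×ₙ 1#
    ⊖-homo zero    zero    = sym (-‿inverseʳ 0#)
    ⊖-homo zero    (suc n) = sym (+-identityˡ _)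
    ⊖-homo (suc m) zero    = sym (trans (+-congˡ -0#≈0#) (+-identityʳ _))
    ⊖-homo (suc m) (suc n) = begin
      ⟦ suc m ℤ.⊖ suc n ⟧ℤ                   ≡⟨ ≡.cong ⟦_⟧ℤ (ℤ.[1+m]⊖[1+n]≡m⊖n m n) ⟩
      ⟦ m ℤ.⊖ n ⟧ℤ                           ≈⟨ ⊖-homo m n ⟩
      m ×ₙ 1# - n ×ₙ 1#                      ≈⟨ +-congʳ (sym (trans (+-congʳ (-‿inverseˡ 1#)) (+-identityˡ _))) ⟩
      (- 1# + 1# + m ×ₙ 1#) - n ×ₙ 1#        ≈⟨ +-congʳ (trans (+-assoc _ _ _) (+-comm _ _)) ⟩
      ((1# + m ×ₙ 1#) + - 1#) - n ×ₙ 1#      ≈⟨ +-assoc _ _ _ ⟩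
      (1# + m ×ₙ 1#) + (- 1# - n ×ₙ 1#)      ≈⟨ +-congˡ (⁻¹-∙-comm _ _) ⟩
      (1# + m ×ₙ 1#) - (1# + n ×ₙ 1#)        ∎

    +-homo : ∀ i j → ⟦ i ℤ.+ j ⟧ℤ ≈ ⟦ i ⟧ℤ + ⟦ j ⟧ℤ
    +-homo (+ m)    (+ n)    = ×-homo-+ 1# m n
    +-homo (+ m)    -[1+ n ] = ⊖-homo m (suc n)
    +-homo -[1+ m ] (+ n)    = trans (⊖-homo n (suc m)) (+-comm _ _)
    +-homo -[1+ m ] -[1+ n ] = begin
      - (suc (suc (m ℕ.+ n)) ×ₙ 1#)        ≡⟨ ≡.cong (λ k → - (suc k ×ₙ 1#)) (≡.sym (+-suc m n)) ⟩
      - ((suc m ℕ.+ suc n) ×ₙ 1#)          ≈⟨ -‿cong (×-homo-+ 1# (suc m) (suc n)) ⟩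
      - (suc m ×ₙ 1# + suc n ×ₙ 1#)        ≈⟨ sym (⁻¹-∙-comm _ _) ⟩
      - (suc m ×ₙ 1#) + - (suc n ×ₙ 1#)    ∎
      where open import Data.Nat.Properties using (+-suc)

    *-homo⁺ : ∀ m j → ⟦ + m ℤ.* j ⟧ℤ ≈ ⟦ + m ⟧ℤ * ⟦ j ⟧ℤ
    *-homo⁺ m (+ n)    = trans (reflexive (≡.cong ⟦_⟧ℤ (≡.sym (ℤ.pos-* m n)))) (×1-homo-* m n)
    *-homo⁺ m -[1+ n ] = begin
      ⟦ + m ℤ.* -[1+ n ] ⟧ℤ         ≡⟨ ≡.cong ⟦_⟧ℤ (≡.sym (ℤ.neg-distribʳ-* (+ m) (+ suc n))) ⟩
      ⟦ ℤ.- (+ m ℤ.* + suc n) ⟧ℤ    ≈⟨ neg-homo (+ m ℤ.* + suc n) ⟩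
      - ⟦ + m ℤ.* + suc n ⟧ℤ        ≈⟨ -‿cong (*-homo⁺ m (+ suc n)) ⟩
      - (⟦ + m ⟧ℤ * ⟦ + suc n ⟧ℤ)   ≈⟨ -‿distribʳ-* _ _ ⟩
      ⟦ + m ⟧ℤ * ⟦ -[1+ n ] ⟧ℤ      ∎

    *-homo : ∀ i j → ⟦ i ℤ.* j ⟧ℤ ≈ ⟦ i ⟧ℤ * ⟦ j ⟧ℤ
    *-homo (+ m)    j = *-homo⁺ m j
    *-homo -[1+ m ] j = begin
      ⟦ -[1+ m ] ℤ.* j ⟧ℤ            ≡⟨ ≡.cong ⟦_⟧ℤ (≡.sym (ℤ.neg-distribˡ-* (+ suc m) j)) ⟩
      ⟦ ℤ.- (+ suc m ℤ.* j) ⟧ℤ       ≈⟨ neg-homo (+ suc m ℤ.* j) ⟩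
      - ⟦ + suc m ℤ.* j ⟧ℤ           ≈⟨ -‿cong (*-homo⁺ (suc m) j) ⟩
      - (⟦ + suc m ⟧ℤ * ⟦ j ⟧ℤ)      ≈⟨ -‿distribˡ-* _ _ ⟩
      ⟦ -[1+ m ] ⟧ℤ * ⟦ j ⟧ℤ         ∎

    ℤ-raw : RawRing 0ℓ 0ℓ
    ℤ-raw = CommutativeRing.rawRing ℤ.+-*-commutativeRing

    morphism : ℤ-raw -Raw-AlmostCommutative⟶ fromCommutativeRing R
    morphism = record
      { ⟦_⟧ = ⟦_⟧ℤ ; +-homo = +-homo ; *-homo = *-homo ; -‿homo = neg-homo
      ; 0-homo = refl ; 1-homo = +-identityʳ 1# }

    -- Coefficients are compared as integers before they are interpreted, since equality in `R` need
    -- not be decidable.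
    weak≟ : ∀ i j → Maybe (⟦ i ⟧ℤ ≈ ⟦ j ⟧ℤ)
    weak≟ i j with i ℤ.≟ j
    ... | yes p = just (reflexive (≡.cong ⟦_⟧ℤ p))
    ... | no _  = nothing

  private module Solver = Algebra.Solver.Ring ℤ-raw (fromCommutativeRing R) morphism weak≟
  open Solver public using (Polynomial; solve; _:=_; _:+_; _:*_; _:-_; :-_)

  -- con (+ 1) would denote 1# + 0#, so identities mentioning 1# pass it as a variable.
  :0 : ∀ {n} → Polynomial n
  :0 = Solver.con (+ 0)

  infix 4 _≉0
  _≉0 : Carrier → Set
  x ≉0 = ¬ (x ≈ 0#)

  -≈0⇒≈ : ∀ {x y} → x - y ≈ 0# → x ≈ y
  -≈0⇒≈ {x} {y} h = trans (solve 2 (λ x y → x := (x :- y) :+ y) refl x y) (trans (+-congʳ h) (+-identityˡ y))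

  ≈⇒-≈0 : ∀ {x y} → x ≈ y → x - y ≈ 0#
  ≈⇒-≈0 {x} {y} h = trans (+-congʳ h) (-‿inverseʳ y)

mkCRing : (A : Set) (_≈_ : A → A → Set) (_+_ _*_ : A → A → A) (-_ : A → A) (0# 1# : A) →
  (∀ {x} → x ≈ x) → (∀ {x y} → x ≈ y → y ≈ x) → (∀ {x y z} → x ≈ y → y ≈ z → x ≈ z) →
  (∀ {x y u v} → x ≈ y → u ≈ v → (x + u) ≈ (y + v)) →
  (∀ {x y u v} → x ≈ y → u ≈ v → (x * u) ≈ (y * v)) →
  (∀ {x y} → x ≈ y → (- x) ≈ (- y)) →
  (∀ x y z → ((x + y) + z) ≈ (x + (y + z))) → (∀ x y → (x + y) ≈ (y + x)) →
  (∀ x → (0# + x) ≈ x) → (∀ x → ((- x) + x) ≈ 0#) →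
  (∀ x y z → ((x * y) * z) ≈ (x * (y * z))) → (∀ x y → (x * y) ≈ (y * x)) →
  (∀ x → (1# * x) ≈ x) → (∀ x y z → (x * (y + z)) ≈ ((x * y) + (x * z))) → CRing
mkCRing A _≈_ _+_ _*_ -_ 0# 1# r s t +c *c -c +a +co +i -i *a *co *i d = record
  { Carrier = A ; _≈_ = _≈_ ; _+_ = _+_ ; _*_ = _*_ ; -_ = -_ ; 0# = 0# ; 1# = 1#
  ; isCommutativeRing = record
    { isRing = record
      { +-isAbelianGroup = record
        { isGroup = record
          { isMonoid = record
            { isSemigroup = record
              { isMagma = record
                { isEquivalence = record { refl = r ; sym = s ; trans = t }
                ; ∙-cong = +c }
              ; assoc = +a }
            ; identity = +i , λ x → t (+co x 0#) (+i x) }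
          ; inverse = -i , λ x → t (+co x (- x)) (-i x)
          ; ⁻¹-cong = -c }
        ; comm = +co }
      ; *-cong = *c
      ; *-assoc = *a
      ; *-identity = *i , λ x → t (*co x 1#) (*i x)
      ; distrib = d , λ x y z → t (*co (y + z) x) (t (d x y z) (+c (*co x y) (*co x z))) }
    ; *-comm = *co } }

record Hom (A B : CRing) : Set where
  private
    module A = CommutativeRing A
    module B = CommutativeRing B
  field
    fn   : A.Carrier → B.Carrier
    cong : ∀ {x y} → x A.≈ y → fn x B.≈ fn y
    +h   : ∀ x y → fn (x A.+ y) B.≈ fn x B.+ fn y
    *h   : ∀ x y → fn (x A.* y) B.≈ fn x B.* fn y
    1h   : fn A.1# B.≈ B.1#
  open IntSolver B

  0h : fn A.0# B.≈ B.0#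
  0h = B.trans (solve 1 (λ x → x := (x :+ x) :- x) B.refl (fn A.0#))
         (≈⇒-≈0 (B.trans (B.sym (+h A.0# A.0#)) (cong (A.+-identityˡ A.0#))))

  -h : ∀ x → fn (A.- x) B.≈ B.- fn x
  -h x = B.trans (solve 2 (λ a b → a := (a :+ b) :- b) B.refl (fn (A.- x)) (fn x))
     (B.trans (B.+-congʳ (B.trans (B.sym (+h (A.- x) x)) (B.trans (cong (A.-‿inverseˡ x)) 0h))) (B.+-identityˡ _))

idHom : (A : CRing) → Hom A A
idHom A = record { fn = λ x → x ; cong = λ e → e ; +h = λ _ _ → refl ; *h = λ _ _ → refl ; 1h = refl }
  where open CommutativeRing A hiding (zero)

infixr 9 _∘h_
_∘h_ : {A B C : CRing} → Hom B C → Hom A B → Hom A C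
_∘h_ {A} {B} {C} G F = record
  { fn = G.fn ∘ F.fn ; cong = λ e → G.cong (F.cong e)
  ; +h = λ x y → C.trans (G.cong (F.+h x y)) (G.+h _ _)
  ; *h = λ x y → C.trans (G.cong (F.*h x y)) (G.*h _ _)
  ; 1h = C.trans (G.cong F.1h) G.1h }
  where
  module G = Hom G
  module F = Hom F
  module C = CommutativeRing C

-- Equality is only assumed stable under double negation, and the product law asks that one factor
-- be refuted to vanish, not that a vanishing factor be found: zero cannot be recognised in the
-- coefficient field constructed below.
record Domain (A : CRing) : Set where
  open CommutativeRing A hiding (zero)
  field
    stable : ∀ {x y} → ¬ ¬ (x ≈ y) → x ≈ y
    dom    : ∀ {x y} → x * y ≈ 0# → ¬ (x ≈ 0#) → y ≈ 0#
    1≉0    : ¬ (1# ≈ 0#)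
  open IntSolver A

  *-≉0 : ∀ {x y} → x ≉0 → y ≉0 → x * y ≉0
  *-≉0 hx hy h = hy (dom h hx)

  cancelˡ : ∀ {x y z} → x ≉0 → x * y ≈ x * z → y ≈ z
  cancelˡ {x} {y} {z} hx h = -≈0⇒≈ (dom (trans (solve 3 (λ x y z → x :* (y :- z) := x :* y :- x :* z) refl x y z) (≈⇒-≈0 h)) hx)

record Ideal (A : CRing) : Set₁ where
  open CommutativeRing A hiding (zero)
  field
    _∈I  : Carrier → Set
    resp : ∀ {x y} → x ≈ y → x ∈I → y ∈I
    0∈   : 0# ∈I
    +∈   : ∀ {x y} → x ∈I → y ∈I → (x + y) ∈I
    *∈   : ∀ a {x} → x ∈I → (a * x) ∈I

module _ (A : CRing) (𝔞 : Ideal A) where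
  open CommutativeRing A hiding (zero)
  open IntSolver A
  open Ideal 𝔞
  private
    of≈ : ∀ {x y} → x ≈ y → (x - y) ∈I
    of≈ h = resp (sym (≈⇒-≈0 h)) 0∈
    neg∈ : ∀ {x} → x ∈I → (- x) ∈I
    neg∈ {x} h = resp (solve 2 (λ o x → (:- o) :* x := :- (o :* x)) refl 1# x) (*∈ (- 1#) h) ▸ trans (-‿cong (*-identityˡ x)) refl
      where
      _▸_ : ∀ {x y} → x ∈I → x ≈ y → y ∈I
      h ▸ e = resp e h

  Quotient : CRing
  Quotient = mkCRing Carrier (λ x y → (x - y) ∈I) _+_ _*_ -_ 0# 1#
    (of≈ refl)
    (λ {x} {y} h → resp (solve 2 (λ x y → :- (x :- y) := y :- x) refl x y) (neg∈ h))
    (λ {x} {y} {z} h k → resp (solve 3 (λ x y z → (x :- y) :+ (y :- z) := x :- z) refl x y z) (+∈ h k))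
    (λ {x} {y} {u} {v} h k → resp (solve 4 (λ x y u v → (x :- y) :+ (u :- v) := (x :+ u) :- (y :+ v)) refl x y u v) (+∈ h k))
    (λ {x} {y} {u} {v} h k → resp (solve 4 (λ x y u v → u :* (x :- y) :+ y :* (u :- v) := x :* u :- y :* v) refl x y u v) (+∈ (*∈ u h) (*∈ y k)))
    (λ {x} {y} h → resp (solve 2 (λ x y → :- (x :- y) := (:- x) :- (:- y)) refl x y) (neg∈ h))
    (λ x y z → of≈ (+-assoc x y z)) (λ x y → of≈ (+-comm x y)) (λ x → of≈ (+-identityˡ x)) (λ x → of≈ (-‿inverseˡ x))
    (λ x y z → of≈ (*-assoc x y z)) (λ x y → of≈ (*-comm x y)) (λ x → of≈ (*-identityˡ x)) (λ x y z → of≈ (distribˡ x y z))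

  proj : Hom A Quotient
  proj = record { fn = λ x → x ; cong = of≈ ; +h = λ _ _ → of≈ refl ; *h = λ _ _ → of≈ refl ; 1h = of≈ refl }

principal : (A : CRing) → CommutativeRing.Carrier A → Ideal A
principal A c = record
  { _∈I  = λ x → Σ Carrier λ h → x ≈ h * c
  ; resp = λ e (h , k) → h , trans (sym e) k
  ; 0∈   = 0# , sym (zeroˡ c)
  ; +∈   = λ (h , k) (h' , k') → h + h' , trans (+-cong k k') (sym (distribʳ c h h'))
  ; *∈   = λ a (h , k) → a * h , trans (*-congˡ k) (sym (*-assoc a h c)) }
  where open CommutativeRing A hiding (zero)

module _ (A : CRing) (c : CommutativeRing.Carrier A) where
  open CommutativeRing A hiding (zero)
  open IntSolver A
  private module Q = CommutativeRing (Quotient A (principal A c))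

  generator≈0 : c Q.≈ 0#
  generator≈0 = 1# , trans (solve 1 (λ c → c :- :0 := c) refl c) (sym (*-identityˡ c))

  ≈0⇒multiple : ∀ {x} → x Q.≈ 0# → Σ Carrier λ h → x ≈ h * c
  ≈0⇒multiple {x} (h , e) = h , trans (solve 1 (λ x → x := x :- :0) refl x) e

-- Polynomial rings in one and in several variables.

module PolyOver (R : CRing) where
  open CommutativeRing R hiding (zero)
  open IntSolver R
  open Domain using (stable; dom; 1≉0)

  coef : List Carrier → ℕ → Carrier
  coef []      _       = 0#
  coef (a ∷ p) zero    = a
  coef (a ∷ p) (suc i) = coef p i

  infix 4 _≋_
  -- Trailing zeros are allowed: normalising a polynomial or naming its degree would require
  -- deciding which coefficients vanish.
  _≋_ : List Carrier → List Carrier → Set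
  p ≋ q = ∀ i → coef p i ≈ coef q i

  infixl 6 _⊞_
  infixl 7 _⊠_ _·_
  _⊞_ : List Carrier → List Carrier → List Carrier
  []      ⊞ q       = q
  (a ∷ p) ⊞ []      = a ∷ p
  (a ∷ p) ⊞ (b ∷ q) = (a + b) ∷ (p ⊞ q)

  _·_ : Carrier → List Carrier → List Carrier
  a · p = map (a *_) p

  _⊠_ : List Carrier → List Carrier → List Carrier
  []      ⊠ q = []
  (a ∷ p) ⊠ q = a · q ⊞ (0# ∷ p ⊠ q)

  coef-⊞ : ∀ p q i → coef (p ⊞ q) i ≈ coef p i + coef q i
  coef-⊞ []      q       i       = sym (+-identityˡ _)
  coef-⊞ (a ∷ p) []      i       = sym (+-identityʳ _)
  coef-⊞ (a ∷ p) (b ∷ q) zero    = refl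
  coef-⊞ (a ∷ p) (b ∷ q) (suc i) = coef-⊞ p q i

  coef-· : ∀ a p i → coef (a · p) i ≈ a * coef p i
  coef-· a []      i       = sym (zeroʳ a)
  coef-· a (b ∷ p) zero    = refl
  coef-· a (b ∷ p) (suc i) = coef-· a p i

  coef-∷⊠ : ∀ a p q i → coef ((a ∷ p) ⊠ q) i ≈ a * coef q i + coef (0# ∷ p ⊠ q) i
  coef-∷⊠ a p q i = trans (coef-⊞ (a · q) (0# ∷ p ⊠ q) i) (+-congʳ (coef-· a q i))

  private
    ⊠-congʳ : ∀ p {q q'} → q ≋ q' → p ⊠ q ≋ p ⊠ q'
    ⊠-congʳ []      h i = refl
    ⊠-congʳ (a ∷ p) {q} {q'} h i = trans (coef-∷⊠ a p q i) (trans (+-cong (*-congˡ (h i)) (sh i)) (sym (coef-∷⊠ a p q' i)))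
      where
      sh : ∀ i → coef (0# ∷ p ⊠ q) i ≈ coef (0# ∷ p ⊠ q') i
      sh zero    = refl
      sh (suc i) = ⊠-congʳ p h i

    ⊠-zeroʳ : ∀ p i → coef (p ⊠ []) i ≈ 0#
    ⊠-zeroʳ []      i       = refl
    ⊠-zeroʳ (a ∷ p) zero    = refl
    ⊠-zeroʳ (a ∷ p) (suc i) = ⊠-zeroʳ p i

    ⊠-consʳ : ∀ p b q i → coef (p ⊠ (b ∷ q)) i ≈ b * coef p i + coef (0# ∷ p ⊠ q) i
    ⊠-consʳ []      b q zero    = solve 1 (λ b → :0 := b :* :0 :+ :0) refl b
    ⊠-consʳ []      b q (suc i) = solve 1 (λ b → :0 := b :* :0 :+ :0) refl b
    ⊠-consʳ (a ∷ p) b q zero    = solve 2 (λ a b → a :* b :+ :0 := b :* a :+ :0) refl a b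
    ⊠-consʳ (a ∷ p) b q (suc i) = trans (coef-∷⊠ a p (b ∷ q) (suc i)) (trans (+-congˡ (⊠-consʳ p b q i))
      (trans (solve 3 (λ x y z → x :+ (y :+ z) := y :+ (x :+ z)) refl _ _ _) (+-congˡ (sym (coef-∷⊠ a p q i)))))

    ⊠-comm : ∀ p q → p ⊠ q ≋ q ⊠ p
    ⊠-comm []      q i = sym (⊠-zeroʳ q i)
    ⊠-comm (a ∷ p) q i = trans (coef-∷⊠ a p q i) (trans (+-congˡ (sh i)) (sym (⊠-consʳ q a p i)))
      where
      sh : ∀ i → coef (0# ∷ p ⊠ q) i ≈ coef (0# ∷ q ⊠ p) i
      sh zero    = refl
      sh (suc i) = ⊠-comm p q i

    ⊠-cong : ∀ {p p' q q'} → p ≋ p' → q ≋ q' → p ⊠ q ≋ p' ⊠ q'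
    ⊠-cong {p} {p'} {q} {q'} h k i = trans (⊠-congʳ p k i) (trans (⊠-comm p q' i) (trans (⊠-congʳ q' h i) (⊠-comm q' p' i)))

    ⊠-distribˡ : ∀ p q r → p ⊠ (q ⊞ r) ≋ p ⊠ q ⊞ p ⊠ r
    ⊠-distribˡ []      q r i = refl
    ⊠-distribˡ (a ∷ p) q r i = trans (coef-∷⊠ a p (q ⊞ r) i) (trans (+-cong (*-congˡ (coef-⊞ q r i)) (sh i))
      (trans (solve 5 (λ a x y z w → a :* (x :+ y) :+ (z :+ w) := (a :* x :+ z) :+ (a :* y :+ w)) refl a _ _ _ _)
      (trans (+-cong (sym (coef-∷⊠ a p q i)) (sym (coef-∷⊠ a p r i))) (sym (coef-⊞ ((a ∷ p) ⊠ q) ((a ∷ p) ⊠ r) i)))))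
      where
      sh : ∀ i → coef (0# ∷ p ⊠ (q ⊞ r)) i ≈ coef (0# ∷ p ⊠ q) i + coef (0# ∷ p ⊠ r) i
      sh zero    = sym (+-identityˡ _)
      sh (suc i) = trans (⊠-distribˡ p q r i) (coef-⊞ (p ⊠ q) (p ⊠ r) i)

    ⊠-distribʳ : ∀ p q r → (q ⊞ r) ⊠ p ≋ q ⊠ p ⊞ r ⊠ p
    ⊠-distribʳ p q r i = trans (⊠-comm (q ⊞ r) p i) (trans (⊠-distribˡ p q r i) (trans (coef-⊞ (p ⊠ q) (p ⊠ r) i)
      (trans (+-cong (⊠-comm p q i) (⊠-comm p r i)) (sym (coef-⊞ (q ⊠ p) (r ⊠ p) i)))))

    ·-⊠ : ∀ a p q → (a · p) ⊠ q ≋ a · (p ⊠ q)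
    ·-⊠ a []      q i = refl
    ·-⊠ a (b ∷ p) q i = trans (coef-∷⊠ (a * b) (a · p) q i) (trans (+-congˡ (sh i))
       (trans (solve 4 (λ a b x y → (a :* b) :* x :+ a :* y := a :* (b :* x :+ y)) refl a b _ _)
       (trans (*-congˡ (sym (coef-∷⊠ b p q i))) (sym (coef-· a ((b ∷ p) ⊠ q) i)))))
      where
      sh : ∀ i → coef (0# ∷ (a · p) ⊠ q) i ≈ a * coef (0# ∷ p ⊠ q) i
      sh zero    = sym (zeroʳ a)
      sh (suc i) = trans (·-⊠ a p q i) (coef-· a (p ⊠ q) i)

    0∷-⊠ : ∀ p q → (0# ∷ p) ⊠ q ≋ 0# ∷ (p ⊠ q)
    0∷-⊠ p q i = trans (coef-∷⊠ 0# p q i) (solve 2 (λ x y → :0 :* x :+ y := y) refl _ _)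

    ⊠-assoc : ∀ p q r → (p ⊠ q) ⊠ r ≋ p ⊠ (q ⊠ r)
    ⊠-assoc []      q r i = refl
    ⊠-assoc (a ∷ p) q r i = trans (⊠-distribʳ r (a · q) (0# ∷ p ⊠ q) i)
      (trans (coef-⊞ ((a · q) ⊠ r) ((0# ∷ p ⊠ q) ⊠ r) i)
      (trans (+-cong (trans (·-⊠ a q r i) (coef-· a (q ⊠ r) i)) (trans (0∷-⊠ (p ⊠ q) r i) (sh i)))
      (sym (coef-∷⊠ a p (q ⊠ r) i))))
      where
      sh : ∀ i → coef (0# ∷ (p ⊠ q) ⊠ r) i ≈ coef (0# ∷ p ⊠ (q ⊠ r)) i
      sh zero    = refl
      sh (suc i) = ⊠-assoc p q r i

    ⊠-identityˡ : ∀ p → (1# ∷ []) ⊠ p ≋ p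
    ⊠-identityˡ p i = trans (coef-∷⊠ 1# [] p i) (trans (+-cong (*-identityˡ _) (sh i)) (+-identityʳ _))
      where
      sh : ∀ i → coef (0# ∷ []) i ≈ 0#
      sh zero    = refl
      sh (suc i) = refl

  neg : List Carrier → List Carrier
  neg p = (- 1#) · p

  coef-neg : ∀ p i → coef (neg p) i ≈ - coef p i
  coef-neg p i = trans (coef-· (- 1#) p i) (trans (solve 2 (λ o x → (:- o) :* x := :- (o :* x)) refl 1# _) (-‿cong (*-identityˡ _)))

  PolyRing : CRing
  PolyRing = mkCRing (List Carrier) _≋_ _⊞_ _⊠_ neg [] (1# ∷ [])
    (λ i → refl) (λ h i → sym (h i)) (λ h k i → trans (h i) (k i))
    (λ {x} {y} {u} {v} h k i → trans (coef-⊞ x u i) (trans (+-cong (h i) (k i)) (sym (coef-⊞ y v i))))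
    (λ {x} {y} {u} {v} → ⊠-cong {x} {y} {u} {v})
    (λ {x} {y} h i → trans (coef-neg x i) (trans (-‿cong (h i)) (sym (coef-neg y i))))
    (λ x y z i → trans (coef-⊞ (x ⊞ y) z i) (trans (+-congʳ (coef-⊞ x y i)) (trans (+-assoc _ _ _)
       (sym (trans (coef-⊞ x (y ⊞ z) i) (+-congˡ (coef-⊞ y z i)))))))
    (λ x y i → trans (coef-⊞ x y i) (trans (+-comm _ _) (sym (coef-⊞ y x i))))
    (λ x i → refl)
    (λ x i → trans (coef-⊞ (neg x) x i) (trans (+-congʳ (coef-neg x i)) (-‿inverseˡ _)))
    ⊠-assoc ⊠-comm ⊠-identityˡ ⊠-distribˡ

  C : Carrier → List Carrier
  C a = a ∷ []

  X : List Carrier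
  X = 0# ∷ 1# ∷ []

  CHom : Hom R PolyRing
  CHom = record
    { fn = C
    ; cong = λ { h zero → h ; h (suc i) → refl }
    ; +h = λ { x y zero → refl ; x y (suc i) → refl }
    ; *h = λ { x y zero → sym (+-identityʳ _) ; x y (suc i) → refl }
    ; 1h = λ i → refl }

  X⊠ : ∀ p → X ⊠ p ≋ 0# ∷ p
  X⊠ p zero    = trans (coef-∷⊠ 0# (1# ∷ []) p zero) (solve 1 (λ x → :0 :* x :+ :0 := :0) refl _)
  X⊠ p (suc i) = trans (coef-∷⊠ 0# (1# ∷ []) p (suc i)) (trans (+-congˡ (⊠-identityˡ p i)) (solve 2 (λ x y → :0 :* x :+ y := y) refl _ _))

  horner : ∀ a p → a ∷ p ≋ C a ⊞ X ⊠ p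
  horner a p zero    = sym (trans (coef-⊞ (C a) (X ⊠ p) zero) (trans (+-congˡ (X⊠ p zero)) (+-identityʳ a)))
  horner a p (suc i) = sym (trans (coef-⊞ (C a) (X ⊠ p) (suc i)) (trans (+-congˡ (X⊠ p (suc i))) (+-identityˡ _)))

  -- The conclusion is stable, so each constant term of `p` may be assumed zero or nonzero although
  -- this is undecidable. A zero term is dropped; at the first nonzero one, `unit-case` forces the
  -- coefficients of `q` to vanish from the bottom up.
  PolyRing-domain : Domain R → Domain PolyRing
  PolyRing-domain D = record
    { stable = λ h i → stable D (λ k → h (λ e → k (e i)))
    ; dom    = λ {p} {q} → domain p q
    ; 1≉0    = λ h → 1≉0 D (h 0) }
    where
    unit-case : ∀ a p q → a ≉0 → (a ∷ p) ⊠ q ≋ [] → q ≋ []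
    unit-case a p []      ha h i = refl
    unit-case a p (b ∷ q) ha h   = λ { zero → b≈0 ; (suc i) → rec i }
      where
      b≈0 : b ≈ 0#
      b≈0 = dom D (trans (sym (+-identityʳ _)) (h 0)) ha
      rec : q ≋ []
      rec = unit-case a p q ha (λ i → trans (sym (trans (⊠-consʳ (a ∷ p) b q (suc i))
              (trans (+-congʳ (trans (*-congʳ b≈0) (zeroˡ _))) (+-identityˡ _)))) (h (suc i)))
    domain : ∀ p q → p ⊠ q ≋ [] → ¬ (p ≋ []) → q ≋ []
    domain []      q h hp = ⊥-elim (hp λ i → refl)
    domain (a ∷ p) q h hp i = stable D λ k → ¬¬-em λ
      { (inj₂ a≉0) → k (unit-case a p q a≉0 h i)
      ; (inj₁ a≈0) → k (domain p q
            (λ j → trans (sym (trans (coef-∷⊠ a p q (suc j)) (trans (+-congʳ (trans (*-congʳ a≈0) (zeroˡ _))) (+-identityˡ _)))) (h (suc j)))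
            (λ e → hp λ { zero → a≈0 ; (suc j) → e j }) i) }

  module _ {A : CRing} where
    private module A = CommutativeRing A
    open IntSolver A using () renaming (solve to solveA; _:=_ to _:=A_; _:+_ to _:+A_; _:*_ to _:*A_; :0 to :0A)

    homs-agree : (F G : Hom PolyRing A) → (∀ a → Hom.fn F (C a) A.≈ Hom.fn G (C a)) → Hom.fn F X A.≈ Hom.fn G X →
                 ∀ p → Hom.fn F p A.≈ Hom.fn G p
    homs-agree F G hC hX []      = A.trans (Hom.0h F) (A.sym (Hom.0h G))
    homs-agree F G hC hX (a ∷ p) = A.trans (Hom.cong F (horner a p)) (A.trans (Hom.+h F _ _)
      (A.trans (A.+-cong (hC a) (A.trans (Hom.*h F X p) (A.trans (A.*-cong hX (homs-agree F G hC hX p)) (A.sym (Hom.*h G X p)))))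
      (A.trans (A.sym (Hom.+h G _ _)) (A.sym (Hom.cong G (horner a p))))))

    module _ (φ : Hom R A) (x : A.Carrier) where
      private
        module φ = Hom φ

        ev : List Carrier → A.Carrier
        ev []      = A.0#
        ev (a ∷ p) = φ.fn a A.+ x A.* ev p

        ev-0 : ∀ p → p ≋ [] → ev p A.≈ A.0#
        ev-0 []      h = A.refl
        ev-0 (a ∷ p) h = A.trans (A.+-cong (A.trans (φ.cong (h 0)) φ.0h) (A.*-congˡ (ev-0 p (λ i → h (suc i)))))
          (solveA 1 (λ x → :0A :+A x :*A :0A :=A :0A) A.refl x)

        ev-cong : ∀ p q → p ≋ q → ev p A.≈ ev q
        ev-cong []      q       h = A.sym (ev-0 q (λ i → sym (h i)))
        ev-cong (a ∷ p) []      h = ev-0 (a ∷ p) h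
        ev-cong (a ∷ p) (b ∷ q) h = A.+-cong (φ.cong (h 0)) (A.*-congˡ (ev-cong p q (λ i → h (suc i))))

        ev-⊞ : ∀ p q → ev (p ⊞ q) A.≈ ev p A.+ ev q
        ev-⊞ []      q       = A.sym (A.+-identityˡ _)
        ev-⊞ (a ∷ p) []      = A.sym (A.+-identityʳ _)
        ev-⊞ (a ∷ p) (b ∷ q) = A.trans (A.+-cong (φ.+h a b) (A.*-congˡ (ev-⊞ p q)))
          (solveA 5 (λ a b x p q → (a :+A b) :+A x :*A (p :+A q) :=A (a :+A x :*A p) :+A (b :+A x :*A q)) A.refl _ _ _ _ _)

        ev-· : ∀ a p → ev (a · p) A.≈ φ.fn a A.* ev p
        ev-· a []      = A.sym (A.zeroʳ _)
        ev-· a (b ∷ p) = A.trans (A.+-cong (φ.*h a b) (A.*-congˡ (ev-· a p)))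
          (solveA 4 (λ a b x p → a :*A b :+A x :*A (a :*A p) :=A a :*A (b :+A x :*A p)) A.refl _ _ _ _)

        ev-⊠ : ∀ p q → ev (p ⊠ q) A.≈ ev p A.* ev q
        ev-⊠ []      q = A.sym (A.zeroˡ _)
        ev-⊠ (a ∷ p) q = A.trans (ev-⊞ (a · q) (0# ∷ p ⊠ q)) (A.trans (A.+-cong (ev-· a q) (A.+-cong φ.0h (A.*-congˡ (ev-⊠ p q))))
          (solveA 4 (λ a x p q → a :*A q :+A (:0A :+A x :*A (p :*A q)) :=A (a :+A x :*A p) :*A q) A.refl _ _ _ _))

      evalHom : Hom PolyRing A
      evalHom = record
        { fn = ev ; cong = λ {p} {q} → ev-cong p q ; +h = ev-⊞ ; *h = ev-⊠
        ; 1h = A.trans (A.+-cong φ.1h (A.zeroʳ x)) (A.+-identityʳ A.1#) }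

      evalHom-C : ∀ a → Hom.fn evalHom (C a) A.≈ φ.fn a
      evalHom-C a = A.trans (A.+-congˡ (A.zeroʳ x)) (A.+-identityʳ _)

      evalHom-X : Hom.fn evalHom X A.≈ x
      evalHom-X = A.trans (A.+-cong φ.0h (A.*-congˡ (A.trans (evalHom-C 1#) φ.1h))) (A.trans (A.+-identityˡ _) (A.*-identityʳ x))

open PolyOver using (PolyRing; CHom; evalHom; evalHom-C; evalHom-X; homs-agree; PolyRing-domain) public

module MvPoly (K : CRing) where
  MvP : ℕ → CRing
  MvP zero    = K
  MvP (suc n) = PolyRing (MvP n)

  con : ∀ n → Hom K (MvP n)
  con zero    = idHom K
  con (suc n) = CHom (MvP n) ∘h con n

  var : ∀ {n} → Fin n → CommutativeRing.Carrier (MvP n)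
  var {suc n} Fin.zero    = PolyOver.X (MvP n)
  var {suc n} (Fin.suc i) = PolyOver.C (MvP n) (var i)

  MvP-domain : Domain K → ∀ n → Domain (MvP n)
  MvP-domain D zero    = D
  MvP-domain D (suc n) = PolyRing-domain (MvP n) (MvP-domain D n)

  module _ {A : CRing} where
    open CommutativeRing A hiding (zero)

    subst-hom : Hom K A → ∀ {n} → (Fin n → Carrier) → Hom (MvP n) A
    subst-hom φ {zero}  ρ = φ
    subst-hom φ {suc n} ρ = evalHom (MvP n) (subst-hom φ (ρ ∘ Fin.suc)) (ρ Fin.zero)

    subst-var : ∀ φ {n} (ρ : Fin n → Carrier) i → Hom.fn (subst-hom φ ρ) (var i) ≈ ρ i
    subst-var φ {suc n} ρ Fin.zero    = evalHom-X (MvP n) (subst-hom φ (ρ ∘ Fin.suc)) (ρ Fin.zero)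
    subst-var φ {suc n} ρ (Fin.suc i) = trans (evalHom-C (MvP n) (subst-hom φ (ρ ∘ Fin.suc)) (ρ Fin.zero) (var i)) (subst-var φ (ρ ∘ Fin.suc) i)

    subst-con : ∀ φ {n} (ρ : Fin n → Carrier) k → Hom.fn (subst-hom φ ρ) (Hom.fn (con n) k) ≈ Hom.fn φ k
    subst-con φ {zero}  ρ k = refl
    subst-con φ {suc n} ρ k = trans (evalHom-C (MvP n) (subst-hom φ (ρ ∘ Fin.suc)) (ρ Fin.zero) _) (subst-con φ (ρ ∘ Fin.suc) k)

    mv-agree : ∀ n (F G : Hom (MvP n) A) → (∀ k → Hom.fn F (Hom.fn (con n) k) ≈ Hom.fn G (Hom.fn (con n) k)) →
               (∀ i → Hom.fn F (var {n} i) ≈ Hom.fn G (var {n} i)) → ∀ p → Hom.fn F p ≈ Hom.fn G p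
    mv-agree zero    F G hc hv = hc
    mv-agree (suc n) F G hc hv = homs-agree (MvP n) F G
      (mv-agree n (F ∘h CHom (MvP n)) (G ∘h CHom (MvP n)) hc (λ i → hv (Fin.suc i))) (hv Fin.zero)

-- Krull's theorem for a countable ring: run through the ring and adjoin each element
-- unless the resulting ideal meets the multiplicative set Q.
module Krull (A : CRing) (enum : ℕ → CommutativeRing.Carrier A)
  (surj : ∀ a → ∃ λ n → CommutativeRing._≈_ A a (enum n))
  (Q : CommutativeRing.Carrier A → Set)
  (Q-resp : ∀ {x y} → CommutativeRing._≈_ A x y → Q x → Q y)
  (Q-* : ∀ {x y} → Q x → Q y → Q (CommutativeRing._*_ A x y))
  (Q-1 : Q (CommutativeRing.1# A))
  (Q-≉0 : ∀ {x} → Q x → ¬ CommutativeRing._≈_ A x (CommutativeRing.0# A)) where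

  open CommutativeRing A hiding (zero)
  open IntSolver A

  mutual
    -- Whether adjoining `enum n` keeps the ideal away from `Q` is not decided: the requirement is
    -- carried inside the membership predicate, which is closed under the ideal operations in either
    -- case.
    stage : ℕ → Carrier → Set
    stage zero    a = a ≈ 0#
    stage (suc n) a = stage n a ⊎ ((∀ p → Q p → ¬ extended n p) × extended n a)

    extended : ℕ → Carrier → Set
    extended n a = Σ Carrier λ x → stage n (a - x * enum n)

  private
    mutual
      st-resp : ∀ n {a b} → a ≈ b → stage n a → stage n b
      st-resp zero    e h              = trans (sym e) h
      st-resp (suc n) e (inj₁ h)       = inj₁ (st-resp n e h)
      st-resp (suc n) e (inj₂ (d , h)) = inj₂ (d , ex-resp n e h)

      ex-resp : ∀ n {a b} → a ≈ b → extended n a → extended n b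
      ex-resp n e (x , h) = x , st-resp n (+-congʳ e) h

    st-ex : ∀ n {a} → stage n a → extended n a
    st-ex n {a} h = 0# , st-resp n (sym (trans (+-congˡ (trans (-‿cong (zeroˡ _)) (solve 0 (:- :0 := :0) refl))) (+-identityʳ a))) h

    mutual
      st-+ : ∀ n {a b} → stage n a → stage n b → stage n (a + b)
      st-+ zero    h k                           = trans (+-cong h k) (+-identityˡ 0#)
      st-+ (suc n) (inj₁ h)       (inj₁ k)       = inj₁ (st-+ n h k)
      st-+ (suc n) (inj₁ h)       (inj₂ (d , k)) = inj₂ (d , ex-+ n (st-ex n h) k)
      st-+ (suc n) (inj₂ (d , h)) (inj₁ k)       = inj₂ (d , ex-+ n h (st-ex n k))
      st-+ (suc n) (inj₂ (d , h)) (inj₂ (_ , k)) = inj₂ (d , ex-+ n h k)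

      ex-+ : ∀ n {a b} → extended n a → extended n b → extended n (a + b)
      ex-+ n {a} {b} (x , h) (y , k) = x + y , st-resp n
        (solve 5 (λ a b x y e → (a :- x :* e) :+ (b :- y :* e) := (a :+ b) :- (x :+ y) :* e) refl a b x y (enum n)) (st-+ n h k)

    mutual
      st-* : ∀ n c {a} → stage n a → stage n (c * a)
      st-* zero    c h              = trans (*-congˡ h) (zeroʳ c)
      st-* (suc n) c (inj₁ h)       = inj₁ (st-* n c h)
      st-* (suc n) c (inj₂ (d , h)) = inj₂ (d , ex-* n c h)

      ex-* : ∀ n c {a} → extended n a → extended n (c * a)
      ex-* n c {a} (x , h) = c * x , st-resp n
        (solve 4 (λ c a x e → c :* (a :- x :* e) := c :* a :- (c :* x) :* e) refl c a x (enum n)) (st-* n c h)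

    st-mono : ∀ {m n a} → m ≤′ n → stage m a → stage n a
    st-mono ≤′-refl     h = h
    st-mono (≤′-step l) h = inj₁ (st-mono l h)

    st-avoid : ∀ n {a} → Q a → ¬ stage n a
    st-avoid zero    q h              = Q-≉0 q h
    st-avoid (suc n) q (inj₁ h)       = st-avoid n q h
    st-avoid (suc n) q (inj₂ (d , h)) = d _ q h

    up : ∀ {m n a} → stage m a → stage (m ℕ.+ n) a
    up {m} {n} = st-mono (ℕ.≤⇒≤′ (ℕ.m≤m+n m n))
    up' : ∀ {m n a} → stage m a → stage (n ℕ.+ m) a
    up' {m} {n} = st-mono (ℕ.≤⇒≤′ (ℕ.m≤n+m m n))

    ∃∈ : Carrier → Set
    ∃∈ a = ∃ λ n → stage n a

    ∃+ : ∀ {a b} → ∃∈ a → ∃∈ b → ∃∈ (a + b)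
    ∃+ (m , h) (n , k) = m ℕ.+ n , st-+ (m ℕ.+ n) (up {m} {n} h) (up' {n} {m} k)

    -- Had the extension by `a` missed `Q` at the stage where `a` is enumerated, `a` would have been
    -- adjoined there. So outside the union that extension meets `Q`, though the witness is only
    -- available under a double negation.
    avoid-or-meet : ∀ a → ¬ ∃∈ a → ¬ ¬ (Σ Carrier λ p → Q p × Σ Carrier λ x → ∃∈ (p - x * a))
    avoid-or-meet a ha k = ha (suc n , inj₂ ((λ p q (x , h) → k (p , q , x , n , st-resp n (+-congˡ (-‿cong (*-congˡ (sym e)))) h))
                                  , ex-resp n (sym e) (1# , st-resp n (sym z) (st-* n 0# (s0 n)))))
      where
      n = proj₁ (surj a)
      e = proj₂ (surj a)
      s0 : ∀ n → stage n 0#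
      s0 zero    = refl
      s0 (suc n) = inj₁ (s0 n)
      z : enum n - 1# * enum n ≈ 0# * 0#
      z = trans (+-congˡ (-‿cong (*-identityˡ _))) (solve 1 (λ x → x :- x := :0 :* :0) refl _)

  -- The double negation makes membership stable, which is what turns the quotient into a `Domain`.
  prime : Ideal A
  prime = record
    { _∈I  = λ a → ¬ ¬ ∃∈ a
    ; resp = λ e h k → h (λ (n , s) → k (n , st-resp n e s))
    ; 0∈   = λ k → k (0 , refl)
    ; +∈   = λ h h' k → h (λ s → h' (λ s' → k (∃+ s s')))
    ; *∈   = λ a h k → h (λ (n , s) → k (n , st-* n a s)) }

  open Ideal prime

  Q-avoids : ∀ {a} → Q a → ¬ (a ∈I)
  Q-avoids q h = h (λ (n , s) → st-avoid n q s)

  private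
    sub0 : ∀ {a} → (a - 0#) ∈I → a ∈I
    sub0 = resp (solve 1 (λ a → a :- :0 := a) refl _)

    -- If both factors lay outside, there would be `p` and `p'` in `Q` congruent to `x * a` and
    -- `x' * b` modulo the ideal. Then `p * p'` would lie in the ideal together with `a * b`, but it
    -- belongs to `Q`.
    prod : ∀ {a b} → (a * b) ∈I → ¬ (a ∈I) → b ∈I
    prod {a} {b} h ha hb = h λ hab → ha λ ia → avoid-or-meet a ia (λ (p , qp , x , hp) →
        avoid-or-meet b hb λ (p' , qp' , x' , hp') →
        Q-avoids (Q-* qp qp') (λ k → k (combine p x p' x' hab hp hp')))
      where
      combine : ∀ p x p' x' → ∃∈ (a * b) → ∃∈ (p - x * a) → ∃∈ (p' - x' * b) → ∃∈ (p * p')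
      combine p x p' x' (l , s) (m , t) (n , u) = subst∈ (∃+ (∃+ (m , st-* m p' t) (n , st-* n (x * a) u)) (l , st-* l (x * x') s))
        where
        subst∈ : ∃∈ ((p' * (p - x * a) + x * a * (p' - x' * b)) + x * x' * (a * b)) → ∃∈ (p * p')
        subst∈ (n , s) = n , st-resp n (solve 6 (λ a b p x p' x' →
          (p' :* (p :- x :* a) :+ x :* a :* (p' :- x' :* b)) :+ x :* x' :* (a :* b) := p :* p') refl a b p x p' x') s

  quotient-domain : Domain (Quotient A prime)
  quotient-domain = record
    { stable = λ h k → h (λ z → z k)
    ; dom    = λ {x} {y} h hx → resp (solve 1 (λ a → a := a :- :0) refl y)
                 (prod (sub0 h) (λ z → hx (resp (solve 1 (λ a → a := a :- :0) refl x) z)))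
    ; 1≉0    = λ h → Q-avoids Q-1 (sub0 h) }

-- f k plays the role of sin(kθ)/sin θ, with x = 2 cos θ.
module Cheb (R : CRing) (x : CommutativeRing.Carrier R) where
  open CommutativeRing R hiding (zero)
  open IntSolver R

  f : ℕ → Carrier
  f zero          = 0#
  f (suc zero)    = 1#
  f (suc (suc n)) = x * f (suc n) - f n

  -- Iterating this formula gives the Clebsch-Gordan rule: a product of two Chebyshev values is a
  -- sum of Chebyshev values with indices descending in steps of two. The cone of positive elements
  -- is closed under products for this reason.
  f-add : ∀ a b → f (suc a) * f (suc b) ≈ f a * f b + f (suc (a ℕ.+ b))
  f-add zero    b = trans (*-identityˡ _) (sym (trans (+-congʳ (zeroˡ _)) (+-identityˡ _)))
  f-add (suc a) b = trans
    (solve 5 (λ x p q r s → (x :* p :- q) :* s := p :* (x :* s :- r) :- q :* s :+ p :* r) refl x (f (suc a)) (f a) (f b) (f (suc b)))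
    (trans (+-congʳ (+-congʳ (f-add a (suc b))))
    (trans (solve 3 (λ u v w → (u :+ v) :- u :+ w := w :+ v) refl _ _ _)
      (+-congˡ (reflexive (≡.cong (λ k → f (suc k)) (ℕ.+-suc a b))))))

  cassini : ∀ n → f (suc n) * f (suc n) ≈ f n * f (suc (suc n)) + 1#
  cassini zero    = trans (*-identityˡ _) (sym (trans (+-congʳ (zeroˡ _)) (+-identityˡ _)))
  cassini (suc n) = -≈0⇒≈ (trans
    (solve 4 (λ x p q o → (x :* p :- q) :* (x :* p :- q) :- (p :* (x :* (x :* p :- q) :- p) :+ o) := p :* p :- (q :* (x :* p :- q) :+ o)) refl x (f (suc n)) (f n) 1#)
    (≈⇒-≈0 (cassini n)))

  -- The factor `f (suc (suc j)) - f j` is 2 cos ((j + 1)θ), so along steps of j + 1 the values of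
  -- `f` obey the Chebyshev recursion for the multiplied angle. This is how π / m is reached from a
  -- finer angle.
  f-double : ∀ j a → f (a ℕ.+ (suc j ℕ.+ suc j)) ≈ (f (suc (suc j)) - f j) * f (a ℕ.+ suc j) - f a
  f-double j zero = begin
      f (suc (j ℕ.+ suc j))                       ≡⟨ ≡.cong (λ k → f (suc k)) (ℕ.+-suc j j) ⟩
      f (suc (suc j ℕ.+ j))                       ≈⟨ solve 2 (λ u v → v := (u :+ v) :- u) refl (f (suc j) * f j) _ ⟩
      (f (suc j) * f j + f (suc (suc j ℕ.+ j))) - f (suc j) * f j  ≈⟨ +-congʳ (sym (f-add (suc j) j)) ⟩
      f (suc (suc j)) * f (suc j) - f (suc j) * f j  ≈⟨ solve 3 (λ u v w → u :* v :- v :* w := (u :- w) :* v :- :0) refl _ _ _ ⟩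
      (f (suc (suc j)) - f j) * f (suc j) - 0#    ∎
    where open import Relation.Binary.Reasoning.Setoid setoid
  f-double j (suc zero) = begin
      f (suc (suc j ℕ.+ suc j))                          ≈⟨ solve 2 (λ u v → v := (u :+ v) :- u) refl (f (suc j) * f (suc j)) _ ⟩
      (f (suc j) * f (suc j) + f (suc (suc j ℕ.+ suc j))) - f (suc j) * f (suc j)  ≈⟨ +-cong (sym (f-add (suc j) (suc j))) (-‿cong (cassini j)) ⟩
      f (suc (suc j)) * f (suc (suc j)) - (f j * f (suc (suc j)) + 1#)  ≈⟨ solve 3 (λ u w o → u :* u :- (w :* u :+ o) := (u :- w) :* u :- o) refl _ _ _ ⟩
      (f (suc (suc j)) - f j) * f (suc (suc j)) - 1#     ∎
    where open import Relation.Binary.Reasoning.Setoid setoid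
  f-double j (suc (suc a)) = trans (+-cong (*-congˡ (f-double j (suc a))) (-‿cong (f-double j a)))
    (solve 6 (λ x c p q r s → x :* (c :* p :- r) :- (c :* q :- s) := c :* (x :* p :- q) :- (x :* r :- s)) refl x _ _ _ _ _)

  module Reflect (M : ℕ) (f-M : f (suc M) ≈ 0#) where

    -- For θ = π / (M + 1) the factor `f M` would be 1. Algebraically only its square is known to be
    -- 1, by taking i = M and j = 1, since θ could be another multiple of that angle.
    f-reflect : ∀ i j → i ℕ.+ j ≡ suc M → f j ≈ f M * f i
    f-reflect zero          j e = trans (trans (reflexive (≡.cong f e)) f-M) (sym (zeroʳ _))
    f-reflect (suc zero)    j e = trans (reflexive (≡.cong f (ℕ.suc-injective e))) (sym (*-identityʳ _))
    f-reflect (suc (suc i)) j e = trans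
      (solve 3 (λ x u v → u := x :* v :- (x :* v :- u)) refl x (f j) (f (suc j)))
      (trans (+-cong (*-congˡ (f-reflect (suc i) (suc j) (≡.cong suc (≡.trans (ℕ.+-suc i j) (ℕ.suc-injective e)))))
                     (-‿cong (f-reflect i (suc (suc j)) (≡.trans (ℕ.+-suc i (suc j)) (≡.trans (≡.cong suc (ℕ.+-suc i j)) e)))))
        (solve 4 (λ x m u v → x :* (m :* u) :- m :* v := m :* (x :* u :- v)) refl x _ _ _))

  -- A zero at m + 1 says that (m + 1)θ is a multiple of π; twice that index is a period whatever
  -- the parity of the multiple.
  f-periodic : ∀ {m} → f (suc m) ≈ 0# → (∀ k → f (k ℕ.+ (suc m ℕ.+ suc m)) ≈ f k)
  f-periodic {m} z zero    = trans (reflexive (≡.cong (λ k → f (suc k)) (ℕ.+-suc m m)))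
     (trans (solve 2 (λ u v → v := (u :+ v) :- u) refl (f (suc m) * f m) _)
     (trans (+-congʳ (sym (f-add (suc m) m))) (trans (+-cong (*-congˡ z) (-‿cong (*-congʳ z))) (solve 2 (λ u v → u :* :0 :- :0 :* v := :0) refl _ _))))
  f-periodic {m} z (suc zero) = trans (solve 2 (λ u v → v := (u :+ v) :- u) refl (f (suc m) * f (suc m)) _)
     (trans (+-congʳ (sym (f-add (suc m) (suc m)))) (trans (+-cong refl (-‿cong (*-congʳ z)))
     (trans (+-cong (*-cong refl refl) refl) (trans
        (solve 4 (λ x p q z → (x :* z :- q) :* (x :* z :- q) :- :0 :* p := q :* q :- z :* ((x :* q :- z :* x :* x) :+ q :* x)) refl x _ (f m) (f (suc m)))
        (trans (+-cong (base m z) (-‿cong (trans (*-congʳ z) (zeroˡ _)))) (solve 1 (λ o → o :- :0 := o) refl 1#))))))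
    where
    base : ∀ m → f (suc m) ≈ 0# → f m * f m ≈ 1#
    base zero    h = trans (zeroˡ _) (sym h)
    base (suc m) h = trans (cassini m) (trans (+-congʳ (trans (*-congˡ h) (zeroʳ _))) (+-identityˡ _))
  f-periodic {m} z (suc (suc k)) = +-cong (*-congˡ (f-periodic z (suc k))) (-‿cong (f-periodic z k))

module _ {A B : CRing} (F : Hom A B) (x : CommutativeRing.Carrier A) where
  private
    module A = Cheb A x
    module B = Cheb B (Hom.fn F x)
  open CommutativeRing B hiding (zero)
  Cheb-hom : ∀ n → Hom.fn F (A.f n) ≈ B.f n
  Cheb-hom zero          = Hom.0h F
  Cheb-hom (suc zero)    = Hom.1h F
  Cheb-hom (suc (suc n)) = trans (Hom.+h F _ _) (+-cong (trans (Hom.*h F _ _) (*-congˡ (Cheb-hom (suc n)))) (trans (Hom.-h F _) (-‿cong (Cheb-hom n))))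

module _ (R : CRing) where
  open CommutativeRing R hiding (zero)
  Cheb-cong : ∀ {x y} → x ≈ y → ∀ n → Cheb.f R x n ≈ Cheb.f R y n
  Cheb-cong h zero          = refl
  Cheb-cong h (suc zero)    = refl
  Cheb-cong h (suc (suc n)) = +-cong (*-cong h (Cheb-cong h (suc n))) (-‿cong (Cheb-cong h n))

-- An enumeration of ℤ[x].

ℤR : CRing
ℤR = ℤ.+-*-commutativeRing

module ℤ[x] = PolyOver ℤR

private
  ℤx : CRing
  ℤx = PolyRing ℤR
  module ZX = CommutativeRing ℤx

-- Successor in bijective binary notation, least digit first, with `false` for the digit 1 and
-- `true` for 2. Having no digit zero, the notation reaches every bit string.
inc : List Bool → List Bool
inc []          = false ∷ []
inc (false ∷ l) = true ∷ l
inc (true ∷ l)  = false ∷ inc l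

nth : ℕ → List Bool
nth zero    = []
nth (suc n) = inc (nth n)

nth-false : ∀ n → nth (suc (n ℕ.+ n)) ≡ false ∷ nth n
nth-false zero    = ≡.refl
nth-false (suc n) rewrite ℕ.+-suc n n | nth-false n = ≡.refl

nth-surjective : ∀ l → ∃ λ n → nth n ≡ l
nth-surjective []          = 0 , ≡.refl
nth-surjective (false ∷ l) with n , e ← nth-surjective l = suc (n ℕ.+ n) , ≡.trans (nth-false n) (≡.cong (false ∷_) e)
nth-surjective (true ∷ l)  with n , e ← nth-surjective l = suc (suc (n ℕ.+ n)) , ≡.trans (≡.cong inc (nth-false n)) (≡.cong (true ∷_) e)

-- Bit strings read as programs: multiply by x, add 1, subtract 1.
run : List Bool → List ℤ
run []                 = []
run (false ∷ l)        = + 0 ∷ run l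
run (true ∷ [])        = []
run (true ∷ false ∷ l) = ℤ[x]._⊞_ (+ 1 ∷ []) (run l)
run (true ∷ true ∷ l)  = ℤ[x]._⊞_ (-[1+ 0 ] ∷ []) (run l)

run-surjective : ∀ p → ∃ λ l → p ZX.≈ run l
run-surjective []      = [] , λ i → ≡.refl
run-surjective (a ∷ p) with l , e ← run-surjective p = go a
  where
  up : ∀ c {a b} → c ℤ.+ a ≡ b → ∀ l → (a ∷ p) ZX.≈ run l → (b ∷ p) ZX.≈ ℤ[x]._⊞_ (c ∷ []) (run l)
  up c ab l h zero    = ≡.trans (≡.sym ab) (≡.trans (≡.cong (λ z → c ℤ.+ z) (h 0)) (≡.sym (ℤ[x].coef-⊞ (c ∷ []) (run l) 0)))
  up c ab l h (suc i) = ≡.trans (h (suc i)) (≡.trans (≡.sym (ℤ.+-identityˡ _)) (≡.sym (ℤ[x].coef-⊞ (c ∷ []) (run l) (suc i))))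
  go : ∀ a → ∃ λ l → (a ∷ p) ZX.≈ run l
  go (+ zero)       = false ∷ l , λ { zero → ≡.refl ; (suc i) → e i }
  go (+ suc n)      with l , h ← go (+ n) = true ∷ false ∷ l , up (+ 1) ≡.refl l h
  go -[1+ zero ]    with l , h ← go (+ 0) = true ∷ true ∷ l , up -[1+ 0 ] ≡.refl l h
  go -[1+ suc n ]   with l , h ← go -[1+ n ] = true ∷ true ∷ l , up -[1+ 0 ] ≡.refl l h

enumℤ[x] : ℕ → List ℤ
enumℤ[x] n = run (nth n)

enumℤ[x]-surjective : ∀ p → ∃ λ n → p ZX.≈ enumℤ[x] n
enumℤ[x]-surjective p =
  let l , e = run-surjective p ; n , q = nth-surjective l
  in n , λ i → ≡.trans (e i) (≡.cong (λ l → ℤ[x].coef (run l) i) (≡.sym q))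

-- Abstract positive numbers and the cosines 2 cos (π / m).

-- The substitute for an ordered field. No trichotomy is demanded: the root system produces its
-- signs itself, and closure under sums and products together with avoiding zero suffices to
-- propagate them.
record PosDomain : Set₁ where
  field
    K      : CRing
    domain : Domain K
  open CommutativeRing K using (Carrier; _≈_; _+_; _*_; 0#; 1#)
  field
    Pos      : Carrier → Set
    Pos-resp : ∀ {x y} → x ≈ y → Pos x → Pos y
    Pos-+    : ∀ {x y} → Pos x → Pos y → Pos (x + y)
    Pos-*    : ∀ {x y} → Pos x → Pos y → Pos (x * y)
    Pos-1    : Pos 1#
    Pos-≉0   : ∀ {x} → Pos x → ¬ (x ≈ 0#)

-- c is an abstract 2 cos (π / m): the Chebyshev value sin(mθ)/sin θ vanishes at c, the earlier ones are positive.
IsAngle : (D : PosDomain) → CommutativeRing.Carrier (PosDomain.K D) → ℕ → Set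
IsAngle D c m = Cheb.f K c m ≈ 0# × (∀ k → 0 ℕ.< k → k ℕ.< m → Pos (Cheb.f K c k))
  where
  open PosDomain D
  open CommutativeRing K using (_≈_; 0#)

module FusionCone (M : ℕ) (A : CRing) (x : CommutativeRing.Carrier A)
  (f-M : CommutativeRing._≈_ A (Cheb.f A x (suc (suc M))) (CommutativeRing.0# A)) where

  open CommutativeRing A hiding (zero)
  open IntSolver A
  open Cheb A x
  open Reflect (suc M) f-M

  M⁺ : ℕ
  M⁺ = suc (suc M)

  data Cone (g : Carrier) : Set where
    none : g ≈ 0# → Cone g
    more : ∀ j g' → 0 ℕ.< j → j ℕ.< M⁺ → g ≈ f j + g' → Cone g' → Cone g

  Cone⁺ : Carrier → Set
  Cone⁺ g = ∃ λ j → ∃ λ g' → 0 ℕ.< j × j ℕ.< M⁺ × g ≈ f j + g' × Cone g'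

  Cone-resp : ∀ {g h} → g ≈ h → Cone g → Cone h
  Cone-resp e (none z)              = none (trans (sym e) z)
  Cone-resp e (more j g' a b h c) = more j g' a b (trans (sym e) h) c

  Cone⁺-resp : ∀ {g h} → g ≈ h → Cone⁺ g → Cone⁺ h
  Cone⁺-resp e (j , g' , a , b , h , c) = j , g' , a , b , trans (sym e) h , c

  weaken : ∀ {g} → Cone⁺ g → Cone g
  weaken (j , g' , a , b , h , c) = more j g' a b h c

  Cone-+ : ∀ {g h} → Cone g → Cone h → Cone (g + h)
  Cone-+ {g} {h} (none z) d              = Cone-resp (sym (trans (+-congʳ z) (+-identityˡ h))) d
  Cone-+ (more j g' a b e c) d = more j _ a b (trans (+-congʳ e) (+-assoc _ _ _)) (Cone-+ c d)

  Cone⁺-+ : ∀ {g h} → Cone⁺ g → Cone h → Cone⁺ (g + h)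
  Cone⁺-+ (j , g' , a , b , e , c) d = j , _ , a , b , trans (+-congʳ e) (+-assoc _ _ _) , Cone-+ c d

  -- Elements that multiply nonempty sums of Chebyshev values to nonempty sums. This property,
  -- unlike membership in `Cone⁺`, is visibly closed under products, as the multiplicative set for
  -- the prime ideal must be.
  Strong : Carrier → Set
  Strong p = ∀ j → 0 ℕ.< j → j ℕ.< M⁺ → Cone⁺ (p * f j)

  Strong-Cone : ∀ {p g} → Strong p → Cone g → Cone (p * g)
  Strong-Cone s (none z)            = none (trans (*-congˡ z) (zeroʳ _))
  Strong-Cone s (more j g' a b e c) = Cone-resp (sym (trans (*-congˡ e) (distribˡ _ _ _))) (Cone-+ (weaken (s j a b)) (Strong-Cone s c))

  Strong-resp : ∀ {p q} → p ≈ q → Strong p → Strong q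
  Strong-resp e s j a b = Cone⁺-resp (*-congʳ e) (s j a b)

  Strong-+ : ∀ {p q} → Strong p → Strong q → Strong (p + q)
  Strong-+ s t j a b = Cone⁺-resp (sym (distribʳ _ _ _)) (Cone⁺-+ (s j a b) (weaken (t j a b)))

  Strong-* : ∀ {p q} → Strong p → Strong q → Strong (p * q)
  Strong-* {p} {q} s t j a b with i , g' , a' , b' , e , c ← t j a b =
    Cone⁺-resp (sym (trans (*-assoc p q _) (trans (*-congˡ e) (distribˡ p _ _)))) (Cone⁺-+ (s i a' b') (Strong-Cone s c))

  Strong-1 : Strong 1#
  Strong-1 j a b = j , 0# , a , b , trans (*-identityˡ _) (sym (+-identityʳ _)) , none refl

  -- The leading term of the Clebsch-Gordan expansion is `f` at k + j - 1, and the bound on k + j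
  -- keeps this index below `M⁺`.
  low-product : ∀ k j → 0 ℕ.< k → 0 ℕ.< j → k ℕ.+ j ℕ.≤ M⁺ → Cone⁺ (f k * f j)
  low-product (suc zero) (suc j) _ _ (s≤s l) = suc j , 0# , s≤s z≤n , s≤s l , trans (*-identityˡ _) (sym (+-identityʳ _)) , none refl
  low-product (suc (suc k)) (suc zero) _ _ l = suc (suc k) , 0# , s≤s z≤n , ≡.subst (ℕ._≤ M⁺) (ℕ.+-comm (suc (suc k)) 1) l , trans (*-identityʳ _) (sym (+-identityʳ _)) , none refl
  low-product (suc (suc k)) (suc (suc j)) _ _ l =
    suc (suc k ℕ.+ suc j) , f (suc k) * f (suc j) , s≤s z≤n , ≡.subst (ℕ._≤ M⁺) (≡.cong (λ z → suc (suc z)) (ℕ.+-suc k (suc j))) l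
    , trans (f-add (suc k) (suc j)) (+-comm _ _)
    , weaken (low-product (suc k) (suc j) (s≤s z≤n) (s≤s z≤n) (ℕ.≤-trans (ℕ.+-mono-≤ (ℕ.n≤1+n (suc k)) (ℕ.n≤1+n (suc j))) l))

  -- If k + j exceeds `M⁺`, both indices are reflected to `M⁺ ∸ k` and `M⁺ ∸ j`, whose sum is at
  -- most `M⁺`. The two factors `f (suc M)` that appear cancel because their product is 1.
  Strong-f : ∀ k → 0 ℕ.< k → k ℕ.< M⁺ → Strong (f k)
  Strong-f k a b j a' b' with k ℕ.+ j ℕ.≤? M⁺
  ... | yes l = low-product k j a a' l
  ... | no ¬l = Cone⁺-resp eq (low-product (M⁺ ℕ.∸ k) (M⁺ ℕ.∸ j) (ℕ.m<n⇒0<n∸m b) (ℕ.m<n⇒0<n∸m b') le)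
    where
    open import Relation.Binary.Reasoning.Setoid setoid
    k' = M⁺ ℕ.∸ k
    j' = M⁺ ℕ.∸ j
    eq : f k' * f j' ≈ f k * f j
    eq = begin
      f k' * f j'                            ≈⟨ *-cong (f-reflect k k' (ℕ.m+[n∸m]≡n (ℕ.<⇒≤ b))) (f-reflect j j' (ℕ.m+[n∸m]≡n (ℕ.<⇒≤ b'))) ⟩
      (f (suc M) * f k) * (f (suc M) * f j)  ≈⟨ solve 3 (λ m u v → (m :* u) :* (m :* v) := (m :* m) :* (u :* v)) refl _ _ _ ⟩
      (f (suc M) * f (suc M)) * (f k * f j)  ≈⟨ *-congʳ (sym (f-reflect (suc M) 1 (ℕ.+-comm (suc M) 1))) ⟩
      1# * (f k * f j)                       ≈⟨ *-identityˡ _ ⟩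
      f k * f j                              ∎
    le : k' ℕ.+ j' ℕ.≤ M⁺
    le = ℕ.+-cancelˡ-≤ (k ℕ.+ j) _ _ (ℕ.≤-trans (ℕ.≤-reflexive (≡.trans (shuffle k j k' j')
            (≡.cong₂ ℕ._+_ (ℕ.m+[n∸m]≡n (ℕ.<⇒≤ b)) (ℕ.m+[n∸m]≡n (ℕ.<⇒≤ b'))))) (ℕ.+-monoˡ-≤ M⁺ (ℕ.<⇒≤ (ℕ.≰⇒> ¬l))))
      where
      open import Data.Nat.Solver using (module +-*-Solver)
      shuffle : ∀ a b c d → (a ℕ.+ b) ℕ.+ (c ℕ.+ d) ≡ (a ℕ.+ c) ℕ.+ (b ℕ.+ d)
      shuffle = +-*-Solver.solve 4 (λ a b c d → (a +-*-Solver.:+ b) +-*-Solver.:+ (c +-*-Solver.:+ d) +-*-Solver.:= (a +-*-Solver.:+ c) +-*-Solver.:+ (b +-*-Solver.:+ d)) ≡.refl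

module FusionField (M : ℕ) (A : CRing) (x : CommutativeRing.Carrier A)
  (f-M : CommutativeRing._≈_ A (Cheb.f A x (suc (suc M))) (CommutativeRing.0# A))
  (Cone⁺-≉0 : ∀ {g} → FusionCone.Cone⁺ M A x f-M g → ¬ CommutativeRing._≈_ A g (CommutativeRing.0# A))
  (enum : ℕ → CommutativeRing.Carrier A) (surj : ∀ a → ∃ λ n → CommutativeRing._≈_ A a (enum n)) where

  open CommutativeRing A hiding (zero)
  open IntSolver A
  open Cheb A x
  open FusionCone M A x f-M

  Strong-≉0 : ∀ {p} → Strong p → ¬ (p ≈ 0#)
  Strong-≉0 s z = Cone⁺-≉0 (s 1 (s≤s z≤n) (s≤s (s≤s z≤n))) (trans (*-congʳ z) (zeroˡ _))

  module Kr = Krull A enum surj Strong Strong-resp Strong-* Strong-1 Strong-≉0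

  K : CRing
  K = Quotient A Kr.prime

  private
    module K = CommutativeRing K
    A→K : Hom A K
    A→K = proj A Kr.prime

  posDomain : PosDomain
  posDomain = record
    { K = K ; domain = Kr.quotient-domain
    -- Positive means being a quotient of `Strong` elements. The Chebyshev values of a coarser angle
    -- are of the form f (k(j + 1)) / f (j + 1), so `Strong` itself would be too narrow.
    ; Pos = λ a → Σ Carrier λ b → a K.≈ b × Σ Carrier λ p → Strong p × Strong (p * b)
    ; Pos-resp = λ e (b , h , r) → b , K.trans (K.sym e) h , r
    ; Pos-+ = λ (b , h , p , s , t) (b' , h' , p' , s' , t') → b + b' , K.+-cong h h' , p * p' , Strong-* s s' ,
         Strong-resp (solve 4 (λ b b' p p' → p' :* (p :* b) :+ p :* (p' :* b') := (p :* p') :* (b :+ b')) refl b b' p p') (Strong-+ (Strong-* s' t) (Strong-* s t'))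
    ; Pos-* = λ {x} {y} (b , h , p , s , t) (b' , h' , p' , s' , t') → b * b' , K.*-cong {x} {b} {y} {b'} h h' , p * p' , Strong-* s s' ,
         Strong-resp (solve 4 (λ b b' p p' → (p :* b) :* (p' :* b') := (p :* p') :* (b :* b')) refl b b' p p') (Strong-* t t')
    ; Pos-1 = 1# , K.refl {1#} , 1# , Strong-1 , Strong-* Strong-1 Strong-1
    ; Pos-≉0 = λ {x} (b , h , p , s , t) z → Kr.Q-avoids t (Ideal.resp Kr.prime (solve 2 (λ p b → p :* (b :- :0) := p :* b) refl p b)
         (Ideal.*∈ Kr.prime p (K.trans {b} {x} {0#} (K.sym {x} {b} h) z))) }

  -- Write `M⁺` as (j + 1) m and take 2 cos ((j + 1)θ). Its Chebyshev value at k, times `f (suc j)`,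
  -- is `f` at k(j + 1). The factor `f (suc j)` is `Strong`, hence nonzero in the quotient, so the
  -- value at m vanishes with `f M⁺`; for smaller k the product is `Strong` again.
  angle : ∀ m → 2 ℕ.≤ m → m ℕ.∣ M⁺ → Σ K.Carrier λ c →
    Cheb.f K c m K.≈ K.0# × (∀ k → 0 ℕ.< k → k ℕ.< m → PosDomain.Pos posDomain (Cheb.f K c k))
  angle m 2≤m (divides zero ())
  angle m 2≤m (divides (suc j) e) = c , f-m , pos
    where
    c : Carrier
    c = f (suc (suc j)) - f j
    module B = Cheb A c
    scaled : ∀ k → B.f k * f (suc j) ≈ f (k ℕ.* suc j)
    scaled zero          = zeroˡ _
    scaled (suc zero)    = trans (*-identityˡ _) (reflexive (≡.cong f (≡.sym (ℕ.*-identityˡ (suc j)))))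
    scaled (suc (suc k)) = trans (solve 4 (λ c u v w → (c :* u :- v) :* w := c :* (u :* w) :- v :* w) refl c _ _ _)
      (trans (+-cong (*-congˡ (trans (scaled (suc k)) (reflexive (≡.cong f (ℕ.+-comm (suc j) (k ℕ.* suc j)))))) (-‿cong (scaled k)))
      (trans (sym (f-double j (k ℕ.* suc j))) (reflexive (≡.cong f (≡.trans (ℕ.+-comm (k ℕ.* suc j) _) (ℕ.+-assoc (suc j) (suc j) _))))))
    K≈A : ∀ n → B.f n K.≈ Cheb.f K c n
    K≈A = Cheb-hom A→K c
    kj< : ∀ k → k ℕ.< m → k ℕ.* suc j ℕ.< M⁺
    kj< k l = ≡.subst (k ℕ.* suc j ℕ.<_) (≡.trans (ℕ.*-comm m (suc j)) (≡.sym e)) (ℕ.*-monoˡ-< (suc j) l)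
    strong-j : Strong (f (suc j))
    strong-j = Strong-f (suc j) (s≤s z≤n) (≡.subst (ℕ._< M⁺) (ℕ.*-identityˡ (suc j)) (kj< 1 2≤m))
    f-m : Cheb.f K c m K.≈ K.0#
    f-m = K.trans {Cheb.f K c m} {B.f m} {0#} (K.sym {B.f m} {Cheb.f K c m} (K≈A m)) (Domain.dom Kr.quotient-domain {f (suc j)} {B.f m} scaled≈0 f≉0)
      where
      scaled≈0 : (f (suc j) * B.f m) K.≈ 0#
      scaled≈0 = Hom.cong A→K (trans (*-comm _ _) (trans (scaled m) (trans (reflexive (≡.cong f (≡.trans (ℕ.*-comm m (suc j)) (≡.sym e)))) f-M)))
      f≉0 : ¬ (f (suc j) K.≈ 0#)
      f≉0 z = Kr.Q-avoids strong-j (Ideal.resp Kr.prime (solve 1 (λ x → x :- :0 := x) refl (f (suc j))) z)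
    pos : ∀ k → 0 ℕ.< k → k ℕ.< m → PosDomain.Pos posDomain (Cheb.f K c k)
    pos k a b = PosDomain.Pos-resp posDomain {B.f k} {Cheb.f K c k} (K≈A k)
      (B.f k , Hom.cong A→K {B.f k} {B.f k} refl , f (suc j) , strong-j , strong-product)
      where
      0<kj : 0 ℕ.< k ℕ.* suc j
      0<kj = ℕ.*-mono-< a (s≤s {n = j} z≤n)
      strong-product : Strong (f (suc j) * B.f k)
      strong-product = Strong-resp (sym (trans (*-comm _ _) (scaled k))) (Strong-f (k ℕ.* suc j) 0<kj (kj< k b))

record PrincipalQuotient (P : CRing) (c : CommutativeRing.Carrier P) : Set₁ where
  private module P = CommutativeRing P
  field
    ring : CRing
    π    : Hom P ring
  private module Q = CommutativeRing ring
  field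
    π-gen  : Hom.fn π c Q.≈ Q.0#
    kernel : ∀ {p} → Hom.fn π p Q.≈ Q.0# → Σ P.Carrier λ h → p P.≈ h P.* c
    onto   : ∀ a → Σ P.Carrier λ p → a Q.≈ Hom.fn π p

principalQuotient : ∀ P c → PrincipalQuotient P c
principalQuotient P c = record
  { ring = Quotient P (principal P c) ; π = proj P (principal P c) ; π-gen = generator≈0 P c ; kernel = ≈0⇒multiple P c
  ; onto = λ a → a , CommutativeRing.refl (Quotient P (principal P c)) {a} }

infix 8 _×[_]
_×[_] : ℕ → (R : CRing) → CommutativeRing.Carrier R
n ×[ R ] = n ×ₙ CommutativeRing.1# R
  where open import Algebra.Properties.Semiring.Mult (CommutativeRing.semiring R) renaming (_×_ to _×ₙ_)

Cheb-2 : ∀ (R : CRing) n → let open CommutativeRing R in Cheb.f R (1# + 1#) n ≈ n ×[ R ]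
Cheb-2 R = go
  where
  open CommutativeRing R hiding (zero)
  open IntSolver R
  go : ∀ n → Cheb.f R (1# + 1#) n ≈ n ×[ R ]
  go zero          = refl
  go (suc zero)    = sym (+-identityʳ 1#)
  go (suc (suc n)) = trans (+-cong (trans (*-congˡ (go (suc n))) (trans (distribʳ _ 1# 1#) (+-cong (*-identityˡ _) (*-identityˡ _)))) (-‿cong (go n)))
    (solve 2 (λ o a → ((o :+ a) :+ (o :+ a)) :- a := o :+ (o :+ a)) refl 1# (n ×[ R ]))

module FusionDegree (R : CRing) (M : ℕ) where

  open CommutativeRing R hiding (zero)
  open IntSolver R
  open PolyOver R using (coef; coef-⊞; coef-neg; coef-∷⊠; X; X⊠; _⊠_)
  open import Algebra.Properties.Semiring.Mult semiring using (×-homo-+) renaming (_×_ to _×ₙ_)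

  private
    P : CRing
    P = PolyRing R
    module P = CommutativeRing P

  module F = Cheb P X

  coef-step : ∀ n i → coef (F.f (suc (suc n))) (suc i) ≈ coef (F.f (suc n)) i - coef (F.f n) (suc i)
  coef-step n i = trans (coef-⊞ (X ⊠ F.f (suc n)) (P.- F.f n) (suc i))
    (+-cong (X⊠ (F.f (suc n)) (suc i)) (coef-neg (F.f n) (suc i)))

  low-degree : ∀ n i → n ℕ.≤ i → coef (F.f n) i ≈ 0#
  low-degree zero          i       l       = refl
  low-degree (suc zero)    (suc i) l       = refl
  low-degree (suc (suc n)) (suc i) (s≤s l) = trans (coef-step n i)
    (trans (+-cong (low-degree (suc n) i l) (-‿cong (low-degree n (suc i) (ℕ.m≤n⇒m≤1+n (ℕ.≤-trans (ℕ.n≤1+n n) l))))) (-‿inverseʳ 0#))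

  monic : ∀ n → coef (F.f (suc n)) n ≈ 1#
  monic zero    = refl
  monic (suc n) = trans (coef-step n n) (trans (+-cong (monic n) (-‿cong (low-degree n (suc n) (ℕ.n≤1+n n)))) (solve 1 (λ o → o :- :0 := o) refl 1#))

  -- The modulus is monic of degree M + 1, so a multiple whose coefficients vanish from that degree
  -- on is zero. The induction treats the tail of `h` first, because the true leading coefficient of
  -- `h` cannot be located; the coefficient in degree M + 1 then isolates `a`.
  multiple-low : ∀ h → (∀ i → suc M ℕ.≤ i → coef (h ⊠ F.f (suc (suc M))) i ≈ 0#) → ∀ i → coef (h ⊠ F.f (suc (suc M))) i ≈ 0#
  multiple-low []      hl i = refl
  multiple-low (a ∷ h) hl = λ i → trans (coef-∷⊠ a h G i) (trans (+-cong (trans (*-congʳ a≈0) (zeroˡ _)) (tail≈0 i)) (+-identityˡ 0#))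
    where
    G = F.f (suc (suc M))
    rec : ∀ i → coef (h ⊠ G) i ≈ 0#
    rec = multiple-low h λ i l → trans (sym (trans (coef-∷⊠ a h G (suc i))
      (trans (+-congʳ (trans (*-congˡ (low-degree (suc (suc M)) (suc i) (s≤s l))) (zeroʳ a))) (+-identityˡ _)))) (hl (suc i) (ℕ.m≤n⇒m≤1+n l))
    tail≈0 : ∀ i → coef (0# ∷ h ⊠ G) i ≈ 0#
    tail≈0 zero    = refl
    tail≈0 (suc i) = rec i
    a≈0 : a ≈ 0#
    a≈0 = trans (sym (trans (coef-∷⊠ a h G (suc M)) (trans (+-cong (trans (*-congˡ (monic (suc M))) (*-identityʳ a)) (rec M)) (+-identityʳ a)))) (hl (suc M) ℕ.≤-refl)

  -- The point x = 2 corresponds to θ = 0, where sin(kθ) / sin θ becomes k, so nonempty sums of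
  -- Chebyshev values take positive integer values there. The modulus does not vanish at 2; the
  -- evaluation is therefore applied to representatives, not to classes.
  at2 : Hom P R
  at2 = evalHom R (idHom R) (1# + 1#)

  at2-f : ∀ n → Hom.fn at2 (F.f n) ≈ n ×ₙ 1#
  at2-f n = trans (Cheb-hom at2 X n) (trans (Cheb-cong R (evalHom-X R (idHom R) (1# + 1#)) n) (Cheb-2 R n))

module FusionNonzero (R : CRing) (M : ℕ) (A : CRing) (π : Hom (PolyRing R) A)
  (f-M : CommutativeRing._≈_ A (Cheb.f A (Hom.fn π (PolyOver.X R)) (suc (suc M))) (CommutativeRing.0# A))
  (kernel : ∀ {p} → CommutativeRing._≈_ A (Hom.fn π p) (CommutativeRing.0# A) →
            Σ (List (CommutativeRing.Carrier R)) λ h → PolyOver._≋_ R p (PolyOver._⊠_ R h (FusionDegree.F.f R M (suc (suc M))))) where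

  open FusionDegree R M
  open CommutativeRing R hiding (zero)
  open PolyOver R using (coef; coef-⊞; X; _⊞_; _≋_)
  open import Algebra.Properties.Semiring.Mult semiring using (×-homo-+) renaming (_×_ to _×ₙ_)
  private
    module A = CommutativeRing A
    module π = Hom π

  open FusionCone M A (π.fn X) f-M using (Cone; none; more; Cone⁺)

  record Lift (g : A.Carrier) : Set where
    field
      rep    : List Carrier
      equal  : g A.≈ π.fn rep
      degree : ∀ i → suc M ℕ.≤ i → coef rep i ≈ 0#
      value  : ℕ
      at     : Hom.fn at2 rep ≈ value ×ₙ 1#

  lift-more : ∀ {g g'} j → j ℕ.< suc (suc M) → g A.≈ Cheb.f A (π.fn X) j A.+ g' → (L : Lift g') → Σ (Lift g) λ L' → Lift.value L' ≡ j ℕ.+ Lift.value L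
  lift-more j (s≤s l) e L = record
    { rep    = F.f j ⊞ rep
    ; equal  = A.trans e (A.trans (A.+-cong (A.sym (Cheb-hom π X j)) equal) (A.sym (π.+h (F.f j) rep)))
    ; degree = λ i h → trans (coef-⊞ (F.f j) rep i) (trans (+-cong (low-degree j i (ℕ.≤-trans l h)) (degree i h)) (+-identityˡ 0#))
    ; value  = j ℕ.+ value
    ; at     = trans (Hom.+h at2 (F.f j) rep) (trans (+-cong (at2-f j) at) (sym (×-homo-+ 1# j value))) } , ≡.refl
    where open Lift L

  lift : ∀ {g} → Cone g → Lift g
  lift (none z)            = record { rep = [] ; equal = A.trans z (A.sym π.0h) ; degree = λ _ _ → refl ; value = 0 ; at = refl }
  lift (more j g' a b e c) = proj₁ (lift-more j b e (lift c))

  module _ (char0 : ∀ n → ¬ (suc n ×ₙ 1# ≈ 0#)) where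

    -- The representative has degree at most `M`. If its class were zero it would be a multiple of
    -- the modulus of degree M + 1, hence zero itself, whereas its value at 2 is a positive sum of
    -- indices.
    Cone⁺-≉0 : ∀ {g} → Cone⁺ g → ¬ (g A.≈ A.0#)
    Cone⁺-≉0 {g} (suc j , g' , a , b , e , c) z with lift-more (suc j) b e (lift c)
    ... | L , q = char0 (j ℕ.+ Lift.value (lift c))
        (trans (reflexive (≡.cong (_×ₙ 1#) (≡.sym q))) (trans (sym at) (trans (Hom.cong at2 {rep} {[]} rep≋0) (Hom.0h at2))))
      where
      open Lift L
      rep-multiple = kernel (A.trans (A.sym equal) z)
      rep≋0 : rep ≋ []
      rep≋0 i = trans (proj₂ rep-multiple i) (multiple-low (proj₁ rep-multiple) (λ i h → trans (sym (proj₂ rep-multiple i)) (degree i h)) i)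

module FusionOver (R : CRing) (char0 : ∀ n → ¬ CommutativeRing._≈_ R (suc n ×[ R ]) (CommutativeRing.0# R))
  (enum : ℕ → List (CommutativeRing.Carrier R)) (surj : ∀ p → ∃ λ n → PolyOver._≋_ R p (enum n)) (M : ℕ)
  (Q : PrincipalQuotient (PolyRing R) (FusionDegree.F.f R M (suc (suc M)))) where

  open PrincipalQuotient Q
  private
    module A = CommutativeRing ring
    x = Hom.fn π (PolyOver.X R)

  f-M : Cheb.f ring x (suc (suc M)) A.≈ A.0#
  f-M = A.trans (A.sym (Cheb-hom π (PolyOver.X R) (suc (suc M)))) π-gen

  private
    module FN = FusionNonzero R M ring π f-M kernel
    module FF = FusionField M ring x f-M (FN.Cone⁺-≉0 char0) (λ n → Hom.fn π (enum n))
      (λ a → proj₁ (surj (proj₁ (onto a))) , A.trans (proj₂ (onto a)) (Hom.cong π (proj₂ (surj (proj₁ (onto a))))))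

  result : Σ PosDomain λ D → ∀ m → 2 ℕ.≤ m → m ℕ.∣ suc (suc M) → ∃ λ c → IsAngle D c m
  result = FF.posDomain , FF.angle

cosines : (M : ℕ) → Σ PosDomain λ D → ∀ m → 2 ℕ.≤ m → m ℕ.∣ suc (suc M) → ∃ λ c → IsAngle D c m
cosines M = FusionOver.result ℤR char0 enumℤ[x] enumℤ[x]-surjective M (principalQuotient (PolyRing ℤR) _)
  where
  ×1 : ∀ n → n ×[ ℤR ] ≡ + n
  ×1 zero    = ≡.refl
  ×1 (suc n) = ≡.cong (λ z → + 1 ℤ.+ z) (×1 n)
  char0 : ∀ n → ¬ (suc n ×[ ℤR ] ≡ + 0)
  char0 n e with ≡.trans (≡.sym (×1 (suc n))) e
  ... | ()

-- Lengths, orders and alternating words in a Coxeter group.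

module Coxeter (C : FiniteCoxeterSystem) (ℓ : FiniteCoxeterSystem.W C → ℕ) (isLength : ∀ w → IsLength C w (ℓ w)) where
  open ≡ using (refl; sym; trans; cong; cong₂; subst)
  open FiniteCoxeterSystem C
  open ≡.≡-Reasoning

  W-group : Group 0ℓ 0ℓ
  W-group = record
    { Carrier = W ; _≈_ = _≡_ ; _∙_ = _·_ ; ε = e ; _⁻¹ = inv
    ; isGroup = record
      { isMonoid = record
        { isSemigroup = record { isMagma = record { isEquivalence = ≡.isEquivalence ; ∙-cong = cong₂ _·_ } ; assoc = assoc }
        ; identity = identityˡ , identityʳ }
      ; inverse = inverseˡ , inverseʳ ; ⁻¹-cong = cong inv } }

  open Algebra.Properties.Group W-group public
    using () renaming (⁻¹-anti-homo-∙ to inv-·; ⁻¹-involutive to inv-inv; ε⁻¹≈ε to inv-e; ∙-cancelˡ to cancelˡ; ∙-cancelʳ to cancelʳ; inverseʳ-unique to inverse-unique)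

  private
    S : Set
    S = Fin n

  infixr 8 _⊙_
  _⊙_ : S → W → W
  s ⊙ w = gen s · w

  gen-gen : ∀ s w → s ⊙ s ⊙ w ≡ w
  gen-gen s w = trans (sym (assoc _ _ _)) (trans (cong (_· w) (gen-sq s)) (identityˡ w))

  inv-gen : ∀ s → inv (gen s) ≡ gen s
  inv-gen s = sym (inverse-unique (gen s) (gen s) (gen-sq s))

  inv-cancelˡ : ∀ x y → inv x · (x · y) ≡ y
  inv-cancelˡ x y = trans (sym (assoc _ _ _)) (trans (cong (_· y) (inverseˡ x)) (identityˡ y))

  cancel-invˡ : ∀ x y → x · (inv x · y) ≡ y
  cancel-invˡ x y = trans (sym (assoc _ _ _)) (trans (cong (_· y) (inverseʳ x)) (identityˡ y))

  word : List S → W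
  word = evalWord C

  word-++ : ∀ us vs → word (us ++ vs) ≡ word us · word vs
  word-++ []       vs = sym (identityˡ _)
  word-++ (u ∷ us) vs = trans (cong (gen u ·_) (word-++ us vs)) (sym (assoc _ _ _))

  word-reverse : ∀ us → word (reverse us) ≡ inv (word us)
  word-reverse []       = sym inv-e
  word-reverse (u ∷ us) = begin
    word (reverse (u ∷ us))            ≡⟨ cong word (List.unfold-reverse u us) ⟩
    word (reverse us ++ [ u ])         ≡⟨ word-++ (reverse us) [ u ] ⟩
    word (reverse us) · (gen u · e)    ≡⟨ cong₂ _·_ (word-reverse us) (trans (identityʳ _) (sym (inv-gen u))) ⟩
    inv (word us) · inv (gen u)        ≡⟨ sym (inv-· _ _) ⟩
    inv (gen u · word us)              ∎

  reduced : ∀ w → Σ (List S) λ ws → word ws ≡ w × length ws ≡ ℓ w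
  reduced w = proj₁ (isLength w)

  ℓ-word : ∀ ws → ℓ (word ws) ℕ.≤ length ws
  ℓ-word ws = proj₂ (isLength (word ws)) ws refl

  ℓ-e : ℓ e ≡ 0
  ℓ-e = ℕ.n≤0⇒n≡0 (ℓ-word [])

  ℓ≡0 : ∀ w → ℓ w ≡ 0 → w ≡ e
  ℓ≡0 w h with reduced w
  ... | []     , q , _ = sym q
  ... | _ ∷ _  , _ , k with trans k h
  ... | ()

  infix 4 _≟_
  -- Equality in `W` is decided through the length, since only the identity has length zero.
  _≟_ : (x y : W) → Dec (x ≡ y)
  x ≟ y with ℓ (inv x · y) ℕ.≟ 0
  ... | yes h = yes (sym (trans (sym (cancel-invˡ x y)) (trans (cong (x ·_) (ℓ≡0 _ h)) (identityʳ x))))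
  ... | no h  = no λ { refl → h (trans (cong ℓ (inverseˡ x)) ℓ-e) }

  ℓ-⊙≤ : ∀ s w → ℓ (s ⊙ w) ℕ.≤ suc (ℓ w)
  ℓ-⊙≤ s w with reduced w
  ... | ws , q , k = ℕ.≤-trans (ℕ.≤-reflexive (cong (λ v → ℓ (s ⊙ v)) (sym q))) (ℕ.≤-trans (ℓ-word (s ∷ ws)) (ℕ.≤-reflexive (cong suc k)))

  ℓ-inv≤ : ∀ w → ℓ (inv w) ℕ.≤ ℓ w
  ℓ-inv≤ w with reduced w
  ... | ws , q , k = ℕ.≤-trans (ℕ.≤-reflexive (cong ℓ (trans (cong inv (sym q)) (sym (word-reverse ws)))))
       (ℕ.≤-trans (ℓ-word (reverse ws)) (ℕ.≤-reflexive (trans (List.length-reverse ws) k)))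

  ℓ-inv : ∀ w → ℓ (inv w) ≡ ℓ w
  ℓ-inv w = ℕ.≤-antisym (ℓ-inv≤ w) (ℕ.≤-trans (ℕ.≤-reflexive (cong ℓ (sym (inv-inv w)))) (ℓ-inv≤ (inv w)))

  pow : W → ℕ → W
  pow = powOp _·_ e

  pow-+ : ∀ x j k → pow x (j ℕ.+ k) ≡ pow x j · pow x k
  pow-+ x zero    k = sym (identityˡ _)
  pow-+ x (suc j) k = trans (cong (x ·_) (pow-+ x j k)) (sym (assoc _ _ _))

  pow-comm : ∀ x k → x · pow x k ≡ pow x k · x
  pow-comm x zero    = trans (identityʳ x) (sym (identityˡ x))
  pow-comm x (suc k) = trans (cong (x ·_) (pow-comm x k)) (sym (assoc _ _ _))

  pow-e : ∀ k → pow e k ≡ e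
  pow-e zero    = refl
  pow-e (suc k) = trans (identityˡ _) (pow-e k)

  pow-* : ∀ x k m → pow x m ≡ e → pow x (k ℕ.* m) ≡ e
  pow-* x zero    m h = refl
  pow-* x (suc k) m h = trans (pow-+ x m (k ℕ.* m)) (trans (cong₂ _·_ h (pow-* x k m h)) (identityˡ e))

  module Representation (H : Group 0ℓ 0ℓ) (φ : S → Group.Carrier H)
    (relation : ∀ i j k → pow (gen i · gen j) k ≡ e → Group._≈_ H (powG H (Group._∙_ H (φ i) (φ j)) k) (Group.ε H)) where
    private module H = Group H

    value : List S → H.Carrier
    value []       = H.ε
    value (i ∷ is) = φ i H.∙ value is

    -- The presentation supplies a homomorphism extending `φ`. It agrees with `value` on every word,
    -- so `value` depends only on the group element.
    value-unique : ∀ us vs → word us ≡ word vs → value us H.≈ value vs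
    value-unique us vs h with presentation H φ relation
    ... | ψ , ψ-· , ψ-gen = H.trans (H.sym (agrees us)) (H.trans (H.reflexive (cong ψ h)) (agrees vs))
      where
      ψ-e : ψ e H.≈ H.ε
      ψ-e = H.trans (H.sym (H.identityˡ _)) (H.trans (H.∙-congʳ (H.sym (H.inverseˡ (ψ e))))
        (H.trans (H.assoc _ _ _) (H.trans (H.∙-congˡ (H.trans (H.sym (ψ-· e e)) (H.reflexive (cong ψ (identityˡ e))))) (H.inverseˡ (ψ e)))))
      agrees : ∀ ws → ψ (word ws) H.≈ value ws
      agrees []       = ψ-e
      agrees (i ∷ ws) = H.trans (ψ-· _ _) (H.∙-cong (ψ-gen i) (agrees ws))

  private
    xor-group : Group 0ℓ 0ℓ
    xor-group = record
      { Carrier = Bool ; _≈_ = _≡_ ; _∙_ = _xor_ ; ε = false ; _⁻¹ = λ b → b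
      ; isGroup = record
        { isMonoid = record
          { isSemigroup = record { isMagma = record { isEquivalence = ≡.isEquivalence ; ∙-cong = cong₂ _xor_ } ; assoc = Bool.xor-assoc }
          ; identity = Bool.xor-identityˡ , Bool.xor-identityʳ }
        ; inverse = Bool.xor-same , Bool.xor-same ; ⁻¹-cong = λ h → h } }

    false^ : ∀ k → powG xor-group false k ≡ false
    false^ zero    = refl
    false^ (suc k) = false^ k

    module Parity = Representation xor-group (λ _ → true) (λ _ _ k _ → false^ k)

    odd : ℕ → Bool
    odd zero    = false
    odd (suc k) = not (odd k)

    value≡odd : ∀ ws → Parity.value ws ≡ odd (length ws)
    value≡odd []       = refl
    value≡odd (i ∷ ws) = cong not (value≡odd ws)

  -- The sign character exists because every relation involves an even number of letters; it makes
  -- the parity of word length an invariant of the element.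
  ℓ-⊙≢ : ∀ s w → ℓ (s ⊙ w) ≢ ℓ w
  ℓ-⊙≢ s w h with reduced w | reduced (s ⊙ w)
  ... | ws , q , k | ws' , q' , k' = not≢ _ bad
    where
    bad : not (odd (length ws)) ≡ odd (length ws)
    bad = begin
      not (odd (length ws))       ≡⟨ sym (value≡odd (s ∷ ws)) ⟩
      Parity.value (s ∷ ws)       ≡⟨ Parity.value-unique (s ∷ ws) ws' (trans (cong (gen s ·_) q) (sym q')) ⟩
      Parity.value ws'            ≡⟨ value≡odd ws' ⟩
      odd (length ws')            ≡⟨ cong odd (trans k' (trans h (sym k))) ⟩
      odd (length ws)             ∎
    not≢ : ∀ b → not b ≢ b
    not≢ true  ()
    not≢ false ()

  data Step (s : S) (w : W) : Set where
    longer  : ℓ (s ⊙ w) ≡ suc (ℓ w) → Step s w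
    shorter : ℓ w ≡ suc (ℓ (s ⊙ w)) → Step s w

  ℓ≤-⊙ : ∀ s w → ℓ w ℕ.≤ suc (ℓ (s ⊙ w))
  ℓ≤-⊙ s w = ℕ.≤-trans (ℕ.≤-reflexive (cong ℓ (sym (gen-gen s w)))) (ℓ-⊙≤ s (s ⊙ w))

  step : ∀ s w → Step s w
  step s w with ℕ.<-cmp (ℓ (s ⊙ w)) (ℓ w)
  ... | tri< a _ _ = shorter (ℕ.≤-antisym (ℓ≤-⊙ s w) a)
  ... | tri≈ _ b _ = ⊥-elim (ℓ-⊙≢ s w b)
  ... | tri> _ _ c = longer (ℕ.≤-antisym (ℓ-⊙≤ s w) c)

  infix 4 _↑_ _↓_
  _↑_ _↓_ : S → W → Set
  s ↑ w = ℓ w ℕ.< ℓ (s ⊙ w)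
  s ↓ w = ℓ (s ⊙ w) ℕ.< ℓ w

  ↑-or-↓ : ∀ s w → s ↑ w ⊎ s ↓ w
  ↑-or-↓ s w with step s w
  ... | longer h  = inj₁ (ℕ.≤-reflexive (sym h))
  ... | shorter h = inj₂ (ℕ.≤-reflexive (sym h))

  ↑-suc : ∀ {s w} → s ↑ w → ℓ (s ⊙ w) ≡ suc (ℓ w)
  ↑-suc {s} {w} h = ℕ.≤-antisym (ℓ-⊙≤ s w) h

  ↓-suc : ∀ {s w} → s ↓ w → ℓ w ≡ suc (ℓ (s ⊙ w))
  ↓-suc {s} {w} h = ℕ.≤-antisym (ℓ≤-⊙ s w) h

  ↑-flip : ∀ {s w} → s ↑ w → s ↓ (s ⊙ w)
  ↑-flip {s} {w} h = subst (ℕ._< ℓ (s ⊙ w)) (cong ℓ (sym (gen-gen s w))) h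

  ↓-flip : ∀ {s w} → s ↓ w → s ↑ (s ⊙ w)
  ↓-flip {s} {w} h = subst (ℓ (s ⊙ w) ℕ.<_) (cong ℓ (sym (gen-gen s w))) h

  has-descent : ∀ w → w ≢ e → ∃ λ s → s ↓ w
  has-descent w h with reduced w
  ... | []     , q , k = ⊥-elim (h (sym q))
  ... | s ∷ ws , q , k = s , ℕ.≤-trans (s≤s (ℕ.≤-trans (ℕ.≤-reflexive (cong ℓ (trans (cong (gen s ·_) (sym q)) (gen-gen s (word ws))))) (ℓ-word ws))) (ℕ.≤-reflexive k)

  private
    power-collision : ∀ x → ∃ λ i → ∃ λ j → i ℕ.< j × j ℕ.≤ length elems × pow x i ≡ pow x j
    power-collision x with Fin.pigeonhole {length elems} {suc (length elems)} ℕ.≤-refl (λ i → index (elems-complete (pow x (toℕ i))))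
    ... | i , j , i<j , h = toℕ i , toℕ j , i<j , ℕ.≤-pred (Fin.toℕ<n j)
        , trans (lookup-index (elems-complete (pow x (toℕ i)))) (trans (cong (lookup elems) h) (sym (lookup-index (elems-complete (pow x (toℕ j))))))

  finite-order : ∀ x → ∃ λ k → 0 ℕ.< k × k ℕ.≤ length elems × pow x k ≡ e
  finite-order x with power-collision x
  ... | i , j , i<j , j≤ , h = j ℕ.∸ i , ℕ.m<n⇒0<n∸m i<j , ℕ.≤-trans (ℕ.m∸n≤m j i) j≤ ,
    cancelˡ (pow x i) _ _ (trans (sym (pow-+ x i (j ℕ.∸ i))) (trans (cong (pow x) (ℕ.m+[n∸m]≡n (ℕ.<⇒≤ i<j))) (trans (sym h) (sym (identityʳ _)))))

  -- The bound `ord≤` is recorded so that one number, divisible by everything up to the size of the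
  -- list of elements, serves as denominator for all the angles.
  record Order (x : W) : Set where
    field
      ord     : ℕ
      0<ord   : 0 ℕ.< ord
      ord≤    : ord ℕ.≤ length elems
      pow-ord : pow x ord ≡ e
      least   : ∀ k → 0 ℕ.< k → k ℕ.< ord → pow x k ≢ e

  abstract
    order : ∀ x → Order x
    order x with finite-order x
    ... | k , a , b , h = search k k ℕ.≤-refl a b h
      where
      search : ∀ fuel k → k ℕ.≤ fuel → 0 ℕ.< k → k ℕ.≤ length elems → pow x k ≡ e → Order x
      smaller? : ∀ k → (∃ λ j → 0 ℕ.< j × j ℕ.< k × pow x j ≡ e) ⊎ (∀ j → 0 ℕ.< j → j ℕ.< k → pow x j ≢ e)
      smaller? zero    = inj₂ λ _ _ ()
      smaller? (suc k) with smaller? k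
      ... | inj₁ (j , a , b , h) = inj₁ (j , a , ℕ.m≤n⇒m≤1+n b , h)
      smaller? (suc zero) | inj₂ f = inj₂ λ { (suc j) a (s≤s ()) }
      smaller? (suc (suc k)) | inj₂ f with pow x (suc k) ≟ e
      ... | yes h = inj₁ (suc k , s≤s z≤n , ℕ.≤-refl , h)
      ... | no ¬h = inj₂ λ j a b → split j a (ℕ.m≤n⇒m<n∨m≡n (ℕ.≤-pred b))
        where
        split : ∀ j → 0 ℕ.< j → j ℕ.< suc k ⊎ j ≡ suc k → pow x j ≢ e
        split j a (inj₁ b)    = f j a b
        split j a (inj₂ refl) = ¬h
      search fuel k l a b h with smaller? k
      ... | inj₂ f = record { ord = k ; 0<ord = a ; ord≤ = b ; pow-ord = h ; least = f }
      search zero k l a b h | inj₁ (j , a' , b' , h') = ⊥-elim (ℕ.n≮0 (ℕ.≤-trans b' l))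
      search (suc fuel) k l a b h | inj₁ (j , a' , b' , h') = search fuel j (ℕ.≤-pred (ℕ.≤-trans b' l)) a' (ℕ.≤-trans (ℕ.<⇒≤ b') b) h'

  module _ {x : W} (O : Order x) where
    open Order O
    ord-divides : ∀ k → pow x k ≡ e → ord ℕ.∣ k
    ord-divides k h = go ord refl 0<ord
      where
      go : ∀ o → o ≡ ord → 0 ℕ.< o → ord ℕ.∣ k
      go (suc o) q _ with k % suc o in r≡ | m≡m%n+[m/n]*n k (suc o) | m%n<n k (suc o)
      ... | r | dm | r< = divides (k / suc o) (trans dm (trans (cong (ℕ._+ (k / suc o) ℕ.* suc o) (r≡0 r dm r<)) (cong ((k / suc o) ℕ.*_) q)))
        where
        r≡0 : ∀ r → k ≡ r ℕ.+ (k / suc o) ℕ.* suc o → r ℕ.< suc o → r ≡ 0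
        r≡0 zero    _  _  = refl
        r≡0 (suc r) dm r< = ⊥-elim (least (suc r) (s≤s z≤n) (subst (suc r ℕ.<_) q r<)
          (trans (sym (identityʳ _)) (trans (cong (pow x (suc r) ·_) (sym (pow-* x (k / suc o) (suc o) (trans (cong (pow x) q) pow-ord))))
            (trans (sym (pow-+ x (suc r) ((k / suc o) ℕ.* suc o))) (trans (cong (pow x) (sym dm)) h)))))

  alt : S → S → ℕ → W
  alt a b zero    = e
  alt a b (suc k) = a ⊙ alt b a k

  altWord : S → S → ℕ → List S
  altWord a b zero    = []
  altWord a b (suc k) = a ∷ altWord b a k

  word-alt : ∀ a b k → word (altWord a b k) ≡ alt a b k
  word-alt a b zero    = refl
  word-alt a b (suc k) = cong (gen a ·_) (word-alt b a k)

  length-alt : ∀ a b k → length (altWord a b k) ≡ k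
  length-alt a b zero    = refl
  length-alt a b (suc k) = cong suc (length-alt b a k)

  ℓ-alt· : ∀ a b k z → ℓ (alt a b k · z) ℕ.≤ k ℕ.+ ℓ z
  ℓ-alt· a b zero    z = ℕ.≤-reflexive (cong ℓ (identityˡ z))
  ℓ-alt· a b (suc k) z = ℕ.≤-trans (ℕ.≤-reflexive (cong ℓ (assoc _ _ _))) (ℕ.≤-trans (ℓ-⊙≤ a _) (s≤s (ℓ-alt· b a k z)))

  pow-swap : ∀ a b k → gen a · pow (gen b · gen a) k · gen b ≡ pow (gen a · gen b) (suc k)
  pow-swap a b zero    = trans (cong (_· gen b) (identityʳ _)) (sym (identityʳ _))
  pow-swap a b (suc k) = begin
    gen a · ((gen b · gen a) · P) · gen b      ≡⟨ cong (_· gen b) (cong (gen a ·_) (assoc _ _ _)) ⟩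
    gen a · (gen b · (gen a · P)) · gen b      ≡⟨ cong (_· gen b) (sym (assoc _ _ _)) ⟩
    (gen a · gen b) · (gen a · P) · gen b      ≡⟨ assoc _ _ _ ⟩
    (gen a · gen b) · (gen a · P · gen b)      ≡⟨ cong ((gen a · gen b) ·_) (pow-swap a b k) ⟩
    pow (gen a · gen b) (suc (suc k))          ∎
    where P = pow (gen b · gen a) k

  inv-pow : ∀ a b k → inv (pow (gen b · gen a) k) ≡ pow (gen a · gen b) k
  inv-pow a b zero    = inv-e
  inv-pow a b (suc k) = trans (inv-· _ _) (trans (cong₂ _·_ (inv-pow a b k) (trans (inv-· _ _) (cong₂ _·_ (inv-gen a) (inv-gen b))))
    (sym (pow-comm (gen a · gen b) k)))

  alt-even : ∀ a b k → alt a b (k ℕ.+ k) ≡ pow (gen a · gen b) k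
  alt-even a b zero    = refl
  alt-even a b (suc k) = trans (cong (alt a b) (cong suc (ℕ.+-suc k k))) (trans (cong (λ v → a ⊙ b ⊙ v) (alt-even a b k)) (sym (assoc _ _ _)))

  alt-inv : ∀ a b i j k → i ℕ.+ j ≡ k ℕ.+ k → alt a b i · inv (alt b a j) ≡ pow (gen a · gen b) k
  alt-inv a b i       zero    k h = trans (trans (cong (alt a b i ·_) inv-e) (identityʳ _)) (trans (cong (alt a b) (trans (sym (ℕ.+-identityʳ i)) h)) (alt-even a b k))
  alt-inv a b zero    (suc j) k h = trans (identityˡ _) (trans (cong inv (trans (cong (alt b a) h) (alt-even b a k))) (inv-pow a b k))
  alt-inv a b (suc i) (suc j) zero ()
  alt-inv a b (suc i) (suc j) (suc k) h = begin
    (gen a · alt b a i) · inv (gen b · alt a b j)          ≡⟨ cong ((gen a · alt b a i) ·_) (trans (inv-· _ _) (cong (inv (alt a b j) ·_) (inv-gen b))) ⟩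
    (gen a · alt b a i) · (inv (alt a b j) · gen b)        ≡⟨ sym (assoc _ _ _) ⟩
    ((gen a · alt b a i) · inv (alt a b j)) · gen b        ≡⟨ cong (_· gen b) (assoc _ _ _) ⟩
    (gen a · (alt b a i · inv (alt a b j))) · gen b        ≡⟨ cong (λ v → gen a · v · gen b) (alt-inv b a i j k h') ⟩
    gen a · pow (gen b · gen a) k · gen b                  ≡⟨ pow-swap a b k ⟩
    pow (gen a · gen b) (suc k)                            ∎
    where
    h' : i ℕ.+ j ≡ k ℕ.+ k
    h' = ℕ.suc-injective (trans (sym (ℕ.+-suc i j)) (trans (ℕ.suc-injective h) (ℕ.+-suc k k)))

  -- The word of length i followed by the inverse of the other has i + j = 2k alternating letters
  -- and equals the k-th power of `gen a · gen b`. The case i = j is the braid relation; unequal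
  -- lengths fold words that run past the longest element.
  alt-mirror : ∀ a b i j k → pow (gen a · gen b) k ≡ e → i ℕ.+ j ≡ k ℕ.+ k → alt a b i ≡ alt b a j
  alt-mirror a b i j k h q = trans (sym (identityʳ _)) (trans (cong (alt a b i ·_) (sym (inverseˡ (alt b a j))))
    (trans (sym (assoc _ _ _)) (trans (cong (_· alt b a j) (trans (alt-inv a b i j k q) h)) (identityˡ _))))

  alt-split : ∀ a b i j → ∃ λ x → ∃ λ y → alt a b (i ℕ.+ j) ≡ alt a b i · alt x y j
  alt-split a b zero    j = a , b , sym (identityˡ _)
  alt-split a b (suc i) j with alt-split b a i j
  ... | x , y , h = x , y , trans (cong (gen a ·_) h) (sym (assoc _ _ _))

  -- The minimal representative of the coset of the parabolic subgroup generated by a and b.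

  record Strip (a b : S) (w : W) : Set where
    field
      k     : ℕ
      z     : W
      split : w ≡ alt a b k · z
      a↑z   : a ↑ z
      b↑z   : b ↑ z
      ℓ-add : ℓ w ≡ k ℕ.+ ℓ z

  strip-⊙ : ∀ {a b w} → b ↓ w → Strip a b (b ⊙ w) → Strip b a w
  strip-⊙ {a} {b} {w} d T = record
    { k = suc k ; z = z ; split = trans (sym (gen-gen b w)) (trans (cong (gen b ·_) split) (sym (assoc _ _ _)))
    ; a↑z = b↑z ; b↑z = a↑z ; ℓ-add = trans (↓-suc d) (cong suc ℓ-add) }
    where open Strip T

  strip : ∀ a b w → b ↑ w → Strip a b w
  strip a b w = go (ℓ w) a b w ℕ.≤-refl
    where
    go : ∀ fuel a b w → ℓ w ℕ.≤ fuel → b ↑ w → Strip a b w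
    go fuel a b w l b↑ with ↑-or-↓ a w
    ... | inj₁ a↑ = record { k = 0 ; z = w ; split = sym (identityˡ w) ; a↑z = a↑ ; b↑z = b↑ ; ℓ-add = refl }
    go zero a b w l b↑ | inj₂ a↓ = ⊥-elim (ℕ.n≮0 (ℕ.≤-trans a↓ l))
    go (suc fuel) a b w l b↑ | inj₂ a↓ = strip-⊙ a↓ (go fuel b a (a ⊙ w) (ℕ.≤-pred (ℕ.≤-trans a↓ l)) (↓-flip a↓))

  strip-any : ∀ a b w → Strip a b w ⊎ Strip b a w
  strip-any a b w with ↑-or-↓ b w
  ... | inj₁ b↑ = inj₁ (strip a b w b↑)
  ... | inj₂ b↓ = inj₂ (strip-⊙ b↓ (strip a b (b ⊙ w) (↓-flip b↓)))

-- The reflection representation.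

module Geometry (C : FiniteCoxeterSystem) (ℓ : FiniteCoxeterSystem.W C → ℕ) (isLength : ∀ w → IsLength C w (ℓ w))
  (D : PosDomain) (cos : ℕ → CommutativeRing.Carrier (PosDomain.K D))
  (cos-angle : ∀ m → 2 ℕ.≤ m → m ℕ.≤ length (FiniteCoxeterSystem.elems C) → IsAngle D (cos m) m) where

  open FiniteCoxeterSystem C
  open Coxeter C ℓ isLength
  open PosDomain D
  open CommutativeRing K hiding (zero)
  open IntSolver K
  open Domain domain
  open import Algebra.Properties.Semiring.Sum semiring using (sum; sum-cong-≋; ∑-distrib-+; *-distribˡ-sum)

  V : Set
  V = Fin n → Carrier

  infix 4 _≋_
  _≋_ : V → V → Set
  u ≋ v = ∀ k → u k ≈ v k

  infixl 6 _⊕_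
  infixr 7 _⊛_
  _⊕_ : V → V → V
  (u ⊕ v) k = u k + v k
  _⊛_ : Carrier → V → V
  (c ⊛ v) k = c * v k

  ≋-refl : ∀ {v} → v ≋ v
  ≋-refl k = refl
  ≋-sym : ∀ {u v} → u ≋ v → v ≋ u
  ≋-sym h k = sym (h k)
  ≋-trans : ∀ {u v w} → u ≋ v → v ≋ w → u ≋ w
  ≋-trans h g k = trans (h k) (g k)

  δ : {m : ℕ} → Fin m → Fin m → Carrier
  δ Fin.zero    Fin.zero    = 1#
  δ Fin.zero    (Fin.suc j) = 0#
  δ (Fin.suc i) Fin.zero    = 0#
  δ (Fin.suc i) (Fin.suc j) = δ i j

  δ-same : ∀ {m} (i : Fin m) → δ i i ≈ 1#
  δ-same Fin.zero    = refl
  δ-same (Fin.suc i) = δ-same i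

  δ-diff : ∀ {m} {i j : Fin m} → i ≢ j → δ i j ≈ 0#
  δ-diff {i = Fin.zero}  {Fin.zero}  h = ⊥-elim (h ≡.refl)
  δ-diff {i = Fin.zero}  {Fin.suc j} h = refl
  δ-diff {i = Fin.suc i} {Fin.zero}  h = refl
  δ-diff {i = Fin.suc i} {Fin.suc j} h = δ-diff (λ e → h (≡.cong Fin.suc e))

  sum-0 : ∀ {m} (g : Fin m → Carrier) → (∀ k → g k ≈ 0#) → sum g ≈ 0#
  sum-0 {zero}  g h = refl
  sum-0 {suc m} g h = trans (+-cong (h Fin.zero) (sum-0 (λ k → g (Fin.suc k)) (λ k → h (Fin.suc k)))) (+-identityˡ 0#)

  sum-δ : ∀ {m} (g : Fin m → Carrier) j → sum (λ k → g k * δ j k) ≈ g j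
  sum-δ g Fin.zero    = trans (+-cong (*-identityʳ _) (sum-0 (λ k → g (Fin.suc k) * 0#) (λ k → zeroʳ (g (Fin.suc k))))) (+-identityʳ _)
  sum-δ g (Fin.suc j) = trans (+-cong (zeroʳ _) (sum-δ (λ k → g (Fin.suc k)) j)) (+-identityˡ _)

  α : Fin n → V
  α = δ

  m : Fin n → Fin n → ℕ
  m i j = Order.ord (order (gen i · gen j))

  -- Twice the usual bilinear form: `cos` stands for 2 cos (π / m), so the reflections involve no
  -- division by 2.
  cartan : Fin n → Fin n → Carrier
  cartan i j with i Fin.≟ j
  ... | yes _ = 1# + 1#
  ... | no _  = - cos (m i j)

  cartan-diag : ∀ i → cartan i i ≈ 1# + 1#
  cartan-diag i with i Fin.≟ i
  ... | yes _ = refl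
  ... | no h  = ⊥-elim (h ≡.refl)

  cartan-off : ∀ {i j} → i ≢ j → cartan i j ≈ - cos (m i j)
  cartan-off {i} {j} h with i Fin.≟ j
  ... | yes e = ⊥-elim (h e)
  ... | no _  = refl

  θ : Fin n → V → Carrier
  θ i v = sum (λ k → cartan i k * v k)

  θ-cong : ∀ i {u v} → u ≋ v → θ i u ≈ θ i v
  θ-cong i h = sum-cong-≋ (λ k → *-congˡ (h k))

  θ-⊕ : ∀ i u v → θ i (u ⊕ v) ≈ θ i u + θ i v
  θ-⊕ i u v = trans (sum-cong-≋ (λ k → distribˡ (cartan i k) (u k) (v k))) (∑-distrib-+ (λ k → cartan i k * u k) (λ k → cartan i k * v k))

  θ-⊛ : ∀ i c v → θ i (c ⊛ v) ≈ c * θ i v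
  θ-⊛ i c v = trans (sum-cong-≋ (λ k → solve 3 (λ a c v → a :* (c :* v) := c :* (a :* v)) refl (cartan i k) c (v k))) (sym (*-distribˡ-sum c (λ k → cartan i k * v k)))

  θ-α : ∀ i j → θ i (α j) ≈ cartan i j
  θ-α i j = sum-δ (cartan i) j

  σ : Fin n → V → V
  σ i v k = v k - θ i v * α i k

  σ-cong : ∀ i {u v} → u ≋ v → σ i u ≋ σ i v
  σ-cong i h k = +-cong (h k) (-‿cong (*-congʳ (θ-cong i h)))

  σ-⊕ : ∀ i u v → σ i (u ⊕ v) ≋ σ i u ⊕ σ i v
  σ-⊕ i u v k = trans (+-congˡ (-‿cong (*-congʳ (θ-⊕ i u v))))
    (solve 5 (λ a b x y z → (a :+ b) :- (x :+ y) :* z := (a :- x :* z) :+ (b :- y :* z)) refl _ _ _ _ _)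

  σ-⊛ : ∀ i c v → σ i (c ⊛ v) ≋ c ⊛ σ i v
  σ-⊛ i c v k = trans (+-congˡ (-‿cong (*-congʳ (θ-⊛ i c v)))) (solve 4 (λ c a x z → c :* a :- (c :* x) :* z := c :* (a :- x :* z)) refl _ _ _ _)

  θ-σ : ∀ i v → θ i (σ i v) ≈ - θ i v
  θ-σ i v = trans (θ-cong i (λ k → solve 3 (λ v t a → v :- t :* a := v :+ (:- t) :* a) refl (v k) (θ i v) (α i k)))
    (trans (θ-⊕ i v ((- θ i v) ⊛ α i)) (trans (+-congˡ (trans (θ-⊛ i (- θ i v) (α i)) (*-congˡ (trans (θ-α i i) (cartan-diag i)))))
      (trans (+-congˡ (distribˡ (- θ i v) 1# 1#)) (trans (+-congˡ (+-cong (*-identityʳ _) (*-identityʳ _)))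
        (solve 1 (λ t → t :+ ((:- t) :+ (:- t)) := :- t) refl (θ i v))))))

  σ-σ : ∀ i v → σ i (σ i v) ≋ v
  σ-σ i v k = trans (+-congˡ (-‿cong (*-congʳ (θ-σ i v)))) (solve 3 (λ v t a → (v :- t :* a) :- (:- t) :* a := v) refl _ _ _)

  σ-α : ∀ i → σ i (α i) ≋ (- 1#) ⊛ α i
  σ-α i k = trans (+-congˡ (-‿cong (trans (*-congʳ (trans (θ-α i i) (cartan-diag i))) (distribʳ _ _ _))))
    (solve 2 (λ o a → a :- (o :* a :+ o :* a) := a :- o :* a :- o :* a) refl 1# (α i k)) ▸
    trans (+-congʳ (+-congˡ (-‿cong (*-identityˡ _)))) (solve 2 (λ o a → (a :- a) :- o :* a := (:- o) :* a) refl 1# (α i k))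
    where
    infixr 5 _▸_
    _▸_ : ∀ {x y z} → x ≈ y → y ≈ z → x ≈ z
    _▸_ = trans

  2≤m : ∀ {i j} → i ≢ j → 2 ℕ.≤ m i j
  2≤m {i} {j} h with Order.ord (order (gen i · gen j)) | Order.0<ord (order (gen i · gen j)) | Order.pow-ord (order (gen i · gen j))
  ... | suc zero    | _ | q = ⊥-elim (h (gen-inj i j (≡.sym (≡.trans (inverse-unique (gen i) (gen j) (≡.trans (≡.sym (identityʳ _)) q)) (inv-gen i)))))
  ... | suc (suc o) | _ | _ = s≤s (s≤s z≤n)

  pow-flip : ∀ i j k → pow (gen i · gen j) k ≡ e → pow (gen j · gen i) k ≡ e
  pow-flip i j k h = ≡.trans (≡.sym (inv-inv _)) (≡.trans (≡.cong inv (≡.trans (inv-pow i j k) h)) inv-e)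

  m-sym : ∀ i j → m i j ≡ m j i
  m-sym i j = ℕ.≤-antisym (half i j) (half j i)
    where
    half : ∀ i j → m i j ℕ.≤ m j i
    half i j with m i j ℕ.≤? m j i
    ... | yes l = l
    ... | no ¬l = ⊥-elim (Order.least (order (gen i · gen j)) (m j i) (Order.0<ord (order (gen j · gen i))) (ℕ.≰⇒> ¬l)
                    (pow-flip j i (m j i) (Order.pow-ord (order (gen j · gen i)))))

  module Plane {i j : Fin n} (i≢j : i ≢ j) where
    c : Carrier
    c = cos (m i j)

    open Cheb K c using (f; f-periodic) public

    f-m : f (m i j) ≈ 0#
    f-m = proj₁ (cos-angle (m i j) (2≤m i≢j) (Order.ord≤ (order (gen i · gen j))))

    f-Pos : ∀ k → 0 ℕ.< k → k ℕ.< m i j → Pos (f k)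
    f-Pos = proj₂ (cos-angle (m i j) (2≤m i≢j) (Order.ord≤ (order (gen i · gen j))))

    plane : Carrier → Carrier → V
    plane P Q = P ⊛ α i ⊕ Q ⊛ α j

    plane-cong : ∀ {P Q P' Q'} → P ≈ P' → Q ≈ Q' → plane P Q ≋ plane P' Q'
    plane-cong h g k = +-cong (*-congʳ h) (*-congʳ g)

    plane-i : ∀ P Q → plane P Q i ≈ P
    plane-i P Q = trans (+-cong (trans (*-congˡ (δ-same i)) (*-identityʳ P)) (trans (*-congˡ (δ-diff (λ e → i≢j (≡.sym e)))) (zeroʳ Q))) (+-identityʳ P)

    plane-j : ∀ P Q → plane P Q j ≈ Q
    plane-j P Q = trans (+-cong (trans (*-congˡ (δ-diff i≢j)) (zeroʳ P)) (trans (*-congˡ (δ-same j)) (*-identityʳ Q))) (+-identityˡ Q)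

    private
      θi : ∀ P Q → θ i (plane P Q) ≈ P + P - Q * c
      θi P Q = trans (θ-⊕ i _ _) (trans (+-cong (trans (θ-⊛ i P _) (*-congˡ (trans (θ-α i i) (cartan-diag i)))) (trans (θ-⊛ i Q _) (*-congˡ (trans (θ-α i j) (cartan-off i≢j)))))
        (trans (+-congʳ (trans (distribˡ P 1# 1#) (+-cong (*-identityʳ P) (*-identityʳ P)))) (solve 3 (λ P Q c → P :+ P :+ Q :* (:- c) := P :+ P :- Q :* c) refl P Q c)))
      θj : ∀ P Q → θ j (plane P Q) ≈ Q + Q - P * c
      θj P Q = trans (θ-⊕ j _ _) (trans (+-cong (trans (θ-⊛ j P _) (*-congˡ (trans (θ-α j i) (trans (cartan-off (λ e → i≢j (≡.sym e))) (-‿cong (reflexive (≡.cong cos (m-sym j i)))))))) (trans (θ-⊛ j Q _) (*-congˡ (trans (θ-α j j) (cartan-diag j)))))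
        (trans (+-congˡ (trans (distribˡ Q 1# 1#) (+-cong (*-identityʳ Q) (*-identityʳ Q)))) (solve 3 (λ P Q c → P :* (:- c) :+ (Q :+ Q) := Q :+ Q :- P :* c) refl P Q c)))

    σi-plane : ∀ P Q → σ i (plane P Q) ≋ plane (c * Q - P) Q
    σi-plane P Q k = trans (+-congˡ (-‿cong (*-congʳ (θi P Q)))) (solve 5 (λ P Q c x y → P :* x :+ Q :* y :- (P :+ P :- Q :* c) :* x := (c :* Q :- P) :* x :+ Q :* y) refl P Q c _ _)

    σj-plane : ∀ P Q → σ j (plane P Q) ≋ plane P (c * P - Q)
    σj-plane P Q k = trans (+-congˡ (-‿cong (*-congʳ (θj P Q)))) (solve 5 (λ P Q c x y → P :* x :+ Q :* y :- (Q :+ Q :- P :* c) :* y := P :* x :+ (c :* P :- Q) :* y) refl P Q c _ _)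

    -- Here 4 - c² = (2 - c)(2 + c). If `c` were 2, `f (m i j)` would be the positive number m; and
    -- 2 + c is positive because `c` is `f 2` when 2 < m and zero when m = 2.
    4-c²≉0 : ∀ Q → c * (c * Q) ≈ Q + Q + (Q + Q) → Q ≈ 0#
    4-c²≉0 Q h = dom {(1# + 1# - c) * (1# + 1# + c)} {Q}
      (trans (trans (*-congʳ (solve 2 (λ o c → (o :+ o :- c) :* (o :+ o :+ c) := o :* o :+ o :* o :+ (o :* o :+ o :* o) :- c :* c) refl 1# c))
        (trans (*-congʳ (+-congʳ (+-cong (+-cong (*-identityˡ 1#) (*-identityˡ 1#)) (+-cong (*-identityˡ 1#) (*-identityˡ 1#)))))
        (trans (solve 3 (λ o c q → (o :+ o :+ (o :+ o) :- c :* c) :* q := (o :* q :+ o :* q :+ (o :* q :+ o :* q)) :- c :* (c :* q)) refl 1# c Q)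
          (+-congʳ (+-cong (+-cong (*-identityˡ Q) (*-identityˡ Q)) (+-cong (*-identityˡ Q) (*-identityˡ Q)))))))
        (trans (+-congˡ (-‿cong h)) (-‿inverseʳ _)))
      (*-≉0 c≉2 c≉-2)
      where
      numeral : ∀ k → Pos (suc k ×[ K ])
      numeral zero    = Pos-resp (sym (+-identityʳ 1#)) Pos-1
      numeral (suc k) = Pos-+ Pos-1 (numeral k)
      positive-numeral : ∀ k → 0 ℕ.< k → Pos (k ×[ K ])
      positive-numeral (suc k) _ = numeral k
      c≉2 : 1# + 1# - c ≉0
      c≉2 z = Pos-≉0 (positive-numeral (m i j) (ℕ.<⇒≤ (2≤m i≢j))) (trans (sym (Cheb-2 K (m i j))) (trans (Cheb-cong K (-≈0⇒≈ z) (m i j)) f-m))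
      f2 : c * 1# - 0# ≈ c
      f2 = trans (+-congʳ (*-identityʳ c)) (solve 1 (λ c → c :- :0 := c) refl c)
      c≉-2 : 1# + 1# + c ≉0
      c≉-2 with ℕ.m≤n⇒m<n∨m≡n (2≤m i≢j)
      ... | inj₁ 2<m = Pos-≉0 (Pos-+ (Pos-+ Pos-1 Pos-1) (Pos-resp f2 (f-Pos 2 (s≤s z≤n) 2<m)))
      ... | inj₂ 2≡m = Pos-≉0 (Pos-resp (trans (sym (+-identityʳ _)) (+-congˡ (sym (trans (sym f2) (trans (reflexive (≡.cong f 2≡m)) f-m))))) (Pos-+ Pos-1 Pos-1))

    -- T = σ j ∘ σ i has finite order on the plane, and T - 1 is injective there.

    T : V → V
    T v = σ j (σ i v)

    iter : ℕ → V → V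
    iter zero    v = v
    iter (suc k) v = iter k (T v)

    T-cong : ∀ {u v} → u ≋ v → T u ≋ T v
    T-cong h = σ-cong j (σ-cong i h)
    T-⊕ : ∀ u v → T (u ⊕ v) ≋ T u ⊕ T v
    T-⊕ u v = ≋-trans (σ-cong j (σ-⊕ i u v)) (σ-⊕ j _ _)
    T-⊛ : ∀ x v → T (x ⊛ v) ≋ x ⊛ T v
    T-⊛ x v = ≋-trans (σ-cong j (σ-⊛ i x v)) (σ-⊛ j _ _)

    iter-cong : ∀ k {u v} → u ≋ v → iter k u ≋ iter k v
    iter-cong zero    h = h
    iter-cong (suc k) h = iter-cong k (T-cong h)
    iter-⊕ : ∀ k u v → iter k (u ⊕ v) ≋ iter k u ⊕ iter k v
    iter-⊕ zero    u v = ≋-refl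
    iter-⊕ (suc k) u v = ≋-trans (iter-cong k (T-⊕ u v)) (iter-⊕ k _ _)
    iter-⊛ : ∀ k x v → iter k (x ⊛ v) ≋ x ⊛ iter k v
    iter-⊛ zero    x v = ≋-refl
    iter-⊛ (suc k) x v = ≋-trans (iter-cong k (T-⊛ x v)) (iter-⊛ k _ _)
    iter-T : ∀ k v → iter k (T v) ≋ T (iter k v)
    iter-T zero    v = ≋-refl
    iter-T (suc k) v = iter-T k (T v)

    private
      -- A pair of consecutive Chebyshev values moves down by two indices, so `m i j` applications
      -- of `T` use up one period of `f`.
      T-f : ∀ k → T (plane (f (suc (suc (suc k)))) (f (suc (suc k)))) ≋ plane (f (suc k)) (f k)
      T-f k = ≋-trans (σ-cong j (≋-trans (σi-plane _ _) (plane-cong (solve 2 (λ u v → u :- (u :- v) := v) refl _ _) refl)))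
        (≋-trans (σj-plane _ _) (plane-cong refl (solve 2 (λ u v → u :- (u :- v) := v) refl _ _)))

      iter-f : ∀ p k → iter p (plane (f (suc (k ℕ.+ (p ℕ.+ p)))) (f (k ℕ.+ (p ℕ.+ p)))) ≋ plane (f (suc k)) (f k)
      iter-f zero    k = plane-cong (reflexive (≡.cong (λ q → f (suc q)) (ℕ.+-identityʳ k))) (reflexive (≡.cong f (ℕ.+-identityʳ k)))
      iter-f (suc p) k = ≋-trans (iter-cong p (≋-trans (T-cong (plane-cong (reflexive (≡.cong (λ q → f (suc q)) shift)) (reflexive (≡.cong f shift)))) (T-f (k ℕ.+ (p ℕ.+ p))))) (iter-f p k)
        where
        shift : k ℕ.+ (suc p ℕ.+ suc p) ≡ suc (suc (k ℕ.+ (p ℕ.+ p)))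
        shift = ≡.trans (≡.cong (λ q → k ℕ.+ suc q) (ℕ.+-suc p p)) (≡.trans (ℕ.+-suc k _) (≡.cong suc (ℕ.+-suc k _)))

      periodic : ∀ p → f p ≈ 0# → 0 ℕ.< p → ∀ k → iter p (plane (f (suc k)) (f k)) ≋ plane (f (suc k)) (f k)
      periodic (suc p) z _ k = ≋-trans (iter-cong (suc p) (plane-cong (sym (f-periodic z (suc k))) (sym (f-periodic z k)))) (iter-f (suc p) k)

      p₀ : ℕ
      p₀ = m i j

      fixes-plane : ∀ P Q → iter p₀ (plane P Q) ≋ plane P Q
      fixes-plane P Q = ≋-trans (iter-cong p₀ decompose) (≋-trans (iter-⊕ p₀ _ _) (≋-trans (λ k → +-cong
          (trans (iter-⊛ p₀ (P - c * Q) _ k) (*-congˡ (per 0 k))) (trans (iter-⊛ p₀ Q _ k) (*-congˡ (per 1 k)))) (≋-sym decompose)))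
        where
        per = periodic p₀ f-m (Order.0<ord (order (gen i · gen j)))
        decompose : plane P Q ≋ (P - c * Q) ⊛ plane (f 1) (f 0) ⊕ Q ⊛ plane (f 2) (f 1)
        decompose k = trans (+-cong (sym (*-congˡ (*-identityˡ _))) (sym (*-congˡ (*-identityˡ _))))
          (solve 6 (λ P Q c o x y → P :* (o :* x) :+ Q :* (o :* y) := (P :- c :* Q) :* (o :* x :+ :0 :* y) :+ Q :* ((c :* o :- :0) :* x :+ o :* y)) refl P Q c 1# (α i k) (α j k))

      offset : ∀ k v → ∃ λ P → ∃ λ Q → iter k v ≋ v ⊕ plane P Q
      offset zero    v = 0# , 0# , λ k → solve 3 (λ v x y → v := v :+ (:0 :* x :+ :0 :* y)) refl _ _ _
      offset (suc k) v with offset k (T v)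
      ... | P , Q , h = P - θ i v , Q - θ j (σ i v) , λ l → trans (h l)
        (solve 7 (λ v t x t' y P Q → ((v :- t :* x) :- t' :* y) :+ (P :* x :+ Q :* y) := v :+ ((P :- t) :* x :+ (Q :- t') :* y)) refl (v l) (θ i v) (α i l) (θ j (σ i v)) (α j l) P Q)

    module _ (v : V) (P Q p q : Carrier) (h : iter p₀ v ≋ v ⊕ plane P Q) (g : T v ≋ v ⊕ plane p q) where
      private
        swap : T (iter p₀ v) ≋ (v ⊕ plane P Q) ⊕ plane p q
        swap = ≋-trans (≋-sym (iter-T p₀ v)) (≋-trans (iter-cong p₀ g) (≋-trans (iter-⊕ p₀ v _) (λ k → +-cong (h k) (fixes-plane p q k))))
        fixed : T (plane P Q) ≋ plane P Q
        fixed k = begin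
          T (plane P Q) k                                     ≈⟨ solve 2 (λ a b → a := (b :+ a) :- b) refl _ (T v k) ⟩
          (T v k + T (plane P Q) k) - T v k                   ≈⟨ +-congʳ (sym (T-⊕ v (plane P Q) k)) ⟩
          T (v ⊕ plane P Q) k - T v k                         ≈⟨ +-cong (trans (T-cong (≋-sym h) k) (swap k)) (-‿cong (g k)) ⟩
          ((v k + plane P Q k) + plane p q k) - (v k + plane p q k)  ≈⟨ solve 3 (λ a b c → ((a :+ b) :+ c) :- (a :+ c) := b) refl (v k) (plane P Q k) (plane p q k) ⟩
          plane P Q k                                         ∎
          where open import Relation.Binary.Reasoning.Setoid setoid
        Tpq : T (plane P Q) ≋ plane (c * Q - P) (c * (c * Q - P) - Q)
        Tpq = ≋-trans (σ-cong j (σi-plane P Q)) (σj-plane _ _)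
        eqP : c * Q - P ≈ P
        eqP = trans (sym (plane-i _ _)) (trans (sym (Tpq i)) (trans (fixed i) (plane-i P Q)))
        eqQ : c * (c * Q - P) - Q ≈ Q
        eqQ = trans (sym (plane-j _ _)) (trans (sym (Tpq j)) (trans (fixed j) (plane-j P Q)))
        cQ : c * Q ≈ P + P
        cQ = trans (solve 2 (λ u P → u := (u :- P) :+ P) refl (c * Q) P) (+-congʳ eqP)
        cP : c * P ≈ Q + Q
        cP = trans (*-congˡ (sym eqP)) (trans (solve 2 (λ u Q → u := (u :- Q) :+ Q) refl _ Q) (+-congʳ eqQ))
        Q≈0 : Q ≈ 0#
        Q≈0 = 4-c²≉0 Q (trans (*-congˡ cQ) (trans (distribˡ c P P) (+-cong cP cP)))
        P≈0 : P ≈ 0#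
        P≈0 = 4-c²≉0 P (trans (*-congˡ cP) (trans (distribˡ c Q Q) (+-cong cQ cQ)))

      -- The power of `T` moves `v` by a vector of the plane. As it commutes with `T` and is the
      -- identity on the plane, `T` fixes that vector; the equations c Q = 2 P and c P = 2 Q then
      -- give P = Q = 0 because 4 - c² is nonzero.
      offset-zero : iter p₀ v ≋ v
      offset-zero k = trans (h k) (trans (+-congˡ (trans (plane-cong P≈0 Q≈0 k) (solve 2 (λ x y → :0 :* x :+ :0 :* y := :0) refl _ _))) (+-identityʳ _))

    T-order : ∀ v → iter p₀ v ≋ v
    T-order v =
      let P , Q , h = offset p₀ v ; p , q , g = offset 1 v
      in offset-zero v P Q p q h g

  record Perm : Set where
    field
      to from   : V → V
      to-cong   : ∀ {u v} → u ≋ v → to u ≋ to v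
      from-cong : ∀ {u v} → u ≋ v → from u ≋ from v
      to-from   : ∀ v → to (from v) ≋ v
      from-to   : ∀ v → from (to v) ≋ v
  open Perm

  private
    perms : Group 0ℓ 0ℓ
    perms = record
      { Carrier = Perm ; _≈_ = λ f g → ∀ v → to f v ≋ to g v
      ; _∙_ = λ f g → record
        { to = λ v → to g (to f v) ; from = λ v → from f (from g v)
        ; to-cong = λ h → to-cong g (to-cong f h) ; from-cong = λ h → from-cong f (from-cong g h)
        ; to-from = λ v → ≋-trans (to-cong g (to-from f _)) (to-from g v)
        ; from-to = λ v → ≋-trans (from-cong f (from-to g _)) (from-to f v) }
      ; ε = record { to = λ v → v ; from = λ v → v ; to-cong = λ h → h ; from-cong = λ h → h ; to-from = λ v → ≋-refl ; from-to = λ v → ≋-refl }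
      ; _⁻¹ = λ f → record { to = from f ; from = to f ; to-cong = from-cong f ; from-cong = to-cong f ; to-from = from-to f ; from-to = to-from f }
      ; isGroup = record
        { isMonoid = record
          { isSemigroup = record
            { isMagma = record
              { isEquivalence = record { refl = λ v → ≋-refl ; sym = λ h v → ≋-sym (h v) ; trans = λ h g v → ≋-trans (h v) (g v) }
              ; ∙-cong = λ {f} {f'} {g} {g'} h k v → ≋-trans (to-cong g (h v)) (k (to f' v)) }
            ; assoc = λ f g h v → ≋-refl }
          ; identity = (λ f v → ≋-refl) , (λ f v → ≋-refl) }
        ; inverse = (λ f v → to-from f v) , (λ f v → from-to f v)
        ; ⁻¹-cong = λ {f} {g} h v → ≋-trans (from-cong f (≋-sym (to-from g v))) (≋-trans (from-cong f (≋-sym (h (from g v)))) (from-to f (from g v))) } }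

    refl-perm : Fin n → Perm
    refl-perm i = record { to = σ i ; from = σ i ; to-cong = σ-cong i ; from-cong = σ-cong i ; to-from = σ-σ i ; from-to = σ-σ i }

    iterate : (V → V) → ℕ → V → V
    iterate F zero    v = v
    iterate F (suc k) v = iterate F k (F v)

    powG-iterate : ∀ f k v → to (powG perms f k) v ≡ iterate (to f) k v
    powG-iterate f zero    v = ≡.refl
    powG-iterate f (suc k) v = powG-iterate f k (to f v)

    iterate-σσ : ∀ i k v → iterate (λ v → σ i (σ i v)) k v ≋ v
    iterate-σσ i zero    v = ≋-refl
    iterate-σσ i (suc k) v = ≋-trans (iterate-σσ i k _) (σ-σ i v)

    module _ {i j : Fin n} (i≢j : i ≢ j) where
      open Plane i≢j
      iterate-iter : ∀ k v → iterate (λ v → σ j (σ i v)) k v ≡ iter k v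
      iterate-iter zero    v = ≡.refl
      iterate-iter (suc k) v = iterate-iter k (T v)
      iter-+ : ∀ a b v → iter (a ℕ.+ b) v ≡ iter b (iter a v)
      iter-+ zero    b v = ≡.refl
      iter-+ (suc a) b v = iter-+ a b (T v)
      iter-multiple : ∀ q o → (∀ v → iter o v ≋ v) → ∀ v → iter (q ℕ.* o) v ≋ v
      iter-multiple zero    o h v = ≋-refl
      iter-multiple (suc q) o h v = ≋-trans (λ k → reflexive (≡.cong (λ u → u k) (iter-+ o (q ℕ.* o) v))) (≋-trans (iter-multiple q o h _) (h v))
      iterate-order : ∀ k → pow (gen i · gen j) k ≡ e → ∀ v → iterate (λ v → σ j (σ i v)) k v ≋ v
      iterate-order k h v with ord-divides (order (gen i · gen j)) k h
      ... | divides q eq = ≋-trans (λ l → reflexive (≡.cong (λ u → u l) (≡.trans (iterate-iter k v) (≡.cong (λ k → iter k v) eq)))) (iter-multiple q (m i j) T-order v)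

    iterate-relation : ∀ i j → Dec (i ≡ j) → ∀ k → pow (gen i · gen j) k ≡ e → ∀ v → iterate (λ v → σ j (σ i v)) k v ≋ v
    iterate-relation i j (yes eq) k h v = ≡.subst (λ j → iterate (λ v → σ j (σ i v)) k v ≋ v) eq (iterate-σσ i k v)
    iterate-relation i j (no i≢j) k h v = iterate-order i≢j k h v

    relation : ∀ i j k → pow (gen i · gen j) k ≡ e → ∀ v → to (powG perms (Group._∙_ perms (refl-perm i) (refl-perm j)) k) v ≋ v
    relation i j k h v = ≋-trans (λ l → reflexive (≡.cong (λ u → u l) (powG-iterate (Group._∙_ perms (refl-perm i) (refl-perm j)) k v)))
      (iterate-relation i j (i Fin.≟ j) k h v)

    module Act = Representation perms refl-perm relation

  -- The right action of W, the first letter of a word acting first.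

  infixl 8 _◂_ _◁_
  _◂_ : V → List (Fin n) → V
  v ◂ []       = v
  v ◂ (i ∷ is) = σ i v ◂ is

  _◁_ : V → W → V
  v ◁ w = v ◂ proj₁ (reduced w)

  ◂-cong : ∀ ws {u v} → u ≋ v → u ◂ ws ≋ v ◂ ws
  ◂-cong []       h = h
  ◂-cong (i ∷ ws) h = ◂-cong ws (σ-cong i h)
  ◂-⊕ : ∀ ws u v → (u ⊕ v) ◂ ws ≋ u ◂ ws ⊕ v ◂ ws
  ◂-⊕ []       u v = ≋-refl
  ◂-⊕ (i ∷ ws) u v = ≋-trans (◂-cong ws (σ-⊕ i u v)) (◂-⊕ ws _ _)
  ◂-⊛ : ∀ ws c v → (c ⊛ v) ◂ ws ≋ c ⊛ (v ◂ ws)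
  ◂-⊛ []       c v = ≋-refl
  ◂-⊛ (i ∷ ws) c v = ≋-trans (◂-cong ws (σ-⊛ i c v)) (◂-⊛ ws _ _)
  ◂-++ : ∀ us vs v → v ◂ (us ++ vs) ≋ v ◂ us ◂ vs
  ◂-++ []       vs v = ≋-refl
  ◂-++ (i ∷ us) vs v = ◂-++ us vs (σ i v)

  private
    value-◂ : ∀ ws v → to (Act.value ws) v ≋ v ◂ ws
    value-◂ []       v = ≋-refl
    value-◂ (i ∷ ws) v = value-◂ ws (σ i v)

  ◂-unique : ∀ us vs v → word us ≡ word vs → v ◂ us ≋ v ◂ vs
  ◂-unique us vs v h = ≋-trans (≋-sym (value-◂ us v)) (≋-trans (Act.value-unique us vs h v) (value-◂ vs v))

  ◁-word : ∀ ws v → v ◁ word ws ≋ v ◂ ws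
  ◁-word ws v = ◂-unique (proj₁ (reduced (word ws))) ws v (proj₁ (proj₂ (reduced (word ws))))

  ◁-cong : ∀ w {u v} → u ≋ v → u ◁ w ≋ v ◁ w
  ◁-cong w = ◂-cong (proj₁ (reduced w))
  ◁-⊕ : ∀ w u v → (u ⊕ v) ◁ w ≋ u ◁ w ⊕ v ◁ w
  ◁-⊕ w = ◂-⊕ (proj₁ (reduced w))
  ◁-⊛ : ∀ w c v → (c ⊛ v) ◁ w ≋ c ⊛ (v ◁ w)
  ◁-⊛ w = ◂-⊛ (proj₁ (reduced w))

  ◁-≡ : ∀ {x y} v → x ≡ y → v ◁ x ≋ v ◁ y
  ◁-≡ v ≡.refl = ≋-refl

  ◁-e : ∀ v → v ◁ e ≋ v
  ◁-e = ◁-word []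

  ◁-gen : ∀ i v → v ◁ gen i ≋ σ i v
  ◁-gen i v = ≋-trans (◁-≡ v (≡.sym (identityʳ (gen i)))) (◁-word (i ∷ []) v)

  ◁-· : ∀ x y v → v ◁ (x · y) ≋ v ◁ x ◁ y
  ◁-· x y v with reduced x | reduced y
  ... | us , h , _ | vs , g , _ = ≋-trans (◁-≡ v (≡.trans (≡.cong₂ _·_ (≡.sym h) (≡.sym g)) (≡.sym (word-++ us vs)))) (≋-trans (◁-word (us ++ vs) v) (◂-++ us vs v))

  ◁-⊙ : ∀ s w v → v ◁ (s ⊙ w) ≋ σ s v ◁ w
  ◁-⊙ s w v = ≋-trans (◁-· (gen s) w v) (◁-cong w (◁-gen s v))

  ◁-inv : ∀ w v → v ◁ w ◁ inv w ≋ v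
  ◁-inv w v = ≋-trans (≋-sym (◁-· w (inv w) v)) (≋-trans (◁-≡ v (inverseʳ w)) (◁-e v))

  inv-◁ : ∀ w v → v ◁ inv w ◁ w ≋ v
  inv-◁ w v = ≋-trans (≋-sym (◁-· (inv w) w v)) (≋-trans (◁-≡ v (inverseˡ w)) (◁-e v))

-- Signs of roots, reflections and the exchange property.

module Roots (C : FiniteCoxeterSystem) (ℓ : FiniteCoxeterSystem.W C → ℕ) (isLength : ∀ w → IsLength C w (ℓ w))
  (D : PosDomain) (cos : ℕ → CommutativeRing.Carrier (PosDomain.K D))
  (cos-angle : ∀ m → 2 ℕ.≤ m → m ℕ.≤ length (FiniteCoxeterSystem.elems C) → IsAngle D (cos m) m) where

  open FiniteCoxeterSystem C
  open Coxeter C ℓ isLength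
  open Geometry C ℓ isLength D cos cos-angle
  open PosDomain D
  open CommutativeRing K hiding (zero)
  open IntSolver K
  open Domain domain

  NN : Carrier → Set
  NN a = a ≈ 0# ⊎ Pos a

  NN-resp : ∀ {a b} → a ≈ b → NN a → NN b
  NN-resp h (inj₁ z) = inj₁ (trans (sym h) z)
  NN-resp h (inj₂ p) = inj₂ (Pos-resp h p)

  NN-+ : ∀ {a b} → NN a → NN b → NN (a + b)
  NN-+ (inj₁ z) q        = NN-resp (sym (trans (+-congʳ z) (+-identityˡ _))) q
  NN-+ (inj₂ p) (inj₁ z) = inj₂ (Pos-resp (sym (trans (+-congˡ z) (+-identityʳ _))) p)
  NN-+ (inj₂ p) (inj₂ q) = inj₂ (Pos-+ p q)

  NN-* : ∀ {a b} → NN a → NN b → NN (a * b)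
  NN-* (inj₁ z) q        = inj₁ (trans (*-congʳ z) (zeroˡ _))
  NN-* (inj₂ p) (inj₁ z) = inj₁ (trans (*-congˡ z) (zeroʳ _))
  NN-* (inj₂ p) (inj₂ q) = inj₂ (Pos-* p q)

  NN-antisym : ∀ {a} → NN a → NN (- a) → a ≈ 0#
  NN-antisym (inj₁ z) _        = z
  NN-antisym (inj₂ p) (inj₁ z) = trans (solve 1 (λ a → a := :- (:- a)) refl _) (trans (-‿cong z) (solve 0 (:- :0 := :0) refl))
  NN-antisym (inj₂ p) (inj₂ q) = ⊥-elim (Pos-≉0 (Pos-+ p q) (-‿inverseʳ _))

  NN-sum-zero : ∀ {a b} → NN a → NN b → a + b ≈ 0# → a ≈ 0#
  NN-sum-zero (inj₁ z) q        h = z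
  NN-sum-zero (inj₂ p) (inj₁ z) h = ⊥-elim (Pos-≉0 (Pos-resp (sym (trans (+-congˡ z) (+-identityʳ _))) p) h)
  NN-sum-zero (inj₂ p) (inj₂ q) h = ⊥-elim (Pos-≉0 (Pos-+ p q) h)

  numeral-Pos : ∀ k → Pos (suc k ×[ K ])
  numeral-Pos zero    = Pos-resp (sym (+-identityʳ 1#)) Pos-1
  numeral-Pos (suc k) = Pos-+ Pos-1 (numeral-Pos k)

  NNv : V → Set
  NNv v = ∀ k → NN (v k)

  neg : V → V
  neg v k = - v k

  NNv-resp : ∀ {u v} → u ≋ v → NNv u → NNv v
  NNv-resp h p k = NN-resp (h k) (p k)

  neg-cong : ∀ {u v} → u ≋ v → neg u ≋ neg v
  neg-cong h k = -‿cong (h k)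

  -1⊛ : ∀ v → (- 1#) ⊛ v ≋ neg v
  -1⊛ v k = trans (solve 2 (λ o x → (:- o) :* x := :- (o :* x)) refl 1# (v k)) (-‿cong (*-identityˡ (v k)))

  neg-◁ : ∀ w v → neg v ◁ w ≋ neg (v ◁ w)
  neg-◁ w v = ≋-trans (◁-cong w (≋-sym (-1⊛ v))) (≋-trans (◁-⊛ w _ v) (-1⊛ (v ◁ w)))

  NNv-α : ∀ i → NNv (α i)
  NNv-α i k with i Fin.≟ k
  ... | yes h = inj₂ (Pos-resp (sym (trans (reflexive (≡.cong (α i) (≡.sym h))) (δ-same i))) Pos-1)
  ... | no h  = inj₁ (δ-diff h)

  NNv-⊕ : ∀ {u v} → NNv u → NNv v → NNv (u ⊕ v)
  NNv-⊕ p q k = NN-+ (p k) (q k)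

  NNv-⊛ : ∀ {c v} → NN c → NNv v → NNv (c ⊛ v)
  NNv-⊛ p q k = NN-* p (q k)

  σ-self : ∀ i w → α i ◁ (i ⊙ w) ≋ neg (α i ◁ w)
  σ-self i w = ≋-trans (◁-⊙ i w (α i)) (≋-trans (◁-cong w (≋-trans (σ-α i) (-1⊛ (α i)))) (neg-◁ w (α i)))

  module AltAction {i j : Fin n} (i≢j : i ≢ j) where
    open Plane i≢j

    private
      f-NN : ∀ k → k ℕ.< m i j → NN (f k)
      f-NN zero    _ = inj₁ refl
      f-NN (suc k) l = inj₂ (f-Pos (suc k) (s≤s z≤n) l)

      f-NN≤ : ∀ k → k ℕ.≤ m i j → NN (f k)
      f-NN≤ k l with ℕ.m≤n⇒m<n∨m≡n l
      ... | inj₁ l' = f-NN k l'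
      ... | inj₂ q  = inj₁ (trans (reflexive (≡.cong f q)) f-m)

    Combination : V → Set
    Combination v = ∃ λ P → ∃ λ Q → NN P × NN Q × v ≋ plane P Q

    mutual
      -- Each letter raises the Chebyshev index by one, and `f` is non-negative up to the index
      -- `m i j`, where it vanishes.
      walk-j : ∀ k p → p ℕ.+ k ℕ.< m i j → Combination (plane (f (suc p)) (f p) ◂ altWord j i k)
      walk-j zero    p l = _ , _ , f-NN≤ (suc p) (≡.subst (ℕ._< m i j) (ℕ.+-identityʳ p) l) , f-NN p (ℕ.≤-trans (s≤s (ℕ.m≤m+n p 0)) l) , ≋-refl
      walk-j (suc k) p l with walk-i k (suc p) (≡.subst (ℕ._< m i j) (ℕ.+-suc p k) l)
      ... | P , Q , a , b , h = P , Q , a , b , ≋-trans (◂-cong (altWord i j k) (σj-plane _ _)) h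

      walk-i : ∀ k p → p ℕ.+ k ℕ.< m i j → Combination (plane (f p) (f (suc p)) ◂ altWord i j k)
      walk-i zero    p l = _ , _ , f-NN p (ℕ.≤-trans (s≤s (ℕ.m≤m+n p 0)) l) , f-NN≤ (suc p) (≡.subst (ℕ._< m i j) (ℕ.+-identityʳ p) l) , ≋-refl
      walk-i (suc k) p l with walk-j k (suc p) (≡.subst (ℕ._< m i j) (ℕ.+-suc p k) l)
      ... | P , Q , a , b , h = P , Q , a , b , ≋-trans (◂-cong (altWord j i k) (σi-plane _ _)) h

    α-alt : ∀ k → k ℕ.< m i j → Combination (α i ◁ alt j i k)
    α-alt k l with walk-j k 0 l
    ... | P , Q , a , b , h = P , Q , a , b , ≋-trans (◁-≡ _ (≡.sym (word-alt j i k))) (≋-trans (◁-word (altWord j i k) (α i))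
      (≋-trans (◂-cong (altWord j i k) (λ l → sym (trans (+-cong (*-identityˡ _) (zeroˡ _)) (+-identityʳ _)))) h))

    combination-◁ : ∀ {v} z → Combination v → NNv (α i ◁ z) → NNv (α j ◁ z) → NNv (v ◁ z)
    combination-◁ z (P , Q , a , b , h) p q = NNv-resp (≋-sym (≋-trans (◁-cong z h) (≋-trans (◁-⊕ z _ _) (λ k → +-cong (◁-⊛ z P (α i) k) (◁-⊛ z Q (α j) k)))))
      (NNv-⊕ (NNv-⊛ a p) (NNv-⊛ b q))

  -- Tits: s u > u makes the root α s ◁ u positive.

  private
    -- A strip of length at least `m s t` could be rewritten by the braid relation to begin with
    -- `s`, making `s` a descent of `u`.
    no-long-strip′ : ∀ {s t u} → s ≢ t → s ↑ u → (T : Strip t s u) → ¬ (m s t ℕ.≤ Strip.k T)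
    no-long-strip′ {s} {t} {u} s≢t s↑u T l = ℕ.<-asym s↑u (s≤s⇒ bound)
      where
      open Strip T
      open ≡.≡-Reasoning
      r : ℕ
      r = k ℕ.∸ m s t
      sp = alt-split t s (m s t) r
      rest : W
      rest = alt (proj₁ sp) (proj₁ (proj₂ sp)) r · z
      m' : ∃ λ m' → m s t ≡ suc m'
      m' with m s t | Order.0<ord (order (gen s · gen t))
      ... | suc m' | _ = m' , ≡.refl
      braid : alt t s (m s t) ≡ alt s t (m s t)
      braid = alt-mirror t s (m s t) (m s t) (m s t) (pow-flip s t (m s t) (Order.pow-ord (order (gen s · gen t)))) ≡.refl
      u≡ : u ≡ s ⊙ (alt t s (proj₁ m') · rest)
      u≡ = begin
        u                                                  ≡⟨ split ⟩
        alt t s k · z                                      ≡⟨ ≡.cong (λ k → alt t s k · z) (≡.sym (ℕ.m+[n∸m]≡n l)) ⟩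
        alt t s (m s t ℕ.+ r) · z                          ≡⟨ ≡.cong (_· z) (proj₂ (proj₂ sp)) ⟩
        (alt t s (m s t) · alt (proj₁ sp) (proj₁ (proj₂ sp)) r) · z  ≡⟨ assoc _ _ _ ⟩
        alt t s (m s t) · rest                             ≡⟨ ≡.cong (_· rest) braid ⟩
        alt s t (m s t) · rest                             ≡⟨ ≡.cong (λ k → alt s t k · rest) (proj₂ m') ⟩
        (s ⊙ alt t s (proj₁ m')) · rest                    ≡⟨ assoc _ _ _ ⟩
        s ⊙ (alt t s (proj₁ m') · rest)                    ∎
      bound : suc (ℓ (s ⊙ u)) ℕ.≤ ℓ u
      bound = ℕ.≤-trans (s≤s (ℕ.≤-trans (ℕ.≤-reflexive (≡.cong ℓ (≡.trans (≡.cong (gen s ·_) u≡) (gen-gen s _))))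
               (ℕ.≤-trans (ℓ-alt· t s (proj₁ m') rest) (ℕ.+-monoʳ-≤ (proj₁ m') (ℓ-alt· _ _ r z)))))
               (ℕ.≤-reflexive (≡.trans (≡.cong (ℕ._+ (r ℕ.+ ℓ z)) (≡.sym (proj₂ m'))) (≡.trans (≡.sym (ℕ.+-assoc (m s t) r (ℓ z)))
                 (≡.trans (≡.cong (ℕ._+ ℓ z) (ℕ.m+[n∸m]≡n l)) (≡.sym ℓ-add)))))
      s≤s⇒ : suc (ℓ (s ⊙ u)) ℕ.≤ ℓ u → ℓ (s ⊙ u) ℕ.< ℓ u
      s≤s⇒ h = h

  no-long-strip : ∀ {s t u} → s ≢ t → s ↑ u → (T : Strip t s u) → Strip.k T ℕ.< m s t
  no-long-strip s≢t s↑u T = ℕ.≰⇒> (no-long-strip′ s≢t s↑u T)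

  -- Induction on the length. The part of `u` generated by `s` and a descent `t` is shorter than
  -- `m s t`, so it takes `α s` to a non-negative combination of `α s` and `α t`; the induction
  -- hypothesis applies to both of these at the minimal coset representative `z`.
  tits-bounded : ∀ N u → ℓ u ℕ.≤ N → ∀ s → s ↑ u → NNv (α s ◁ u)
  tits-bounded N u l s s↑u with u ≟ e
  ... | yes u≡e = NNv-resp (≋-sym (≋-trans (◁-≡ (α s) u≡e) (◁-e (α s)))) (NNv-α s)
  tits-bounded zero u l s s↑u | no u≢e = ⊥-elim (u≢e (ℓ≡0 u (ℕ.n≤0⇒n≡0 l)))
  tits-bounded (suc N) u l s s↑u | no u≢e with has-descent u u≢e
  ... | t , t↓u with s Fin.≟ t
  ...   | yes ≡.refl = ⊥-elim (ℕ.<-asym s↑u t↓u)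
  ...   | no s≢t with strip t s u s↑u
  ...     | record { k = zero ; z = z ; split = sp ; a↑z = t↑z } = ⊥-elim (ℕ.<-asym t↓u (≡.subst (t ↑_) (≡.sym (≡.trans sp (identityˡ z))) t↑z))
  ...     | T@record { k = suc k ; z = z ; split = sp ; a↑z = t↑z ; b↑z = s↑z ; ℓ-add = add }
            = NNv-resp (≋-sym (≋-trans (◁-≡ (α s) sp) (◁-· _ z (α s))))
                         (combination-◁ z (α-alt (suc k) (no-long-strip s≢t s↑u T)) (tits-bounded N z z≤ s s↑z) (tits-bounded N z z≤ t t↑z))
    where
    open AltAction s≢t
    z≤ : ℓ z ℕ.≤ N
    z≤ = ℕ.≤-pred (ℕ.≤-trans (s≤s (ℕ.m≤n+m (ℓ z) k)) (ℕ.≤-trans (ℕ.≤-reflexive (≡.sym add)) l))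

  positive : ∀ {s u} → s ↑ u → NNv (α s ◁ u)
  positive {s} {u} h = tits-bounded (ℓ u) u ℕ.≤-refl s h

  negative : ∀ {s u} → s ↓ u → NNv (neg (α s ◁ u))
  negative {s} {u} h = NNv-resp (λ k → trans (solve 1 (λ a → a := :- (:- a)) refl _)
    (-‿cong (trans (sym (σ-self s (s ⊙ u) k)) (◁-≡ (α s) (gen-gen s u) k)))) (positive (↓-flip h))

  -- A nontrivial element has a descent `s` and makes `α s` negative, so it cannot fix it.
  faithful : ∀ w → (∀ v → v ◁ w ≋ v) → w ≡ e
  faithful w h with w ≟ e
  ... | yes q = q
  ... | no w≢e with has-descent w w≢e
  ...   | s , s↓w = ⊥-elim (1≉0 (NN-antisym (inj₂ Pos-1) (NN-resp (-‿cong (trans (h (α s) s) (δ-same s))) (negative s↓w s))))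

  root≉0 : ∀ x i → ¬ (∀ k → (α i ◁ x) k ≈ 0#)
  root≉0 x i h = 1≉0 (trans (sym (δ-same i)) (trans (sym (◁-inv x (α i) i)) (trans (◁-cong (inv x) (λ k → trans (h k) (sym (zeroˡ 0#))) i)
    (trans (◁-⊛ (inv x) 0# (λ _ → 0#) i) (zeroˡ _)))))

  rise-alt : ∀ {a b z} → a ≢ b → a ↑ z → b ↑ z → ∀ k → k ℕ.< m a b → a ↑ (alt b a k · z)
  rise-alt {a} {b} {z} a≢b a↑z b↑z k l with ↑-or-↓ a (alt b a k · z)
  ... | inj₁ h = h
  ... | inj₂ h = ⊥-elim (root≉0 (alt b a k · z) a (λ j → NN-antisym
          (NNv-resp (≋-sym (◁-· (alt b a k) z (α a))) (combination-◁ z (α-alt k l) (positive a↑z) (positive b↑z)) j) (negative h j)))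
    where open AltAction a≢b

  -- The reflection in the root α i ◁ x.

  refl-at : W → Fin n → W
  refl-at x i = inv x · (i ⊙ x)

  refl-at-◁ : ∀ x i v → v ◁ refl-at x i ≋ v ⊕ (- θ i (v ◁ inv x)) ⊛ (α i ◁ x)
  refl-at-◁ x i v = ≋-trans (◁-· (inv x) (i ⊙ x) v) (≋-trans (◁-⊙ i x _) (≋-trans (◁-cong x (λ k → solve 3 (λ v t a → v :- t :* a := v :+ (:- t) :* a) refl _ _ _))
    (≋-trans (◁-⊕ x _ _) (λ k → +-cong (inv-◁ x v k) (◁-⊛ x _ (α i) k)))))

  -- Two reflections with proportional roots differ by a transvection of finite order, hence agree.
  proportional : ∀ x i j κ → α i ◁ x ≋ κ ⊛ α j → refl-at x i ≡ gen j
  proportional x i j κ h = ≡.trans (≡.sym (≡.trans (assoc t (gen j) (gen j)) (≡.trans (≡.cong (t ·_) (gen-sq j)) (identityʳ t))))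
      (≡.trans (≡.cong (_· gen j) (faithful w fixed)) (identityˡ (gen j)))
    where
    t w : W
    t = refl-at x i
    w = t · gen j

    η : V → Carrier
    η v = κ * θ i (v ◁ inv x) - θ j v

    w-◁ : ∀ v → v ◁ w ≋ v ⊕ η v ⊛ α j
    w-◁ v = ≋-trans (◁-· t (gen j) v) (≋-trans (◁-cong (gen j) (≋-trans (refl-at-◁ x i v) (λ k → +-congˡ (trans (*-congˡ (h k)) (sym (*-assoc _ _ _))))))
      (≋-trans (◁-gen j _) (≋-trans (σ-⊕ j _ _) (λ k → trans (+-congˡ (trans (σ-⊛ j _ (α j) k) (*-congˡ (trans (σ-α j k) (-1⊛ (α j) k)))))
        (solve 5 (λ v t a s κ → (v :- t :* a) :+ ((:- s) :* κ) :* (:- a) := v :+ (κ :* s :- t) :* a) refl (v k) (θ j v) (α j k) (θ i (v ◁ inv x)) κ)))))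

    η-αj : η (α j) ≈ 0#
    η-αj = trans (+-cong (trans (sym (θ-⊛ i κ _)) (trans (θ-cong i (≋-trans (≋-sym (◁-⊛ (inv x) κ (α j))) (≋-trans (◁-cong (inv x) (≋-sym h)) (◁-inv x (α i)))))
      (trans (θ-α i i) (cartan-diag i)))) (-‿cong (trans (θ-α j j) (cartan-diag j)))) (-‿inverseʳ _)

    η-shift : ∀ v → η (v ⊕ η v ⊛ α j) ≈ η v
    η-shift v = trans (+-cong (*-congˡ (trans (θ-cong i (≋-trans (◁-⊕ (inv x) _ _) (λ k → +-congˡ (◁-⊛ (inv x) _ (α j) k)))) (trans (θ-⊕ i _ _) (+-congˡ (θ-⊛ i _ _)))))
        (-‿cong (trans (θ-⊕ j _ _) (+-congˡ (θ-⊛ j _ _)))))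
      (trans (solve 6 (λ κ a n b c d → κ :* (a :+ n :* b) :- (c :+ n :* d) := (κ :* a :- c) :+ n :* (κ :* b :- d)) refl κ _ (η v) _ _ _)
        (trans (+-congˡ (trans (*-congˡ η-αj) (zeroʳ _))) (+-identityʳ _)))

    pow-◁ : ∀ k v → v ◁ pow w k ≋ v ⊕ ((k ×[ K ]) * η v) ⊛ α j
    pow-◁ zero    v l = trans (◁-e v l) (solve 3 (λ v n a → v := v :+ (:0 :* n) :* a) refl (v l) (η v) (α j l))
    pow-◁ (suc k) v l = trans (◁-· w (pow w k) v l) (trans (◁-cong (pow w k) (w-◁ v) l) (trans (pow-◁ k _ l)
      (trans (+-congˡ (*-congʳ (*-congˡ (η-shift v)))) (trans (solve 4 (λ v n a k → (v :+ n :* a) :+ (k :* n) :* a := v :+ (n :+ k :* n) :* a) refl _ _ _ _)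
        (+-congˡ (*-congʳ (trans (+-congʳ (sym (*-identityˡ _))) (sym (distribʳ _ _ _)))))))))

    η≈0 : ∀ v → η v ≈ 0#
    η≈0 v with finite-order w
    ... | suc N , _ , _ , q = dom {suc N ×[ K ]} Nη≈0 (Pos-≉0 (numeral-Pos N))
      where
      Nη = (suc N ×[ K ]) * η v
      Nη≈0 : Nη ≈ 0#
      Nη≈0 = trans (solve 2 (λ v x → x := (v :+ x) :- v) refl (v j) Nη)
        (≈⇒-≈0 (trans (+-congˡ (sym (trans (*-congˡ (δ-same j)) (*-identityʳ _)))) (trans (sym (pow-◁ (suc N) v j)) (trans (◁-≡ v q j) (◁-e v j)))))

    fixed : ∀ v → v ◁ w ≋ v
    fixed v k = trans (w-◁ v k) (trans (+-congˡ (trans (*-congʳ (η≈0 v)) (zeroˡ _))) (+-identityʳ _))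

  refl-at-shift : ∀ x i s → s ⊙ (refl-at (x · gen s) i) ≡ refl-at x i · gen s
  refl-at-shift x i s = begin
    gen s · (inv (x · gen s) · (gen i · (x · gen s)))        ≡⟨ ≡.cong (λ v → gen s · (v · (gen i · (x · gen s)))) (≡.trans (inv-· x (gen s)) (≡.cong (_· inv x) (inv-gen s))) ⟩
    gen s · ((gen s · inv x) · (gen i · (x · gen s)))        ≡⟨ ≡.cong (gen s ·_) (assoc _ _ _) ⟩
    gen s · (gen s · (inv x · (gen i · (x · gen s))))        ≡⟨ gen-gen s _ ⟩
    inv x · (gen i · (x · gen s))                            ≡⟨ ≡.cong (inv x ·_) (≡.sym (assoc _ _ _)) ⟩
    inv x · ((gen i · x) · gen s)                            ≡⟨ ≡.sym (assoc _ _ _) ⟩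
    (inv x · (gen i · x)) · gen s                            ∎
    where open ≡.≡-Reasoning

  refl-at-⊙ : ∀ x i → refl-at (i ⊙ x) i ≡ refl-at x i
  refl-at-⊙ x i = ≡.trans (≡.cong₂ _·_ (≡.trans (inv-· (gen i) x) (≡.cong (inv x ·_) (inv-gen i))) (gen-gen i x)) (assoc _ _ _)

  refl-at-invol : ∀ x i → refl-at x i · refl-at x i ≡ e
  refl-at-invol x i = ≡.trans (assoc _ _ _) (≡.trans (≡.cong (inv x ·_) (≡.trans (assoc _ _ _) (≡.trans (≡.cong (gen i ·_) (cancel-invˡ x _)) (gen-gen i x)))) (inverseˡ x))

  ·-refl-at : ∀ x i u → x · (refl-at x i · u) ≡ i ⊙ (x · u)
  ·-refl-at x i u = ≡.trans (≡.cong (x ·_) (assoc _ _ _)) (≡.trans (cancel-invˡ x _) (assoc _ _ _))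

  private
    -- `σ s` changes only the coordinate at `s`. The other coordinates are therefore both
    -- non-negative and non-positive, hence zero, and the root is a multiple of `α s`.
    flip⇒gen : ∀ x i s → NNv (α i ◁ x) → NNv (neg (σ s (α i ◁ x))) → refl-at x i ≡ gen s
    flip⇒gen x i s p q = proportional x i s ((α i ◁ x) s) prop
      where
      prop : α i ◁ x ≋ ((α i ◁ x) s) ⊛ α s
      prop k with s Fin.≟ k
      ... | yes ≡.refl = sym (trans (*-congˡ (δ-same s)) (*-identityʳ _))
      ... | no s≢k = trans (NN-antisym (p k) (NN-resp (-‿cong (trans (+-congˡ (-‿cong (trans (*-congˡ (δ-diff s≢k)) (zeroʳ _)))) (solve 1 (λ a → a :- :0 := a) refl _))) (q k)))
                       (sym (trans (*-congˡ (δ-diff s≢k)) (zeroʳ _)))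

    root-gen : ∀ x i s → σ s (α i ◁ x) ≋ α i ◁ (x · gen s)
    root-gen x i s = ≋-sym (≋-trans (◁-· x (gen s) (α i)) (◁-gen s _))

    -- Strong exchange. Along the word the root must turn negative at some letter; there the
    -- transported reflection is that letter, so multiplying by the reflection deletes it.
    scan : ∀ ws x i → i ↑ x → i ↓ (x · word ws) → ∃ λ vs → word vs ≡ refl-at x i · word ws × length vs ℕ.< length ws
    scan []       x i a b = ⊥-elim (ℕ.<-asym a (≡.subst (i ↓_) (identityʳ x) b))
    scan (s ∷ ws) x i a b with ↑-or-↓ i (x · gen s)
    ... | inj₁ rise with scan ws (x · gen s) i rise (≡.subst (i ↓_) (≡.sym (assoc _ _ _)) b)
    ...   | vs , h , l = s ∷ vs , ≡.trans (≡.cong (gen s ·_) h) (≡.trans (≡.sym (assoc _ _ _)) (≡.trans (≡.cong (_· word ws) (refl-at-shift x i s)) (assoc _ _ _))) , s≤s l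
    scan (s ∷ ws) x i a b | inj₂ dn = ws , ≡.sym (≡.trans (≡.cong (_· word (s ∷ ws)) (flip⇒gen x i s (positive a) (NNv-resp (neg-cong (≋-sym (root-gen x i s))) (negative dn)))) (gen-gen s (word ws))) , ℕ.≤-refl

  -- The root `α i ◁ x` changes sign under `u`, that is, its reflection is an inversion of `u`.
  -- There are two constructors because the root named by `x` and `i` may itself have either sign.
  data Opposite (x : W) (i : Fin n) (u : W) : Set where
    ↑↓ : i ↑ x → i ↓ (x · u) → Opposite x i u
    ↓↑ : i ↓ x → i ↑ (x · u) → Opposite x i u

  data Same (x : W) (i : Fin n) (u : W) : Set where
    ↑↑ : i ↑ x → i ↑ (x · u) → Same x i u
    ↓↓ : i ↓ x → i ↓ (x · u) → Same x i u

  same-or-opposite : ∀ x i u → Same x i u ⊎ Opposite x i u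
  same-or-opposite x i u with ↑-or-↓ i x | ↑-or-↓ i (x · u)
  ... | inj₁ a | inj₁ b = inj₁ (↑↑ a b)
  ... | inj₁ a | inj₂ b = inj₂ (↑↓ a b)
  ... | inj₂ a | inj₁ b = inj₂ (↓↑ a b)
  ... | inj₂ a | inj₂ b = inj₁ (↓↓ a b)

  private
    exchange : ∀ x i u → i ↑ x → i ↓ (x · u) → ℓ (refl-at x i · u) ℕ.< ℓ u
    exchange x i u a b with reduced u
    ... | ws , h , l with scan ws x i a (≡.subst (λ u → i ↓ (x · u)) (≡.sym h) b)
    ...   | vs , g , k = ℕ.≤-trans (s≤s (ℕ.≤-trans (ℕ.≤-reflexive (≡.cong ℓ (≡.trans (≡.cong (refl-at x i ·_) (≡.sym h)) (≡.sym g)))) (ℓ-word vs))) (ℕ.≤-trans k (ℕ.≤-reflexive l))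

  opposite⇒< : ∀ {x i u} → Opposite x i u → ℓ (refl-at x i · u) ℕ.< ℓ u
  opposite⇒< {x} {i} {u} (↑↓ a b) = exchange x i u a b
  opposite⇒< {x} {i} {u} (↓↑ a b) = ≡.subst (λ t → ℓ (t · u) ℕ.< ℓ u) (refl-at-⊙ x i)
    (exchange (i ⊙ x) i u (↓-flip a) (≡.subst (i ↓_) (≡.sym (assoc _ _ _)) (↑-flip b)))

  same⇒> : ∀ {x i u} → Same x i u → ℓ u ℕ.< ℓ (refl-at x i · u)
  same⇒> {x} {i} {u} S = ≡.subst (λ v → ℓ v ℕ.< ℓ (refl-at x i · u)) back (opposite⇒< (opp S))
    where
    back : refl-at x i · (refl-at x i · u) ≡ u
    back = ≡.trans (≡.sym (assoc _ _ _)) (≡.trans (≡.cong (_· u) (refl-at-invol x i)) (identityˡ u))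
    opp : Same x i u → Opposite x i (refl-at x i · u)
    opp (↑↑ a b) = ↑↓ a (≡.subst (i ↓_) (≡.sym (·-refl-at x i u)) (↑-flip b))
    opp (↓↓ a b) = ↓↑ a (≡.subst (i ↑_) (≡.sym (·-refl-at x i u)) (↓-flip b))

  >⇒same : ∀ {x i u} → ℓ u ℕ.< ℓ (refl-at x i · u) → Same x i u
  >⇒same {x} {i} {u} h with same-or-opposite x i u
  ... | inj₁ S = S
  ... | inj₂ O = ⊥-elim (ℕ.<-asym h (opposite⇒< O))

  <⇒opposite : ∀ {x i u} → ℓ (refl-at x i · u) ℕ.< ℓ u → Opposite x i u
  <⇒opposite {x} {i} {u} h with same-or-opposite x i u
  ... | inj₁ S = ⊥-elim (ℕ.<-asym h (same⇒> S))
  ... | inj₂ O = O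

  opposite-gen : ∀ {x i s} → Opposite x i (gen s) → refl-at x i ≡ gen s
  opposite-gen {x} {i} {s} (↑↓ a b) = flip⇒gen x i s (positive a) (NNv-resp (neg-cong (≋-sym (root-gen x i s))) (negative b))
  opposite-gen {x} {i} {s} (↓↑ a b) = ≡.trans (≡.sym (refl-at-⊙ x i))
    (opposite-gen {i ⊙ x} {i} {s} (↑↓ (↓-flip a) (≡.subst (i ↓_) (≡.sym (assoc _ _ _)) (↑-flip b))))

-- Counting in lists without repetition.

bit : Bool → ℕ
bit b = if b then 1 else 0

count : {A : Set} → (A → Bool) → List A → ℕ
count f []       = 0
count f (x ∷ xs) = bit (f x) ℕ.+ count f xs

count-cong : {A : Set} {f g : A → Bool} (xs : List A) → (∀ x → x ∈ xs → f x ≡ g x) → count f xs ≡ count g xs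
count-cong []       h = ≡.refl
count-cong (x ∷ xs) h = ≡.cong₂ (λ b k → bit b ℕ.+ k) (h x (here ≡.refl)) (count-cong xs (λ y m → h y (there m)))

count-change : {A : Set} {f g : A → Bool} {t : A} (xs : List A) → Unique xs → t ∈ xs →
  (∀ x → x ∈ xs → x ≢ t → f x ≡ g x) → g t ≡ false → count f xs ≡ count g xs ℕ.+ bit (f t)
count-change {f = f} {g} {t} (x ∷ xs) (x∉ ∷ u) (here ≡.refl) h gt rewrite gt = ≡.trans (ℕ.+-comm (bit (f x)) _)
  (≡.cong (ℕ._+ bit (f x)) (count-cong xs (λ y m → h y (there m) (λ e → All.lookup x∉ m (≡.sym e)))))
count-change {f = f} {g} {t} (x ∷ xs) (x∉ ∷ u) (there m) h gt rewrite h x (here ≡.refl) (All.lookup x∉ m) =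
  ≡.trans (≡.cong (bit (g x) ℕ.+_) (count-change {f = f} {g} xs u m (λ y m → h y (there m)) gt)) (≡.sym (ℕ.+-assoc (bit (g x)) _ _))

module _ {A : Set} where
  remove : {x : A} (ys : List A) → x ∈ ys → List A
  remove (_ ∷ ys) (here _)  = ys
  remove (y ∷ ys) (there m) = y ∷ remove ys m

  length-remove : ∀ {x} ys (m : x ∈ ys) → length ys ≡ suc (length (remove ys m))
  length-remove (_ ∷ ys) (here _)  = ≡.refl
  length-remove (y ∷ ys) (there m) = ≡.cong suc (length-remove ys m)

  ∈-remove : ∀ {x z} ys (m : x ∈ ys) → z ≢ x → z ∈ ys → z ∈ remove ys m
  ∈-remove (_ ∷ ys) (here ≡.refl) h (here ≡.refl) = ⊥-elim (h ≡.refl)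
  ∈-remove (_ ∷ ys) (here ≡.refl) h (there k)   = k
  ∈-remove (y ∷ ys) (there m)   h (here ≡.refl) = here ≡.refl
  ∈-remove (y ∷ ys) (there m)   h (there k)   = there (∈-remove ys m h k)

  unique-length≤ : (xs ys : List A) → Unique xs → (∀ x → x ∈ xs → x ∈ ys) → length xs ℕ.≤ length ys
  unique-length≤ []       ys u         h = z≤n
  unique-length≤ (x ∷ xs) ys (x∉ ∷ u) h = ≡.subst (suc (length xs) ℕ.≤_) (≡.sym (length-remove ys (h x (here ≡.refl))))
    (s≤s (unique-length≤ xs (remove ys (h x (here ≡.refl))) u (λ z m → ∈-remove ys (h x (here ≡.refl)) (λ e → All.lookup x∉ m (≡.sym e)) (h z (there m)))))

  unique-length : (xs ys : List A) → Unique xs → Unique ys → (∀ x → x ∈ xs → x ∈ ys) → (∀ x → x ∈ ys → x ∈ xs) → length xs ≡ length ys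
  unique-length xs ys u v h k = ℕ.≤-antisym (unique-length≤ xs ys u h) (unique-length≤ ys xs v k)

-- Bruhat order, the list of reflections and the interval.

module Bruhat (C : FiniteCoxeterSystem) (ℓ : FiniteCoxeterSystem.W C → ℕ) (isLength : ∀ w → IsLength C w (ℓ w))
  (D : PosDomain) (cos : ℕ → CommutativeRing.Carrier (PosDomain.K D))
  (cos-angle : ∀ m → 2 ℕ.≤ m → m ℕ.≤ length (FiniteCoxeterSystem.elems C) → IsAngle D (cos m) m) where
  open ≡ using (refl; sym; trans; cong; subst)

  open FiniteCoxeterSystem C
  open Coxeter C ℓ isLength
  open Roots C ℓ isLength D cos cos-angle using (refl-at; refl-at-shift; refl-at-⊙; refl-at-invol; ·-refl-at; Same; Opposite; ↑↑; ↓↓; ↑↓; ↓↑;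
     same-or-opposite; opposite⇒<; same⇒>; >⇒same; <⇒opposite; opposite-gen)

  infix 4 _≼_
  _≼_ : W → W → Set
  _≼_ = _≤B_ C ℓ

  ≼-trans : ∀ {u v w} → u ≼ v → v ≼ w → u ≼ w
  ≼-trans p ≤B-refl         = p
  ≼-trans p (≤B-step q r l) = ≤B-step (≼-trans p q) r l

  ≼-ℓ : ∀ {u v} → u ≼ v → ℓ u ℕ.≤ ℓ v
  ≼-ℓ ≤B-refl         = ℕ.≤-refl
  ≼-ℓ (≤B-step q r l) = ℕ.≤-trans (≼-ℓ q) (ℕ.<⇒≤ l)

  IsRefl : W → Set
  IsRefl t = ∃ λ x → ∃ λ i → t ≡ refl-at x i

  -- Bruhat steps multiply by reflections on the right, whereas the inversion arguments use left
  -- factors; this is the passage between the two.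
  refl-at-right : ∀ x i v → refl-at x i · v ≡ v · (inv (x · v) · gen i · inv (inv (x · v)))
  refl-at-right x i v = begin
    (inv x · (gen i · x)) · v                              ≡⟨ assoc _ _ _ ⟩
    inv x · ((gen i · x) · v)                              ≡⟨ cong (inv x ·_) (assoc _ _ _) ⟩
    inv x · (gen i · (x · v))                              ≡⟨ sym (cong (_· (gen i · (x · v))) (cancel-invˡ v (inv x))) ⟩
    (v · (inv v · inv x)) · (gen i · (x · v))              ≡⟨ assoc _ _ _ ⟩
    v · ((inv v · inv x) · (gen i · (x · v)))              ≡⟨ cong (λ z → v · (z · (gen i · (x · v)))) (sym (inv-· x v)) ⟩
    v · (inv (x · v) · (gen i · (x · v)))                  ≡⟨ cong (v ·_) (sym (assoc _ _ _)) ⟩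
    v · (inv (x · v) · gen i · (x · v))                    ≡⟨ cong (λ z → v · (inv (x · v) · gen i · z)) (sym (inv-inv _)) ⟩
    v · (inv (x · v) · gen i · inv (inv (x · v)))          ∎
    where open ≡.≡-Reasoning

  right-refl-at : ∀ v u i → v · (u · gen i · inv u) ≡ refl-at (inv u · inv v) i · v
  right-refl-at v u i = sym (trans (refl-at-right _ i v) (trans (cong (λ y → v · (inv y · gen i · inv (inv y))) y≡) (cong (λ y → v · (y · gen i · inv y)) (inv-inv u))))
    where
    y≡ : (inv u · inv v) · v ≡ inv u
    y≡ = trans (assoc _ _ _) (trans (cong (inv u ·_) (inverseˡ v)) (identityʳ _))

  ≼-refl-at : ∀ {u v} x i → u ≼ v → ℓ v ℕ.< ℓ (refl-at x i · v) → u ≼ refl-at x i · v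
  ≼-refl-at {u} {v} x i p l = subst (u ≼_) (sym (refl-at-right x i v))
    (≤B-step p (inv (x · v) , i , refl) (subst (λ z → ℓ v ℕ.< ℓ z) (refl-at-right x i v) l))

  refl-at-e : ∀ s → refl-at e s ≡ gen s
  refl-at-e s = trans (cong₂ inv-e (identityʳ (gen s))) (identityˡ (gen s))
    where
    cong₂ : ∀ {a b c d : W} → a ≡ b → c ≡ d → a · c ≡ b · d
    cong₂ refl refl = refl

  ≼-⊙ : ∀ {s v} → s ↑ v → v ≼ s ⊙ v
  ≼-⊙ {s} {v} h = subst (λ t → v ≼ t · v) (refl-at-e s) (≼-refl-at e s ≤B-refl (subst (λ t → ℓ v ℕ.< ℓ (t · v)) (sym (refl-at-e s)) h))

  e≼ : ∀ v → e ≼ v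
  e≼ v = go (ℓ v) v ℕ.≤-refl
    where
    go : ∀ N v → ℓ v ℕ.≤ N → e ≼ v
    go N v l with v ≟ e
    ... | yes refl = ≤B-refl
    go zero    v l | no h = ⊥-elim (h (ℓ≡0 v (ℕ.n≤0⇒n≡0 l)))
    go (suc N) v l | no h with has-descent v h
    ... | s , d = subst (e ≼_) (gen-gen s v) (≼-trans (go N (s ⊙ v) (ℕ.≤-pred (ℕ.≤-trans d l))) (≼-⊙ (↓-flip d)))

  ≼-lift : ∀ s {x v} → x ≼ v → s ⊙ x ≼ s ⊙ v ⊎ s ⊙ x ≼ v
  ≼-lift s ≤B-refl = inj₁ ≤B-refl
  ≼-lift s {x} (≤B-step {v = v} q (u , i , refl) l) with ≼-lift s q
  ... | inj₂ p = inj₂ (≤B-step p (u , i , refl) l)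
  ... | inj₁ p with same-or-opposite (inv u · inv v) i (gen s)
  ...   | inj₂ O = inj₂ (subst (s ⊙ x ≼_) (trans (cong (_· v) (sym (opposite-gen O))) (sym (right-refl-at v u i))) p)
  ...   | inj₁ S = inj₁ (subst (s ⊙ x ≼_) eq (≼-refl-at (y · gen s) i p (same⇒> (shift S (>⇒same (subst (λ z → ℓ v ℕ.< ℓ z) (right-refl-at v u i) l))))))
    where
    y = inv u · inv v
    ysv : (y · gen s) · (s ⊙ v) ≡ y · v
    ysv = trans (assoc _ _ _) (cong (y ·_) (gen-gen s v))
    shift : Same y i (gen s) → Same y i v → Same (y · gen s) i (s ⊙ v)
    shift (↑↑ _ b) (↑↑ _ d) = ↑↑ b (subst (i ↑_) (sym ysv) d)
    shift (↓↓ _ b) (↓↓ _ d) = ↓↓ b (subst (i ↓_) (sym ysv) d)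
    shift (↑↑ a _) (↓↓ c _) = ⊥-elim (ℕ.<-asym a c)
    shift (↓↓ a _) (↑↑ c _) = ⊥-elim (ℕ.<-asym a c)
    eq : refl-at (y · gen s) i · (s ⊙ v) ≡ s ⊙ (v · (u · gen i · inv u))
    eq = begin
      refl-at (y · gen s) i · (gen s · v)                          ≡⟨ sym (gen-gen s _) ⟩
      s ⊙ s ⊙ (refl-at (y · gen s) i · (gen s · v))                ≡⟨ cong (s ⊙_) (sym (assoc _ _ _)) ⟩
      s ⊙ ((s ⊙ refl-at (y · gen s) i) · (gen s · v))              ≡⟨ cong (λ z → s ⊙ (z · (gen s · v))) (refl-at-shift y i s) ⟩
      s ⊙ ((refl-at y i · gen s) · (gen s · v))                    ≡⟨ cong (s ⊙_) (trans (assoc _ _ _) (cong (refl-at y i ·_) (gen-gen s v))) ⟩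
      s ⊙ (refl-at y i · v)                                        ≡⟨ cong (s ⊙_) (sym (right-refl-at v u i)) ⟩
      s ⊙ (v · (u · gen i · inv u))                                ∎
      where open ≡.≡-Reasoning

  T : List W
  T = deduplicate _≟_ (cartesianProductWith refl-at elems (allFin n))

  T-unique : Unique T
  T-unique = DecUnique.deduplicate-! _≟_ _

  T-complete : ∀ {t} → IsRefl t → t ∈ T
  T-complete (x , i , refl) = ∈-deduplicate⁺ _≟_ (∈-cartesianProductWith⁺ refl-at (elems-complete x) (∈-allFin i))

  T-sound : ∀ {t} → t ∈ T → IsRefl t
  T-sound m with ∈-cartesianProductWith⁻ refl-at elems (allFin n) (∈-deduplicate⁻ _≟_ _ m)
  ... | x , i , _ , _ , h = x , i , h

  module Interval (w : W) (L : List W) (enum : Enumerates C ℓ w L) where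

    I : W → Set
    I v = v ∈ L

    open DecMembership _≟_ using (_∈?_)

    I? : ∀ v → Dec (I v)
    I? v = v ∈? L

    I-unique : Unique L
    I-unique = proj₁ enum

    I⇒≼ : ∀ {v} → I v → v ≼ w
    I⇒≼ {v} m = proj₂ (proj₁ (proj₂ enum v) m)

    ≼⇒I : ∀ {v} → v ≼ w → I v
    ≼⇒I {v} p = proj₂ (proj₂ enum v) (e≼ v , p)

    I-lower : ∀ {x i v} → ℓ (refl-at x i · v) ℕ.< ℓ v → I v → I (refl-at x i · v)
    I-lower {x} {i} {v} l m = ≼⇒I (≼-trans (subst (refl-at x i · v ≼_) back (≼-refl-at x i ≤B-refl (subst (λ z → ℓ (refl-at x i · v) ℕ.< ℓ z) (sym back) l))) (I⇒≼ m))
      where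
      back : refl-at x i · (refl-at x i · v) ≡ v
      back = trans (sym (assoc _ _ _)) (trans (cong (_· v) (refl-at-invol x i)) (identityˡ v))

    module _ (regular : Regular C ℓ w) where

      -- Edges at `inv y · h` are rewritten as left factors `t` of `h`. In this form `y` stays fixed
      -- while `h` moves through a dihedral coset.
      neighbours : ∀ y h → I (inv y · h) → Σ (List W) λ N → Unique N × (∀ t → t ∈ N → IsRefl t × I (inv y · (t · h))) ×
        (∀ t → IsRefl t → I (inv y · (t · h)) → t ∈ N) × length N ≡ ℓ w
      neighbours y h m with regular (inv y · h) (proj₁ (proj₂ enum _) m)
      ... | N , u , char , len = map f N , Unique.map⁺ inj u , sound , complete , trans (List.length-map f N) len
        where
        v = inv y · h
        f : W → W
        f x = y · (x · inv h)
        f⁻¹ : W → W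
        f⁻¹ t = inv y · (t · h)
        f⁻¹f : ∀ x → f⁻¹ (f x) ≡ x
        f⁻¹f x = trans (cong (inv y ·_) (assoc _ _ _)) (trans (inv-cancelˡ y _) (trans (assoc _ _ _) (trans (cong (x ·_) (inverseˡ h)) (identityʳ x))))
        ff⁻¹ : ∀ t → f (f⁻¹ t) ≡ t
        ff⁻¹ t = trans (cong (y ·_) (assoc _ _ _)) (trans (cancel-invˡ y _) (trans (assoc _ _ _) (trans (cong (t ·_) (inverseʳ h)) (identityʳ t))))
        inj : ∀ {x x'} → f x ≡ f x' → x ≡ x'
        inj q = trans (sym (f⁻¹f _)) (trans (cong f⁻¹ q) (f⁻¹f _))
        edge⇒refl : ∀ u i → f (v · (u · gen i · inv u)) ≡ refl-at (inv u · inv h) i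
        edge⇒refl u i = begin
          y · ((inv y · h) · (u · gen i · inv u) · inv h)        ≡⟨ cong (y ·_) (trans (assoc _ _ _) (assoc _ _ _)) ⟩
          y · (inv y · (h · ((u · gen i · inv u) · inv h)))      ≡⟨ cancel-invˡ y _ ⟩
          h · ((u · gen i · inv u) · inv h)                      ≡⟨ sym (assoc _ _ _) ⟩
          (h · (u · gen i · inv u)) · inv h                      ≡⟨ cong (_· inv h) (right-refl-at h u i) ⟩
          (refl-at (inv u · inv h) i · h) · inv h                ≡⟨ trans (assoc _ _ _) (trans (cong (refl-at (inv u · inv h) i ·_) (inverseʳ h)) (identityʳ _)) ⟩
          refl-at (inv u · inv h) i                              ∎
          where open ≡.≡-Reasoning
        refl⇒edge : ∀ x i → f⁻¹ (refl-at x i) ≡ v · (inv (x · h) · gen i · inv (inv (x · h)))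
        refl⇒edge x i = trans (cong (inv y ·_) (refl-at-right x i h)) (sym (assoc _ _ _))
        sound : ∀ t → t ∈ map f N → IsRefl t × I (f⁻¹ t)
        sound t mt with ∈-map⁻ f mt
        ... | x , mx , refl with proj₁ (char x) mx
        ...   | int , (_ , (u , i , refl) , refl) = (inv u · inv h , i , edge⇒refl u i) , subst I (sym (f⁻¹f x)) (proj₂ (proj₂ enum x) int)
        complete : ∀ t → IsRefl t → I (f⁻¹ t) → t ∈ map f N
        complete t (x , i , refl) mi = subst (_∈ map f N) (ff⁻¹ t) (∈-map⁺ f (proj₂ (char (f⁻¹ t)) (proj₁ (proj₂ enum _) mi , _ , (inv (x · h) , i , refl) , refl⇒edge x i)))

-- Inversion counts and multiplication in the Hecke algebra.

module Hecke (C : FiniteCoxeterSystem) (ℓ : FiniteCoxeterSystem.W C → ℕ) (isLength : ∀ w → IsLength C w (ℓ w))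
  (D : PosDomain) (cos : ℕ → CommutativeRing.Carrier (PosDomain.K D))
  (cos-angle : ∀ m → 2 ℕ.≤ m → m ℕ.≤ length (FiniteCoxeterSystem.elems C) → IsAngle D (cos m) m) where

  open FiniteCoxeterSystem C
  open Coxeter C ℓ isLength
  open Roots C ℓ isLength D cos cos-angle using (refl-at; refl-at-⊙; refl-at-invol; ·-refl-at; Same; Opposite; ↑↑; ↓↓; ↑↓; ↓↑;
     same-or-opposite; opposite⇒<; same⇒>; >⇒same; <⇒opposite; opposite-gen)
  open Bruhat C ℓ isLength D cos cos-angle

  inv-·gen : ∀ z t → inv (z · gen t) ≡ t ⊙ inv z
  inv-·gen z t = ≡.trans (inv-· z (gen t)) (≡.cong (_· inv z) (inv-gen t))

  inv-⊙ : ∀ s z → inv (s ⊙ z) ≡ inv z · gen s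
  inv-⊙ s z = ≡.trans (inv-· (gen s) z) (≡.cong (inv z ·_) (inv-gen s))

  ℓ-·gen : ∀ z t → ℓ (z · gen t) ≡ ℓ (t ⊙ inv z)
  ℓ-·gen z t = ≡.trans (≡.sym (ℓ-inv (z · gen t))) (≡.cong ℓ (inv-·gen z t))

  gen-gen-right : ∀ z t → z · gen t · gen t ≡ z
  gen-gen-right z t = ≡.trans (assoc _ _ _) (≡.trans (≡.cong (z ·_) (gen-sq t)) (identityʳ z))

  crossing : ∀ {s t z} → Opposite (inv z) t (gen s) → s ⊙ z ≡ z · gen t
  crossing {s} {t} {z} O = ≡.trans (≡.cong (_· z) (≡.sym (opposite-gen O)))
    (≡.trans (assoc _ _ _) (≡.trans (≡.cong₂ _·_ (inv-inv z) (≡.trans (assoc _ _ _) (≡.trans (≡.cong (gen t ·_) (inverseˡ z)) (identityʳ _)))) ≡.refl))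

  module Inversions (w : W) (L : List W) (enum : Enumerates C ℓ w L) where
    open Interval w L enum

    test : W → W → W → Bool
    test y v t = does (ℓ (y · t) ℕ.<? ℓ y) ∧ does (I? (t · v))

    -- The exponent of q at T_(yv) in the product of T_y with the sum of the T_x over the interval:
    -- it counts inversions `t` of `y` for which `t · v` stays in the interval.
    N : W → W → ℕ
    N y v = count (test y v) T

    -- Multiplication by an ascent `s` keeps all inversions of `y` and adds exactly one,
    -- `refl-at y s`, because `s` makes only one positive root negative.
    N-step : ∀ y s v → s ↑ y → N (s ⊙ y) v ≡ N y v ℕ.+ bit (does (I? (refl-at y s · v)))
    N-step y s v a = ≡.trans (count-change {f = test (s ⊙ y) v} {g = test y v} {t = t} T T-unique (T-complete (y , s , ≡.refl)) other old) (≡.cong (λ b → N y v ℕ.+ bit b) new)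
      where
      t : W
      t = refl-at y s
      yt : y · t ≡ s ⊙ y
      yt = cancel-invˡ y (s ⊙ y)
      old : test y v t ≡ false
      old rewrite dec-false (ℓ (y · t) ℕ.<? ℓ y) (λ h → ℕ.<-asym a (≡.subst (λ z → ℓ z ℕ.< ℓ y) yt h)) = ≡.refl
      syt : (s ⊙ y) · t ≡ y
      syt = ≡.trans (assoc _ _ _) (≡.trans (≡.cong (gen s ·_) yt) (gen-gen s y))
      new : test (s ⊙ y) v t ≡ does (I? (t · v))
      new rewrite dec-true (ℓ ((s ⊙ y) · t) ℕ.<? ℓ (s ⊙ y)) (≡.subst (λ z → ℓ z ℕ.< ℓ (s ⊙ y)) (≡.sym syt) a) = ≡.refl
      ℓ-y·refl : ∀ y x i → ℓ (y · refl-at x i) ≡ ℓ (refl-at x i · inv y)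
      ℓ-y·refl y x i = ≡.trans (≡.sym (ℓ-inv _)) (≡.cong ℓ (≡.trans (inv-· y (refl-at x i)) (≡.cong (_· inv y) (≡.sym (inverse-unique _ _ (refl-at-invol x i))))))
      <⇔opposite : ∀ y x i → ℓ (y · refl-at x i) ℕ.< ℓ y → Opposite x i (inv y)
      <⇔opposite y x i h = <⇒opposite (≡.subst₂ ℕ._<_ (ℓ-y·refl y x i) (≡.sym (ℓ-inv y)) h)
      opposite⇔< : ∀ y x i → Opposite x i (inv y) → ℓ (y · refl-at x i) ℕ.< ℓ y
      opposite⇔< y x i O = ≡.subst₂ ℕ._<_ (≡.sym (ℓ-y·refl y x i)) (ℓ-inv y) (opposite⇒< O)
      other : ∀ r → r ∈ T → r ≢ t → test (s ⊙ y) v r ≡ test y v r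
      other r m r≢t with T-sound m
      ... | x , i , ≡.refl = ≡.cong (_∧ does (I? (refl-at x i · v))) same-test
        where
        xsy : x · inv (s ⊙ y) ≡ (x · inv y) · gen s
        xsy = ≡.trans (≡.cong (x ·_) (inv-⊙ s y)) (≡.sym (assoc _ _ _))
        conj : refl-at (x · inv y) i ≡ y · (refl-at x i · inv y)
        conj = begin
          inv (x · inv y) · (gen i · (x · inv y))      ≡⟨ ≡.cong (_· (gen i · (x · inv y))) (≡.trans (inv-· x (inv y)) (≡.cong (_· inv x) (inv-inv y))) ⟩
          (y · inv x) · (gen i · (x · inv y))          ≡⟨ assoc _ _ _ ⟩
          y · (inv x · (gen i · (x · inv y)))          ≡⟨ ≡.cong (λ z → y · (inv x · z)) (≡.sym (assoc _ _ _)) ⟩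
          y · (inv x · ((gen i · x) · inv y))          ≡⟨ ≡.cong (y ·_) (≡.sym (assoc _ _ _)) ⟩
          y · (refl-at x i · inv y)                    ∎
          where open ≡.≡-Reasoning
        not-s : ¬ Opposite (x · inv y) i (gen s)
        not-s O = r≢t (begin
          refl-at x i                                ≡⟨ ≡.sym (≡.trans (assoc _ _ _) (≡.trans (≡.cong (refl-at x i ·_) (inverseˡ y)) (identityʳ _))) ⟩
          (refl-at x i · inv y) · y                  ≡⟨ ≡.sym (inv-cancelˡ y _) ⟩
          inv y · (y · ((refl-at x i · inv y) · y))  ≡⟨ ≡.cong (inv y ·_) (≡.sym (assoc _ _ _)) ⟩
          inv y · ((y · (refl-at x i · inv y)) · y)  ≡⟨ ≡.cong (λ z → inv y · (z · y)) (≡.trans (≡.sym conj) (opposite-gen O)) ⟩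
          refl-at y s                                ∎)
          where open ≡.≡-Reasoning
        to : Opposite x i (inv (s ⊙ y)) → Opposite x i (inv y)
        to O with same-or-opposite x i (inv y)
        to O | inj₂ O' = O'
        to (↑↓ a b) | inj₁ (↑↑ _ c) = ⊥-elim (not-s (↑↓ c (≡.subst (i ↓_) xsy b)))
        to (↑↓ a b) | inj₁ (↓↓ c _) = ⊥-elim (ℕ.<-asym a c)
        to (↓↑ a b) | inj₁ (↓↓ _ c) = ⊥-elim (not-s (↓↑ c (≡.subst (i ↑_) xsy b)))
        to (↓↑ a b) | inj₁ (↑↑ c _) = ⊥-elim (ℕ.<-asym a c)
        from : Opposite x i (inv y) → Opposite x i (inv (s ⊙ y))
        from O with same-or-opposite x i (inv (s ⊙ y))
        from O | inj₂ O' = O'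
        from (↑↓ a b) | inj₁ (↑↑ _ c) = ⊥-elim (not-s (↓↑ b (≡.subst (i ↑_) xsy c)))
        from (↑↓ a b) | inj₁ (↓↓ c _) = ⊥-elim (ℕ.<-asym a c)
        from (↓↑ a b) | inj₁ (↓↓ _ c) = ⊥-elim (not-s (↑↓ b (≡.subst (i ↓_) xsy c)))
        from (↓↑ a b) | inj₁ (↑↑ c _) = ⊥-elim (ℕ.<-asym a c)
        same-test : does (ℓ ((s ⊙ y) · refl-at x i) ℕ.<? ℓ (s ⊙ y)) ≡ does (ℓ (y · refl-at x i) ℕ.<? ℓ y)
        same-test = does-⇔ (mk⇔ (λ k → opposite⇔< y x i (to (<⇔opposite (s ⊙ y) x i k))) (λ h → opposite⇔< (s ⊙ y) x i (from (<⇔opposite y x i h))))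
          (ℓ ((s ⊙ y) · refl-at x i) ℕ.<? ℓ (s ⊙ y)) (ℓ (y · refl-at x i) ℕ.<? ℓ y)

    -- Under this condition the coefficient q^N(y,v) + (q - 1) q^N(y,tv), which arises when `y` is
    -- extended by `s`, is again a power of q.
    Balanced : Set
    Balanced = ∀ y s v → s ↑ y → I v → I (refl-at y s · v) → N y v ≡ N y (refl-at y s · v)

  module Operators (R : CRing) (q : CommutativeRing.Carrier R) where
    open CommutativeRing R hiding (zero)
    open IntSolver R
    open import Algebra.Properties.Semiring.Exp semiring using (_^_)

    Fun : Set
    Fun = W → Carrier

    -- Coefficient functions of T_s · Σ g(z) T_z and Σ g(z) T_z · T_t.

    lam' : ∀ s (g : Fun) z → s ↑ z ⊎ s ↓ z → Carrier
    lam' s g z (inj₁ _) = q * g (s ⊙ z)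
    lam' s g z (inj₂ _) = g (s ⊙ z) + (q - 1#) * g z

    lam : Fin n → Fun → Fun
    lam s g z = lam' s g z (↑-or-↓ s z)

    rho' : ∀ t (g : Fun) z → t ↑ inv z ⊎ t ↓ inv z → Carrier
    rho' t g z (inj₁ _) = q * g (z · gen t)
    rho' t g z (inj₂ _) = g (z · gen t) + (q - 1#) * g z

    rho : Fin n → Fun → Fun
    rho t g z = rho' t g z (↑-or-↓ t (inv z))

    lam-↑ : ∀ {s z} g → s ↑ z → lam s g z ≈ q * g (s ⊙ z)
    lam-↑ {s} {z} g a with ↑-or-↓ s z
    ... | inj₁ _ = refl
    ... | inj₂ b = ⊥-elim (ℕ.<-asym a b)

    lam-↓ : ∀ {s z} g → s ↓ z → lam s g z ≈ g (s ⊙ z) + (q - 1#) * g z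
    lam-↓ {s} {z} g b with ↑-or-↓ s z
    ... | inj₁ a = ⊥-elim (ℕ.<-asym a b)
    ... | inj₂ _ = refl

    rho-↑ : ∀ {t z} g → t ↑ inv z → rho t g z ≈ q * g (z · gen t)
    rho-↑ {t} {z} g a with ↑-or-↓ t (inv z)
    ... | inj₁ _ = refl
    ... | inj₂ b = ⊥-elim (ℕ.<-asym a b)

    rho-↓ : ∀ {t z} g → t ↓ inv z → rho t g z ≈ g (z · gen t) + (q - 1#) * g z
    rho-↓ {t} {z} g b with ↑-or-↓ t (inv z)
    ... | inj₁ a = ⊥-elim (ℕ.<-asym a b)
    ... | inj₂ _ = refl

    lam-cong : ∀ s {g h} → (∀ z → g z ≈ h z) → ∀ z → lam s g z ≈ lam s h z
    lam-cong s e z with ↑-or-↓ s z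
    ... | inj₁ _ = *-congˡ (e _)
    ... | inj₂ _ = +-cong (e _) (*-congˡ (e _))

    lam-+ : ∀ s g h z → lam s (λ z → g z + h z) z ≈ lam s g z + lam s h z
    lam-+ s g h z with ↑-or-↓ s z
    ... | inj₁ _ = distribˡ _ _ _
    ... | inj₂ _ = solve 5 (λ a b c x y → (a :+ b) :+ c :* (x :+ y) := (a :+ c :* x) :+ (b :+ c :* y)) refl _ _ _ _ _

    lam-0 : ∀ s z → lam s (λ _ → 0#) z ≈ 0#
    lam-0 s z with ↑-or-↓ s z
    ... | inj₁ _ = zeroʳ q
    ... | inj₂ _ = trans (+-congˡ (zeroʳ _)) (+-identityˡ 0#)

    private
      at : ∀ (g : Fun) {x y} → x ≡ y → g x ≈ g y
      at g h = reflexive (≡.cong g h)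

      cross : ∀ s t g z → s ⊙ z ≡ z · gen t → lam s (rho t g) z ≈ rho t (lam s g) z
      cross s t g z h = go (↑-or-↓ s z) (↑-or-↓ t (inv z))
        where
        back : s ⊙ z · gen t ≡ z
        back = ≡.trans (≡.cong (_· gen t) h) (gen-gen-right z t)
        back″ : s ⊙ (z · gen t) ≡ z
        back″ = ≡.trans (≡.cong (s ⊙_) (≡.sym h)) (gen-gen s z)
        t⊙ : t ⊙ inv z ≡ inv (s ⊙ z)
        t⊙ = ≡.trans (≡.sym (inv-·gen z t)) (≡.cong inv (≡.sym h))
        go : s ↑ z ⊎ s ↓ z → t ↑ inv z ⊎ t ↓ inv z → lam s (rho t g) z ≈ rho t (lam s g) z
        go (inj₁ a) (inj₂ b) = ⊥-elim (ℕ.<-asym a (≡.subst₂ ℕ._<_ (≡.trans (≡.sym (ℓ-·gen z t)) (≡.cong ℓ (≡.sym h))) (ℓ-inv z) b))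
        go (inj₂ a) (inj₁ b) = ⊥-elim (ℕ.<-asym a (≡.subst₂ ℕ._<_ (ℓ-inv z) (≡.trans (≡.sym (ℓ-·gen z t)) (≡.cong ℓ (≡.sym h))) b))
        go (inj₁ a) (inj₁ b) = trans (lam-↑ (rho t g) a) (trans
          (*-congˡ (trans (rho-↓ g (≡.subst (t ↓_) t⊙ (↑-flip b))) (trans (+-cong (at g back) (*-congˡ (at g h))) (sym (trans (lam-↓ g (≡.subst (s ↓_) h (↑-flip a))) (+-congʳ (at g back″)))))))
          (sym (rho-↑ (lam s g) b)))
        go (inj₂ a) (inj₂ b) = trans (lam-↓ (rho t g) a) (trans
          (+-cong (trans (rho-↑ g (≡.subst (t ↑_) t⊙ (↓-flip b))) (trans (*-congˡ (at g back)) (sym (trans (lam-↑ g (≡.subst (s ↑_) h (↓-flip a))) (*-congˡ (at g back″))))))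
            (*-congˡ (trans (rho-↓ g b) (sym (trans (lam-↓ g a) (+-congʳ (at g h)))))))
          (sym (rho-↓ (lam s g) b)))

    private
      data Agree (P Q P' Q' : Set) : Set where
        both-up   : P → P' → Agree P Q P' Q'
        both-down : Q → Q' → Agree P Q P' Q'

      right-status : ∀ s t z → Agree (t ↑ inv z) (t ↓ inv z) (t ↑ inv (s ⊙ z)) (t ↓ inv (s ⊙ z)) ⊎ (s ⊙ z ≡ z · gen t)
      right-status s t z with same-or-opposite (inv z) t (gen s)
      ... | inj₂ O       = inj₂ (crossing O)
      ... | inj₁ (↑↑ a b) = inj₁ (both-up a (≡.subst (t ↑_) (≡.sym (inv-⊙ s z)) b))
      ... | inj₁ (↓↓ a b) = inj₁ (both-down a (≡.subst (t ↓_) (≡.sym (inv-⊙ s z)) b))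

      left-status : ∀ s t z → Agree (s ↑ z) (s ↓ z) (s ↑ (z · gen t)) (s ↓ (z · gen t)) ⊎ (s ⊙ z ≡ z · gen t)
      left-status s t z with same-or-opposite z s (gen t)
      ... | inj₁ (↑↑ a b) = inj₁ (both-up a b)
      ... | inj₁ (↓↓ a b) = inj₁ (both-down a b)
      ... | inj₂ O = inj₂ (≡.trans (≡.sym (cancel-invˡ z _)) (≡.cong (z ·_) (opposite-gen O)))

    -- Commutation of left and right multiplication is all the associativity that is needed, so the
    -- operators can stand in for the algebra. Either `s ⊙ z` and `z · gen t` coincide and both
    -- operators use the same two values, or neither multiplication affects whether the other
    -- lengthens.
    lam-rho : ∀ s t g z → lam s (rho t g) z ≈ rho t (lam s g) z
    lam-rho s t g z with left-status s t z | right-status s t z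
    ... | inj₂ h | _      = cross s t g z h
    ... | inj₁ _ | inj₂ h = cross s t g z h
    ... | inj₁ (both-up a a') | inj₁ (both-up b b') = trans (lam-↑ (rho t g) a) (trans (*-congˡ (trans (rho-↑ g b') (*-congˡ (at g (assoc _ _ _)))))
          (sym (trans (rho-↑ (lam s g) b) (*-congˡ (lam-↑ g a')))))
    ... | inj₁ (both-up a a') | inj₁ (both-down b b') = trans (lam-↑ (rho t g) a) (trans (*-congˡ (trans (rho-↓ g b') (+-congʳ (at g (assoc _ _ _)))))
          (trans (solve 4 (λ q x r y → q :* (x :+ r :* y) := q :* x :+ r :* (q :* y)) refl _ _ _ _) (sym (trans (rho-↓ (lam s g) b) (+-cong (lam-↑ g a') (*-congˡ (lam-↑ g a)))))))
    ... | inj₁ (both-down a a') | inj₁ (both-up b b') = trans (lam-↓ (rho t g) a) (trans (+-cong (trans (rho-↑ g b') (*-congˡ (at g (assoc _ _ _)))) (*-congˡ (rho-↑ g b)))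
          (trans (solve 4 (λ q x r y → q :* x :+ r :* (q :* y) := q :* (x :+ r :* y)) refl _ _ _ _) (sym (trans (rho-↑ (lam s g) b) (*-congˡ (lam-↓ g a'))))))
    ... | inj₁ (both-down a a') | inj₁ (both-down b b') = trans (lam-↓ (rho t g) a) (trans (+-cong (trans (rho-↓ g b') (+-congʳ (at g (assoc _ _ _)))) (*-congˡ (rho-↓ g b)))
          (trans (solve 5 (λ x r y u v → (x :+ r :* y) :+ r :* (u :+ r :* v) := (x :+ r :* u) :+ r :* (y :+ r :* v)) refl _ _ _ _ _)
            (sym (trans (rho-↓ (lam s g) b) (+-cong (lam-↓ g a') (*-congˡ (lam-↓ g a)))))))

    lamW : List (Fin n) → Fun → Fun
    lamW []       g = g
    lamW (s ∷ ws) g = lam s (lamW ws g)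

    lamW-cong : ∀ ws {g h} → (∀ z → g z ≈ h z) → ∀ z → lamW ws g z ≈ lamW ws h z
    lamW-cong []       e = e
    lamW-cong (s ∷ ws) e = lam-cong s (lamW-cong ws e)

    lamW-rho : ∀ ws t g z → lamW ws (rho t g) z ≈ rho t (lamW ws g) z
    lamW-rho []       t g z = refl
    lamW-rho (s ∷ ws) t g z = trans (lam-cong s (lamW-rho ws t g) z) (lam-rho s t (lamW ws g) z)

    lamW-+ : ∀ ws g h z → lamW ws (λ z → g z + h z) z ≈ lamW ws g z + lamW ws h z
    lamW-+ []       g h z = refl
    lamW-+ (s ∷ ws) g h z = trans (lam-cong s (lamW-+ ws g h) z) (lam-+ s _ _ z)

    lamW-0 : ∀ ws z → lamW ws (λ _ → 0#) z ≈ 0#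
    lamW-0 []       z = refl
    lamW-0 (s ∷ ws) z = trans (lam-cong s (lamW-0 ws) z) (lam-0 s z)

    ∑ : List W → Fun → Carrier
    ∑ []       g = 0#
    ∑ (x ∷ xs) g = g x + ∑ xs g

    ∑-cong : ∀ xs {g h} → (∀ x → g x ≈ h x) → ∑ xs g ≈ ∑ xs h
    ∑-cong []       e = refl
    ∑-cong (x ∷ xs) e = +-cong (e x) (∑-cong xs e)

    lamW-∑ : ∀ ws xs (g : W → Fun) z → lamW ws (λ z → ∑ xs (λ x → g x z)) z ≈ ∑ xs (λ x → lamW ws (g x) z)
    lamW-∑ ws []       g z = lamW-0 ws z
    lamW-∑ ws (x ∷ xs) g z = trans (lamW-+ ws (g x) (λ z → ∑ xs (λ x → g x z)) z) (+-congˡ (lamW-∑ ws xs g z))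

    Δ : W → Fun
    Δ x z = if does (x ≟ z) then 1# else 0#

    Δ-same : ∀ {x z} → x ≡ z → Δ x z ≈ 1#
    Δ-same {x} {z} h rewrite dec-true (x ≟ z) h = refl

    Δ-diff : ∀ {x z} → x ≢ z → Δ x z ≈ 0#
    Δ-diff {x} {z} h rewrite dec-false (x ≟ z) h = refl

    ∑-Δ-out : ∀ xs z → (∀ x → x ∈ xs → x ≢ z) → ∑ xs (λ x → Δ x z) ≈ 0#
    ∑-Δ-out []       z h = refl
    ∑-Δ-out (x ∷ xs) z h = trans (+-cong (Δ-diff (h x (here ≡.refl))) (∑-Δ-out xs z (λ y m → h y (there m)))) (+-identityˡ 0#)

    ∑-Δ-in : ∀ xs z → Unique xs → z ∈ xs → ∑ xs (λ x → Δ x z) ≈ 1#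
    ∑-Δ-in (x ∷ xs) z (x∉ ∷ u) (here ≡.refl) = trans (+-cong (Δ-same {x} ≡.refl) (∑-Δ-out xs x (λ y m e → All.lookup x∉ m (≡.sym e)))) (+-identityʳ 1#)
    ∑-Δ-in (x ∷ xs) z (x∉ ∷ u) (there m)     = trans (+-cong (Δ-diff (All.lookup x∉ m)) (∑-Δ-in xs z u m)) (+-identityˡ 1#)

    lam-Δ : ∀ {s y} → s ↑ y → ∀ z → lam s (Δ y) z ≈ Δ (s ⊙ y) z
    lam-Δ {s} {y} a z with y ≟ (s ⊙ z) | ↑-or-↓ s z
    ... | yes ≡.refl | inj₁ b = ⊥-elim (ℕ.<-asym b (≡.subst (s ↓_) (gen-gen s z) (↑-flip a)))
    ... | yes ≡.refl | inj₂ b = trans (+-cong (Δ-same {s ⊙ z} ≡.refl) (*-congˡ (Δ-diff (λ e → ℕ.<-irrefl (≡.cong ℓ e) b))))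
             (trans (trans (+-congˡ (zeroʳ _)) (+-identityʳ 1#)) (sym (Δ-same (gen-gen s z))))
    ... | no h | inj₁ b = trans (*-congˡ (Δ-diff h)) (trans (zeroʳ q) (sym (Δ-diff (λ e → h (≡.trans (≡.sym (gen-gen s y)) (≡.cong (s ⊙_) e))))))
    ... | no h | inj₂ b = trans (+-cong (Δ-diff h) (*-congˡ (Δ-diff (λ { ≡.refl → ℕ.<-asym a b }))))
             (trans (trans (+-congˡ (zeroʳ _)) (+-identityʳ 0#)) (sym (Δ-diff (λ e → h (≡.trans (≡.sym (gen-gen s y)) (≡.cong (s ⊙_) e))))))

    rho-Δ : ∀ {t x} → t ↑ inv x → ∀ z → rho t (Δ x) z ≈ Δ (x · gen t) z
    rho-Δ {t} {x} a z with x ≟ (z · gen t) | ↑-or-↓ t (inv z)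
    ... | yes ≡.refl | inj₁ b = ⊥-elim (ℕ.<-asym b (≡.subst (t ↓_) (gen-gen t (inv z)) (↑-flip (≡.subst (t ↑_) (inv-·gen z t) a))))
    ... | yes ≡.refl | inj₂ b = trans (+-cong (Δ-same {z · gen t} ≡.refl) (*-congˡ (Δ-diff (λ e → ℕ.<-irrefl (≡.trans (≡.sym (ℓ-·gen z t)) (≡.trans (≡.cong ℓ e) (≡.sym (ℓ-inv z)))) b))))
             (trans (trans (+-congˡ (zeroʳ _)) (+-identityʳ 1#)) (sym (Δ-same (gen-gen-right z t))))
    ... | no h | inj₁ b = trans (*-congˡ (Δ-diff h)) (trans (zeroʳ q) (sym (Δ-diff (λ e → h (≡.trans (≡.sym (gen-gen-right x t)) (≡.cong (_· gen t) e))))))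
    ... | no h | inj₂ b = trans (+-cong (Δ-diff h) (*-congˡ (Δ-diff (λ { ≡.refl → ℕ.<-asym a b }))))
             (trans (trans (+-congˡ (zeroʳ _)) (+-identityʳ 0#)) (sym (Δ-diff (λ e → h (≡.trans (≡.sym (gen-gen-right x t)) (≡.cong (_· gen t) e))))))

    data Reduced : List (Fin n) → Set where
      []  : Reduced []
      _∷_ : ∀ {s ws} → s ↑ word ws → Reduced ws → Reduced (s ∷ ws)

    is-reduced : ∀ ws → length ws ≡ ℓ (word ws) → Reduced ws
    is-reduced []       h = []
    is-reduced (s ∷ ws) h = ℕ.≤-trans (s≤s (ℓ-word ws)) (ℕ.≤-reflexive h) ∷ is-reduced ws
      (ℕ.≤-antisym (ℕ.≤-pred (ℕ.≤-trans (ℕ.≤-reflexive h) (ℓ-⊙≤ s (word ws)))) (ℓ-word ws))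

    lamW-Δe : ∀ {ws} → Reduced ws → ∀ z → lamW ws (Δ e) z ≈ Δ (word ws) z
    lamW-Δe []       z = refl
    lamW-Δe (_∷_ {s} a r) z = trans (lam-cong s (lamW-Δe r) z) (lam-Δ a z)

    longest : Σ W λ w₀ → ∀ w → ℓ w ℕ.≤ ℓ w₀
    longest with go elems
      where
      go : ∀ xs → Σ W λ w₀ → ∀ w → w ∈ xs → ℓ w ℕ.≤ ℓ w₀
      go []       = e , λ _ ()
      go (x ∷ xs) with go xs
      ... | y , h with ℕ.≤-total (ℓ x) (ℓ y)
      ...   | inj₁ l = y , λ { w (here ≡.refl) → l ; w (there m) → h w m }
      ...   | inj₂ l = x , λ { w (here ≡.refl) → ℕ.≤-refl ; w (there m) → ℕ.≤-trans (h w m) l }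
    ... | y , h = y , λ w → h w (elems-complete w)

    w₀ : W
    w₀ = proj₁ longest

    -- Otherwise the reflection would lengthen `inv w₀`, whose length is maximal.
    w₀-opposite : ∀ x i → Opposite x i (inv w₀)
    w₀-opposite x i with same-or-opposite x i (inv w₀)
    ... | inj₂ O = O
    ... | inj₁ S = ⊥-elim (ℕ.<⇒≱ (same⇒> S) (ℕ.≤-trans (proj₂ longest _) (ℕ.≤-reflexive (≡.sym (ℓ-inv w₀)))))

    module RPolynomials (r : W → W → Carrier)
      (r-not≤ : ∀ u w → ¬ (u ≼ w) → r u w ≈ 0#)
      (r-diag : ∀ u → r u u ≈ 1#)
      (r-desc : ∀ u w i → ℓ (w · gen i) ℕ.< ℓ w → ℓ (u · gen i) ℕ.< ℓ u → r u w ≈ r (u · gen i) (w · gen i))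
      (r-asc  : ∀ u w i → ℓ (w · gen i) ℕ.< ℓ w → ℓ u ℕ.< ℓ (u · gen i) → r u w ≈ (q - 1#) * r u (w · gen i) + q * r (u · gen i) (w · gen i)) where

      w₀-word : List (Fin n)
      w₀-word = proj₁ (reduced w₀)

      w₀-reduced : Reduced w₀-word
      w₀-reduced = is-reduced w₀-word (≡.trans (proj₂ (proj₂ (reduced w₀))) (≡.cong ℓ (≡.sym (proj₁ (proj₂ (reduced w₀))))))

      -- T_(w₀) T_x is the sum of q^ℓ(v) R_(v,x) T_(w₀v), by induction along a right descent `i` of
      -- `x`. Passing from `v` to `w₀ · v` exchanges right ascents and descents, so the quadratic
      -- relation produces two terms exactly where the recursion for R does.
      coefficient : ∀ N x → ℓ x ℕ.≤ N → ∀ v → lamW w₀-word (Δ x) (w₀ · v) ≈ q ^ ℓ v * r v x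
      coefficient N x l v with x ≟ e
      ... | yes ≡.refl = trans (lamW-Δe w₀-reduced (w₀ · v)) (trans (reflexive (≡.cong (λ y → Δ y (w₀ · v)) (proj₁ (proj₂ (reduced w₀))))) base)
        where
        base : Δ w₀ (w₀ · v) ≈ q ^ ℓ v * r v e
        base with v ≟ e
        ... | yes ≡.refl = trans (Δ-same (≡.sym (identityʳ w₀))) (sym (trans (*-cong (reflexive (≡.cong (q ^_) ℓ-e)) (r-diag e)) (*-identityˡ 1#)))
        ... | no h = trans (Δ-diff (λ eq → h (cancelˡ w₀ v e (≡.trans (≡.sym eq) (≡.sym (identityʳ w₀))))))
                       (sym (trans (*-congˡ (r-not≤ v e (λ p → h (ℓ≡0 v (ℕ.n≤0⇒n≡0 (ℕ.≤-trans (≼-ℓ p) (ℕ.≤-reflexive ℓ-e))))))) (zeroʳ _)))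
      coefficient zero    x l v | no h = ⊥-elim (h (ℓ≡0 x (ℕ.n≤0⇒n≡0 l)))
      coefficient (suc N) x l v | no h with has-descent (inv x) (λ q → h (≡.trans (≡.sym (inv-inv x)) (≡.trans (≡.cong inv q) inv-e)))
      ... | i , i↓ = trans (lamW-cong w₀-word (λ z → trans (reflexive (≡.cong (λ y → Δ y z) (≡.sym (gen-gen-right x i)))) (sym (rho-Δ i↑x' z))) (w₀ · v))
                       (trans (lamW-rho w₀-word i (Δ x') (w₀ · v)) (step-case (w₀-opposite (inv v) i)))
        where
        x' : W
        x' = x · gen i
        x'<x : ℓ x' ℕ.< ℓ x
        x'<x = ≡.subst₂ ℕ._<_ (≡.sym (ℓ-·gen x i)) (ℓ-inv x) i↓
        i↑x' : i ↑ inv x'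
        i↑x' = ≡.subst (i ↑_) (≡.sym (inv-·gen x i)) (↓-flip i↓)
        G : Fun
        G = lamW w₀-word (Δ x')
        IH : ∀ v → G (w₀ · v) ≈ q ^ ℓ v * r v x'
        IH = coefficient N x' (ℕ.≤-pred (ℕ.≤-trans x'<x l))
        w₀v : inv v · inv w₀ ≡ inv (w₀ · v)
        w₀v = ≡.sym (inv-· w₀ v)
        vs : G (w₀ · v · gen i) ≈ q ^ ℓ (v · gen i) * r (v · gen i) x'
        vs = trans (reflexive (≡.cong G (assoc _ _ _))) (IH (v · gen i))
        step-case : Opposite (inv v) i (inv w₀) → rho i G (w₀ · v) ≈ q ^ ℓ v * r v x
        step-case (↑↓ a b) = trans (rho-↓ G (≡.subst (i ↓_) w₀v b)) (trans (+-cong (trans vs (*-congʳ (reflexive (≡.cong (q ^_) ℓ-up)))) (*-congˡ (IH v)))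
           (trans (solve 5 (λ q p a b o → (q :* p) :* a :+ (q :- o) :* (p :* b) := p :* ((q :- o) :* b :+ q :* a)) refl q (q ^ ℓ v) _ _ 1#)
             (*-congˡ (sym (r-asc v x i x'<x (≡.subst₂ ℕ._<_ (ℓ-inv v) (≡.sym (ℓ-·gen v i)) a))))))
          where
          ℓ-up : ℓ (v · gen i) ≡ suc (ℓ v)
          ℓ-up = ≡.trans (ℓ-·gen v i) (≡.trans (↑-suc a) (≡.cong suc (ℓ-inv v)))
        step-case (↓↑ a b) = trans (rho-↑ G (≡.subst (i ↑_) w₀v b)) (trans (*-congˡ vs) (trans (sym (*-assoc _ _ _))
           (*-cong (reflexive (≡.cong (q ^_) ℓ-down)) (sym (r-desc v x i x'<x (≡.subst₂ ℕ._<_ (≡.sym (ℓ-·gen v i)) (ℓ-inv v) a))))))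
          where
          ℓ-down : suc (ℓ (v · gen i)) ≡ ℓ v
          ℓ-down = ≡.trans (≡.cong suc (ℓ-·gen v i)) (≡.trans (≡.sym (↓-suc a)) (ℓ-inv v))

      module Process (w : W) (L : List W) (enum : Enumerates C ℓ w L) where
        open Interval w L enum

        open Inversions w L enum

        module _ (balanced : Balanced) where
          value : W → W → Carrier
          value y v = if does (I? v) then q ^ N y v else 0#

          value-in : ∀ {y v} → I v → value y v ≈ q ^ N y v
          value-in {y} {v} h rewrite dec-true (I? v) h = refl

          value-out : ∀ {y v} → ¬ I v → value y v ≈ 0#
          value-out {y} {v} h rewrite dec-false (I? v) h = refl

          N-in : ∀ {y s v} → s ↑ y → I (refl-at y s · v) → N (s ⊙ y) v ≡ suc (N y v)
          N-in {y} {s} {v} a h = ≡.trans (N-step y s v a) (≡.trans (≡.cong (λ b → N y v ℕ.+ bit b) (dec-true (I? _) h)) (ℕ.+-comm (N y v) 1))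

          N-out : ∀ {y s v} → s ↑ y → ¬ I (refl-at y s · v) → N (s ⊙ y) v ≡ N y v
          N-out {y} {s} {v} a h = ≡.trans (N-step y s v a) (≡.trans (≡.cong (λ b → N y v ℕ.+ bit b) (dec-false (I? _) h)) (ℕ.+-identityʳ (N y v)))

          indicator : Fun
          indicator = value e

          -- Left multiplication by `s` mixes only the coefficients at `v` and `t · v`, where `t` is
          -- `refl-at y s`. When both lie in the interval and `s ↑ (y · v)`, balance merges the two
          -- terms; in the other cases one term is absent or a whole factor q appears.
          process : ∀ {ws} → Reduced ws → ∀ v → lamW ws indicator (word ws · v) ≈ value (word ws) v
          process []       v = reflexive (≡.cong indicator (identityˡ v))
          process {s ∷ ws} (a ∷ r) v = trans (reflexive (≡.cong (lam s h) (assoc _ _ _))) (cases (↑-or-↓ s (y · v)) (I? v) (I? (t · v)))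
            where
            y t : W
            y = word ws
            t = refl-at y s
            h : Fun
            h = lamW ws indicator
            low : h (s ⊙ (s ⊙ (y · v))) ≈ value y v
            low = trans (reflexive (≡.cong h (gen-gen s (y · v)))) (process r v)
            high : h (s ⊙ (y · v)) ≈ value y (t · v)
            high = trans (reflexive (≡.cong h (≡.sym (·-refl-at y s v)))) (process r (t · v))
            cases : s ↑ (y · v) ⊎ s ↓ (y · v) → Dec (I v) → Dec (I (t · v)) → lam s h (s ⊙ (y · v)) ≈ value (s ⊙ y) v
            cases (inj₁ b) (yes i) (yes j) = trans (lam-↓ h (↑-flip b)) (trans (+-cong (trans low (value-in i)) (*-congˡ (trans high (trans (value-in j)
                (reflexive (≡.cong (q ^_) (≡.sym (balanced y s v a i j)))))))) (trans (solve 3 (λ q p o → p :+ (q :- o) :* p := q :* p :+ (p :- o :* p)) refl q (q ^ N y v) 1#)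
                (trans (+-congˡ (≈⇒-≈0 (sym (*-identityˡ _)))) (trans (+-identityʳ _) (sym (trans (value-in i) (reflexive (≡.cong (q ^_) (N-in a j)))))))))
            cases (inj₁ b) (yes i) (no j) = trans (lam-↓ h (↑-flip b)) (trans (+-cong (trans low (value-in i)) (*-congˡ (trans high (value-out j))))
                (trans (trans (+-congˡ (zeroʳ _)) (+-identityʳ _)) (sym (trans (value-in i) (reflexive (≡.cong (q ^_) (N-out a j)))))))
            -- Here `t · v` is longer than `v`, and the interval, being closed downwards, cannot
            -- contain it without `v`.
            cases (inj₁ b) (no i) (yes j) = ⊥-elim (i (≡.subst I (≡.trans (≡.sym (assoc _ _ _)) (≡.trans (≡.cong (_· v) (refl-at-invol y s)) (identityˡ v)))
                (I-lower (≡.subst (λ z → ℓ z ℕ.< ℓ (t · v)) (≡.trans (≡.sym (identityˡ v)) (≡.trans (≡.cong (_· v) (≡.sym (refl-at-invol y s))) (assoc _ _ _))) (same⇒> (↑↑ a b))) j)))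
            cases (inj₁ b) (no i) (no j) = trans (lam-↓ h (↑-flip b)) (trans (+-cong (trans low (value-out i)) (*-congˡ (trans high (value-out j))))
                (trans (trans (+-congˡ (zeroʳ _)) (+-identityʳ _)) (sym (value-out i))))
            cases (inj₂ b) (yes i) _ = trans (lam-↑ h (↓-flip b)) (trans (*-congˡ (trans low (value-in i))) (sym (trans (value-in i) (reflexive (≡.cong (q ^_)
                (N-in a (I-lower (opposite⇒< (↑↓ a b)) i)))))))
            cases (inj₂ b) (no i) _ = trans (lam-↑ h (↓-flip b)) (trans (*-congˡ (trans low (value-out i))) (trans (zeroʳ q) (sym (value-out i))))

          indicator-∑ : ∀ z → indicator z ≈ ∑ L (λ x → Δ x z)
          indicator-∑ z with I? z
          ... | yes h = trans (reflexive (≡.cong (q ^_) zero-count)) (sym (∑-Δ-in L z I-unique h))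
            where
            zero-count : N e z ≡ 0
            zero-count = none T
              where
              none : ∀ ts → count (test e z) ts ≡ 0
              none []       = ≡.refl
              none (t ∷ ts) rewrite dec-false (ℓ (e · t) ℕ.<? ℓ e) (λ k → ℕ.n≮0 (ℕ.≤-trans k (ℕ.≤-reflexive ℓ-e))) = none ts
          ... | no h = sym (∑-Δ-out L z (λ { x m ≡.refl → h m }))

          -- Take `y = w₀` and `v = e`. Every reflection is an inversion of `w₀`, so the exponent
          -- counts the reflections in the interval; these are the neighbours of `e`, and regularity
          -- fixes their number.
          R-sum : (regular : Regular C ℓ w) → ∑ L (r e) ≈ q ^ ℓ w
          R-sum regular = begin
            ∑ L (r e)                                                ≈⟨ ∑-cong L (λ x → sym (trans (coefficient (ℓ x) x ℕ.≤-refl e) (trans (*-congʳ (reflexive (≡.cong (q ^_) ℓ-e))) (*-identityˡ _)))) ⟩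
            ∑ L (λ x → lamW w₀-word (Δ x) (w₀ · e))                  ≈⟨ sym (lamW-∑ w₀-word L Δ (w₀ · e)) ⟩
            lamW w₀-word (λ z → ∑ L (λ x → Δ x z)) (w₀ · e)          ≈⟨ lamW-cong w₀-word (λ z → sym (indicator-∑ z)) (w₀ · e) ⟩
            lamW w₀-word indicator (w₀ · e)                          ≡⟨ ≡.cong (λ y → lamW w₀-word indicator (y · e)) (≡.sym (proj₁ (proj₂ (reduced w₀)))) ⟩
            lamW w₀-word indicator (word w₀-word · e)                ≈⟨ process w₀-reduced e ⟩
            value (word w₀-word) e                                   ≡⟨ ≡.cong (λ y → value y e) (proj₁ (proj₂ (reduced w₀))) ⟩
            value w₀ e                                               ≈⟨ value-in (≼⇒I (e≼ w)) ⟩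
            q ^ N w₀ e                                               ≡⟨ ≡.cong (q ^_) all-reflections ⟩
            q ^ ℓ w                                                  ∎
            where
            open import Relation.Binary.Reasoning.Setoid setoid
            open import Data.List using (filter)
            open import Data.List.Membership.Propositional.Properties using (∈-filter⁺; ∈-filter⁻)
            open import Data.List.Relation.Unary.Unique.Propositional.Properties using (filter⁺)
            nb = neighbours regular e e (≡.subst I (≡.sym (≡.trans (identityʳ (inv e)) inv-e)) (≼⇒I (e≼ w)))
            ete : ∀ t → inv e · (t · e) ≡ t
            ete t = ≡.trans (≡.cong₂ _·_ inv-e (identityʳ t)) (identityˡ t)
            below : ∀ t → IsRefl t → does (ℓ (w₀ · t) ℕ.<? ℓ w₀) ≡ true
            below t (x , i , ≡.refl) = dec-true (_ ℕ.<? _) (≡.subst₂ ℕ._<_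
              (≡.trans (≡.sym (ℓ-inv _)) (≡.cong ℓ (≡.trans (inv-· _ _) (≡.cong₂ _·_ (inv-inv w₀) (≡.sym (inverse-unique _ _ (refl-at-invol x i)))))))
              (ℓ-inv w₀) (opposite⇒< (w₀-opposite x i)))
            count-filter : ∀ ts → (∀ t → t ∈ ts → IsRefl t) → count (test w₀ e) ts ≡ length (filter I? ts)
            count-filter []       h = ≡.refl
            count-filter (t ∷ ts) h rewrite below t (h t (here ≡.refl)) | ≡.cong (λ z → does (I? z)) (identityʳ t) with does (I? t)
            ... | true  = ≡.cong suc (count-filter ts (λ t m → h t (there m)))
            ... | false = count-filter ts (λ t m → h t (there m))
            all-reflections : N w₀ e ≡ ℓ w
            all-reflections = ≡.trans (count-filter T (λ t → T-sound)) (≡.trans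
              (unique-length (filter I? T) (proj₁ nb) (filter⁺ I? T-unique) (proj₁ (proj₂ nb))
                (λ t m → let a , b = ∈-filter⁻ I? {xs = T} m in proj₁ (proj₂ (proj₂ (proj₂ nb))) t (T-sound a) (≡.subst I (≡.sym (ete t)) b))
                (λ t m → let a , b = proj₁ (proj₂ (proj₂ nb)) t m in ∈-filter⁺ I? (T-complete a) (≡.subst I (ete t) b)))
              (proj₂ (proj₂ (proj₂ (proj₂ nb)))))

-- Finite sums of natural numbers.

∑< : ℕ → (ℕ → ℕ) → ℕ
∑< zero    g = 0
∑< (suc m) g = g 0 ℕ.+ ∑< m (λ i → g (suc i))

∑<-cong : ∀ m {g h : ℕ → ℕ} → (∀ i → i ℕ.< m → g i ≡ h i) → ∑< m g ≡ ∑< m h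
∑<-cong zero    e = ≡.refl
∑<-cong (suc m) e = ≡.cong₂ ℕ._+_ (e 0 (s≤s z≤n)) (∑<-cong m (λ i l → e (suc i) (s≤s l)))

∑<-last : ∀ m (g : ℕ → ℕ) → ∑< (suc m) g ≡ ∑< m g ℕ.+ g m
∑<-last zero    g = ℕ.+-identityʳ _
∑<-last (suc m) g = ≡.trans (≡.cong (g 0 ℕ.+_) (∑<-last m (λ i → g (suc i)))) (≡.sym (ℕ.+-assoc (g 0) _ _))

∑<-reverse : ∀ m (g : ℕ → ℕ) → ∑< m (λ i → g (m ℕ.∸ i)) ≡ ∑< m (λ i → g (suc i))
∑<-reverse zero    g = ≡.refl
∑<-reverse (suc m) g = ≡.trans (ℕ.+-comm (g (suc m)) _) (≡.trans (≡.cong (ℕ._+ g (suc m)) (∑<-reverse m g)) (≡.sym (∑<-last m (λ i → g (suc i)))))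

∑<-append : ∀ m k (g : ℕ → ℕ) → ∑< (m ℕ.+ k) g ≡ ∑< m g ℕ.+ ∑< k (λ i → g (m ℕ.+ i))
∑<-append zero    k g = ≡.refl
∑<-append (suc m) k g = ≡.trans (≡.cong (g 0 ℕ.+_) (∑<-append m k (λ i → g (suc i)))) (≡.sym (ℕ.+-assoc (g 0) _ _))

∑<-parity : ∀ m (g : ℕ → ℕ) → ∑< (m ℕ.+ m) g ≡ ∑< m (λ i → g (i ℕ.+ i)) ℕ.+ ∑< m (λ i → g (suc (i ℕ.+ i)))
∑<-parity zero    g = ≡.refl
∑<-parity (suc m) g = ≡.trans (≡.cong (λ k → g 0 ℕ.+ ∑< k (λ i → g (suc i))) (ℕ.+-suc m m))
  (≡.trans (≡.cong (λ s → g 0 ℕ.+ (g 1 ℕ.+ s)) (≡.trans (∑<-parity m (λ i → g (suc (suc i))))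
    (≡.cong₂ ℕ._+_ (∑<-cong m (λ i _ → ≡.cong (λ k → g (suc k)) (≡.sym (ℕ.+-suc i i)))) (∑<-cong m (λ i _ → ≡.cong (λ k → g (suc (suc k))) (≡.sym (ℕ.+-suc i i)))))))
  (shuffle (g 0) (g 1) _ _))
  where
  open import Data.Nat.Solver using (module +-*-Solver)
  shuffle : ∀ a b c d → a ℕ.+ (b ℕ.+ (c ℕ.+ d)) ≡ (a ℕ.+ c) ℕ.+ (b ℕ.+ d)
  shuffle = +-*-Solver.solve 4 (λ a b c d → a +-*-Solver.:+ (b +-*-Solver.:+ (c +-*-Solver.:+ d)) +-*-Solver.:= (a +-*-Solver.:+ c) +-*-Solver.:+ (b +-*-Solver.:+ d)) ≡.refl

∑<-threshold : ∀ m j (g : ℕ → ℕ) → j ℕ.≤ m → (∀ i → i ℕ.< j → g i ≡ 1) → (∀ i → j ℕ.≤ i → i ℕ.< m → g i ≡ 0) → ∑< m g ≡ j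
∑<-threshold zero    zero    g l a b = ≡.refl
∑<-threshold (suc m) zero    g l a b = ≡.cong₂ ℕ._+_ (b 0 z≤n (s≤s z≤n)) (∑<-threshold m 0 (λ i → g (suc i)) z≤n (λ _ ()) (λ i h k → b (suc i) z≤n (s≤s k)))
∑<-threshold (suc m) (suc j) g (s≤s l) a b = ≡.cong₂ ℕ._+_ (a 0 (s≤s z≤n)) (∑<-threshold m j (λ i → g (suc i)) l (λ i h → a (suc i) (s≤s h)) (λ i h k → b (suc i) (s≤s h) (s≤s k)))

double≢odd : ∀ a b → a ℕ.+ a ≢ suc (b ℕ.+ b)
double≢odd zero    b ()
double≢odd (suc a) zero h with ≡.trans (≡.sym (ℕ.+-suc a a)) (ℕ.suc-injective h)
... | ()
double≢odd (suc a) (suc b) h = double≢odd a b (ℕ.suc-injective (≡.trans (≡.sym (ℕ.+-suc a a)) (≡.trans (ℕ.suc-injective h) (≡.cong suc (ℕ.+-suc b b)))))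

-- Dihedral cosets: from equal parities to balance.

module Dihedral (C : FiniteCoxeterSystem) (ℓ : FiniteCoxeterSystem.W C → ℕ) (isLength : ∀ w → IsLength C w (ℓ w))
  (D : PosDomain) (cos : ℕ → CommutativeRing.Carrier (PosDomain.K D))
  (cos-angle : ∀ m → 2 ℕ.≤ m → m ℕ.≤ length (FiniteCoxeterSystem.elems C) → IsAngle D (cos m) m) where
  open ≡ using (refl; sym; trans; cong; cong₂; subst)

  open FiniteCoxeterSystem C
  open Coxeter C ℓ isLength
  open Geometry C ℓ isLength D cos cos-angle using (m; m-sym)
  open Roots C ℓ isLength D cos cos-angle using (refl-at; refl-at-⊙; refl-at-invol; ·-refl-at; Same; Opposite; ↑↑; ↓↓; ↑↓; ↓↑;
     opposite⇒<; rise-alt; no-long-strip)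
  open Bruhat C ℓ isLength D cos cos-angle
  open Hecke C ℓ isLength D cos cos-angle using (module Inversions)

  last : Fin n → Fin n → ℕ → Fin n
  last a b zero    = a
  last a b (suc k) = last b a k

  alt-snoc : ∀ a b k → alt a b (suc k) ≡ alt a b k · gen (last a b k)
  alt-snoc a b zero    = trans (identityʳ _) (sym (identityˡ _))
  alt-snoc a b (suc k) = trans (cong (gen a ·_) (alt-snoc b a k)) (sym (assoc _ _ _))

  inv-alt-suc : ∀ a b k → inv (alt a b (suc k)) ≡ last a b k ⊙ inv (alt a b k)
  inv-alt-suc a b k = trans (cong inv (alt-snoc a b k)) (trans (inv-· _ _) (cong (_· inv (alt a b k)) (inv-gen _)))

  last-even : ∀ a b k → last a b (k ℕ.+ k) ≡ a
  last-even a b zero    = refl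
  last-even a b (suc k) = trans (cong (λ j → last b a j) (ℕ.+-suc k k)) (last-even a b k)

  -- The reflections of the dihedral group are the alternating words of odd length; the middle
  -- letter, at position k + 1, is the generator being conjugated.
  palindrome : ∀ a b k → alt a b (suc k) · inv (alt a b k) ≡ alt a b (suc (k ℕ.+ k))
  palindrome a b zero    = trans (cong (alt a b 1 ·_) inv-e) (identityʳ _)
  palindrome a b (suc k) = begin
    (gen a · alt b a (suc k)) · inv (gen a · alt b a k)          ≡⟨ cong ((gen a · alt b a (suc k)) ·_) (trans (inv-· _ _) (cong (inv (alt b a k) ·_) (inv-gen a))) ⟩
    (gen a · alt b a (suc k)) · (inv (alt b a k) · gen a)        ≡⟨ assoc _ _ _ ⟩
    gen a · (alt b a (suc k) · (inv (alt b a k) · gen a))        ≡⟨ cong (gen a ·_) (sym (assoc _ _ _)) ⟩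
    gen a · ((alt b a (suc k) · inv (alt b a k)) · gen a)        ≡⟨ cong (λ v → gen a · (v · gen a)) (palindrome b a k) ⟩
    gen a · (alt b a (suc (k ℕ.+ k)) · gen a)                    ≡⟨ cong (λ s → gen a · (alt b a (suc (k ℕ.+ k)) · gen s)) (sym (last-even a b k)) ⟩
    gen a · (alt b a (suc (k ℕ.+ k)) · gen (last b a (suc (k ℕ.+ k))))  ≡⟨ cong (gen a ·_) (sym (alt-snoc b a (suc (k ℕ.+ k)))) ⟩
    gen a · alt b a (suc (suc (k ℕ.+ k)))                        ≡⟨ cong (λ j → alt a b (suc (suc j))) (sym (ℕ.+-suc k k)) ⟩
    alt a b (suc (suc k ℕ.+ suc k))                              ∎
    where open ≡.≡-Reasoning

  palindrome-invol : ∀ a b k → alt a b (suc (k ℕ.+ k)) · alt a b (suc (k ℕ.+ k)) ≡ e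
  palindrome-invol a b k = begin
    P · P                                                        ≡⟨ cong₂ _·_ (sym (palindrome a b k)) (sym (palindrome a b k)) ⟩
    (A' · inv A) · (A' · inv A)                                  ≡⟨ cong (λ v → (A' · inv A) · (v · inv A)) (alt-snoc a b k) ⟩
    (A' · inv A) · ((A · gen l) · inv A)                         ≡⟨ cong ((A' · inv A) ·_) (assoc _ _ _) ⟩
    (A' · inv A) · (A · (gen l · inv A))                         ≡⟨ trans (assoc _ _ _) (cong (A' ·_) (inv-cancelˡ A _)) ⟩
    A' · (gen l · inv A)                                         ≡⟨ cong (_· (gen l · inv A)) (alt-snoc a b k) ⟩
    (A · gen l) · (gen l · inv A)                                ≡⟨ trans (assoc _ _ _) (cong (A ·_) (gen-gen l _)) ⟩
    A · inv A                                                    ≡⟨ inverseʳ A ⟩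
    e                                                            ∎
    where
    open ≡.≡-Reasoning
    P = alt a b (suc (k ℕ.+ k))
    A = alt a b k
    A' = alt a b (suc k)
    l = last a b k

  alt-odd-split : ∀ a b k j → alt a b (suc (k ℕ.+ k) ℕ.+ j) ≡ alt a b (suc (k ℕ.+ k)) · alt b a j
  alt-odd-split a b zero    j = cong (_· alt b a j) (sym (identityʳ (gen a)))
  alt-odd-split a b (suc k) j = begin
    alt a b (suc (suc k ℕ.+ suc k) ℕ.+ j)                        ≡⟨ cong (λ i → alt a b (suc (suc i) ℕ.+ j)) (ℕ.+-suc k k) ⟩
    a ⊙ b ⊙ alt a b (suc (k ℕ.+ k) ℕ.+ j)                        ≡⟨ cong (λ v → a ⊙ b ⊙ v) (alt-odd-split a b k j) ⟩
    a ⊙ b ⊙ (alt a b (suc (k ℕ.+ k)) · alt b a j)                ≡⟨ trans (cong (a ⊙_) (sym (assoc _ _ _))) (sym (assoc _ _ _)) ⟩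
    (a ⊙ b ⊙ alt a b (suc (k ℕ.+ k))) · alt b a j                ≡⟨ cong (λ i → alt a b (suc (suc i)) · alt b a j) (sym (ℕ.+-suc k k)) ⟩
    alt a b (suc (suc k ℕ.+ suc k)) · alt b a j                  ∎
    where open ≡.≡-Reasoning

  palindrome-product : ∀ a b l d → alt a b (suc (l ℕ.+ l)) · alt a b (suc ((l ℕ.+ d) ℕ.+ (l ℕ.+ d))) ≡ alt b a (d ℕ.+ d)
  palindrome-product a b l d = trans (cong (λ i → P · alt a b (suc i)) (shuffle l d)) (trans (cong (P ·_) (alt-odd-split a b l (d ℕ.+ d)))
    (trans (sym (assoc _ _ _)) (trans (cong (_· alt b a (d ℕ.+ d)) (palindrome-invol a b l)) (identityˡ _))))
    where
    open import Data.Nat.Solver using (module +-*-Solver)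
    P = alt a b (suc (l ℕ.+ l))
    shuffle : ∀ l d → (l ℕ.+ d) ℕ.+ (l ℕ.+ d) ≡ (l ℕ.+ l) ℕ.+ (d ℕ.+ d)
    shuffle = +-*-Solver.solve 2 (λ l d → (l +-*-Solver.:+ d) +-*-Solver.:+ (l +-*-Solver.:+ d) +-*-Solver.:= (l +-*-Solver.:+ l) +-*-Solver.:+ (d +-*-Solver.:+ d)) refl

  -- The inverse of an alternating word is alternating, but its first letter depends on the parity
  -- of `k`. The letters `a` and `b` are chosen so that the inverse begins with `s'` and the next
  -- letter of the original word is `s`.
  orient : ∀ k s s' → ∃ λ a → ∃ λ b → ((a ≡ s × b ≡ s') ⊎ (a ≡ s' × b ≡ s)) × last a b k ≡ s × last a b (suc k) ≡ s' × inv (alt a b k) ≡ alt s' s k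
  orient zero    s s' = s , s' , inj₁ (refl , refl) , refl , refl , inv-e
  orient (suc k) s s' with orient k s' s
  ... | a , b , o , h , h' , q = a , b , swap o , h' , trans (two a b k) h , trans (inv-alt-suc a b k) (cong₂ (λ x y → gen x · y) h q)
    where
    swap : ∀ {P Q : Set} → P ⊎ Q → Q ⊎ P
    swap (inj₁ x) = inj₂ x
    swap (inj₂ x) = inj₁ x
    two : ∀ a b k → last a b (suc (suc k)) ≡ last a b k
    two a b zero    = refl
    two a b (suc k) = two b a k

  refl-at-alt : ∀ a b k y → refl-at (inv (alt a b k) · y) (last a b k) ≡ inv y · (alt a b (suc (k ℕ.+ k)) · y)
  refl-at-alt a b k y = begin
    inv (inv A · y) · (gen l · (inv A · y))          ≡⟨ cong (_· (gen l · (inv A · y))) (trans (inv-· _ _) (cong (inv y ·_) (inv-inv A))) ⟩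
    (inv y · A) · (gen l · (inv A · y))              ≡⟨ assoc _ _ _ ⟩
    inv y · (A · (gen l · (inv A · y)))              ≡⟨ cong (inv y ·_) (sym (assoc _ _ _)) ⟩
    inv y · ((A · gen l) · (inv A · y))              ≡⟨ cong (λ v → inv y · (v · (inv A · y))) (sym (alt-snoc a b k)) ⟩
    inv y · (alt a b (suc k) · (inv A · y))          ≡⟨ cong (inv y ·_) (sym (assoc _ _ _)) ⟩
    inv y · ((alt a b (suc k) · inv A) · y)          ≡⟨ cong (λ v → inv y · (v · y)) (palindrome a b k) ⟩
    inv y · (alt a b (suc (k ℕ.+ k)) · y)            ∎
    where
    open ≡.≡-Reasoning
    A = alt a b k
    l = last a b k

  rise-inv-alt : ∀ {a b y} → a ≢ b → a ↑ y → b ↑ y → ∀ k → k ℕ.< m a b → last a b k ↑ (inv (alt a b k) · y)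
  rise-inv-alt {a} {b} {y} a≢b a↑ b↑ k l with orient-of a b k
    where
    orient-of : ∀ a b k → ∃ λ s → ∃ λ s' → ((s ≡ a × s' ≡ b) ⊎ (s ≡ b × s' ≡ a)) × last a b k ≡ s × last a b (suc k) ≡ s' × inv (alt a b k) ≡ alt s' s k
    orient-of a b zero    = a , b , inj₁ (refl , refl) , refl , refl , inv-e
    orient-of a b (suc k) with orient-of a b k
    ... | s , s' , o , h , h' , q = s' , s , swap o , h' , trans (two a b k) h , trans (inv-alt-suc a b k) (cong₂ (λ x y → gen x · y) h q)
      where
      swap : ∀ {P Q R S : Set} → (P × Q) ⊎ (R × S) → (S × R) ⊎ (Q × P)
      swap (inj₁ (x , y)) = inj₂ (y , x)
      swap (inj₂ (x , y)) = inj₁ (y , x)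
      two : ∀ a b k → last a b (suc (suc k)) ≡ last a b k
      two a b zero    = refl
      two a b (suc k) = two b a k
  ... | s , s' , inj₁ (refl , refl) , h , _ , q rewrite h | q = rise-alt a≢b a↑ b↑ k l
  ... | s , s' , inj₂ (refl , refl) , h , _ , q rewrite h | q = rise-alt (λ r → a≢b (sym r)) b↑ a↑ k (subst (k ℕ.<_) (m-sym a b) l)

  module Cosets (w : W) (L : List W) (enum : Enumerates C ℓ w L) where
    open Interval w L enum
    open Inversions w L enum

    -- For l below `m a b` the words of length 2l + 1 and 2l, wrapping past the longest element, run
    -- over all reflections and all rotations of the dihedral group. So a coset with an `a`-edge
    -- inside the interval meets the interval in equally many elements of either parity.
    Local : Set
    Local = ∀ y a b z → a ≢ b → I (inv y · z) → I (inv y · (a ⊙ z)) →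
      ∑< (m a b) (λ l → bit (does (I? (inv y · (alt a b (suc (l ℕ.+ l)) · z))))) ≡ ∑< (m a b) (λ l → bit (does (I? (inv y · (alt a b (l ℕ.+ l) · z)))))

    module OneCoset (a b : Fin n) (a≢b : a ≢ b) (y z : W) (a↑y : a ↑ y) (b↑y : b ↑ y) (a↑z : a ↑ z) (b↑z : b ↑ z) where

      J : W → Set
      J h = I (inv y · h)

      P : ℕ → Set
      P i = J (alt a b i · z)

      P' : ℕ → Set
      P' i = J (alt b a i · z)

      refl-at-y : ∀ h → refl-at y a · (inv y · h) ≡ inv y · (a ⊙ h)
      refl-at-y h = trans (assoc _ _ _) (cong (inv y ·_) (trans (assoc _ _ _) (cong (gen a ·_) (cancel-invˡ y h))))

      -- Together with `P⇒P` this makes `J` an order ideal of the coset: since `y` and `z` are both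
      -- minimal, dropping the first or the last letter lowers `inv y · h` in Bruhat order.
      P⇒P' : ∀ i → i ℕ.< m a b → P (suc i) → P' i
      P⇒P' i l p = subst I eq (I-lower (opposite⇒< (↑↓ a↑y a↓)) p)
        where
        eq : refl-at y a · (inv y · (alt a b (suc i) · z)) ≡ inv y · (alt b a i · z)
        eq = trans (refl-at-y _) (cong (inv y ·_) (trans (cong (gen a ·_) (assoc _ _ _)) (gen-gen a _)))
        a↓ : a ↓ (y · (inv y · (alt a b (suc i) · z)))
        a↓ = subst (a ↓_) (sym (trans (cancel-invˡ y _) (assoc _ _ _))) (↑-flip (rise-alt a≢b a↑z b↑z i l))

      P⇒P : ∀ i → i ℕ.< m a b → P (suc i) → P i
      P⇒P i l p = subst I eq (I-lower (opposite⇒< (↑↓ (rise-inv-alt a≢b a↑y b↑y i l) d)) p)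
        where
        s = last a b i
        x = inv (alt a b i) · y
        eq : refl-at x s · (inv y · (alt a b (suc i) · z)) ≡ inv y · (alt a b i · z)
        eq = trans (cong (_· (inv y · (alt a b (suc i) · z))) (refl-at-alt a b i y)) (trans (assoc _ _ _) (cong (inv y ·_) (trans (assoc _ _ _)
          (trans (cong (alt a b (suc (i ℕ.+ i)) ·_) (trans (cancel-invˡ y _) (cong (_· z) up))) (trans (cong (alt a b (suc (i ℕ.+ i)) ·_) (assoc _ _ _)) (trans (sym (assoc _ _ _))
            (trans (cong (_· (alt a b i · z)) (palindrome-invol a b i)) (identityˡ _))))))))
          where
          up : alt a b (suc i) ≡ alt a b (suc (i ℕ.+ i)) · alt a b i
          up = trans (sym (trans (assoc _ _ _) (trans (cong (alt a b (suc i) ·_) (inverseˡ _)) (identityʳ _)))) (cong (_· alt a b i) (palindrome a b i))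
        d : s ↓ (x · (inv y · (alt a b (suc i) · z)))
        d = subst (s ↓_) (sym (trans (assoc _ _ _) (trans (cong (inv (alt a b i) ·_) (cancel-invˡ y _)) (trans (cong (λ v → inv (alt a b i) · (v · z)) (alt-snoc a b i))
              (trans (cong (inv (alt a b i) ·_) (assoc _ _ _)) (inv-cancelˡ _ _)))))) (↑-flip (last-cases i))
          where
          last-cases : ∀ i → last a b i ↑ z
          last-cases i = go a b a↑z b↑z i
            where
            go : ∀ a b → a ↑ z → b ↑ z → ∀ i → last a b i ↑ z
            go a b p q zero    = p
            go a b p q (suc i) = go b a q p i

      N-const : (∀ v → I v → I (refl-at y a · v) → N y v ≡ N y (refl-at y a · v)) → ∀ i → P (suc i) → P' i → N y (inv y · (alt a b (suc i) · z)) ≡ N y (inv y · (alt b a i · z))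
      N-const bal i p p' = trans (cong (N y) (sym eq)) (sym (bal _ p' (subst I (sym eq) p)))
        where
        eq : refl-at y a · (inv y · (alt b a i · z)) ≡ inv y · (alt a b (suc i) · z)
        eq = trans (refl-at-y _) (cong (inv y ·_) (sym (assoc _ _ _)))

    module Coset (local : Local) (a b : Fin n) (a≢b : a ≢ b) (y z : W) (a↑y : a ↑ y) (b↑y : b ↑ y) (a↑z : a ↑ z) (b↑z : b ↑ z) where
      M : ℕ
      M = m a b

      b≢a : b ≢ a
      b≢a h = a≢b (sym h)

      open OneCoset a b a≢b y z a↑y b↑y a↑z b↑z
      private module B = OneCoset b a b≢a y z b↑y a↑y b↑z a↑z

      relation : pow (gen a · gen b) M ≡ e
      relation = Order.pow-ord (order (gen a · gen b))

      0<M : 0 ℕ.< M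
      0<M = Order.0<ord (order (gen a · gen b))

      braid : alt a b M ≡ alt b a M
      braid = alt-mirror a b M M M relation refl

      <M' : ∀ {i} → i ℕ.< M → i ℕ.< m b a
      <M' {i} = subst (i ℕ.<_) (m-sym a b)

      data In (h : W) : Set where
        in-a : ∀ i → i ℕ.≤ M → h ≡ alt a b i · z → In h
        in-b : ∀ i → i ℕ.≤ M → h ≡ alt b a i · z → In h

      private
        flip-eq : ∀ c d i {h} → h ≡ alt c d (suc i) · z → c ⊙ h ≡ alt d c i · z
        flip-eq c d i q = trans (cong (gen c ·_) (trans q (assoc _ _ _))) (gen-gen c _)

      In-a : ∀ {h} → In h → In (a ⊙ h)
      In-a (in-a zero    l q) = in-a 1 0<M (trans (cong (gen a ·_) (trans q (identityˡ z))) (cong (_· z) (sym (identityʳ (gen a)))))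
      In-a (in-a (suc i) l q) = in-b i (ℕ.<⇒≤ l) (flip-eq a b i q)
      In-a (in-b i l q) with ℕ.m≤n⇒m<n∨m≡n l
      ... | inj₁ l'   = in-a (suc i) l' (trans (cong (gen a ·_) q) (sym (assoc _ _ _)))
      In-a (in-b zero l q) | inj₂ r = ⊥-elim (ℕ.<-irrefl r 0<M)
      In-a (in-b (suc i) l q) | inj₂ r = in-b i (ℕ.<⇒≤ l) (flip-eq a b i (trans q (cong (_· z) (trans (cong (alt b a) r) (trans (sym braid) (cong (alt a b) (sym r)))))))

      In-b : ∀ {h} → In h → In (b ⊙ h)
      In-b (in-b zero    l q) = in-b 1 0<M (trans (cong (gen b ·_) (trans q (identityˡ z))) (cong (_· z) (sym (identityʳ (gen b)))))
      In-b (in-b (suc i) l q) = in-a i (ℕ.<⇒≤ l) (flip-eq b a i q)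
      In-b (in-a i l q) with ℕ.m≤n⇒m<n∨m≡n l
      ... | inj₁ l'   = in-b (suc i) l' (trans (cong (gen b ·_) q) (sym (assoc _ _ _)))
      In-b (in-a zero l q) | inj₂ r = ⊥-elim (ℕ.<-irrefl r 0<M)
      In-b (in-a (suc i) l q) | inj₂ r = in-a i (ℕ.<⇒≤ l) (flip-eq b a i (trans q (cong (_· z) (trans (cong (alt a b) r) (trans braid (cong (alt b a) (sym r)))))))

      mutual
        In-alt : ∀ i {h} → In h → In (alt a b i · h)
        In-alt zero    H = subst In (sym (identityˡ _)) H
        In-alt (suc i) H = subst In (sym (assoc _ _ _)) (In-a (In-alt' i H))
        In-alt' : ∀ i {h} → In h → In (alt b a i · h)
        In-alt' zero    H = subst In (sym (identityˡ _)) H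
        In-alt' (suc i) H = subst In (sym (assoc _ _ _)) (In-b (In-alt i H))

      In-z : In z
      In-z = in-a 0 z≤n (sym (identityˡ z))

      P-down : ∀ {i j} → i ℕ.≤ j → j ℕ.≤ M → P j → P i
      P-down {i} {j} l k p with ℕ.m≤n⇒m<n∨m≡n l
      ... | inj₂ refl = p
      P-down {i} {suc j} l k p | inj₁ (s≤s l') = P-down l' (ℕ.<⇒≤ k) (P⇒P j k p)

      P'-down : ∀ {i j} → i ℕ.≤ j → j ℕ.≤ M → P' j → P' i
      P'-down {i} {j} l k p with ℕ.m≤n⇒m<n∨m≡n l
      ... | inj₂ refl = p
      P'-down {i} {suc j} l k p | inj₁ (s≤s l') = P'-down l' (ℕ.<⇒≤ k) (B.P⇒P j (<M' k) p)

      Sym-a Sym-b Single : Set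
      Sym-a  = ∀ i → i ℕ.< M → (P' i → P (suc i)) × (P (suc i) → P' i)
      Sym-b  = ∀ i → i ℕ.< M → (P i → P' (suc i)) × (P' (suc i) → P i)
      Single = ∀ h → In h → J h → h ≡ z

      -- An interval of the coset with two maximal elements has an odd number of elements,
      -- but regularity forces as many elements of even as of odd length.
      two-topped : ∀ j → suc (suc j) ℕ.≤ M → (∀ i → i ℕ.≤ suc j → P i × P' i) → ¬ P (suc (suc j)) → ¬ P' (suc (suc j)) → ⊥
      two-topped j l inside out out' = double≢odd (∑< M (λ i → q (i ℕ.+ i))) (suc j) (begin
        ∑< M (λ i → q (i ℕ.+ i)) ℕ.+ ∑< M (λ i → q (i ℕ.+ i))            ≡⟨ cong (∑< M (λ i → q (i ℕ.+ i)) ℕ.+_) (sym (local y a b z a≢b (subst J (identityˡ z) (proj₁ (inside 0 z≤n)))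
                                                                               (subst J (trans (assoc _ _ _) (cong (gen a ·_) (identityˡ z))) (proj₁ (inside 1 (s≤s z≤n)))))) ⟩
        ∑< M (λ i → q (i ℕ.+ i)) ℕ.+ ∑< M (λ i → q (suc (i ℕ.+ i)))      ≡⟨ sym (∑<-parity M q) ⟩
        ∑< (M ℕ.+ M) q                                                   ≡⟨ ∑<-append M M q ⟩
        ∑< M q ℕ.+ ∑< M (λ i → q (M ℕ.+ i))                              ≡⟨ cong₂ ℕ._+_ lower upper ⟩
        suc (suc j) ℕ.+ suc j                                            ∎)
        where
        open ≡.≡-Reasoning
        q q' : ℕ → ℕ
        q i = bit (does (I? (inv y · (alt a b i · z))))
        q' i = bit (does (I? (inv y · (alt b a i · z))))
        lower : ∑< M q ≡ suc (suc j)
        lower = ∑<-threshold M (suc (suc j)) q l (λ i h → cong bit (dec-true (I? _) (proj₁ (inside i (ℕ.≤-pred h)))))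
                  (λ i h k → cong bit (dec-false (I? _) (λ p → out (P-down h (ℕ.<⇒≤ k) p))))
        mirror : ∀ i → i ℕ.< M → q (M ℕ.+ i) ≡ q' (M ℕ.∸ i)
        mirror i k = cong (λ v → bit (does (I? (inv y · (v · z))))) (alt-mirror a b (M ℕ.+ i) (M ℕ.∸ i) M relation (trans (ℕ.+-assoc M i (M ℕ.∸ i)) (cong (M ℕ.+_) (ℕ.m+[n∸m]≡n (ℕ.<⇒≤ k)))))
        upper : ∑< M (λ i → q (M ℕ.+ i)) ≡ suc j
        upper = trans (∑<-cong M mirror) (trans (∑<-reverse M q') (∑<-threshold M (suc j) (λ i → q' (suc i)) (ℕ.<⇒≤ l)
                  (λ i h → cong bit (dec-true (I? _) (proj₂ (inside (suc i) h))))
                  (λ i h k → cong bit (dec-false (I? _) (λ p → out' (P'-down (s≤s h) k p))))))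

      -- The ideal contains all words up to some length. If exactly one word of the next length
      -- belongs to it, or if it is the whole coset, it has a single maximal element and is stable
      -- under multiplication by a first letter of that element. If neither does, it is a single
      -- element or falls under `two-topped`.
      classify : J z → Sym-a ⊎ Sym-b ⊎ Single
      classify Jz = search M 0 (ℕ.+-identityʳ M) (λ { zero _ → subst J (sym (identityˡ z)) Jz , subst J (sym (identityˡ z)) Jz })
        where
        search : ∀ fuel j → fuel ℕ.+ j ≡ M → (∀ i → i ℕ.≤ j → P i × P' i) → Sym-a ⊎ Sym-b ⊎ Single
        search zero    j refl inside = inj₁ (λ i l → (λ _ → proj₁ (inside (suc i) l)) , (λ _ → proj₂ (inside i (ℕ.<⇒≤ l))))
        search (suc fuel) j q inside with I? (inv y · (alt a b (suc j) · z)) | I? (inv y · (alt b a (suc j) · z))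
        ... | yes p | yes p' = search fuel (suc j) (trans (ℕ.+-suc fuel j) q) extend
          where
          extend : ∀ i → i ℕ.≤ suc j → P i × P' i
          extend i l with ℕ.m≤n⇒m<n∨m≡n l
          ... | inj₁ l'   = inside i (ℕ.≤-pred l')
          ... | inj₂ refl = p , p'
        ... | yes p | no ¬p' = inj₁ sym-a
          where
          sym-a : Sym-a
          sym-a i l with i ℕ.≤? j
          ... | yes i≤j = (λ _ → P-down (s≤s i≤j) (subst (suc j ℕ.≤_) q (s≤s (ℕ.m≤n+m j fuel))) p) , (λ _ → proj₂ (inside i i≤j))
          ... | no i≰j  = (λ r → ⊥-elim (¬p' (P'-down (ℕ.≰⇒> i≰j) (ℕ.<⇒≤ l) r))) , (λ r → ⊥-elim (¬p' (P'-down (ℕ.≰⇒> i≰j) (ℕ.<⇒≤ l) (P⇒P' i l r))))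
        ... | no ¬p | yes p' = inj₂ (inj₁ sym-b)
          where
          sym-b : Sym-b
          sym-b i l with i ℕ.≤? j
          ... | yes i≤j = (λ _ → P'-down (s≤s i≤j) (subst (suc j ℕ.≤_) q (s≤s (ℕ.m≤n+m j fuel))) p') , (λ _ → proj₁ (inside i i≤j))
          ... | no i≰j  = (λ r → ⊥-elim (¬p (P-down (ℕ.≰⇒> i≰j) (ℕ.<⇒≤ l) r))) , (λ r → ⊥-elim (¬p (P-down (ℕ.≰⇒> i≰j) (ℕ.<⇒≤ l) (B.P⇒P' i (<M' l) r))))
        search (suc fuel) zero q inside | no ¬p | no ¬p' = inj₂ (inj₂ single)
          where
          single : Single
          single h (in-a zero    l r) Jh = trans r (identityˡ z)
          single h (in-a (suc i) l r) Jh = ⊥-elim (¬p (P-down (s≤s z≤n) l (subst J r Jh)))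
          single h (in-b zero    l r) Jh = trans r (identityˡ z)
          single h (in-b (suc i) l r) Jh = ⊥-elim (¬p' (P'-down (s≤s z≤n) l (subst J r Jh)))
        search (suc fuel) (suc j) q inside | no ¬p | no ¬p' = ⊥-elim (two-topped j (subst (suc (suc j) ℕ.≤_) q (s≤s (ℕ.m≤n+m (suc j) fuel))) inside ¬p ¬p')

      j? : W → Bool
      j? h = does (I? (inv y · h))

      private
        same : ∀ {h h'} → (J h → J h') → (J h' → J h) → j? h ≡ j? h'
        same f g = does-⇔ (mk⇔ f g) (I? _) (I? _)

      sym-a⇒ : Sym-a → ∀ h → In h → j? (a ⊙ h) ≡ j? h
      sym-a⇒ S h (in-a zero l q) = same (λ p → subst J (sym (trans q refl)) (proj₂ (S 0 0<M) (subst J (trans (cong (gen a ·_) q) (sym (assoc _ _ _))) p)))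
                                        (λ p → subst J (trans (assoc _ _ _) (cong (gen a ·_) (sym q))) (proj₁ (S 0 0<M) (subst J q p)))
      sym-a⇒ S h (in-a (suc i) l q) = same (λ p → subst J (sym q) (proj₁ (S i l) (subst J (flip-eq a b i q) p))) (λ p → subst J (sym (flip-eq a b i q)) (proj₂ (S i l) (subst J q p)))
      sym-a⇒ S h (in-b i l q) with ℕ.m≤n⇒m<n∨m≡n l
      ... | inj₁ l' = same (λ p → subst J (sym q) (proj₂ (S i l') (subst J (trans (cong (gen a ·_) q) (sym (assoc _ _ _))) p)))
                           (λ p → subst J (trans (assoc _ _ _) (cong (gen a ·_) (sym q))) (proj₁ (S i l') (subst J q p)))
      sym-a⇒ S h (in-b zero l q) | inj₂ r = ⊥-elim (ℕ.<-irrefl r 0<M)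
      sym-a⇒ S h (in-b (suc i) l q) | inj₂ r = sym-a⇒ S h (in-a (suc i) l (trans q (cong (_· z) (trans (cong (alt b a) r) (trans (sym braid) (cong (alt a b) (sym r)))))))

      sym-b⇒ : Sym-b → ∀ h → In h → j? (b ⊙ h) ≡ j? h
      sym-b⇒ S h (in-b zero l q) = same (λ p → subst J (sym (trans q refl)) (proj₂ (S 0 0<M) (subst J (trans (cong (gen b ·_) q) (sym (assoc _ _ _))) p)))
                                        (λ p → subst J (trans (assoc _ _ _) (cong (gen b ·_) (sym q))) (proj₁ (S 0 0<M) (subst J q p)))
      sym-b⇒ S h (in-b (suc i) l q) = same (λ p → subst J (sym q) (proj₁ (S i l) (subst J (flip-eq b a i q) p))) (λ p → subst J (sym (flip-eq b a i q)) (proj₂ (S i l) (subst J q p)))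
      sym-b⇒ S h (in-a i l q) with ℕ.m≤n⇒m<n∨m≡n l
      ... | inj₁ l' = same (λ p → subst J (sym q) (proj₂ (S i l') (subst J (trans (cong (gen b ·_) q) (sym (assoc _ _ _))) p)))
                           (λ p → subst J (trans (assoc _ _ _) (cong (gen b ·_) (sym q))) (proj₁ (S i l') (subst J q p)))
      sym-b⇒ S h (in-a zero l q) | inj₂ r = ⊥-elim (ℕ.<-irrefl r 0<M)
      sym-b⇒ S h (in-a (suc i) l q) | inj₂ r = sym-b⇒ S h (in-b (suc i) l (trans q (cong (_· z) (trans (cong (alt a b) r) (trans braid (cong (alt b a) (sym r)))))))

      -- Both sums run over k consecutive elements of one parity of the coset; the symmetry of J matches them.
      sums : ∀ k g → In g → J z → J g → J (alt a b (suc (k ℕ.+ k)) · g) →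
        ∑< k (λ l → bit (j? (alt a b (suc (l ℕ.+ l)) · g))) ≡ ∑< k (λ l → bit (j? (alt b a (suc l ℕ.+ suc l) · g)))
      sums k g H Jz Jg Jtg with classify Jz
      -- The term at `k` is 1 because the far end lies in the interval, and the term at 0 is 1 by
      -- symmetry. Adding the former and removing the latter shifts the sum by one index, after
      -- which `a` matches it term by term.
      ... | inj₁ S = ℕ.+-cancelʳ-≡ 1 _ _ (begin
          ∑< k F ℕ.+ 1                          ≡⟨ cong (∑< k F ℕ.+_) (cong bit (sym (dec-true (I? _) Jtg))) ⟩
          ∑< k F ℕ.+ F k                        ≡⟨ sym (∑<-last k F) ⟩
          F 0 ℕ.+ ∑< k (λ l → F (suc l))        ≡⟨ ℕ.+-comm (F 0) _ ⟩
          ∑< k (λ l → F (suc l)) ℕ.+ F 0        ≡⟨ cong₂ ℕ._+_ (∑<-cong k (λ l _ → cong bit (shift l))) (cong bit F0) ⟩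
          ∑< k G ℕ.+ 1                          ∎)
        where
        open ≡.≡-Reasoning
        F G : ℕ → ℕ
        F l = bit (j? (alt a b (suc (l ℕ.+ l)) · g))
        G l = bit (j? (alt b a (suc l ℕ.+ suc l) · g))
        shift : ∀ l → j? (alt a b (suc (suc l ℕ.+ suc l)) · g) ≡ j? (alt b a (suc l ℕ.+ suc l) · g)
        shift l = trans (cong j? (assoc _ _ _)) (sym-a⇒ S _ (In-alt' (suc l ℕ.+ suc l) H))
        F0 : j? (alt a b 1 · g) ≡ true
        F0 = trans (cong j? (cong (_· g) (identityʳ (gen a)))) (trans (sym-a⇒ S g H) (dec-true (I? _) Jg))
      ... | inj₂ (inj₁ S) = ∑<-cong k (λ l _ → cong bit (sym (trans (cong j? (trans (cong (λ i → alt b a (suc i) · g) (ℕ.+-suc l l)) (assoc _ _ _))) (sym-b⇒ S _ (In-alt (suc (l ℕ.+ l)) H)))))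
      -- A one-element `J` would have to contain both `g` and its image under a reflection.
      ... | inj₂ (inj₂ S) = ⊥-elim (odd≢e k (cancelʳ z _ _ (trans (trans (cong (alt a b (suc (k ℕ.+ k)) ·_) (sym (S g H Jg))) (S _ (In-alt (suc (k ℕ.+ k)) H) Jtg)) (sym (identityˡ z)))))
        where
        odd≢e : ∀ k → alt a b (suc (k ℕ.+ k)) ≢ e
        odd≢e k h = gen-ne (last a b k) (begin
          gen s                            ≡⟨ sym (inv-cancelˡ A _) ⟩
          inv A · (A · gen s)              ≡⟨ cong (inv A ·_) (sym (alt-snoc a b k)) ⟩
          inv A · alt a b (suc k)          ≡⟨ cong (inv A ·_) (sym (trans (assoc _ _ _) (trans (cong (alt a b (suc k) ·_) (inverseˡ A)) (identityʳ _)))) ⟩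
          inv A · ((alt a b (suc k) · inv A) · A)  ≡⟨ cong (λ v → inv A · (v · A)) (trans (palindrome a b k) h) ⟩
          inv A · (e · A)                  ≡⟨ trans (cong (inv A ·_) (identityˡ A)) (inverseˡ A) ⟩
          e                                ∎)
          where
          open ≡.≡-Reasoning
          A = alt a b k
          s = last a b k

      module _ (bal : ∀ s v → s ↑ y → I v → I (refl-at y s · v) → N y v ≡ N y (refl-at y s · v)) where

        N-a : ∀ i → i ℕ.≤ M → P i → N y (inv y · (alt a b i · z)) ≡ N y (inv y · z)
        N-b : ∀ i → i ℕ.≤ M → P' i → N y (inv y · (alt b a i · z)) ≡ N y (inv y · z)
        N-a zero    l p = cong (λ h → N y (inv y · h)) (identityˡ z)
        N-a (suc i) l p = trans (N-const (λ v → bal a v a↑y) i p (P⇒P' i l p)) (N-b i (ℕ.<⇒≤ l) (P⇒P' i l p))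
        N-b zero    l p = cong (λ h → N y (inv y · h)) (identityˡ z)
        N-b (suc i) l p = trans (B.N-const (λ v → bal b v b↑y) i p (B.P⇒P' i (<M' l) p)) (N-a i (ℕ.<⇒≤ l) (B.P⇒P' i (<M' l) p))

        -- Dropping first letters one by one leads from `h` to `z` inside `J`. Each drop is a
        -- reflection `refl-at y a` or `refl-at y b`, and balance at `y` keeps the count unchanged.
        N-coset : ∀ h → In h → J h → N y (inv y · h) ≡ N y (inv y · z)
        N-coset h (in-a i l q) Jh = trans (cong (λ h → N y (inv y · h)) q) (N-a i l (subst J q Jh))
        N-coset h (in-b i l q) Jh = trans (cong (λ h → N y (inv y · h)) q) (N-b i l (subst J q Jh))

      J⇒Jz : ∀ h → In h → J h → J z
      J⇒Jz h (in-a i l q) Jh = subst J (identityˡ z) (P-down z≤n l (subst J q Jh))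
      J⇒Jz h (in-b i l q) Jh = subst J (identityˡ z) (P'-down z≤n l (subst J q Jh))

    -- The new inversions are the palindromes of length 1, 3, ..., 2k - 1, conjugated by `y`.
    N-chain : ∀ a b y v → a ≢ b → a ↑ y → b ↑ y → ∀ k → k ℕ.≤ m a b →
      N (inv (alt a b k) · y) v ≡ N y v ℕ.+ ∑< k (λ l → bit (does (I? (inv y · (alt a b (suc (l ℕ.+ l)) · (y · v))))))
    N-chain a b y v a≢b a↑ b↑ zero    l = trans (cong (λ x → N x v) (trans (cong (_· y) inv-e) (identityˡ y))) (sym (ℕ.+-identityʳ _))
    N-chain a b y v a≢b a↑ b↑ (suc k) l = begin
      N (inv (alt a b (suc k)) · y) v                     ≡⟨ cong (λ x → N x v) (trans (cong (_· y) (inv-alt-suc a b k)) (assoc _ _ _)) ⟩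
      N (last a b k ⊙ (inv (alt a b k) · y)) v            ≡⟨ N-step _ _ v (rise-inv-alt a≢b a↑ b↑ k l) ⟩
      N (inv (alt a b k) · y) v ℕ.+ bit (does (I? (refl-at (inv (alt a b k) · y) (last a b k) · v)))
                                                          ≡⟨ cong₂ ℕ._+_ (N-chain a b y v a≢b a↑ b↑ k (ℕ.<⇒≤ l)) (cong (λ x → bit (does (I? x)))
                                                               (trans (cong (_· v) (refl-at-alt a b k y)) (trans (assoc _ _ _) (cong (inv y ·_) (assoc _ _ _))))) ⟩
      (N y v ℕ.+ ∑< k F) ℕ.+ F k                          ≡⟨ ℕ.+-assoc (N y v) _ _ ⟩
      N y v ℕ.+ (∑< k F ℕ.+ F k)                          ≡⟨ cong (N y v ℕ.+_) (sym (∑<-last k F)) ⟩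
      N y v ℕ.+ ∑< (suc k) F                              ∎
      where
      open ≡.≡-Reasoning
      F : ℕ → ℕ
      F l = bit (does (I? (inv y · (alt a b (suc (l ℕ.+ l)) · (y · v)))))

    N-e : ∀ v → N e v ≡ 0
    N-e v = none T
      where
      none : ∀ ts → count (test e v) ts ≡ 0
      none []       = refl
      none (t ∷ ts) rewrite dec-false (ℓ (e · t) ℕ.<? ℓ e) (λ k → ℕ.n≮0 (ℕ.≤-trans k (ℕ.≤-reflexive ℓ-e))) = none ts

    module _ (local : Local) where

      -- The inversions of `inv (alt a b k) · y` are those of `y` and `k` dihedral ones. The first
      -- kind contributes equally because `N y` is constant on the part of the coset inside the
      -- interval; the second kind is compared by `sums`.
      dihedral-step : ∀ a b y v → a ≢ b → a ↑ y → b ↑ y → ∀ k → k ℕ.< m a b →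
        (∀ s v → s ↑ y → I v → I (refl-at y s · v) → N y v ≡ N y (refl-at y s · v)) →
        I v → I (refl-at (inv (alt a b k) · y) (last a b k) · v) →
        N (inv (alt a b k) · y) v ≡ N (inv (alt a b k) · y) (refl-at (inv (alt a b k) · y) (last a b k) · v)
      dihedral-step a b y v a≢b a↑ b↑ k l bal Iv Itv = begin
        N x v                                                                  ≡⟨ N-chain a b y v a≢b a↑ b↑ k (ℕ.<⇒≤ l) ⟩
        N y v ℕ.+ ∑< k (λ l → bit (j? (alt a b (suc (l ℕ.+ l)) · g)))          ≡⟨ cong₂ ℕ._+_ level (sums k g In-g Jz Jg Jtg) ⟩
        N y tv ℕ.+ ∑< k (λ l → bit (j? (alt b a (suc l ℕ.+ suc l) · g)))       ≡⟨ cong (N y tv ℕ.+_) (sym (∑<-reverse k (λ l → bit (j? (alt b a (l ℕ.+ l) · g))))) ⟩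
        N y tv ℕ.+ ∑< k (λ l → bit (j? (alt b a ((k ℕ.∸ l) ℕ.+ (k ℕ.∸ l)) · g)))  ≡⟨ cong (N y tv ℕ.+_) (∑<-cong k (λ l h → cong (λ v → bit (j? v)) (product l h))) ⟩
        N y tv ℕ.+ ∑< k (λ l → bit (j? (alt a b (suc (l ℕ.+ l)) · (y · tv))))  ≡⟨ sym (N-chain a b y tv a≢b a↑ b↑ k (ℕ.<⇒≤ l)) ⟩
        N x tv                                                                 ∎
        where
        open ≡.≡-Reasoning
        x g tv z : W
        x = inv (alt a b k) · y
        g = y · v
        tv = refl-at x (last a b k) · v
        stripped : ∃ λ z → a ↑ z × b ↑ z × (∃ λ i → g ≡ alt a b i · z ⊎ g ≡ alt b a i · z)
        stripped with strip-any a b g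
        ... | inj₁ S = Strip.z S , Strip.a↑z S , Strip.b↑z S , Strip.k S , inj₁ (Strip.split S)
        ... | inj₂ S = Strip.z S , Strip.b↑z S , Strip.a↑z S , Strip.k S , inj₂ (Strip.split S)
        z = proj₁ stripped
        open Coset local a b a≢b y z a↑ b↑ (proj₁ (proj₂ stripped)) (proj₁ (proj₂ (proj₂ stripped)))
        open OneCoset a b a≢b y z a↑ b↑ (proj₁ (proj₂ stripped)) (proj₁ (proj₂ (proj₂ stripped))) using (J)
        In-g : In g
        In-g with proj₂ (proj₂ (proj₂ stripped))
        ... | i , inj₁ q = subst In (sym q) (In-alt i In-z)
        ... | i , inj₂ q = subst In (sym q) (In-alt' i In-z)
        ytv : y · tv ≡ alt a b (suc (k ℕ.+ k)) · g
        ytv = trans (cong (λ t → y · (t · v)) (refl-at-alt a b k y)) (trans (cong (y ·_) (trans (assoc _ _ _) (cong (inv y ·_) (assoc _ _ _)))) (cancel-invˡ y _))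
        Jg : J g
        Jg = subst I (sym (inv-cancelˡ y v)) Iv
        Jtg : J (alt a b (suc (k ℕ.+ k)) · g)
        Jtg = subst I (trans (sym (inv-cancelˡ y tv)) (cong (inv y ·_) ytv)) Itv
        Jz : J z
        Jz = J⇒Jz g In-g Jg
        level : N y v ≡ N y tv
        level = trans (cong (N y) (sym (inv-cancelˡ y v))) (trans (N-coset bal g In-g Jg) (trans (sym (N-coset bal _ (In-alt (suc (k ℕ.+ k)) In-g) Jtg))
                  (cong (N y) (trans (cong (inv y ·_) (sym ytv)) (inv-cancelˡ y tv)))))
        -- The palindromes with indices l and k compose to a rotation of length 2(k - l). The
        -- dihedral contributions at `tv` thus form the second sum in reversed order.
        product : ∀ l → l ℕ.< k → alt b a ((k ℕ.∸ l) ℕ.+ (k ℕ.∸ l)) · g ≡ alt a b (suc (l ℕ.+ l)) · (y · tv)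
        product l h = trans (cong (_· g) (trans (sym (palindrome-product a b l (k ℕ.∸ l))) (cong (λ i → alt a b (suc (l ℕ.+ l)) · alt a b (suc (i ℕ.+ i))) (ℕ.m+[n∸m]≡n (ℕ.<⇒≤ h)))))
                        (trans (assoc _ _ _) (cong (alt a b (suc (l ℕ.+ l)) ·_) (sym ytv)))

      -- Induction on the length of `y`. A descent `s'` of `y` differs from the ascent `s`;
      -- stripping off the part generated by both leaves a shorter element with both as ascents,
      -- where balance is known by induction and `dihedral-step` carries it back to `y`.
      local⇒balanced : Balanced
      local⇒balanced y s v = go (ℓ y) y ℕ.≤-refl s v
        where
        go : ∀ B y → ℓ y ℕ.≤ B → ∀ s v → s ↑ y → I v → I (refl-at y s · v) → N y v ≡ N y (refl-at y s · v)
        go B y l s v s↑ Iv Itv with y ≟ e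
        ... | yes refl = trans (N-e v) (sym (N-e _))
        go zero    y l s v s↑ Iv Itv | no y≢e = ⊥-elim (y≢e (ℓ≡0 y (ℕ.n≤0⇒n≡0 l)))
        go (suc B) y l s v s↑ Iv Itv | no y≢e with has-descent y y≢e
        ... | s' , s'↓ with s Fin.≟ s'
        ...   | yes refl = ⊥-elim (ℕ.<-asym s↑ s'↓)
        ...   | no s≢s' with strip s' s y s↑
        ...     | S with orient (Strip.k S) s s'
        ...       | a , b , o , la , _ , q = subst (λ x → I (refl-at x s · v) → N x v ≡ N x (refl-at x s · v)) x≡y
                      (subst (λ t → I (refl-at x t · v) → N x v ≡ N x (refl-at x t · v)) la
                        (dihedral-step a b (Strip.z S) v (proj₁ cond) (proj₁ (proj₂ cond)) (proj₁ (proj₂ (proj₂ cond))) (Strip.k S) (proj₂ (proj₂ (proj₂ cond))) (go B (Strip.z S) smaller) Iv)) Itv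
          where
          x : W
          x = inv (alt a b (Strip.k S)) · Strip.z S
          x≡y : x ≡ y
          x≡y = trans (cong (_· Strip.z S) q) (sym (Strip.split S))
          k<m : Strip.k S ℕ.< m s s'
          k<m = no-long-strip s≢s' s↑ S
          conditions : ∀ {a b} → (a ≡ s × b ≡ s') ⊎ (a ≡ s' × b ≡ s) → a ≢ b × a ↑ Strip.z S × b ↑ Strip.z S × Strip.k S ℕ.< m a b
          conditions (inj₁ (refl , refl)) = s≢s' , Strip.b↑z S , Strip.a↑z S , k<m
          conditions (inj₂ (refl , refl)) = (λ r → s≢s' (sym r)) , Strip.a↑z S , Strip.b↑z S , subst (Strip.k S ℕ.<_) (m-sym s s') k<m
          cond : a ≢ b × a ↑ Strip.z S × b ↑ Strip.z S × Strip.k S ℕ.< m a b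
          cond = conditions o
          k≢0 : 0 ℕ.< Strip.k S
          k≢0 with Strip.k S in eq
          ... | suc _ = s≤s z≤n
          ... | zero  = ⊥-elim (ℕ.<-asym s'↓ (subst (s' ↑_) (sym (trans (Strip.split S) (trans (cong (λ k → alt s' s k · Strip.z S) eq) (identityˡ _)))) (Strip.a↑z S)))
          smaller : ℓ (Strip.z S) ℕ.≤ B
          smaller = ℕ.≤-pred (ℕ.≤-trans (ℕ.+-monoˡ-≤ (ℓ (Strip.z S)) k≢0) (ℕ.≤-trans (ℕ.≤-reflexive (sym (Strip.ℓ-add S))) l))

-- Polynomial functions and orders of vanishing.

-- A polynomial ring seen through its constants, its variable and evaluation at zero. It serves
-- twice: over the polynomial functions to test homogeneity, and over the coefficient field to
-- measure orders of vanishing.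
record OneVar (S : CRing) : Set₁ where
  private module S = CommutativeRing S
  field
    Q        : CRing
    Q-domain : Domain Q
    c        : Hom S Q
    X        : CommutativeRing.Carrier Q
    X≉0      : ¬ CommutativeRing._≈_ Q X (CommutativeRing.0# Q)
    ev       : Hom Q S
    ev-c     : ∀ f → Hom.fn ev (Hom.fn c f) S.≈ f
    ev-X     : Hom.fn ev X S.≈ S.0#

oneVar : ∀ S → Domain S → OneVar S
oneVar S D = record
  { Q = PolyRing S ; Q-domain = PolyRing-domain S D ; c = CHom S ; X = PolyOver.X S ; X≉0 = λ h → Domain.1≉0 D (h 1)
  ; ev = evalHom S (idHom S) 0# ; ev-c = evalHom-C S (idHom S) 0# ; ev-X = evalHom-X S (idHom S) 0# }
  where open CommutativeRing S using (0#)

record Free (K : CRing) (n : ℕ) : Set₁ where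
  field
    S        : CRing
    S-domain : Domain S
    con      : Hom K S
    var      : Fin n → CommutativeRing.Carrier S
    sub      : ∀ {A} → Hom K A → (Fin n → CommutativeRing.Carrier A) → Hom S A
    sub-con  : ∀ {A} φ ρ k → CommutativeRing._≈_ A (Hom.fn (sub {A} φ ρ) (Hom.fn con k)) (Hom.fn φ k)
    sub-var  : ∀ {A} φ ρ i → CommutativeRing._≈_ A (Hom.fn (sub {A} φ ρ) (var i)) (ρ i)
    agree    : ∀ {A} (F G : Hom S A) → (∀ k → CommutativeRing._≈_ A (Hom.fn F (Hom.fn con k)) (Hom.fn G (Hom.fn con k))) →
               (∀ i → CommutativeRing._≈_ A (Hom.fn F (var i)) (Hom.fn G (var i))) → ∀ f → CommutativeRing._≈_ A (Hom.fn F f) (Hom.fn G f)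

free : ∀ K → Domain K → ∀ n → Free K n
free K D n = record
  { S = MvP n ; S-domain = MvP-domain D n ; con = con n ; var = var ; sub = λ φ ρ → subst-hom φ ρ
  ; sub-con = λ φ ρ k → subst-con φ ρ k ; sub-var = λ φ ρ i → subst-var φ ρ i ; agree = λ F G → mv-agree n F G }
  where open MvPoly K

module Vanishing (K : CRing) (O : OneVar K) where
  open OneVar O
  open CommutativeRing Q hiding (zero)
  open IntSolver Q
  open Domain Q-domain
  open import Algebra.Properties.Semiring.Exp semiring using (_^_; ^-homo-*)
  private module K = CommutativeRing K

  HasOrder : ℕ → Carrier → Set
  HasOrder d f = Σ Carrier λ g → f ≈ X ^ d * g × ¬ (Hom.fn ev g K.≈ K.0#)

  HasOrder-resp : ∀ {d f f'} → f ≈ f' → HasOrder d f → HasOrder d f'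
  HasOrder-resp e (g , h , k) = g , trans (sym e) h , k

  order-* : Domain K → ∀ {d d' f f'} → HasOrder d f → HasOrder d' f' → HasOrder (d ℕ.+ d') (f * f')
  order-* DK {d} {d'} (g , h , k) (g' , h' , k') = g * g' , trans (*-cong h h') (trans (solve 4 (λ a g b g' → (a :* g) :* (b :* g') := (a :* b) :* (g :* g')) refl _ _ _ _)
    (*-congʳ (sym (^-homo-* X d d')))) , λ z → Domain.*-≉0 DK k k' (K.trans (K.sym (Hom.*h ev g g')) z)

  X^≉0 : ∀ d → X ^ d ≉0
  X^≉0 zero    = 1≉0
  X^≉0 (suc d) = *-≉0 X≉0 (X^≉0 d)

  private
    order-≤ : ∀ d r {g g'} → X ^ d * g ≈ X ^ (d ℕ.+ suc r) * g' → Hom.fn ev g K.≈ K.0#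
    order-≤ d r {g} {g'} h = K.trans (Hom.cong ev (cancelˡ (X^≉0 d) (trans h (trans (*-congʳ (^-homo-* X d (suc r))) (*-assoc _ _ _)))))
      (K.trans (Hom.cong ev (*-assoc X (X ^ r) g')) (K.trans (Hom.*h ev X _) (K.trans (K.*-congʳ ev-X) (K.zeroˡ _))))

  order-unique : ∀ {d d' f} → HasOrder d f → HasOrder d' f → d ≡ d'
  order-unique {d} {d'} (g , h , k) (g' , h' , k') with ℕ.<-cmp d d'
  ... | tri≈ _ q _ = q
  ... | tri< l _ _ = ⊥-elim (k (order-≤ d (d' ℕ.∸ suc d) (trans (sym h) (trans h' (*-congʳ (reflexive (≡.cong (X ^_) (≡.sym (≡.trans (ℕ.+-suc d _) (ℕ.m+[n∸m]≡n l))))))))))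
  ... | tri> _ _ l = ⊥-elim (k' (order-≤ d' (d ℕ.∸ suc d') (trans (sym h') (trans h (*-congʳ (reflexive (≡.cong (X ^_) (≡.sym (≡.trans (ℕ.+-suc d' _) (ℕ.m+[n∸m]≡n l))))))))))

-- Roots as prime linear forms, and the nil Hecke functions.

module NilHecke (C : FiniteCoxeterSystem) (ℓ : FiniteCoxeterSystem.W C → ℕ) (isLength : ∀ w → IsLength C w (ℓ w))
  (D : PosDomain) (cos : ℕ → CommutativeRing.Carrier (PosDomain.K D))
  (cos-angle : ∀ m → 2 ℕ.≤ m → m ℕ.≤ length (FiniteCoxeterSystem.elems C) → IsAngle D (cos m) m)
  (FA : Free (PosDomain.K D) (FiniteCoxeterSystem.n C)) (OS : OneVar (Free.S FA)) where

  open FiniteCoxeterSystem C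
  open Coxeter C ℓ isLength
  open Geometry C ℓ isLength D cos cos-angle hiding (m)
  open Roots C ℓ isLength D cos cos-angle
  open Bruhat C ℓ isLength D cos cos-angle
  open PosDomain D using (K; domain)
  private
    module K = CommutativeRing K
  open Free FA
  open CommutativeRing S hiding (zero)
  open IntSolver S
  open Domain S-domain using (dom; *-≉0; 1≉0)
  module KS = IntSolver K

  module Linear (A : CRing) (φ : Hom K A) where
    private module A = CommutativeRing A
    open import Algebra.Properties.Semiring.Sum A.semiring using (sum; sum-cong-≋)
    open import Algebra.Properties.Semiring.Sum K.semiring using () renaming (sum to sumK)

    record IsLinear (F : V → A.Carrier) : Set where
      field
        L-cong : ∀ {u v} → u ≋ v → F u A.≈ F v
        L-⊕    : ∀ u v → F (u ⊕ v) A.≈ F u A.+ F v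
        L-⊛    : ∀ k v → F (k ⊛ v) A.≈ Hom.fn φ k A.* F v

    module _ {F : V → A.Carrier} (L : IsLinear F) where
      open IsLinear L

      L-0 : F (λ _ → K.0#) A.≈ A.0#
      L-0 = A.trans (L-cong (λ k → K.sym (K.zeroˡ K.0#))) (A.trans (L-⊛ K.0# (λ _ → K.0#)) (A.trans (A.*-congʳ (Hom.0h φ)) (A.zeroˡ _)))

      private
        L-sum : ∀ {m} (g : Fin m → V) → F (λ k → sumK (λ j → g j k)) A.≈ sum (λ j → F (g j))
        L-sum {zero}  g = L-0
        L-sum {suc m} g = A.trans (L-⊕ _ _) (A.+-congˡ (L-sum (λ j → g (Fin.suc j))))

        δ-sym : ∀ {m} (i j : Fin m) → δ i j ≡ δ j i
        δ-sym Fin.zero    Fin.zero    = ≡.refl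
        δ-sym Fin.zero    (Fin.suc j) = ≡.refl
        δ-sym (Fin.suc i) Fin.zero    = ≡.refl
        δ-sym (Fin.suc i) (Fin.suc j) = δ-sym i j

      expand : ∀ v → F v A.≈ sum (λ j → Hom.fn φ (v j) A.* F (α j))
      expand v = A.trans (L-cong (λ k → K.trans (K.sym (sum-δ v k)) (K.reflexive (sum≡ k)))) (A.trans (L-sum (λ j → v j ⊛ α j)) (sum-cong-≋ (λ j → L-⊛ (v j) (α j))))
        where
        open import Algebra.Properties.Semiring.Sum K.semiring using (sum-cong-≗)
        sum≡ : ∀ k → sumK (λ j → v j K.* δ k j) ≡ sumK (λ j → v j K.* δ j k)
        sum≡ k = sum-cong-≗ (λ j → ≡.cong (v j K.*_) (δ-sym k j))

  module LS = Linear S con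
  open import Algebra.Properties.Semiring.Sum semiring using (sum; sum-cong-≋; ∑-distrib-+; *-distribˡ-sum)

  lin : V → Carrier
  lin v = sum (λ j → Hom.fn con (v j) * var j)

  lin-linear : LS.IsLinear lin
  lin-linear = record
    { L-cong = λ h → sum-cong-≋ (λ j → *-congʳ (Hom.cong con (h j)))
    ; L-⊕    = λ u v → trans (sum-cong-≋ (λ j → trans (*-congʳ (Hom.+h con (u j) (v j))) (distribʳ (var j) (Hom.fn con (u j)) (Hom.fn con (v j)))))
                        (∑-distrib-+ (λ j → Hom.fn con (u j) * var j) (λ j → Hom.fn con (v j) * var j))
    ; L-⊛    = λ k v → trans (sum-cong-≋ (λ j → trans (*-congʳ (Hom.*h con k (v j))) (*-assoc (Hom.fn con k) (Hom.fn con (v j)) (var j))))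
                        (sym (*-distribˡ-sum (Hom.fn con k) (λ j → Hom.fn con (v j) * var j))) }

  open LS.IsLinear lin-linear public renaming (L-cong to lin-cong; L-⊕ to lin-⊕; L-⊛ to lin-⊛)

  lin-neg : ∀ v → lin (neg v) ≈ - lin v
  lin-neg v = trans (lin-cong (≋-sym (-1⊛ v))) (trans (lin-⊛ (K.- K.1#) v) (trans (*-congʳ (trans (Hom.-h con K.1#) (-‿cong (Hom.1h con))))
    (trans (solve 2 (λ o x → (:- o) :* x := :- (o :* x)) refl 1# (lin v)) (-‿cong (*-identityˡ _)))))

  private
    sum-con-zero : ∀ {m} (g : Fin m → Carrier) → sum (λ k → Hom.fn con K.0# * g k) ≈ 0#
    sum-con-zero {zero}  g = refl
    sum-con-zero {suc m} g = trans (+-cong (trans (*-congʳ (Hom.0h con)) (zeroˡ _)) (sum-con-zero (λ k → g (Fin.suc k)))) (+-identityˡ 0#)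

    sum-con-δ : ∀ {m} (g : Fin m → Carrier) (j : Fin m) → sum (λ k → Hom.fn con (δ j k) * g k) ≈ g j
    sum-con-δ g Fin.zero    = trans (+-cong (trans (*-congʳ (Hom.1h con)) (*-identityˡ _)) (sum-con-zero (λ k → g (Fin.suc k)))) (+-identityʳ _)
    sum-con-δ g (Fin.suc j) = trans (+-cong (trans (*-congʳ (Hom.0h con)) (zeroˡ _)) (sum-con-δ (λ k → g (Fin.suc k)) j)) (+-identityˡ _)

  lin-α : ∀ j → lin (α j) ≈ var j
  lin-α j = sum-con-δ var j

  module _ {A : CRing} (φ : Hom K A) (F : V → CommutativeRing.Carrier A) (LF : Linear.IsLinear A φ F) where
    private module A = CommutativeRing A
    open import Algebra.Properties.Semiring.Sum A.semiring using () renaming (sum to sumA; sum-cong-≋ to sumA-cong)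

    sub-lin : (h : Hom S A) → (∀ k → Hom.fn h (Hom.fn con k) A.≈ Hom.fn φ k) → (∀ j → Hom.fn h (var j) A.≈ F (α j)) → ∀ v → Hom.fn h (lin v) A.≈ F v
    sub-lin h hc hv v = A.trans (hom-sum (λ j → Hom.fn con (v j) * var j)) (A.trans (sumA-cong (λ j → A.trans (Hom.*h h (Hom.fn con (v j)) (var j)) (A.*-cong (hc (v j)) (hv j)))) (A.sym (Linear.expand A φ LF v)))
      where
      hom-sum : ∀ {m} (g : Fin m → Carrier) → Hom.fn h (sum g) A.≈ sumA (λ j → Hom.fn h (g j))
      hom-sum {zero}  g = Hom.0h h
      hom-sum {suc m} g = A.trans (Hom.+h h _ _) (A.+-congˡ (hom-sum (λ j → g (Fin.suc j))))

  private
    zeros : Fin n → K.Carrier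
    zeros _ = K.0#

  ε : Hom S K
  ε = sub (idHom K) zeros

  con-≉0 : ∀ {k} → Hom.fn con k ≈ 0# → k K.≈ K.0#
  con-≉0 {k} h = K.trans (K.sym (sub-con {K} (idHom K) zeros k)) (K.trans (Hom.cong ε h) (Hom.0h ε))

  lin-injective : ∀ v → lin v ≈ 0# → ∀ k → v k K.≈ K.0#
  lin-injective v h k = K.trans (K.sym (sub-lin (idHom K) (λ v → v k) coordinate at (sub-con (idHom K) _) (sub-var (idHom K) _) v)) (K.trans (Hom.cong at h) (Hom.0h at))
    where
    coordinate : Linear.IsLinear K (idHom K) (λ v → v k)
    coordinate = record { L-cong = λ h → h k ; L-⊕ = λ u v → K.refl ; L-⊛ = λ c v → K.refl }
    at : Hom S K
    at = sub (idHom K) (λ j → α j k)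

  infix 4 _∣_
  _∣_ : Carrier → Carrier → Set
  a ∣ f = Σ Carrier λ h → f ≈ h * a

  ∣-resp : ∀ {a f g} → f ≈ g → a ∣ f → a ∣ g
  ∣-resp e (h , q) = h , trans (sym e) q

  ∣-+ : ∀ {a f g} → a ∣ f → a ∣ g → a ∣ f + g
  ∣-+ (h , q) (k , r) = h + k , trans (+-cong q r) (sym (distribʳ _ h k))

  ∣-* : ∀ {a f} g → a ∣ f → a ∣ g * f
  ∣-* g (h , q) = g * h , trans (*-congˡ q) (sym (*-assoc g h _))

  ∣-0 : ∀ {a f} → f ≈ 0# → a ∣ f
  ∣-0 e = 0# , trans e (sym (zeroˡ _))

  ∣-neg : ∀ {a b f} → b ≈ - a → a ∣ f → b ∣ f
  ∣-neg e (h , q) = - h , trans q (trans (solve 2 (λ h a → h :* a := (:- h) :* (:- a)) refl _ _) (*-congˡ (sym e)))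

  -- Roots are prime elements: reduction modulo a root is the homomorphism
  -- var j ↦ var j − κ(α j) · root, where the functional κ takes the value 1 on the root.
  module Prime (x : W) (i : Fin n) where
    ρ : Carrier
    ρ = lin (α i ◁ x)

    κ : V → K.Carrier
    κ v = (v ◁ inv x) i

    image : Fin n → Carrier
    image j = var j - Hom.fn con (κ (α j)) * ρ

    reduce : Hom S S
    reduce = sub con image

    reduce-lin : ∀ v → Hom.fn reduce (lin v) ≈ lin v - Hom.fn con (κ v) * ρ
    reduce-lin = sub-lin con (λ v → lin v - Hom.fn con (κ v) * ρ) linear reduce (sub-con {S} con image)
      (λ j → trans (sub-var {S} con image j) (+-congʳ (sym (lin-α j))))
      where
      linear : LS.IsLinear (λ v → lin v - Hom.fn con (κ v) * ρ)
      linear = record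
        { L-cong = λ h → +-cong (lin-cong h) (-‿cong (*-congʳ (Hom.cong con (◁-cong (inv x) h i))))
        ; L-⊕ = λ u v → trans (+-cong (lin-⊕ u v) (-‿cong (*-congʳ (trans (Hom.cong con (◁-⊕ (inv x) u v i)) (Hom.+h con _ _)))))
            (solve 5 (λ a b k l r → (a :+ b) :- (k :+ l) :* r := (a :- k :* r) :+ (b :- l :* r)) refl _ _ _ _ _)
        ; L-⊛ = λ c v → trans (+-cong (lin-⊛ c v) (-‿cong (*-congʳ (trans (Hom.cong con (◁-⊛ (inv x) c v i)) (Hom.*h con _ _)))))
            (solve 4 (λ c a k r → c :* a :- (c :* k) :* r := c :* (a :- k :* r)) refl _ _ _ _) }

    κ-ρ : κ (α i ◁ x) K.≈ K.1#
    κ-ρ = K.trans (◁-inv x (α i) i) (δ-same i)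

    reduce-ρ : Hom.fn reduce ρ ≈ 0#
    reduce-ρ = trans (reduce-lin (α i ◁ x)) (trans (+-congˡ (-‿cong (trans (*-congʳ (trans (Hom.cong con κ-ρ) (Hom.1h con))) (*-identityˡ ρ)))) (-‿inverseʳ ρ))

    private
      quotient : CRing
      quotient = Quotient S (principal S ρ)
      π : Hom S quotient
      π = proj S (principal S ρ)

    reduce-mod : ∀ f → ρ ∣ (f - Hom.fn reduce f)
    reduce-mod f = agree π (π ∘h reduce)
        (λ k → Hom.cong π {Hom.fn con k} {Hom.fn reduce (Hom.fn con k)} (sym (sub-con {S} con image k)))
        (λ j → Hom.fn con (κ (α j)) , trans (+-congˡ (-‿cong (sub-var {S} con image j))) (solve 2 (λ v z → v :- (v :- z) := z) refl _ _)) f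

    zero⇒∣ : ∀ {f} → Hom.fn reduce f ≈ 0# → ρ ∣ f
    zero⇒∣ {f} h = ∣-resp (trans (+-congˡ (-‿cong h)) (solve 1 (λ f → f :- :0 := f) refl f)) (reduce-mod f)

    ∣⇒zero : ∀ {f} → ρ ∣ f → Hom.fn reduce f ≈ 0#
    ∣⇒zero (h , q) = trans (Hom.cong reduce q) (trans (Hom.*h reduce h ρ) (trans (*-congˡ reduce-ρ) (zeroʳ _)))

    -- A linear form that vanishes modulo `ρ` is a scalar multiple of `ρ`, and proportional roots
    -- define the same reflection.
    root≉ : ∀ x' j → refl-at x' j ≢ refl-at x i → Hom.fn reduce (lin (α j ◁ x')) ≉0
    root≉ x' j ne h = ne (≡.trans back (≡.cong (λ t → inv x · (t · x)) (proportional (x' · inv x) j i κ' prop)))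
      where
      κ' : K.Carrier
      κ' = κ (α j ◁ x')
      vanish : ∀ k → ((α j ◁ x') ⊕ (K.- κ') ⊛ (α i ◁ x)) k K.≈ K.0#
      vanish = lin-injective _ (trans (lin-⊕ _ _) (trans (+-congˡ (trans (lin-⊛ _ _) (*-congʳ (Hom.-h con κ'))))
        (trans (solve 3 (λ a k r → a :+ (:- k) :* r := a :- k :* r) refl _ _ _) (trans (sym (reduce-lin (α j ◁ x'))) h))))
      prop : α j ◁ (x' · inv x) ≋ κ' ⊛ α i
      prop = ≋-trans (◁-· x' (inv x) (α j)) (≋-trans (◁-cong (inv x) (λ k → KS.-≈0⇒≈ (K.trans (KS.solve 3 (λ a k r → a KS.:- k KS.:* r KS.:= a KS.:+ (KS.:- k) KS.:* r) K.refl _ _ _) (vanish k))))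
               (≋-trans (◁-⊛ (inv x) κ' _) (λ k → K.*-congˡ (◁-inv x (α i) k))))
      back : refl-at x' j ≡ inv x · (refl-at (x' · inv x) j · x)
      back = ≡.sym (begin
        inv x · ((inv (x' · inv x) · (gen j · (x' · inv x))) · x)    ≡⟨ ≡.cong (λ v → inv x · ((v · (gen j · (x' · inv x))) · x)) (≡.trans (inv-· _ _) (≡.cong (_· inv x') (inv-inv x))) ⟩
        inv x · (((x · inv x') · (gen j · (x' · inv x))) · x)        ≡⟨ ≡.cong (inv x ·_) (≡.trans (assoc _ _ _) (assoc _ _ _)) ⟩
        inv x · (x · (inv x' · ((gen j · (x' · inv x)) · x)))        ≡⟨ inv-cancelˡ x _ ⟩
        inv x' · ((gen j · (x' · inv x)) · x)                        ≡⟨ ≡.cong (inv x' ·_) (≡.trans (assoc _ _ _) (≡.cong (gen j ·_) (≡.trans (assoc _ _ _) (≡.trans (≡.cong (x' ·_) (inverseˡ x)) (identityʳ x'))))) ⟩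
        inv x' · (gen j · x')                                        ∎)
        where open ≡.≡-Reasoning

    prime : ∀ {f} x' j → refl-at x' j ≢ refl-at x i → ρ ∣ lin (α j ◁ x') * f → ρ ∣ f
    prime {f} x' j ne d = zero⇒∣ (dom (trans (sym (Hom.*h reduce _ f)) (∣⇒zero d)) (root≉ x' j ne))

    ∣-con : ∀ {k} → ρ ∣ Hom.fn con k → k K.≈ K.0#
    ∣-con {k} d = con-≉0 (trans (sym (sub-con {S} con image k)) (∣⇒zero d))

  lin-root≉0 : ∀ x i → lin (α i ◁ x) ≉0
  lin-root≉0 x i h = root≉0 x i (lin-injective _ h)

  -- The reflection of a root negates it, so here `σ i` negates `α j ◁ x`. Since `σ i` leaves every
  -- coordinate except the one at `i` alone, twice each of those coordinates is zero.
  same-reflection : ∀ x j i → refl-at x j ≡ gen i → α j ◁ x ≋ ((α j ◁ x) i) ⊛ α i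
  same-reflection x j i h k with i Fin.≟ k
  ... | yes ≡.refl = K.sym (K.trans (K.*-congˡ (δ-same i)) (K.*-identityʳ _))
  ... | no i≢k = K.trans (Domain.dom domain {K.1# K.+ K.1#} (K.trans (K.distribʳ _ _ _) (K.trans (K.+-cong (K.*-identityˡ _) (K.*-identityˡ _)) double)) (PosDomain.Pos-≉0 D (PosDomain.Pos-+ D (PosDomain.Pos-1 D) (PosDomain.Pos-1 D))))
                   (K.sym (K.trans (K.*-congˡ (δ-diff i≢k)) (K.zeroʳ _)))
    where
    r : V
    r = α j ◁ x
    flipped : σ i r ≋ neg r
    flipped = ≋-trans (≋-sym (◁-gen i r)) (≋-trans (≋-sym (◁-· x (gen i) (α j))) (≋-trans (◁-≡ (α j) (≡.trans (≡.cong (x ·_) (≡.sym h)) (cancel-invˡ x (j ⊙ x)))) (σ-self j x)))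
    double : r k K.+ r k K.≈ K.0#
    double = K.trans (K.+-congˡ (K.trans (K.sym (KS.solve 2 (λ a t → a KS.:- t KS.:* KS.:0 KS.:= a) K.refl (r k) (θ i r)))
       (K.trans (K.+-congˡ (K.-‿cong (K.*-congˡ (K.sym (δ-diff i≢k))))) (flipped k)))) (K.-‿inverseʳ _)

  same-root : ∀ x' j x i → refl-at x' j ≡ refl-at x i → ∃ λ κ → α j ◁ x' ≋ κ ⊛ (α i ◁ x)
  same-root x' j x i h = _ , ≋-trans (≋-sym (inv-◁ x (α j ◁ x'))) (≋-trans (◁-cong x (≋-trans (≋-sym (◁-· x' (inv x) (α j))) (same-reflection (x' · inv x) j i conj))) (◁-⊛ x _ (α i)))
    where
    conj : refl-at (x' · inv x) j ≡ gen i
    conj = begin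
      inv (x' · inv x) · (gen j · (x' · inv x))      ≡⟨ ≡.cong (_· (gen j · (x' · inv x))) (≡.trans (inv-· _ _) (≡.cong (_· inv x') (inv-inv x))) ⟩
      (x · inv x') · (gen j · (x' · inv x))          ≡⟨ ≡.trans (assoc _ _ _) (≡.cong (λ v → x · (inv x' · v)) (≡.sym (assoc _ _ _))) ⟩
      x · (inv x' · ((gen j · x') · inv x))          ≡⟨ ≡.cong (x ·_) (≡.sym (assoc _ _ _)) ⟩
      x · (refl-at x' j · inv x)                     ≡⟨ ≡.cong (λ v → x · (v · inv x)) h ⟩
      x · ((inv x · (gen i · x)) · inv x)            ≡⟨ ≡.cong (x ·_) (assoc _ _ _) ⟩
      x · (inv x · ((gen i · x) · inv x))            ≡⟨ cancel-invˡ x _ ⟩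
      (gen i · x) · inv x                            ≡⟨ ≡.trans (assoc _ _ _) (≡.trans (≡.cong (gen i ·_) (inverseʳ x)) (identityʳ _)) ⟩
      gen i                                          ∎
      where open ≡.≡-Reasoning

  Pair : Set
  Pair = W × Fin n

  ref : Pair → W
  ref (x , i) = refl-at x i

  private
    choose : (ts : List W) → (∀ {t} → t ∈ ts → IsRefl t) → Σ (List Pair) λ ps → map ref ps ≡ ts
    choose []       h = [] , ≡.refl
    choose (t ∷ ts) h with h (here ≡.refl) | choose ts (λ m → h (there m))
    ... | x , i , q | ps , r = (x , i) ∷ ps , ≡.cong₂ _∷_ (≡.sym q) r

  -- One root, of either sign, for each reflection; another choice would change each root by a
  -- scalar factor only.
  roots : List Pair
  roots = proj₁ (choose T T-sound)

  roots-T : map ref roots ≡ T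
  roots-T = proj₂ (choose T T-sound)

  factor : W → Pair → Carrier
  factor h (x , i) = lin (α i ◁ (x · h))

  ∏ : W → List Pair → Carrier
  ∏ h []       = 1#
  ∏ h (r ∷ rs) = factor h r * ∏ h rs

  ∏-≉0 : ∀ h rs → ∏ h rs ≉0
  ∏-≉0 h []             = 1≉0
  ∏-≉0 h ((x , i) ∷ rs) = *-≉0 (lin-root≉0 (x · h) i) (∏-≉0 h rs)

  refl-at-conj : ∀ x i h → refl-at (x · h) i ≡ inv h · (refl-at x i · h)
  refl-at-conj x i h = ≡.trans (≡.cong (_· (gen i · (x · h))) (inv-· x h)) (≡.trans (assoc _ _ _) (≡.cong (inv h ·_)
    (≡.trans (≡.cong (inv x ·_) (≡.sym (assoc _ _ _))) (≡.sym (assoc _ _ _)))))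

  refl-at-distinct : ∀ {x i x' j} h → refl-at x i ≢ refl-at x' j → refl-at (x · h) i ≢ refl-at (x' · h) j
  refl-at-distinct {x} {i} {x'} {j} h ne q = ne (cancelʳ h _ _ (cancelˡ (inv h) _ _ (≡.trans (≡.sym (refl-at-conj x i h)) (≡.trans q (refl-at-conj x' j h)))))

  factor-∣-∏ : ∀ (h : W) {x : W} {i : Fin n} (rs : List Pair) → ∀ {r : Pair} → r ∈ rs → ref r ≡ refl-at x i → lin (α i ◁ (x · h)) ∣ ∏ h rs
  factor-∣-∏ h {x} {i} ((x' , j) ∷ rs) (here ≡.refl) q = ∏ h rs * Hom.fn con κ , trans (*-congʳ scaled) (solve 3 (λ k a p → (k :* a) :* p := (p :* k) :* a) refl (Hom.fn con κ) (lin (α i ◁ (x · h))) (∏ h rs))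
    where
    κ : K.Carrier
    κ = proj₁ (same-root x' j x i q)
    scaled : lin (α j ◁ (x' · h)) ≈ Hom.fn con κ * lin (α i ◁ (x · h))
    scaled = trans (lin-cong (≋-trans (◁-· x' h (α j)) (≋-trans (◁-cong h (proj₂ (same-root x' j x i q))) (≋-trans (◁-⊛ h κ (α i ◁ x)) (λ k → K.*-congˡ (K.sym (◁-· x h (α i) k))))))) (lin-⊛ κ (α i ◁ (x · h)))
  factor-∣-∏ h (r ∷ rs) (there m) q = ∣-* (factor h r) (factor-∣-∏ h rs m q)

  prime-∏ : ∀ (h x : W) (i : Fin n) (f : Carrier) (rs : List Pair) → (∀ {r : Pair} → r ∈ rs → ref r ≢ refl-at x i) → lin (α i ◁ (x · h)) ∣ f * ∏ h rs → lin (α i ◁ (x · h)) ∣ f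
  prime-∏ h x i f []               ne d = ∣-resp (*-identityʳ f) d
  prime-∏ h x i f ((x' , j) ∷ rs) ne d = prime-∏ h x i f rs (λ m → ne (there m)) (Prime.prime (x · h) i {f * ∏ h rs} (x' · h) j distinct swapped)
    where
    distinct : refl-at (x' · h) j ≢ refl-at (x · h) i
    distinct = refl-at-distinct {x'} {j} {x} {i} h (ne {x' , j} (here ≡.refl))
    swapped : lin (α i ◁ (x · h)) ∣ lin (α j ◁ (x' · h)) * (f * ∏ h rs)
    swapped = ∣-resp (solve 3 (λ f a p → f :* (a :* p) := a :* (f :* p)) refl f (lin (α j ◁ (x' · h))) (∏ h rs)) d

  -- Roots of different reflections are primes that do not divide one another, so divisibility by
  -- each of them accumulates to divisibility by their product.
  ∏-∣ : ∀ (h : W) (f : Carrier) (rs : List Pair) → Unique (map ref rs) → (∀ {r : Pair} → r ∈ rs → factor h r ∣ f) → ∏ h rs ∣ f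
  ∏-∣ h f []             u d = f , sym (*-identityʳ f)
  ∏-∣ h f ((x , i) ∷ rs) (r∉ ∷ u) d =
    let g , q = ∏-∣ h f rs u (λ m → d (there m))
        g' , q' = prime-∏ h x i g rs (λ m e → All.lookup (All.map⁻ r∉) m (≡.sym e)) (∣-resp q (d (here ≡.refl)))
    in g' , trans q (trans (*-congʳ q') (*-assoc g' (lin (α i ◁ (x · h))) (∏ h rs)))

  -- Homogeneity is tested by the homomorphism scaling every variable by X.

  open OneVar OS using (Q; Q-domain; c; X; X≉0; ev; ev-c; ev-X)
  private
    module Q = CommutativeRing Q
    module QS = IntSolver Q
  open import Algebra.Properties.Semiring.Exp Q.semiring using (_^_; ^-homo-*)

  private
    scaled-var : Fin n → Q.Carrier
    scaled-var j = X Q.* Hom.fn c (var j)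

  scale : Hom S Q
  scale = sub (c ∘h con) scaled-var

  Homogeneous : ℕ → Carrier → Set
  Homogeneous d f = Hom.fn scale f Q.≈ X ^ d Q.* Hom.fn c f

  homogeneous-lin : ∀ v → Homogeneous 1 (lin v)
  homogeneous-lin v = Q.trans (sub-lin (c ∘h con) (λ v → X Q.* Hom.fn c (lin v)) linear scale (sub-con {Q} (c ∘h con) scaled-var)
      (λ j → Q.trans (sub-var {Q} (c ∘h con) scaled-var j) (Q.*-congˡ (Hom.cong c (sym (lin-α j))))) v) (Q.*-congʳ (Q.sym (Q.*-identityʳ X)))
    where
    linear : Linear.IsLinear Q (c ∘h con) (λ v → X Q.* Hom.fn c (lin v))
    linear = record
      { L-cong = λ h → Q.*-congˡ (Hom.cong c (lin-cong h))
      ; L-⊕ = λ u v → Q.trans (Q.*-congˡ (Q.trans (Hom.cong c (lin-⊕ u v)) (Hom.+h c _ _))) (Q.distribˡ _ _ _)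
      ; L-⊛ = λ k v → Q.trans (Q.*-congˡ (Q.trans (Hom.cong c (lin-⊛ k v)) (Hom.*h c _ _))) (QS.solve 3 (λ x k l → x QS.:* (k QS.:* l) QS.:= k QS.:* (x QS.:* l)) Q.refl _ _ _) }

  homogeneous-+ : ∀ {d f g} → Homogeneous d f → Homogeneous d g → Homogeneous d (f + g)
  homogeneous-+ h k = Q.trans (Hom.+h scale _ _) (Q.trans (Q.+-cong h k) (Q.trans (Q.sym (Q.distribˡ _ _ _)) (Q.*-congˡ (Q.sym (Hom.+h c _ _)))))

  homogeneous-0 : ∀ d → Homogeneous d 0#
  homogeneous-0 d = Q.trans (Hom.0h scale) (Q.sym (Q.trans (Q.*-congˡ (Hom.0h c)) (Q.zeroʳ _)))

  homogeneous-1 : Homogeneous 0 1#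
  homogeneous-1 = Q.trans (Hom.1h scale) (Q.sym (Q.trans (Q.*-identityˡ _) (Hom.1h c)))

  homogeneous-* : ∀ {d e f g} → Homogeneous d f → Homogeneous e g → Homogeneous (d ℕ.+ e) (f * g)
  homogeneous-* {d} {e} h k = Q.trans (Hom.*h scale _ _) (Q.trans (Q.*-cong h k)
    (Q.trans (QS.solve 4 (λ a f b g → (a QS.:* f) QS.:* (b QS.:* g) QS.:= (a QS.:* b) QS.:* (f QS.:* g)) Q.refl _ _ _ _) (Q.*-cong (Q.sym (^-homo-* X d e)) (Q.sym (Hom.*h c _ _)))))

  private
    X^≉0 : ∀ d → ¬ (X ^ d Q.≈ Q.0#)
    X^≉0 zero    = Domain.1≉0 Q-domain
    X^≉0 (suc d) = Domain.*-≉0 Q-domain X≉0 (X^≉0 d)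

    c-≉0 : ∀ {f} → f ≉0 → ¬ (Hom.fn c f Q.≈ Q.0#)
    c-≉0 h z = h (trans (sym (ev-c _)) (trans (Hom.cong ev z) (Hom.0h ev)))

  homogeneous-/ : ∀ {d e f g h} → f ≈ h * g → g ≉0 → Homogeneous (d ℕ.+ e) f → Homogeneous e g → Homogeneous d h
  homogeneous-/ {d} {e} {f} {g} {h} q ne hf hg = Domain.cancelˡ Q-domain (Domain.*-≉0 Q-domain (X^≉0 e) (c-≉0 ne))
    (Q.trans (Q.trans (Q.*-congʳ (Q.sym hg)) (Q.trans (Q.*-comm _ _) (Q.sym (Hom.*h scale h g)))) (Q.trans (Hom.cong scale (sym q)) (Q.trans hf
      (Q.trans (Q.*-cong (^-homo-* X d e) (Q.trans (Hom.cong c q) (Hom.*h c h g))) (QS.solve 4 (λ a b h g → (a QS.:* b) QS.:* (h QS.:* g) QS.:= (b QS.:* g) QS.:* (a QS.:* h)) Q.refl _ _ _ _)))))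

  -- A polynomial unchanged when all variables are scaled by `X` equals what remains at `X = 0`, its
  -- constant term.
  degree-0 : ∀ {f} → Homogeneous 0 f → f ≈ Hom.fn con (Hom.fn ε f)
  degree-0 {f} h = trans (sym (ev-c f)) (trans (Hom.cong ev (Q.sym (Q.trans h (Q.*-identityˡ _))))
    (agree (ev ∘h scale) (con ∘h ε)
      (λ k → trans (Hom.cong ev (sub-con {Q} (c ∘h con) scaled-var k)) (trans (ev-c _) (Hom.cong con (K.sym (sub-con {K} (idHom K) zeros k)))))
      (λ j → trans (Hom.cong ev (sub-var {Q} (c ∘h con) scaled-var j)) (trans (Hom.*h ev _ _) (trans (*-congʳ ev-X) (trans (zeroˡ _) (sym (trans (Hom.cong con (sub-var {K} (idHom K) zeros j)) (Hom.0h con))))))) f))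

  homogeneous-∏ : ∀ h rs → Homogeneous (length rs) (∏ h rs)
  homogeneous-∏ h []             = homogeneous-1
  homogeneous-∏ h ((x , i) ∷ rs) = homogeneous-* {1} {length rs} (homogeneous-lin (α i ◁ (x · h))) (homogeneous-∏ h rs)

  -- The coefficients of the nil Hecke basis element of w, multiplied by all positive roots.

  record Nil (w : W) : Set where
    field
      p       : W → Carrier
      star    : ∀ v x i → lin (α i ◁ (x · v)) ∣ p v + p (refl-at x i · v)
      degree  : ℕ
      degree+ : degree ℕ.+ ℓ w ≡ length roots
      homog   : ∀ v → Homogeneous degree (p v)
      support : ∀ v → ¬ (v ≼ w) → p v ≈ 0#
      top     : p w ≉0

  -- The function lives at `e` only. Its value there is the product of all roots, hence divisible by
  -- the root of every edge at `e`.
  nil-e : Nil e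
  nil-e = record
    { p = p ; star = λ v x i → ∣-+ (first v x i) (second v x i) ; degree = length roots
    ; degree+ = ≡.trans (≡.cong (length roots ℕ.+_) ℓ-e) (ℕ.+-identityʳ _) ; homog = homog ; support = λ v h → p-other (λ q → h (≡.subst (_≼ e) (≡.sym q) ≤B-refl))
    ; top = λ h → ∏-≉0 e roots (trans (sym p-e) h) }
    where
    p : W → Carrier
    p v with v ≟ e
    ... | yes _ = ∏ e roots
    ... | no _  = 0#
    p-e : p e ≈ ∏ e roots
    p-e with e ≟ e
    ... | yes _ = refl
    ... | no h  = ⊥-elim (h ≡.refl)
    p-other : ∀ {v} → v ≢ e → p v ≈ 0#
    p-other {v} h with v ≟ e
    ... | yes q = ⊥-elim (h q)
    ... | no _  = refl
    homog : ∀ v → Homogeneous (length roots) (p v)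
    homog v with v ≟ e
    ... | yes _ = homogeneous-∏ e roots
    ... | no _  = homogeneous-0 (length roots)
    divides-top : ∀ x i → lin (α i ◁ (x · e)) ∣ ∏ e roots
    divides-top x i with List-∈ (≡.subst (refl-at x i ∈_) (≡.sym roots-T) (T-complete (x , i , ≡.refl)))
      where
      open import Data.List.Membership.Propositional.Properties using (∈-map⁻)
      List-∈ : refl-at x i ∈ map ref roots → ∃ λ r → r ∈ roots × refl-at x i ≡ ref r
      List-∈ m = ∈-map⁻ ref m
    ... | r , m , q = factor-∣-∏ e roots m (≡.sym q)
    first : ∀ v x i → lin (α i ◁ (x · v)) ∣ p v
    first v x i with v ≟ e
    ... | yes ≡.refl = divides-top x i
    ... | no _       = ∣-0 refl
    second : ∀ v x i → lin (α i ◁ (x · v)) ∣ p (refl-at x i · v)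
    second v x i with (refl-at x i · v) ≟ e
    ... | no _  = ∣-0 refl
    ... | yes q = ∣-neg (trans (lin-cong (≋-trans (◁-≡ (α i) xv) (σ-self i (x · e)))) (lin-neg _)) (divides-top x i)
      where
      xv : x · v ≡ i ⊙ (x · e)
      xv = ≡.trans (≡.sym (gen-gen i (x · v))) (≡.cong (i ⊙_) (≡.trans (≡.sym (·-refl-at x i v)) (≡.cong (x ·_) q)))

  module NilStep {w' : W} (N : Nil w') (s : Fin n) (s↑w' : s ↑ w') where
    open Nil N renaming (p to p'; star to star'; degree to degree'; degree+ to degree'+; homog to homog'; support to support'; top to top')

    a : W → Carrier
    a v = lin (α s ◁ v)

    division : ∀ v → a v ∣ p' v + p' (s ⊙ v)
    division v with star' v e s
    ... | h , q = h , trans (+-congˡ (reflexive (≡.cong (λ t → p' (t · v)) (≡.sym (refl-at-e s))))) (trans q (*-congˡ (lin-cong (◁-≡ (α s) (identityˡ v)))))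

    -- The divided difference of `p'` along left multiplication by `s`. A sum stands where a
    -- difference is usual because `star` compares neighbouring values up to sign.
    p : W → Carrier
    p v = proj₁ (division v)

    p-eq : ∀ v → p' v + p' (s ⊙ v) ≈ p v * a v
    p-eq v = proj₂ (division v)

    a-s : ∀ v → a (s ⊙ v) ≈ - a v
    a-s v = trans (lin-cong (σ-self s v)) (lin-neg _)

    p-s : ∀ v → p v + p (s ⊙ v) ≈ 0#
    p-s v = dom (trans (distribˡ (a v) (p v) (p (s ⊙ v))) (trans (+-cong (trans (*-comm _ _) (sym (p-eq v))) (trans (solve 2 (λ a p → a :* p := :- (p :* (:- a))) refl (a v) (p (s ⊙ v)))
        (-‿cong (trans (*-congˡ (sym (a-s v))) (trans (sym (p-eq (s ⊙ v))) (trans (+-comm _ _) (+-congʳ (reflexive (≡.cong p' (gen-gen s v)))))))))) (-‿inverseʳ _))) (lin-root≉0 v s)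

    -- For the reflection `s` itself the two values are opposite. Otherwise the claim is multiplied
    -- by `a v` and `a v'`, which are congruent modulo `ρ` and prime to it; the product is a
    -- combination of two instances of `star'` and a multiple of `ρ`.
    star : ∀ v x i → lin (α i ◁ (x · v)) ∣ p v + p (refl-at x i · v)
    star v x i with refl-at x i ≟ gen s
    ... | yes q = ∣-0 (trans (+-congˡ (reflexive (≡.cong (λ t → p (t · v)) q))) (p-s v))
    ... | no ne = Prime.prime (x · v) i v s distinct₁ (Prime.prime (x · v) i v' s distinct₂ total)
      where
      t v' : W
      t = refl-at x i
      v' = t · v
      ρ : Carrier
      ρ = lin (α i ◁ (x · v))
      k : K.Carrier
      k = K.- θ i (α s ◁ inv x)
      a' : a v' ≈ a v + Hom.fn con k * ρ
      a' = trans (lin-cong (≋-trans (◁-· t v (α s)) (≋-trans (◁-cong v (refl-at-◁ x i (α s))) (≋-trans (◁-⊕ v _ _) (λ j → K.+-congˡ (K.trans (◁-⊛ v k _ j) (K.*-congˡ (K.sym (◁-· x v (α i) j)))))))))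
             (trans (lin-⊕ _ _) (+-congˡ (lin-⊛ k _)))
      distinct₁ : refl-at v s ≢ refl-at (x · v) i
      distinct₁ q = ne (≡.trans (cancelʳ v _ _ (cancelˡ (inv v) _ _ (≡.trans (≡.sym (refl-at-conj x i v)) (≡.trans (≡.sym q) (≡.cong (inv v ·_) ≡.refl))))) ≡.refl)
      t² : t · t ≡ e
      t² = refl-at-invol x i
      distinct₂ : refl-at v' s ≢ refl-at (x · v) i
      distinct₂ q = ne (≡.sym (begin
        gen s                              ≡⟨ ≡.sym (≡.trans (≡.cong (_· (gen s · e)) t²) (≡.trans (identityˡ _) (identityʳ _))) ⟩
        (t · t) · (gen s · e)              ≡⟨ ≡.cong (λ z → (t · t) · (gen s · z)) (≡.sym t²) ⟩
        (t · t) · (gen s · (t · t))        ≡⟨ ≡.trans (assoc _ _ _) (≡.cong (t ·_) (≡.trans (≡.cong (t ·_) (≡.sym (assoc _ _ _))) (≡.sym (assoc _ _ _)))) ⟩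
        t · ((t · (gen s · t)) · t)        ≡⟨ ≡.cong (λ z → t · (z · t)) conj ⟩
        t · (t · t)                        ≡⟨ ≡.trans (≡.cong (t ·_) t²) (identityʳ t) ⟩
        t                                  ∎))
        where
        open ≡.≡-Reasoning
        invt : inv t ≡ t
        invt = ≡.sym (inverse-unique t t t²)
        conj : t · (gen s · t) ≡ t
        conj = cancelʳ v _ _ (cancelˡ (inv v) _ _ (begin
          inv v · ((t · (gen s · t)) · v)        ≡⟨ ≡.cong (inv v ·_) (≡.trans (assoc _ _ _) (≡.cong (t ·_) (assoc _ _ _))) ⟩
          inv v · (t · (gen s · v'))             ≡⟨ ≡.sym (assoc _ _ _) ⟩
          (inv v · t) · (gen s · v')             ≡⟨ ≡.cong (_· (gen s · v')) (≡.sym (≡.trans (inv-· t v) (≡.cong (inv v ·_) invt))) ⟩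
          inv v' · (gen s · v')                  ≡⟨ q ⟩
          refl-at (x · v) i                      ≡⟨ refl-at-conj x i v ⟩
          inv v · (t · v)                        ∎))
      pairs : ρ ∣ (p' v + p' v') + (p' (s ⊙ v) + p' (s ⊙ v'))
      pairs = ∣-+ (star' v x i) (∣-resp (+-congˡ (reflexive (≡.cong p' shift))) (≡.subst (λ u → lin (α i ◁ u) ∣ p' (s ⊙ v) + p' (refl-at (x · gen s) i · (s ⊙ v))) xs (star' (s ⊙ v) (x · gen s) i)))
        where
        xs : (x · gen s) · (s ⊙ v) ≡ x · v
        xs = ≡.trans (assoc _ _ _) (≡.cong (x ·_) (gen-gen s v))
        shift : refl-at (x · gen s) i · (s ⊙ v) ≡ s ⊙ v'
        shift = ≡.trans (≡.sym (gen-gen s _)) (≡.cong (s ⊙_) (≡.trans (≡.sym (assoc _ _ _)) (≡.trans (≡.cong (_· (s ⊙ v)) (refl-at-shift x i s)) (≡.trans (assoc _ _ _) (≡.cong (t ·_) (gen-gen s v))))))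
      total : ρ ∣ a v' * (a v * (p v + p v'))
      total = ∣-resp (begin
        a v * ((p' v + p' v') + (p' (s ⊙ v) + p' (s ⊙ v'))) + (Hom.fn con k * (p' v + p' (s ⊙ v))) * ρ
          ≈⟨ solve 7 (λ a p q r u k ρ → a :* ((p :+ q) :+ (r :+ u)) :+ (k :* (p :+ r)) :* ρ := (a :+ k :* ρ) :* (p :+ r) :+ a :* (q :+ u)) refl (a v) _ _ _ _ _ ρ ⟩
        (a v + Hom.fn con k * ρ) * (p' v + p' (s ⊙ v)) + a v * (p' v' + p' (s ⊙ v'))
          ≈⟨ +-cong (*-cong (sym a') (p-eq v)) (*-congˡ (p-eq v')) ⟩
        a v' * (p v * a v) + a v * (p v' * a v')
          ≈⟨ solve 4 (λ b p a q → b :* (p :* a) :+ a :* (q :* b) := b :* (a :* (p :+ q))) refl (a v') (p v) (a v) (p v') ⟩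
        a v' * (a v * (p v + p v')) ∎)
        (∣-+ (∣-* (a v) pairs) (Hom.fn con k * (p' v + p' (s ⊙ v)) , refl))
        where open import Relation.Binary.Reasoning.Setoid setoid
    -- In degree 0 the value `p' w'` would be a nonzero constant. But `s ⊙ w'` lies outside the
    -- support of `p'`, so the root of `s` at `w'` would divide that constant.
    degree-suc : ∃ λ d → degree' ≡ suc d
    degree-suc with degree' in eq
    ... | suc d = d , ≡.refl
    ... | zero  = ⊥-elim (Prime-unit (homog' w'))
      where
      Prime-unit : Homogeneous degree' (p' w') → ⊥
      Prime-unit h = top' (trans const (trans (Hom.cong con k≈0) (Hom.0h con)))
        where
        const : p' w' ≈ Hom.fn con (Hom.fn ε (p' w'))
        const = degree-0 (≡.subst (λ d → Homogeneous d (p' w')) eq h)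
        k≈0 : Hom.fn ε (p' w') K.≈ K.0#
        k≈0 = Prime.∣-con w' s (∣-resp (trans (trans (+-congˡ (support' (s ⊙ w') not-below)) (+-identityʳ _)) const) (division w'))
          where
          not-below : ¬ (s ⊙ w' ≼ w')
          not-below q = ℕ.<⇒≱ s↑w' (≼-ℓ q)

    nil : Nil (s ⊙ w')
    nil = record
      { p = p ; star = star ; degree = proj₁ degree-suc
      ; degree+ = ≡.trans (≡.cong (proj₁ degree-suc ℕ.+_) (↑-suc s↑w')) (≡.trans (ℕ.+-suc _ _) (≡.trans (≡.cong (ℕ._+ ℓ w') (≡.sym (proj₂ degree-suc))) degree'+))
      ; homog = λ v → homogeneous-/ {proj₁ degree-suc} {1} (p-eq v) (lin-root≉0 v s) (homogeneous-+ {proj₁ degree-suc ℕ.+ 1} (graded v) (graded (s ⊙ v))) (homogeneous-lin (α s ◁ v))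
      ; support = support
      ; top = λ h → top' (trans (sym (trans (+-congʳ (support' (s ⊙ w') not-below)) (+-identityˡ _))) (trans (+-congˡ (reflexive (≡.cong p' (≡.sym (gen-gen s w'))))) (trans (p-eq (s ⊙ w')) (trans (*-congʳ h) (zeroˡ _))))) }
      where
      not-below : ¬ (s ⊙ w' ≼ w')
      not-below q = ℕ.<⇒≱ s↑w' (≼-ℓ q)
      graded : ∀ v → Homogeneous (proj₁ degree-suc ℕ.+ 1) (p' v)
      graded v = ≡.subst (λ d → Homogeneous d (p' v)) (≡.trans (proj₂ degree-suc) (ℕ.+-comm 1 _)) (homog' v)
      -- By the lifting property, `v` or `s ⊙ v` being below `w'` would put `v` below `s ⊙ w'`; so
      -- both values in the numerator vanish.
      support : ∀ v → ¬ (v ≼ s ⊙ w') → p v ≈ 0#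
      support v h = dom (trans (*-comm (a v) (p v)) (trans (sym (p-eq v)) (trans (+-cong (support' v (λ q → h (≼-trans q (≼-⊙ s↑w')))) (support' (s ⊙ v) below)) (+-identityˡ 0#)))) (lin-root≉0 v s)
        where
        below : ¬ (s ⊙ v ≼ w')
        below q with ≼-lift s q
        ... | inj₁ r = h (≡.subst (_≼ s ⊙ w') (gen-gen s v) r)
        ... | inj₂ r = h (≼-trans (≡.subst (_≼ w') (gen-gen s v) r) (≼-⊙ s↑w'))

  nil : ∀ w → Nil w
  nil w = go (ℓ w) w ℕ.≤-refl
    where
    go : ∀ N w → ℓ w ℕ.≤ N → Nil w
    go N w l with w ≟ e
    ... | yes q = ≡.subst Nil (≡.sym q) nil-e
    go zero    w l | no h = ⊥-elim (h (ℓ≡0 w (ℕ.n≤0⇒n≡0 l)))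
    go (suc N) w l | no h with has-descent w h
    ... | s , d = ≡.subst Nil (gen-gen s w) (NilStep.nil (go N (s ⊙ w) (ℕ.≤-pred (ℕ.≤-trans d l))) s (↓-flip d))

-- Counting by filters.

module _ {A : Set} {P : A → Set} (P? : ∀ x → Dec (P x)) where

  length-filter-split : ∀ xs → length (filter P? xs) ℕ.+ length (filter (λ x → ¬? (P? x)) xs) ≡ length xs
  length-filter-split []       = ≡.refl
  length-filter-split (x ∷ xs) with P? x
  ... | yes _ = ≡.cong suc (length-filter-split xs)
  ... | no _  = ≡.trans (ℕ.+-suc _ _) (≡.cong suc (length-filter-split xs))

  unique-map-filter : ∀ {B : Set} (f : A → B) xs → Unique (map f xs) → Unique (map f (filter P? xs))
  unique-map-filter f []       u = []
  unique-map-filter f (x ∷ xs) (x∉ ∷ u) with P? x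
  ... | no _  = unique-map-filter f xs u
  ... | yes _ = All.map⁺ (All.tabulate (λ m → All.lookup (All.map⁻ x∉) (proj₁ (∈-filter⁻ P? m)))) ∷ unique-map-filter f xs u

  applyUpTo-count : ∀ (f : ℕ → A) m → length (filter (λ x → ¬? (P? x)) (applyUpTo f m)) ℕ.+ ∑< m (λ l → bit (does (P? (f l)))) ≡ m
  applyUpTo-count f zero    = ≡.refl
  applyUpTo-count f (suc m) with P? (f 0)
  ... | yes _ = ≡.trans (ℕ.+-suc _ _) (≡.cong suc (applyUpTo-count (λ l → f (suc l)) m))
  ... | no _  = ≡.cong suc (applyUpTo-count (λ l → f (suc l)) m)

-- With order o + 1 and j = (k + 1) o, the lengths 2k + 1 and 2j + 1 add up to k + 1 full turns.
-- Alternating words of these lengths with different first letters therefore coincide.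
mirror-index : ∀ k o → suc (k ℕ.+ k) ℕ.+ suc ((o ℕ.+ k ℕ.* o) ℕ.+ (o ℕ.+ k ℕ.* o)) ≡ suc k ℕ.* suc o ℕ.+ suc k ℕ.* suc o
mirror-index = solve 2 (λ k o → (con 1 :+ (k :+ k)) :+ (con 1 :+ ((o :+ k :* o) :+ (o :+ k :* o))) := (con 1 :+ k) :* (con 1 :+ o) :+ (con 1 :+ k) :* (con 1 :+ o)) ≡.refl
  where
  open import Data.Nat.Solver using (module +-*-Solver)
  open +-*-Solver using (solve; _:=_; _:+_; _:*_; con)

-- From regularity to equal parities in dihedral cosets.

module LocalStructure (C : FiniteCoxeterSystem) (ℓ : FiniteCoxeterSystem.W C → ℕ) (isLength : ∀ w → IsLength C w (ℓ w))
  (D : PosDomain) (cos : ℕ → CommutativeRing.Carrier (PosDomain.K D))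
  (cos-angle : ∀ m → 2 ℕ.≤ m → m ℕ.≤ length (FiniteCoxeterSystem.elems C) → IsAngle D (cos m) m)
  (FA : Free (PosDomain.K D) (FiniteCoxeterSystem.n C)) (OS : OneVar (Free.S FA)) (OK : OneVar (PosDomain.K D))
  (w : FiniteCoxeterSystem.W C) (L : List (FiniteCoxeterSystem.W C)) (enum : Enumerates C ℓ w L) (regular : Regular C ℓ w) where

  open FiniteCoxeterSystem C
  open Coxeter C ℓ isLength
  open Geometry C ℓ isLength D cos cos-angle
  open Roots C ℓ isLength D cos cos-angle
  open Bruhat C ℓ isLength D cos cos-angle
  open Dihedral C ℓ isLength D cos cos-angle using (last; alt-snoc; inv-alt-suc; last-even; palindrome; refl-at-alt; module Cosets)
  open NilHecke C ℓ isLength D cos cos-angle FA OS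
  open PosDomain D using (K; domain; Pos; Pos-1; Pos-≉0)
  open Free FA
  open CommutativeRing S hiding (zero)
  open IntSolver S
  open Domain S-domain using (dom; 1≉0)
  open Interval w L enum
  open Cosets w L enum using (Local)
  open Nil (nil w)
  private
    module K = CommutativeRing K

  outside : W → W → List Pair
  outside y h = filter (λ r → ¬? (I? (inv y · (ref r · h)))) roots

  roots-unique : Unique (map ref roots)
  roots-unique = ≡.subst Unique (≡.sym roots-T) T-unique

  IsRefl⇒∈ : ∀ {t} → IsRefl t → ∃ λ r → r ∈ roots × t ≡ ref r
  IsRefl⇒∈ {t} R = ∈-map⁻ ref (≡.subst (t ∈_) (≡.sym roots-T) (T-complete R))

  length-outside : ∀ y h → I (inv y · h) → length (outside y h) ≡ degree
  length-outside y h m = ℕ.+-cancelˡ-≡ (ℓ w) _ _ (≡.trans (≡.cong (ℕ._+ length (outside y h)) (≡.sym inside)) (≡.trans (length-filter-split I'? roots) (≡.trans (≡.sym degree+) (ℕ.+-comm degree (ℓ w)))))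
    where
    I'? : ∀ r → Dec (I (inv y · (ref r · h)))
    I'? r = I? (inv y · (ref r · h))
    N = neighbours regular y h m
    inside : length (filter I'? roots) ≡ ℓ w
    inside = ≡.trans (≡.sym (List.length-map ref (filter I'? roots))) (≡.trans
      (unique-length (map ref (filter I'? roots)) (proj₁ N) (unique-map-filter I'? ref roots roots-unique) (proj₁ (proj₂ N)) to from) (proj₂ (proj₂ (proj₂ (proj₂ N)))))
      where
      to : ∀ t → t ∈ map ref (filter I'? roots) → t ∈ proj₁ N
      to t m with ∈-map⁻ ref m
      ... | (x , i) , m' , ≡.refl = proj₁ (proj₂ (proj₂ (proj₂ N))) _ (x , i , ≡.refl) (proj₂ (∈-filter⁻ I'? {xs = roots} m'))
      from : ∀ t → t ∈ proj₁ N → t ∈ map ref (filter I'? roots)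
      from t m with proj₁ (proj₂ (proj₂ N)) t m
      ... | R , It with IsRefl⇒∈ R
      ...   | r , r∈ , ≡.refl = ∈-map⁺ ref (∈-filter⁺ I'? r∈ It)

  move : ∀ x i y h → refl-at (x · y) i · (inv y · h) ≡ inv y · (refl-at x i · h)
  move x i y h = ≡.trans (≡.cong (_· (inv y · h)) (refl-at-conj x i y)) (≡.trans (assoc _ _ _) (≡.cong (inv y ·_) (≡.trans (assoc _ _ _) (≡.cong (refl-at x i ·_) (cancel-invˡ y h)))))

  shift-root : ∀ x y h → (x · y) · (inv y · h) ≡ x · h
  shift-root x y h = ≡.trans (assoc _ _ _) (≡.cong (x ·_) (cancel-invˡ y h))

  star-at : ∀ x i y h → lin (α i ◁ (x · h)) ∣ p (inv y · h) + p (inv y · (refl-at x i · h))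
  star-at x i y h = ≡.subst₂ (λ u v → lin (α i ◁ u) ∣ p (inv y · h) + p v) (shift-root x y h) (move x i y h) (star (inv y · h) (x · y) i)

  -- The roots of the missing edges divide p, and by regularity their number is its degree.
  shape : ∀ y h → I (inv y · h) → Σ K.Carrier λ k → p (inv y · h) ≈ Hom.fn con k * ∏ h (outside y h)
  shape y h m = Hom.fn ε g , trans q (*-congʳ (degree-0 (homogeneous-/ {0} {degree} q (∏-≉0 h (outside y h)) (homog (inv y · h))
      (≡.subst (λ d → Homogeneous d (∏ h (outside y h))) (length-outside y h m) (homogeneous-∏ h (outside y h))))))
    where
    each : ∀ {r} → r ∈ outside y h → factor h r ∣ p (inv y · h)
    each {x , i} m' = ∣-resp (trans (+-congˡ (support _ (λ le → proj₂ (∈-filter⁻ (λ r → ¬? (I? (inv y · (ref r · h)))) {xs = roots} m') (≼⇒I le)))) (+-identityʳ _)) (star-at x i y h)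
    divided : ∏ h (outside y h) ∣ p (inv y · h)
    divided = ∏-∣ h (p (inv y · h)) (outside y h) (unique-map-filter (λ r → ¬? (I? (inv y · (ref r · h)))) ref roots roots-unique) each
    g : Carrier
    g = proj₁ divided
    q : p (inv y · h) ≈ g * ∏ h (outside y h)
    q = proj₂ divided

  inv-e· : ∀ v → inv e · v ≡ v
  inv-e· v = ≡.trans (≡.cong (_· v) inv-e) (identityˡ v)

  -- Nonvanishing descends along Bruhat chains from `w`. If `p v` were zero, the root of the edge
  -- from `v` to `tv` would divide `p tv`, a scalar times the roots of the edges missing at `tv`.
  -- The edge back to `v` is not missing, so the root would divide the scalar, which would then be
  -- zero.
  nonzero : ∀ v → I v → p v ≉0
  nonzero v m = descend (I⇒≼ m) (≼⇒I ≤B-refl) top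
    where
    step-down : ∀ v x i → I v → I (refl-at x i · v) → p (refl-at x i · v) ≉0 → p v ≉0
    step-down v x i Iv Itv ne pv≈0 = ne (trans const (trans (*-congʳ (trans (Hom.cong con k≈0) (Hom.0h con))) (zeroˡ _)))
      where
      tv : W
      tv = refl-at x i · v
      Ie : I (inv e · tv)
      Ie = ≡.subst I (≡.sym (inv-e· tv)) Itv
      k : K.Carrier
      k = proj₁ (shape e tv Ie)
      const : p tv ≈ Hom.fn con k * ∏ tv (outside e tv)
      const = trans (reflexive (≡.cong p (≡.sym (inv-e· tv)))) (proj₂ (shape e tv Ie))
      root-tv : lin (α i ◁ (x · tv)) ≈ - lin (α i ◁ (x · v))
      root-tv = trans (lin-cong (≋-trans (◁-≡ (α i) (·-refl-at x i v)) (σ-self i (x · v)))) (lin-neg _)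
      k≈0 : k K.≈ K.0#
      k≈0 = Prime.∣-con (x · tv) i (prime-∏ tv x i (Hom.fn con k) (outside e tv) avoid
              (∣-resp const (∣-neg root-tv (∣-resp (trans (+-congʳ pv≈0) (+-identityˡ _)) (star v x i)))))
        where
        avoid : ∀ {r} → r ∈ outside e tv → ref r ≢ refl-at x i
        avoid {r} m' q = proj₂ (∈-filter⁻ (λ r → ¬? (I? (inv e · (ref r · tv)))) {xs = roots} m')
          (≡.subst I (≡.sym (≡.trans (inv-e· _) (≡.trans (≡.cong (_· tv) q) (≡.trans (≡.sym (assoc _ _ _)) (≡.trans (≡.cong (_· v) (refl-at-invol x i)) (identityˡ v)))))) Iv)
    descend : ∀ {u v} → u ≼ v → I v → p v ≉0 → p u ≉0
    descend ≤B-refl m ne = ne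
    descend (≤B-step {v = v} q (u , i , ≡.refl) l) m ne = descend q Iv (step-down v (inv u · inv v) i Iv (≡.subst I (right-refl-at v u i) m) (≡.subst (λ z → p z ≉0) (right-refl-at v u i) ne))
      where
      Iv : I v
      Iv = ≼⇒I (≼-trans (≤B-step ≤B-refl (u , i , ≡.refl) l) (I⇒≼ m))

  module Pencil (a b : Fin n) (a≢b : a ≢ b) where

    Span : V → Set
    Span v = ∀ k → a ≢ k → b ≢ k → v k K.≈ K.0#

    Span-resp : ∀ {u v} → u ≋ v → Span u → Span v
    Span-resp h s k x y = K.trans (K.sym (h k)) (s k x y)

    InAB : Fin n → Set
    InAB c = c ≡ a ⊎ c ≡ b

    Span-α : ∀ {c} → InAB c → Span (α c)
    Span-α (inj₁ ≡.refl) k x y = δ-diff x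
    Span-α (inj₂ ≡.refl) k x y = δ-diff y

    Span-σ : ∀ {c v} → InAB c → Span v → Span (σ c v)
    Span-σ {c} {v} o s k x y = K.trans (K.+-cong (s k x y) (K.-‿cong (K.trans (K.*-congˡ (Span-α o k x y)) (K.zeroʳ _)))) (K.-‿inverseʳ K.0#)

    last-InAB : ∀ {c d} k → InAB c → InAB d → InAB (last c d k)
    last-InAB zero    oc od = oc
    last-InAB (suc k) oc od = last-InAB k od oc

    Span-alt : ∀ {c d} k v → InAB c → InAB d → Span v → Span (v ◁ alt c d k)
    Span-alt zero    v oc od s = Span-resp (≋-sym (◁-e v)) s
    Span-alt {c} {d} (suc k) v oc od s = Span-resp (≋-sym (◁-⊙ c (alt d c k) v)) (Span-alt k (σ c v) od oc (Span-σ oc s))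

    Span-inv-alt : ∀ {c d} k v → InAB c → InAB d → Span v → Span (v ◁ inv (alt c d k))
    Span-inv-alt zero    v oc od s = Span-resp (≋-sym (≋-trans (◁-≡ v inv-e) (◁-e v))) s
    Span-inv-alt {c} {d} (suc k) v oc od s = Span-resp (≋-sym (≋-trans (◁-≡ v (inv-alt-suc c d k)) (◁-⊙ (last c d k) _ v)))
      (Span-inv-alt k (σ (last c d k) v) oc od (Span-σ (last-InAB k oc od) s))

    M : ℕ
    M = m a b

    J : ℕ → W
    J l = alt a b (suc (l ℕ.+ l))

    Js : List W
    Js = applyUpTo J M

    relation : pow (gen a · gen b) M ≡ e
    relation = Order.pow-ord (order (gen a · gen b))

    J-pow : ∀ l → J l ≡ pow (gen a · gen b) l · gen a
    J-pow l = ≡.trans (alt-snoc a b (l ℕ.+ l)) (≡.cong₂ (λ x y → x · gen y) (alt-even a b l) (last-even a b l))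

    Js-unique : Unique Js
    Js-unique = Unique.applyUpTo⁺₁ J M λ {i} {j} i<j j<M q → Order.least (order (gen a · gen b)) (j ℕ.∸ i) (ℕ.m<n⇒0<n∸m i<j) (ℕ.≤-trans (s≤s (ℕ.m∸n≤m j i)) j<M)
      (cancelˡ (pow (gen a · gen b) i) _ _ (≡.trans (≡.sym (pow-+ _ i (j ℕ.∸ i))) (≡.trans (≡.cong (pow (gen a · gen b)) (ℕ.m+[n∸m]≡n (ℕ.<⇒≤ i<j)))
        (≡.trans (≡.sym (cancelʳ (gen a) _ _ (≡.trans (≡.sym (J-pow i)) (≡.trans q (J-pow j))))) (≡.sym (identityʳ _))))))

    J∈Js : ∀ k → J k ∈ Js
    J∈Js k = go M ≡.refl (Order.0<ord (order (gen a · gen b)))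
      where
      go : ∀ o → o ≡ M → 0 ℕ.< o → J k ∈ Js
      go (suc o) q _ = ≡.subst (_∈ Js) same (∈-applyUpTo⁺ J (≡.subst (k % suc o ℕ.<_) q (m%n<n k (suc o))))
        where
        P = pow (gen a · gen b)
        same : J (k % suc o) ≡ J k
        same = ≡.trans (J-pow (k % suc o)) (≡.trans (≡.cong (_· gen a) (≡.trans (≡.sym (identityʳ _)) (≡.trans (≡.cong (P (k % suc o) ·_)
                 (≡.sym (pow-* (gen a · gen b) (k / suc o) (suc o) (≡.trans (≡.cong P q) relation))))
                 (≡.trans (≡.sym (pow-+ _ (k % suc o) _)) (≡.cong P (≡.sym (m≡m%n+[m/n]*n k (suc o)))))))) (≡.sym (J-pow k)))

    J'∈Js : ∀ k → alt b a (suc (k ℕ.+ k)) ∈ Js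
    J'∈Js k = go M ≡.refl (Order.0<ord (order (gen a · gen b)))
      where
      go : ∀ o → o ≡ M → 0 ℕ.< o → alt b a (suc (k ℕ.+ k)) ∈ Js
      go (suc o) q _ = ≡.subst (_∈ Js) (≡.sym mirror) (J∈Js j)
        where
        j : ℕ
        j = o ℕ.+ k ℕ.* o
        mirror : alt b a (suc (k ℕ.+ k)) ≡ J j
        mirror = alt-mirror b a (suc (k ℕ.+ k)) (suc (j ℕ.+ j)) (suc k ℕ.* suc o)
                   (pow-flip a b (suc k ℕ.* suc o) (pow-* (gen a · gen b) (suc k) (suc o) (≡.trans (≡.cong (pow (gen a · gen b)) q) relation))) (mirror-index k o)

    odd∈Js : ∀ {c d} k → InAB c → InAB d → c ≢ d → alt c d (suc (k ℕ.+ k)) ∈ Js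
    odd∈Js k (inj₁ ≡.refl) (inj₁ ≡.refl) ne = ⊥-elim (ne ≡.refl)
    odd∈Js k (inj₁ ≡.refl) (inj₂ ≡.refl) ne = J∈Js k
    odd∈Js k (inj₂ ≡.refl) (inj₁ ≡.refl) ne = J'∈Js k
    odd∈Js k (inj₂ ≡.refl) (inj₂ ≡.refl) ne = ⊥-elim (ne ≡.refl)

    last-or : ∀ {c d g} k → InAB c → InAB d → c ≢ d → InAB g → g ≡ last c d k ⊎ g ≡ last c d (suc k)
    last-or (suc k) oc od ne og = last-or k od oc (λ q → ne (≡.sym q)) og
    last-or zero (inj₁ ≡.refl) _ ne (inj₁ ≡.refl) = inj₁ ≡.refl
    last-or zero (inj₂ ≡.refl) _ ne (inj₂ ≡.refl) = inj₁ ≡.refl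
    last-or zero (inj₁ ≡.refl) (inj₂ ≡.refl) ne (inj₂ ≡.refl) = inj₂ ≡.refl
    last-or zero (inj₁ ≡.refl) (inj₁ ≡.refl) ne (inj₂ ≡.refl) = ⊥-elim (ne ≡.refl)
    last-or zero (inj₂ ≡.refl) (inj₁ ≡.refl) ne (inj₁ ≡.refl) = inj₂ ≡.refl
    last-or zero (inj₂ ≡.refl) (inj₂ ≡.refl) ne (inj₁ ≡.refl) = ⊥-elim (ne ≡.refl)

    conj∈Js : ∀ {c d g} k → InAB c → InAB d → c ≢ d → InAB g → alt c d k · (gen g · inv (alt c d k)) ∈ Js
    conj∈Js {c} {d} {g} k oc od ne og with last-or k oc od ne og
    ... | inj₁ ≡.refl = ≡.subst (_∈ Js) (≡.trans (≡.sym (palindrome c d k)) (≡.trans (≡.cong (_· inv (alt c d k)) (alt-snoc c d k)) (assoc _ _ _))) (odd∈Js k oc od ne)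
    conj∈Js {c} {d} {g} zero oc od ne og | inj₂ ≡.refl = ≡.subst (_∈ Js) (≡.sym (≡.trans (identityˡ _) (≡.cong (gen g ·_) inv-e))) (odd∈Js 0 od oc (λ q → ne (≡.sym q)))
    conj∈Js {c} {d} {g} (suc k) oc od ne og | inj₂ q = ≡.subst (_∈ Js) (begin
        alt c d (suc (k ℕ.+ k))                                ≡⟨ ≡.sym (palindrome c d k) ⟩
        alt c d (suc k) · inv (alt c d k)                      ≡⟨ ≡.cong (alt c d (suc k) ·_) (≡.sym (gen-gen g _)) ⟩
        alt c d (suc k) · (gen g · (gen g · inv (alt c d k)))  ≡⟨ ≡.cong (λ v → alt c d (suc k) · (gen g · v)) (≡.trans (≡.cong (λ g → gen g · inv (alt c d k)) g≡) (≡.sym (inv-alt-suc c d k))) ⟩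
        alt c d (suc k) · (gen g · inv (alt c d (suc k)))      ∎) (odd∈Js k oc od ne)
      where
      open ≡.≡-Reasoning
      g≡ : g ≡ last c d k
      g≡ = ≡.trans q (two c d k)
        where
        two : ∀ c d k → last c d (suc (suc k)) ≡ last c d k
        two c d zero    = ≡.refl
        two c d (suc k) = two d c k

    ∈Js⇒Span : ∀ x i → refl-at x i ∈ Js → Span (α i ◁ x)
    ∈Js⇒Span x i m' = go (∈-applyUpTo⁻ J m')
      where
      go : (∃ λ l → l ℕ.< M × refl-at x i ≡ J l) → Span (α i ◁ x)
      go (l , _ , q) = Span-resp (≋-sym (proj₂ proportion)) (λ k x y → K.trans (K.*-congˡ (Span-inv-alt l (α s) (inj₁ ≡.refl) (inj₂ ≡.refl) (Span-α (last-InAB l (inj₁ ≡.refl) (inj₂ ≡.refl))) k x y)) (K.zeroʳ _))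
        where
        s : Fin n
        s = last a b l
        same : refl-at x i ≡ refl-at (inv (alt a b l)) s
        same = ≡.trans q (≡.sym (≡.trans (≡.cong (λ v → refl-at v s) (≡.sym (identityʳ _))) (≡.trans (refl-at-alt a b l e) (≡.trans (inv-e· _) (identityʳ _)))))
        proportion = same-root x i (inv (alt a b l)) s same

    combination : ∀ {v} → Span v → ∀ u → v ◁ u ≋ (v a ⊛ (α a ◁ u)) ⊕ (v b ⊛ (α b ◁ u))
    combination {v} s u = ≋-trans (◁-cong u decompose) (≋-trans (◁-⊕ u _ _) (λ k → K.+-cong (◁-⊛ u (v a) (α a) k) (◁-⊛ u (v b) (α b) k)))
      where
      decompose : v ≋ (v a ⊛ α a) ⊕ (v b ⊛ α b)
      decompose k with a Fin.≟ k | b Fin.≟ k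
      ... | yes ≡.refl | _ = K.sym (K.trans (K.+-cong (K.trans (K.*-congˡ (δ-same a)) (K.*-identityʳ _)) (K.trans (K.*-congˡ (δ-diff (λ q → a≢b (≡.sym q)))) (K.zeroʳ _))) (K.+-identityʳ _))
      ... | no a≢k | yes ≡.refl = K.sym (K.trans (K.+-cong (K.trans (K.*-congˡ (δ-diff a≢k)) (K.zeroʳ _)) (K.trans (K.*-congˡ (δ-same b)) (K.*-identityʳ _))) (K.+-identityˡ _))
      ... | no a≢k | no b≢k = K.trans (s k a≢k b≢k) (K.sym (K.trans (K.+-cong (K.trans (K.*-congˡ (δ-diff a≢k)) (K.zeroʳ _)) (K.trans (K.*-congˡ (δ-diff b≢k)) (K.zeroʳ _))) (K.+-identityˡ _)))

    NN-product-zero : ∀ {x y} → Pos x → x K.* y K.≈ K.0# → y K.≈ K.0#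
    NN-product-zero p h = Domain.dom domain h (Pos-≉0 p)

    -- Transported by `z`, the simple root `α i` becomes a combination of the positive roots
    -- `α a ◁ z` and `α b ◁ z` with coefficients of one sign. Negative signs contradict the
    -- coordinate of `α i` at `i`. With non-negative coefficients nothing can cancel, so a root with
    -- positive coefficient is a multiple of `α i`.
    simple-in-span : ∀ i z → a ↑ z → b ↑ z → Span (α i ◁ inv z) → ∃ λ g → InAB g × refl-at z g ≡ gen i
    simple-in-span i z a↑ b↑ s = sign (↑-or-↓ i (inv z))
      where
      τ : V
      τ = α i ◁ inv z
      expansion : α i ≋ (τ a ⊛ (α a ◁ z)) ⊕ (τ b ⊛ (α b ◁ z))
      expansion = ≋-trans (≋-sym (inv-◁ z (α i))) (combination s z)
      pa = positive a↑
      pb = positive b↑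
      multiple : ∀ g → (∀ k → i ≢ k → (α g ◁ z) k K.≈ K.0#) → α g ◁ z ≋ ((α g ◁ z) i) ⊛ α i
      multiple g h k with i Fin.≟ k
      ... | yes ≡.refl = K.sym (K.trans (K.*-congˡ (δ-same i)) (K.*-identityʳ _))
      ... | no i≢k     = K.trans (h k i≢k) (K.sym (K.trans (K.*-congˡ (δ-diff i≢k)) (K.zeroʳ _)))
      pick : NN (τ a) → NN (τ b) → ∃ λ g → InAB g × refl-at z g ≡ gen i
      pick (inj₂ P) nb = a , inj₁ ≡.refl , proportional z a i _ (multiple a (λ k i≢k → NN-product-zero P (NN-sum-zero (NN-* (inj₂ P) (pa k)) (NN-* nb (pb k)) (K.trans (K.sym (expansion k)) (δ-diff i≢k)))))
      pick (inj₁ z) (inj₂ P) = b , inj₂ ≡.refl , proportional _ b i _ (multiple b (λ k i≢k → NN-product-zero P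
         (NN-sum-zero (NN-* (inj₂ P) (pb k)) (NN-* (inj₁ z) (pa k)) (K.trans (K.+-comm _ _) (K.trans (K.sym (expansion k)) (δ-diff i≢k))))))
      pick (inj₁ za) (inj₁ zb) = ⊥-elim (Domain.1≉0 domain (K.trans (K.sym (δ-same i)) (K.trans (expansion i)
         (K.trans (K.+-cong (K.trans (K.*-congʳ za) (K.zeroˡ _)) (K.trans (K.*-congʳ zb) (K.zeroˡ _))) (K.+-identityˡ _)))))
      sign : i ↑ inv z ⊎ i ↓ inv z → ∃ λ g → InAB g × refl-at z g ≡ gen i
      sign (inj₁ up) = pick (positive up a) (positive up b)
      sign (inj₂ dn) = ⊥-elim (Domain.1≉0 domain (NN-antisym (inj₂ Pos-1) (NN-resp minus (NN-+ (NN-* (negative dn a) (pa i)) (NN-* (negative dn b) (pb i))))))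
        where
        minus : (K.- τ a) K.* (α a ◁ z) i K.+ (K.- τ b) K.* (α b ◁ z) i K.≈ K.- K.1#
        minus = K.trans (KS.solve 4 (λ p x q y → (KS.:- p) KS.:* x KS.:+ (KS.:- q) KS.:* y KS.:= KS.:- (p KS.:* x KS.:+ q KS.:* y)) K.refl (τ a) ((α a ◁ z) i) (τ b) ((α b ◁ z) i))
          (K.-‿cong (K.trans (K.sym (expansion i)) (δ-same i)))

    -- Splitting `inv x` into a dihedral part and a minimal coset representative `z` reduces the
    -- claim to a simple root at `z`. The reflection is then a conjugate of `gen a` or `gen b` by
    -- the dihedral part.
    Span⇒∈Js : ∀ x i → Span (α i ◁ x) → refl-at x i ∈ Js
    Span⇒∈Js x i s = cases (strip-any a b (inv x))
      where
      build : ∀ {c d} k z → InAB c → InAB d → c ≢ d → inv x ≡ alt c d k · z → a ↑ z → b ↑ z → refl-at x i ∈ Js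
      build {c} {d} k z oc od ne q a↑ b↑ = ≡.subst (_∈ Js) conj (conj∈Js k oc od ne (proj₁ (proj₂ found)))
        where
        A : W
        A = alt c d k
        x≡ : x ≡ inv z · inv A
        x≡ = ≡.trans (≡.sym (inv-inv x)) (≡.trans (≡.cong inv q) (inv-· A z))
        xA : x · A ≡ inv z
        xA = ≡.trans (≡.cong (_· A) x≡) (≡.trans (assoc _ _ _) (≡.trans (≡.cong (inv z ·_) (inverseˡ A)) (identityʳ _)))
        found : ∃ λ g → InAB g × refl-at z g ≡ gen i
        found = simple-in-span i z a↑ b↑ (Span-resp (≋-trans (≋-sym (◁-· x A (α i))) (◁-≡ (α i) xA)) (Span-alt k (α i ◁ x) oc od s))
        g : Fin n
        g = proj₁ found
        conj : A · (gen g · inv A) ≡ refl-at x i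
        conj = begin
          A · (gen g · inv A)                                ≡⟨ ≡.cong (A ·_) (≡.cong (_· inv A) (≡.sym (cancel-invˡ z (gen g)))) ⟩
          A · ((z · (inv z · gen g)) · inv A)                ≡⟨ ≡.cong (λ v → A · ((z · v) · inv A)) (≡.trans (≡.sym (identityʳ _)) (≡.cong ((inv z · gen g) ·_) (≡.sym (inverseʳ z)))) ⟩
          A · ((z · ((inv z · gen g) · (z · inv z))) · inv A)  ≡⟨ ≡.cong (λ v → A · ((z · v) · inv A)) (≡.trans (≡.sym (assoc _ _ _)) (≡.cong (_· inv z) (assoc _ _ _))) ⟩
          A · ((z · (refl-at z g · inv z)) · inv A)          ≡⟨ ≡.cong (λ v → A · ((z · (v · inv z)) · inv A)) (proj₂ (proj₂ found)) ⟩
          A · ((z · (gen i · inv z)) · inv A)                ≡⟨ ≡.trans (≡.cong (A ·_) (assoc _ _ _)) (≡.sym (assoc _ _ _)) ⟩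
          (A · z) · ((gen i · inv z) · inv A)                ≡⟨ ≡.cong₂ (λ u v → u · v) (≡.sym q) (≡.trans (assoc _ _ _) (≡.cong (gen i ·_) (≡.sym x≡))) ⟩
          inv x · (gen i · x)                                ∎
          where open ≡.≡-Reasoning
      cases : Strip a b (inv x) ⊎ Strip b a (inv x) → refl-at x i ∈ Js
      cases (inj₁ T) = build (Strip.k T) (Strip.z T) (inj₁ ≡.refl) (inj₂ ≡.refl) a≢b (Strip.split T) (Strip.a↑z T) (Strip.b↑z T)
      cases (inj₂ T) = build (Strip.k T) (Strip.z T) (inj₂ ≡.refl) (inj₁ ≡.refl) (λ q → a≢b (≡.sym q)) (Strip.split T) (Strip.b↑z T) (Strip.a↑z T)

    -- The specialization α a ↦ 0, α b ↦ X, all other simple roots to 1.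

    open OneVar OK renaming (Q to R; Q-domain to R-domain; c to cK; X to XK; X≉0 to XK≉0; ev to evK; ev-c to evK-c; ev-X to evK-X)
    open Vanishing K OK
    private
      module R = CommutativeRing R
      module RS = IntSolver R
    open import Algebra.Properties.Semiring.Sum K.semiring using () renaming (sum to sumK; sum-cong-≋ to sumK-cong; ∑-distrib-+ to sumK-+; *-distribˡ-sum to sumK-*)

    mask : Fin n → V → K.Carrier
    mask k v with a Fin.≟ k | b Fin.≟ k
    ... | no _ | no _  = v k
    ... | _    | _     = K.0#

    mask-cong : ∀ k {u v} → u ≋ v → mask k u K.≈ mask k v
    mask-cong k h with a Fin.≟ k | b Fin.≟ k
    ... | no _  | no _  = h k
    ... | no _  | yes _ = K.refl
    ... | yes _ | no _  = K.refl
    ... | yes _ | yes _ = K.refl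

    mask-⊕ : ∀ k u v → mask k (u ⊕ v) K.≈ mask k u K.+ mask k v
    mask-⊕ k u v with a Fin.≟ k | b Fin.≟ k
    ... | no _  | no _  = K.refl
    ... | no _  | yes _ = K.sym (K.+-identityˡ _)
    ... | yes _ | no _  = K.sym (K.+-identityˡ _)
    ... | yes _ | yes _ = K.sym (K.+-identityˡ _)

    mask-⊛ : ∀ k c v → mask k (c ⊛ v) K.≈ c K.* mask k v
    mask-⊛ k c v with a Fin.≟ k | b Fin.≟ k
    ... | no _  | no _  = K.refl
    ... | no _  | yes _ = K.sym (K.zeroʳ _)
    ... | yes _ | no _  = K.sym (K.zeroʳ _)
    ... | yes _ | yes _ = K.sym (K.zeroʳ _)

    mask-Span : ∀ k {v} → Span v → mask k v K.≈ K.0#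
    mask-Span k s with a Fin.≟ k | b Fin.≟ k
    ... | no x  | no y  = s k x y
    ... | no _  | yes _ = K.refl
    ... | yes _ | no _  = K.refl
    ... | yes _ | yes _ = K.refl

    mask-NN : ∀ k {v} → NNv v → NN (mask k v)
    mask-NN k p with a Fin.≟ k | b Fin.≟ k
    ... | no _  | no _  = p k
    ... | no _  | yes _ = inj₁ K.refl
    ... | yes _ | no _  = inj₁ K.refl
    ... | yes _ | yes _ = inj₁ K.refl

    mask-other : ∀ k v → a ≢ k → b ≢ k → mask k v ≡ v k
    mask-other k v x y with a Fin.≟ k | b Fin.≟ k
    ... | no _  | no _  = ≡.refl
    ... | no _  | yes q = ⊥-elim (y q)
    ... | yes q | _     = ⊥-elim (x q)

    others : V → K.Carrier
    others v = sumK (λ k → mask k v)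

    others-Span : ∀ {v} → Span v → others v K.≈ K.0#
    others-Span s = sum-0 _ (λ k → mask-Span k s)

    NN-sums : ∀ {m} (g : Fin m → K.Carrier) → (∀ k → NN (g k)) → NN (sumK g)
    NN-sums {zero}  g h = inj₁ K.refl
    NN-sums {suc m} g h = NN-+ (h Fin.zero) (NN-sums (λ k → g (Fin.suc k)) (λ k → h (Fin.suc k)))

    NN-sums-zero : ∀ {m} (g : Fin m → K.Carrier) → (∀ k → NN (g k)) → sumK g K.≈ K.0# → ∀ k → g k K.≈ K.0#
    NN-sums-zero g h z Fin.zero    = NN-sum-zero (h Fin.zero) (NN-sums _ (λ k → h (Fin.suc k))) z
    NN-sums-zero g h z (Fin.suc k) = NN-sums-zero (λ k → g (Fin.suc k)) (λ k → h (Fin.suc k)) (NN-sum-zero (NN-sums _ (λ k → h (Fin.suc k))) (h Fin.zero) (K.trans (K.+-comm _ _) z)) k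

    -- Positivity prevents cancellation: a sum of non-negative coordinates vanishes only if each of
    -- them does. This is why all variables outside the plane may be sent to the same number 1.
    others-positive : ∀ {v} → NNv v → others v K.≈ K.0# → Span v
    others-positive {v} p z k x y = K.trans (K.reflexive (≡.sym (mask-other k v x y))) (NN-sums-zero (λ k → mask k v) (λ k → mask-NN k p) z k)

    Lf : V → R.Carrier
    Lf v = Hom.fn cK (v b) R.* XK R.+ Hom.fn cK (others v)

    module LR = Linear R cK

    Lf-linear : LR.IsLinear Lf
    Lf-linear = record
      { L-cong = λ h → R.+-cong (R.*-congʳ (Hom.cong cK (h b))) (Hom.cong cK (sumK-cong (λ k → mask-cong k h)))
      ; L-⊕ = λ u v → R.trans (R.+-cong (R.*-congʳ (Hom.+h cK (u b) (v b))) (R.trans (Hom.cong cK (K.trans (sumK-cong (λ k → mask-⊕ k u v)) (sumK-+ (λ k → mask k u) (λ k → mask k v)))) (Hom.+h cK (others u) (others v))))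
          (RS.solve 5 (λ a b x u v → (a RS.:+ b) RS.:* x RS.:+ (u RS.:+ v) RS.:= (a RS.:* x RS.:+ u) RS.:+ (b RS.:* x RS.:+ v)) R.refl (Hom.fn cK (u b)) (Hom.fn cK (v b)) XK (Hom.fn cK (others u)) (Hom.fn cK (others v)))
      ; L-⊛ = λ c v → R.trans (R.+-cong (R.*-congʳ (Hom.*h cK c (v b))) (R.trans (Hom.cong cK (K.trans (sumK-cong (λ k → mask-⊛ k c v)) (K.sym (sumK-* c (λ k → mask k v))))) (Hom.*h cK c (others v))))
          (RS.solve 4 (λ c a x u → (c RS.:* a) RS.:* x RS.:+ c RS.:* u RS.:= c RS.:* (a RS.:* x RS.:+ u)) R.refl (Hom.fn cK c) (Hom.fn cK (v b)) XK (Hom.fn cK (others v))) }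

    open LR.IsLinear Lf-linear renaming (L-cong to Lf-cong; L-⊕ to Lf-⊕; L-⊛ to Lf-⊛)

    Lf-a : Lf (α a) R.≈ R.0#
    Lf-a = R.trans (R.+-cong (R.trans (R.*-congʳ (R.trans (Hom.cong cK (δ-diff a≢b)) (Hom.0h cK))) (R.zeroˡ _)) (R.trans (Hom.cong cK (others-Span (Span-α (inj₁ ≡.refl)))) (Hom.0h cK))) (R.+-identityˡ _)

    Lf-σa : ∀ v → Lf (σ a v) R.≈ Lf v
    Lf-σa v = R.trans (Lf-cong (λ k → KS.solve 3 (λ v t a → v KS.:- t KS.:* a KS.:= v KS.:+ (KS.:- t) KS.:* a) K.refl (v k) (θ a v) (α a k)))
      (R.trans (Lf-⊕ v ((K.- θ a v) ⊛ α a)) (R.trans (R.+-congˡ (R.trans (Lf-⊛ (K.- θ a v) (α a)) (R.trans (R.*-congˡ Lf-a) (R.zeroʳ _)))) (R.+-identityʳ _)))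

    -- A root of the plane goes to its `b`-coordinate times `XK`, and that coordinate vanishes only
    -- for multiples of `α a`.
    order-in : ∀ x i → refl-at x i ∈ Js → refl-at x i ≢ gen a → HasOrder 1 (Lf (α i ◁ x))
    order-in x i m' ne = Hom.fn cK (r b) , R.trans (R.+-cong (R.*-comm _ _) (R.trans (Hom.cong cK (others-Span s)) (Hom.0h cK))) (R.trans (R.+-identityʳ _) (R.*-congʳ (R.sym (R.*-identityʳ XK))))
        , λ z → ne (proportional x i a (r a) (only-a (K.trans (K.sym (evK-c (r b))) z)))
      where
      r : V
      r = α i ◁ x
      s : Span r
      s = ∈Js⇒Span x i m'
      only-a : r b K.≈ K.0# → r ≋ r a ⊛ α a
      only-a z = ≋-trans (≋-sym (◁-e r)) (≋-trans (combination s e) (λ k → K.trans (K.+-cong (K.*-congˡ (◁-e (α a) k)) (K.trans (K.*-congʳ z) (K.zeroˡ _))) (K.+-identityʳ _)))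

    -- At `XK = 0` there remains the sum of the coordinates outside the plane. It is nonzero because
    -- all coordinates of a root share one sign.
    order-out : ∀ x i → ¬ (refl-at x i ∈ Js) → HasOrder 0 (Lf (α i ◁ x))
    order-out x i ne = Lf r , R.sym (R.*-identityˡ _) , λ z → ne (Span⇒∈Js x i (span (↑-or-↓ i x) (K.trans (K.sym value) z)))
      where
      r : V
      r = α i ◁ x
      value : Hom.fn evK (Lf r) K.≈ others r
      value = K.trans (Hom.+h evK _ _) (K.trans (K.+-cong (K.trans (Hom.*h evK _ _) (K.trans (K.*-congˡ evK-X) (K.zeroʳ _))) (evK-c (others r))) (K.+-identityˡ _))
      span : i ↑ x ⊎ i ↓ x → others r K.≈ K.0# → Span r
      span (inj₁ up) z = others-positive (positive up) z
      span (inj₂ dn) z = λ k x y → K.trans (KS.solve 1 (λ a → a KS.:= KS.:- (KS.:- a)) K.refl (r k)) (K.trans (K.-‿cong (others-positive (negative dn) negated k x y)) (KS.solve 0 (KS.:- KS.:0 KS.:= KS.:0) K.refl))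
        where
        negated : others (neg r) K.≈ K.0#
        negated = K.trans (sumK-cong (λ k → K.trans (mask-cong k (≋-sym (-1⊛ r))) (mask-⊛ k (K.- K.1#) r))) (K.trans (K.sym (sumK-* (K.- K.1#) (λ k → mask k r))) (K.trans (K.*-congˡ z) (K.zeroʳ _)))

    module At (y z : W) (Iz : I (inv y · z)) (Iaz : I (inv y · (a ⊙ z))) where

      private
        image : Fin n → R.Carrier
        image j = Lf (α j ◁ inv z)

      ψ : Hom S R
      ψ = sub cK image

      ψ-lin : ∀ v → Hom.fn ψ (lin v) R.≈ Lf (v ◁ inv z)
      ψ-lin = sub-lin cK (λ v → Lf (v ◁ inv z)) linear ψ (sub-con {R} cK image) (sub-var {R} cK image)
        where
        linear : LR.IsLinear (λ v → Lf (v ◁ inv z))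
        linear = record
          { L-cong = λ h → Lf-cong (◁-cong (inv z) h)
          ; L-⊕ = λ u v → R.trans (Lf-cong (◁-⊕ (inv z) u v)) (Lf-⊕ (u ◁ inv z) (v ◁ inv z))
          ; L-⊛ = λ c v → R.trans (Lf-cong (◁-⊛ (inv z) c v)) (Lf-⊛ c (v ◁ inv z)) }

      -- Both ends of the edge from `z` to `a ⊙ z` satisfy this with the same right-hand side: the
      -- specialization sends `α a` to 0, so `σ a` does not change it.
      Near : W → Set
      Near h = ∀ x i → Hom.fn ψ (factor h (x , i)) R.≈ Lf (α i ◁ x)

      near-z : Near z
      near-z x i = R.trans (ψ-lin (α i ◁ (x · z))) (Lf-cong (≋-trans (◁-cong (inv z) (◁-· x z (α i))) (◁-inv z (α i ◁ x))))

      near-az : Near (a ⊙ z)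
      near-az x i = R.trans (ψ-lin (α i ◁ (x · (a ⊙ z)))) (R.trans (Lf-cong (≋-trans (◁-cong (inv z) (≋-trans (◁-· x (a ⊙ z) (α i)) (◁-⊙ a z (α i ◁ x)))) (◁-inv z (σ a (α i ◁ x))))) (Lf-σa (α i ◁ x)))

      open DecMembership _≟_ using (_∈?_)

      inJ? : ∀ r → Dec (ref r ∈ Js)
      inJ? r = ref r ∈? Js

      order-∏ : ∀ h → Near h → ∀ rs → (∀ {r} → r ∈ rs → ref r ≢ gen a) → HasOrder (length (filter inJ? rs)) (Hom.fn ψ (∏ h rs))
      order-∏ h near []             ne = R.1# , R.trans (Hom.1h ψ) (R.sym (R.*-identityˡ _)) , λ z → Domain.1≉0 domain (K.trans (K.sym (Hom.1h evK)) z)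
      order-∏ h near ((x , i) ∷ rs) ne = cases (inJ? (x , i))
        where
        rest : HasOrder (length (filter inJ? rs)) (Hom.fn ψ (∏ h rs))
        rest = order-∏ h near rs (λ m' → ne (there m'))
        split : Lf (α i ◁ x) R.* Hom.fn ψ (∏ h rs) R.≈ Hom.fn ψ (∏ h ((x , i) ∷ rs))
        split = R.sym (R.trans (Hom.*h ψ (factor h (x , i)) (∏ h rs)) (R.*-congʳ (near x i)))
        cases : Dec (ref (x , i) ∈ Js) → HasOrder (length (filter inJ? ((x , i) ∷ rs))) (Hom.fn ψ (∏ h ((x , i) ∷ rs)))
        cases (yes q) = ≡.subst (λ d → HasOrder d (Hom.fn ψ (∏ h ((x , i) ∷ rs)))) (≡.sym (≡.cong length (List.filter-accept inJ? {xs = rs} q)))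
          (HasOrder-resp {suc (length (filter inJ? rs))} split (order-* domain {1} {length (filter inJ? rs)} (order-in x i q (ne (here ≡.refl))) rest))
        cases (no q) = ≡.subst (λ d → HasOrder d (Hom.fn ψ (∏ h ((x , i) ∷ rs)))) (≡.sym (≡.cong length (List.filter-reject inJ? {xs = rs} q)))
          (HasOrder-resp {length (filter inJ? rs)} split (order-* domain {0} {length (filter inJ? rs)} (order-out x i q) rest))

      -- The scalar in `shape` is nonzero, and the root sent to 0 is not among the missing ones
      -- because `a ⊙ h` stays inside. Every remaining factor has order 1 or 0 according to whether
      -- its reflection is dihedral.
      order-p : ∀ h → Near h → (Ih : I (inv y · h)) → I (inv y · (a ⊙ h)) → HasOrder (length (filter inJ? (outside y h))) (Hom.fn ψ (p (inv y · h)))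
      order-p h near Ih Iah = HasOrder-resp {length (filter inJ? (outside y h))} (R.sym (R.trans (Hom.cong ψ (proj₂ (shape y h Ih))) (R.trans (Hom.*h ψ _ _) (R.*-congʳ (sub-con {R} cK image k)))))
          (order-* domain {0} {length (filter inJ? (outside y h))} constant (order-∏ h near (outside y h) avoid))
        where
        k : K.Carrier
        k = proj₁ (shape y h Ih)
        constant : HasOrder 0 (Hom.fn cK k)
        constant = Hom.fn cK k , R.sym (R.*-identityˡ _) , λ z → nonzero (inv y · h) Ih (trans (proj₂ (shape y h Ih)) (trans (*-congʳ (trans (Hom.cong con (K.trans (K.sym (evK-c k)) z)) (Hom.0h con))) (zeroˡ _)))
        avoid : ∀ {r} → r ∈ outside y h → ref r ≢ gen a
        avoid {r} m' q = proj₂ (∈-filter⁻ (λ r → ¬? (I? (inv y · (ref r · h)))) {xs = roots} m') (≡.subst (λ t → I (inv y · (t · h))) (≡.sym q) Iah)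

      -- The root of the edge is sent to 0, so divisibility of the sum of the two values by it
      -- becomes vanishing of their sum.
      opposite : Hom.fn ψ (p (inv y · z)) R.≈ R.- Hom.fn ψ (p (inv y · (a ⊙ z)))
      opposite = RS.-≈0⇒≈ (R.trans (RS.solve 2 (λ u v → u RS.:- (RS.:- v) RS.:= u RS.:+ v) R.refl _ _) (R.trans (R.sym (Hom.+h ψ _ _)) (R.trans (Hom.cong ψ (proj₂ edge)) (R.trans (Hom.*h ψ _ _)
          (R.trans (R.*-congˡ (R.trans (near-z e a) (R.trans (Lf-cong (◁-e (α a))) Lf-a))) (R.zeroʳ _))))))
        where
        edge : lin (α a ◁ (e · z)) ∣ p (inv y · z) + p (inv y · (a ⊙ z))
        edge = ≡.subst (λ t → lin (α a ◁ (e · z)) ∣ p (inv y · z) + p (inv y · (t · z))) (refl-at-e a) (star-at e a y z)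

      HasOrder-neg : ∀ {d f} → HasOrder d f → HasOrder d (R.- f)
      HasOrder-neg (g , h , k) = R.- g , R.trans (R.-‿cong h) (RS.solve 2 (λ x g → RS.:- (x RS.:* g) RS.:= x RS.:* (RS.:- g)) R.refl _ g)
        , λ z → k (K.trans (KS.solve 1 (λ a → a KS.:= KS.:- (KS.:- a)) K.refl _) (K.trans (K.-‿cong (K.trans (K.sym (Hom.-h evK g)) z)) (KS.solve 0 (KS.:- KS.:0 KS.:= KS.:0) K.refl)))

      equal-orders : length (filter inJ? (outside y z)) ≡ length (filter inJ? (outside y (a ⊙ z)))
      equal-orders = order-unique (order-p z near-z Iz Iaz)
        (HasOrder-resp {length (filter inJ? (outside y (a ⊙ z)))} (R.sym opposite) (HasOrder-neg {length (filter inJ? (outside y (a ⊙ z)))} (order-p (a ⊙ z) near-az Iaz (≡.subst (λ v → I (inv y · v)) (≡.sym (gen-gen a z)) Iz))))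

      count-J : ∀ h → length (filter inJ? (outside y h)) ℕ.+ ∑< M (λ l → bit (does (I? (inv y · (J l · h))))) ≡ M
      count-J h = ≡.trans (≡.cong (ℕ._+ ∑< M (λ l → bit (does (I? (inv y · (J l · h)))))) same-length) (applyUpTo-count I'? J M)
        where
        I'? : ∀ t → Dec (I (inv y · (t · h)))
        I'? t = I? (inv y · (t · h))
        out? : ∀ t → Dec (¬ I (inv y · (t · h)))
        out? t = ¬? (I'? t)
        same-length : length (filter inJ? (outside y h)) ≡ length (filter out? Js)
        same-length = ≡.trans (≡.sym (List.length-map ref (filter inJ? (outside y h)))) (unique-length (map ref (filter inJ? (outside y h))) (filter out? Js)
            (unique-map-filter inJ? ref (outside y h) (unique-map-filter (λ r → ¬? (I? (inv y · (ref r · h)))) ref roots roots-unique)) (Unique.filter⁺ out? Js-unique) to from)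
          where
          to : ∀ t → t ∈ map ref (filter inJ? (outside y h)) → t ∈ filter out? Js
          to t m' with ∈-map⁻ ref m'
          ... | r , r∈ , ≡.refl with ∈-filter⁻ inJ? {xs = outside y h} r∈
          ...   | o∈ , j∈ = ∈-filter⁺ out? j∈ (proj₂ (∈-filter⁻ (λ r → ¬? (I? (inv y · (ref r · h)))) {xs = roots} o∈))
          from : ∀ t → t ∈ filter out? Js → t ∈ map ref (filter inJ? (outside y h))
          from t m' with ∈-filter⁻ out? {xs = Js} m'
          ... | j∈ , out with ∈-applyUpTo⁻ J j∈
          ...   | l , _ , q with IsRefl⇒∈ {t} (inv (alt a b l) , last a b l , ≡.trans q (≡.sym (≡.trans (≡.cong (λ v → refl-at v (last a b l)) (≡.sym (identityʳ _))) (≡.trans (refl-at-alt a b l e) (≡.trans (inv-e· _) (identityʳ _))))))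
          ...     | r , r∈ , ≡.refl = ∈-map⁺ ref (∈-filter⁺ inJ? (∈-filter⁺ (λ r → ¬? (I? (inv y · (ref r · h)))) r∈ out) j∈)

  -- Both ends of the edge have equally many missing dihedral neighbours, hence equally many present
  -- ones. At `z` these are counted by odd words, at `a ⊙ z` by odd words times `gen a`, which are
  -- the even words at `z`.
  regular⇒local : Local
  regular⇒local y a b z a≢b Iz Iaz = ≡.trans (ℕ.+-cancelˡ-≡ (length (filter inJ? (outside y z))) _ _
      (≡.trans (count-J z) (≡.sym (≡.trans (≡.cong (ℕ._+ ∑< M (λ l → bit (does (I? (inv y · (J l · (a ⊙ z))))))) equal-orders) (count-J (a ⊙ z))))))
      (∑<-cong M (λ l _ → ≡.cong (λ v → bit (does (I? (inv y · v)))) (shift l)))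
    where
    open Pencil a b a≢b
    open At y z Iz Iaz
    shift : ∀ l → J l · (a ⊙ z) ≡ alt a b (l ℕ.+ l) · z
    shift l = ≡.trans (≡.cong (_· (a ⊙ z)) (≡.trans (alt-snoc a b (l ℕ.+ l)) (≡.cong (λ c → alt a b (l ℕ.+ l) · gen c) (last-even a b l))))
      (≡.trans (assoc _ _ _) (≡.cong (alt a b (l ℕ.+ l) ·_) (gen-gen a z)))

-- A uniform choice of cosines, and evaluation in the dual numbers.

module _ {P : PosDomain} (M : ℕ) where
  open PosDomain P
  open CommutativeRing K using (Carrier; 0#)

  -- The choice of 2 cos (π / m) must not depend on the proof of divisibility.
  module _ (angle : ∀ m → 2 ℕ.≤ m → m ℕ.∣ M → ∃ λ c → IsAngle P c m) where

    cos : ℕ → Carrier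
    cos m with 2 ℕ.≤? m | m ℕ.∣? M
    ... | yes p | yes q = proj₁ (angle m p q)
    ... | _     | _     = 0#

    cos-angle : ∀ m → 2 ℕ.≤ m → m ℕ.∣ M → IsAngle P (cos m) m
    cos-angle m p q with 2 ℕ.≤? m | m ℕ.∣? M
    ... | yes p' | yes q' = proj₂ (angle m p' q')
    ... | no ¬p  | _      = ⊥-elim (¬p p)
    ... | yes _  | no ¬q  = ⊥-elim (¬q q)

-- Evaluating at x + ε in the dual numbers a + b ε records a value and a derivative.

Dual : CRing
Dual = mkCRing (ℤ × ℤ) _≡_ (λ (a , b) (c , d) → a ℤ.+ c , b ℤ.+ d) (λ (a , b) (c , d) → a ℤ.* c , a ℤ.* d ℤ.+ b ℤ.* c)
  (λ (a , b) → ℤ.- a , ℤ.- b) (+ 0 , + 0) (+ 1 , + 0) ≡.refl ≡.sym ≡.trans (≡.cong₂ _) (≡.cong₂ _) (≡.cong _)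
  (λ (a , b) (c , d) (e , f) → ≡.cong₂ _,_ (ℤ.+-assoc a c e) (ℤ.+-assoc b d f)) (λ (a , b) (c , d) → ≡.cong₂ _,_ (ℤ.+-comm a c) (ℤ.+-comm b d))
  (λ (a , b) → ≡.cong₂ _,_ (ℤ.+-identityˡ a) (ℤ.+-identityˡ b)) (λ (a , b) → ≡.cong₂ _,_ (ℤ.+-inverseˡ a) (ℤ.+-inverseˡ b))
  (λ (a , b) (c , d) (e , f) → ≡.cong₂ _,_ (ℤ.*-assoc a c e)
     (solve 6 (λ a b c d e f → (a :* c) :* f :+ (a :* d :+ b :* c) :* e := a :* (c :* f :+ d :* e) :+ b :* (c :* e)) ≡.refl a b c d e f))
  (λ (a , b) (c , d) → ≡.cong₂ _,_ (ℤ.*-comm a c) (solve 4 (λ a b c d → a :* d :+ b :* c := c :* b :+ d :* a) ≡.refl a b c d))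
  (λ (a , b) → ≡.cong₂ _,_ (ℤ.*-identityˡ a) (solve 2 (λ a b → con (+ 1) :* b :+ con (+ 0) :* a := b) ≡.refl a b))
  (λ (a , b) (c , d) (e , f) → ≡.cong₂ _,_ (ℤ.*-distribˡ-+ a c e)
     (solve 6 (λ a b c d e f → a :* (d :+ f) :+ b :* (c :+ e) := (a :* d :+ b :* c) :+ (a :* f :+ b :* e)) ≡.refl a b c d e f))
  where
  open import Data.Integer.Solver using (module +-*-Solver)
  open +-*-Solver using (solve; _:=_; _:+_; _:*_; con)

constant : Hom ℤR Dual
constant = record { fn = λ a → a , + 0 ; cong = ≡.cong _ ; +h = λ _ _ → ≡.refl
  ; *h = λ a b → ≡.cong (a ℤ.* b ,_) (≡.sym (≡.trans (≡.cong₂ ℤ._+_ (ℤ.*-zeroʳ a) (ℤ.*-zeroˡ b)) ≡.refl)) ; 1h = ≡.refl }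

module Eval {A : CRing} (φ : Hom ℤR A) (q : CommutativeRing.Carrier A) where
  open CommutativeRing A hiding (zero)
  open IntSolver A
  open ℤ[x] using (coef; _⊞_; _⊠_)

  private
    coef≡ : ∀ p i → coeff p i ≡ coef p i
    coef≡ []      i       = ≡.refl
    coef≡ (a ∷ p) zero    = ≡.refl
    coef≡ (a ∷ p) (suc i) = coef≡ p i

    +≡ : ∀ p r → p +ₚ r ≡ p ⊞ r
    +≡ []      r       = ≡.refl
    +≡ (a ∷ p) []      = ≡.refl
    +≡ (a ∷ p) (b ∷ r) = ≡.cong (a ℤ.+ b ∷_) (+≡ p r)

    *≡ : ∀ p r → p *ₚ r ≡ p ⊠ r
    *≡ []      r = ≡.refl
    *≡ (a ∷ p) r = ≡.trans (+≡ (scaleₚ a r) (+ 0 ∷ p *ₚ r)) (≡.cong (λ s → scaleₚ a r ⊞ (+ 0 ∷ s)) (*≡ p r))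

  hom : Hom (PolyRing ℤR) A
  hom = evalHom ℤR φ q

  eval : Poly → Carrier
  eval = Hom.fn hom

  eval-≈ : ∀ {p r} → p ≈ₚ r → eval p ≈ eval r
  eval-≈ {p} {r} h = Hom.cong hom {p} {r} (λ i → ≡.trans (≡.sym (coef≡ p i)) (≡.trans (h i) (coef≡ r i)))

  eval-+ : ∀ p r → eval (p +ₚ r) ≈ eval p + eval r
  eval-+ p r = trans (reflexive (≡.cong eval (+≡ p r))) (Hom.+h hom p r)

  eval-* : ∀ p r → eval (p *ₚ r) ≈ CommutativeRing._*_ A (eval p) (eval r)
  eval-* p r = trans (reflexive (≡.cong eval (*≡ p r))) (Hom.*h hom p r)

  eval-sub : ∀ p r → eval (p -ₚ r) ≈ eval p - eval r
  eval-sub p r = trans (eval-+ p (-ₚ r)) (+-congˡ (Hom.-h hom r))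

  eval-X : eval Xₚ ≈ q
  eval-X = evalHom-X ℤR φ q

  eval-1 : eval 1ₚ ≈ 1#
  eval-1 = Hom.1h hom

  eval-sum : ∀ ps → eval (sumₚ ps) ≈ List.foldr (λ p s → eval p + s) 0# ps
  eval-sum []       = Hom.0h hom
  eval-sum (p ∷ ps) = trans (eval-+ p (sumₚ ps)) (+-congˡ (eval-sum ps))

eval-shift : ∀ {A} (φ : Hom ℤR A) q p → let open CommutativeRing A in Eval.eval φ q (shift1ₚ p) ≈ Eval.eval φ (q + 1#) p
eval-shift {A} φ q []      = CommutativeRing.refl A
eval-shift {A} φ q (a ∷ p) = trans (E.eval-+ (a ∷ []) ((Xₚ +ₚ 1ₚ) *ₚ shift1ₚ p))
  (+-cong (evalHom-C ℤR φ q a) (trans (E.eval-* (Xₚ +ₚ 1ₚ) (shift1ₚ p)) (*-cong (trans (E.eval-+ Xₚ 1ₚ) (+-cong E.eval-X E.eval-1)) (eval-shift φ q p))))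
  where
  open CommutativeRing A
  module E = Eval φ q

1+ε : ℤ × ℤ
1+ε = + 1 , + 1

dual-value : ∀ p → Eval.eval constant 1+ε p ≡ (evalₚ p (+ 1) , evalₚ (derivₚ p) (+ 1))
dual-value []      = ≡.refl
dual-value (a ∷ p) = ≡.trans (≡.cong (λ v → CommutativeRing._+_ Dual (a , + 0) (CommutativeRing._*_ Dual 1+ε v)) (dual-value p)) (≡.cong₂ _,_ ≡.refl (≡.trans (rearrange (evalₚ p (+ 1)) (evalₚ (derivₚ p) (+ 1))) (≡.sym (deriv-from 1 p))))
  where
  open import Data.Integer.Solver using (module +-*-Solver)
  open +-*-Solver using (solve; _:=_; _:+_; _:*_; con)
  rearrange : ∀ v d → + 0 ℤ.+ (+ 1 ℤ.* d ℤ.+ + 1 ℤ.* v) ≡ + 1 ℤ.* v ℤ.+ d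
  rearrange = solve 2 (λ v d → con (+ 0) :+ (con (+ 1) :* d :+ con (+ 1) :* v) := con (+ 1) :* v :+ d) ≡.refl
  deriv-from : ∀ k p → evalₚ (derivFrom k p) (+ 1) ≡ + k ℤ.* evalₚ p (+ 1) ℤ.+ evalₚ (derivₚ p) (+ 1)
  deriv-from k []      = ≡.sym (≡.trans (ℤ.+-identityʳ _) (ℤ.*-zeroʳ (+ k)))
  deriv-from k (b ∷ p) = ≡.trans (≡.cong (λ s → + k ℤ.* b ℤ.+ + 1 ℤ.* s) (deriv-from (suc k) p))
    (≡.trans (solve 4 (λ k b v d → k :* b :+ con (+ 1) :* ((con (+ 1) :+ k) :* v :+ d) := k :* (b :+ con (+ 1) :* v) :+ (con (+ 1) :* v :+ d)) ≡.refl (+ k) b (evalₚ p (+ 1)) (evalₚ (derivₚ p) (+ 1)))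
      (≡.cong (λ s → + k ℤ.* (b ℤ.+ + 1 ℤ.* evalₚ p (+ 1)) ℤ.+ s) (≡.sym (deriv-from 1 p))))

-- The sum of R-polynomials and the average.

module Main (C : FiniteCoxeterSystem) (ℓ : FiniteCoxeterSystem.W C → ℕ) (isLength : ∀ w → IsLength C w (ℓ w))
  (D : PosDomain) (cos : ℕ → CommutativeRing.Carrier (PosDomain.K D))
  (cos-angle : ∀ m → 2 ℕ.≤ m → m ℕ.≤ length (FiniteCoxeterSystem.elems C) → IsAngle D (cos m) m)
  (R : FiniteCoxeterSystem.W C → FiniteCoxeterSystem.W C → Poly) (isR : IsRFamily C ℓ R)
  (w : FiniteCoxeterSystem.W C) (L : List (FiniteCoxeterSystem.W C)) (enum : Enumerates C ℓ w L) (regular : Regular C ℓ w) where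

  open FiniteCoxeterSystem C using (W; e; n; gen; _·_)
  open IsRFamily isR

  module _ {A : CRing} (φ : Hom ℤR A) (q : CommutativeRing.Carrier A) where
    open CommutativeRing A
    open import Algebra.Properties.Semiring.Exp semiring using (_^_)
    open Eval φ q
    open Hecke C ℓ isLength D cos cos-angle using (module Operators)
    open Operators A q using (∑; module RPolynomials)

    value : W → W → Carrier
    value u v = eval (R u v)

    value-desc : ∀ u v i → ℓ (v · gen i) ℕ.< ℓ v → ℓ (u · gen i) ℕ.< ℓ u → value u v ≈ value (u · gen i) (v · gen i)
    value-desc u v i a b = eval-≈ {R u v} {R (u · gen i) (v · gen i)} (R-desc u v i a b)

    value-asc : ∀ u v i → ℓ (v · gen i) ℕ.< ℓ v → ℓ u ℕ.< ℓ (u · gen i) →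
      value u v ≈ (q - 1#) * value u (v · gen i) + q * value (u · gen i) (v · gen i)
    value-asc u v i a b = trans (eval-≈ {R u v} {(Xₚ -ₚ 1ₚ) *ₚ r₁ +ₚ Xₚ *ₚ r₂} (R-asc u v i a b)) (trans (eval-+ ((Xₚ -ₚ 1ₚ) *ₚ r₁) (Xₚ *ₚ r₂)) (+-cong
      (trans (eval-* (Xₚ -ₚ 1ₚ) r₁) (*-congʳ (trans (eval-sub Xₚ 1ₚ) (+-cong eval-X (-‿cong eval-1)))))
      (trans (eval-* Xₚ r₂) (*-congʳ eval-X))))
      where
      r₁ = R u (v · gen i)
      r₂ = R (u · gen i) (v · gen i)

    value-not≤ : ∀ u v → ¬ (_≤B_ C ℓ u v) → value u v ≈ 0#
    value-not≤ u v h = eval-≈ {R u v} {0ₚ} (R-not≤ u v h)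

    value-diag : ∀ u → value u u ≈ 1#
    value-diag u = trans (eval-≈ {R u u} {1ₚ} (R-diag u)) eval-1

    open RPolynomials value value-not≤ value-diag value-desc value-asc using (module Process)

    sum-R : ∑ L (λ v → eval (R e v)) ≈ q ^ ℓ w
    sum-R = Process.R-sum w L enum (Dihedral.Cosets.local⇒balanced C ℓ isLength D cos cos-angle w L enum
      (LocalStructure.regular⇒local C ℓ isLength D cos cos-angle (free _ (PosDomain.domain D) n) (oneVar _ (Free.S-domain (free _ (PosDomain.domain D) n))) (oneVar _ (PosDomain.domain D)) w L enum regular)) regular

    -- The shift of the variable in the Bruhat-Poincaré polynomial becomes a shift of the evaluation
    -- point, so its value and derivative at 1 are read off from the R-polynomials at 2 + ε.
    poincare : (q' : Carrier) → q' + 1# ≈ q → Eval.eval φ q' (BruhatPoincare C ℓ R L) ≈ q ^ ℓ w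
    poincare q' h = trans (Eval.eval-sum φ q' (map (λ v → shift1ₚ (R e v)) L)) (trans (terms L) sum-R)
      where
      shifted : ∀ p → Eval.eval φ q' (shift1ₚ p) ≈ eval p
      shifted p = trans (eval-shift φ q' p) (same-point p)
        where
        same-point : ∀ p → Eval.eval φ (q' + 1#) p ≈ eval p
        same-point []      = refl
        same-point (a ∷ p) = +-congˡ (*-cong h (same-point p))
      terms : ∀ xs → List.foldr (λ p s → Eval.eval φ q' p + s) 0# (map (λ v → shift1ₚ (R e v)) xs) ≈ ∑ xs (λ v → eval (R e v))
      terms []       = refl
      terms (x ∷ xs) = +-cong (shifted (R e x)) (terms xs)

  open import Algebra.Properties.Semiring.Exp (CommutativeRing.semiring Dual) using (_^_)

  -- (2 + ε)^k is 2^k + k 2^(k - 1) ε; multiplying by 2 avoids the exponent k - 1.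
  power : ∀ k → + 2 ℤ.* proj₂ ((+ 2 , + 1) ^ k) ≡ + k ℤ.* proj₁ ((+ 2 , + 1) ^ k)
  power zero    = ≡.refl
  power (suc k) = ≡.trans (solve 2 (λ f s → con (+ 2) :* (con (+ 2) :* s :+ con (+ 1) :* f) := con (+ 2) :* (con (+ 2) :* s) :+ con (+ 2) :* f) ≡.refl (proj₁ ((+ 2 , + 1) ^ k)) (proj₂ ((+ 2 , + 1) ^ k)))
    (≡.trans (≡.cong (λ z → + 2 ℤ.* z ℤ.+ + 2 ℤ.* proj₁ ((+ 2 , + 1) ^ k)) (power k))
      (solve 2 (λ f k → con (+ 2) :* (k :* f) :+ con (+ 2) :* f := (con (+ 1) :+ k) :* (con (+ 2) :* f)) ≡.refl (proj₁ ((+ 2 , + 1) ^ k)) (+ k)))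
    where
    open import Data.Integer.Solver using (module +-*-Solver)
    open +-*-Solver using (solve; _:=_; _:+_; _:*_; con)

  average : + 2 ℤ.* evalₚ (derivₚ (BruhatPoincare C ℓ R L)) (+ 1) ≡ + ℓ w ℤ.* evalₚ (BruhatPoincare C ℓ R L) (+ 1)
  average = ≡.trans (≡.cong (+ 2 ℤ.*_) (≡.cong proj₂ dual)) (≡.trans (power (ℓ w)) (≡.cong (+ ℓ w ℤ.*_) (≡.sym (≡.cong proj₁ dual))))
    where
    dual : (evalₚ (BruhatPoincare C ℓ R L) (+ 1) , evalₚ (derivₚ (BruhatPoincare C ℓ R L)) (+ 1)) ≡ (+ 2 , + 1) ^ ℓ w
    dual = ≡.trans (≡.sym (dual-value (BruhatPoincare C ℓ R L))) (poincare constant (+ 2 , + 1) 1+ε ≡.refl)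

open import Data.Integer using (_*_)

theorem2 : (C : FiniteCoxeterSystem) →
    (ℓ : FiniteCoxeterSystem.W C → ℕ) →
    (∀ w → IsLength C w (ℓ w)) →
    (R : FiniteCoxeterSystem.W C → FiniteCoxeterSystem.W C → Poly) →
    IsRFamily C ℓ R →
    (w : FiniteCoxeterSystem.W C) (L : List (FiniteCoxeterSystem.W C)) →
    Enumerates C ℓ w L →
    (+ 2) * evalₚ (derivₚ (BruhatPoincare C ℓ R L)) (+ 1)
    ≢ (+ ℓ w) * evalₚ (BruhatPoincare C ℓ R L) (+ 1) →
    Irregular C ℓ w
theorem2 C ℓ isLength R isR w L enum av≢ regular = go (cosines (2 ℕ.* N ! ℕ.∸ 2))
  where
  N : ℕ
  N = length (FiniteCoxeterSystem.elems C)
  -- The factorial is divisible by every possible order of a product of two generators. The factor 2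
  -- keeps the denominator at least 2, as the form `suc (suc M)` in `cosines` demands, even when the
  -- factorial is 1.
  M≡ : suc (suc (2 ℕ.* N ! ℕ.∸ 2)) ≡ 2 ℕ.* N !
  M≡ = ℕ.m+[n∸m]≡n {2} {2 ℕ.* N !} (ℕ.*-monoʳ-≤ 2 (ℕ.1≤n! N))
  divides-M : ∀ m → 2 ℕ.≤ m → m ℕ.≤ N → m ℕ.∣ suc (suc (2 ℕ.* N ! ℕ.∸ 2))
  divides-M (suc m) _ l = ≡.subst (suc m ℕ.∣_) (≡.sym M≡) (∣-trans (∣-trans (m∣m*n (m !)) (m≤n⇒m!∣n! l)) (n∣m*n 2))
  go : (Σ PosDomain λ D → ∀ m → 2 ℕ.≤ m → m ℕ.∣ suc (suc (2 ℕ.* N ! ℕ.∸ 2)) → ∃ λ c → IsAngle D c m) → ⊥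
  go (D , angle) = av≢ (Main.average C ℓ isLength D (cos {D} (suc (suc (2 ℕ.* N ! ℕ.∸ 2))) angle)
    (λ m p l → cos-angle {D} (suc (suc (2 ℕ.* N ! ℕ.∸ 2))) angle m p (divides-M m p l)) R isR w L enum regular)
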